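{- Let $\mathbb{P}$ be the set of all primes, and let $b\ge2$ and $k\ge0$ be integers. Then $$\alpha_k(\mathbb{P},b)=\max\left\{0,\ \left\lfloor\frac{k-\omega(b)}{\varphi(b)}\right\rfloor+\left\lfloor\frac{k-\omega(b)}{b\varphi(b)}\right\rfloor+\left\lfloor\frac{k-\omega(b)}{b^2\varphi(b)}\right\rfloor+\cdots\right\},$$ where $\varphi$ is Euler's totient function and $\omega(b)$ is the number of distinct prime divisors of $b$. In particular, $\alpha_k(\mathbb{P},b)=0$ if $\varphi(b)+\omega(b)>k$.
   Context: For $a\in\mathbb{Z}$, $\operatorname{ord}_b(a):=\sup\{k\in\mathbb{N}: b^k\mid a\}$ ($\operatorname{ord}_b(0)=+\infty$). A $b$-ordering of a nonempty $S\subseteq\mathbb{Z}$ is an infinite sequence $(a_i)_{i\ge0}$ in $S$ such that for each $i\ge1$, $\sum_{j<i}\operatorname{ord}_b(a_i-a_j)=\min_{a'\in S}\sum_{j<i}\operatorname{ord}_b(a'-a_j)$. The value $\alpha_k(S,b):=\sum_{j<k}\operatorname{ord}_b(a_k-a_j)$ (with $\alpha_0=0$) does not depend on the choice of $b$-ordering. -}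

module Defs where

open import Data.Nat using (ℕ; zero; suc; _+_; _*_; _∸_; _^_; _≤_; _/_; NonZero)
open import Data.Nat.Divisibility using (_∣_; _∣?_)
open import Data.Nat.Primality using (Prime; prime?)
open import Data.Nat.Coprimality using (Coprime; coprime?)
open import Data.Integer as ℤ using (ℤ; +_; ∣_∣)
open import Data.List using (List; length; filter; upTo; map)
open import Data.Nat.ListAction using (sum)
open import Relation.Nullary.Decidable using (yes; no; _×-dec_)
open import Data.Product using (Σ; _×_)
open import Relation.Binary.PropositionalEquality using (_≡_)

data ℕ∞ : Set where
  fin : ℕ → ℕ∞
  ∞   : ℕ∞

infixl 6 _+∞_
_+∞_ : ℕ∞ → ℕ∞ → ℕ∞
fin m +∞ fin n = fin (m + n)
fin _ +∞ ∞     = ∞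
∞     +∞ _     = ∞

infix 4 _≤∞_
data _≤∞_ : ℕ∞ → ℕ∞ → Set where
  fin≤fin : ∀ {m n} → m ≤ n → fin m ≤∞ fin n
  _≤∞∞    : ∀ x → x ≤∞ ∞

-- ord_b(a) = sup { k : b^k ∣ a },  ord_b(0) = +∞.
-- For a ≠ 0 and b ≥ 2 we have b^k ∣ a ⇒ k ≤ |a|, so the sup is the
-- largest k ≤ |a| with b^k ∣ |a| (integer divisibility b^k ∣ a is the
-- same as b^k ∣ |a| in ℕ).

ordSearch : ℕ → ℕ → ℕ → ℕ
ordSearch b a zero    = zero
ordSearch b a (suc k) with (b ^ suc k) ∣? a
... | yes _ = suc k
... | no  _ = ordSearch b a k

ord : ℕ → ℤ → ℕ∞
ord b (+ zero) = ∞
ord b a        = fin (ordSearch b ∣ a ∣ ∣ a ∣)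

ordSum : ℕ → (ℕ → ℤ) → ℕ → ℤ → ℕ∞
ordSum b a zero    x = fin 0
ordSum b a (suc i) x = ordSum b a i x +∞ ord b (x ℤ.- a i)

IsPrimeℤ : ℤ → Set
IsPrimeℤ x = Σ ℕ (λ p → Prime p × x ≡ + p)

-- (a_i) is a b-ordering of ℙ: every a_i is prime, and for i ≥ 1 the
-- value Σ_{j<i} ord_b(a_i − a_j) is the minimum over all primes p of
-- Σ_{j<i} ord_b(p − a_j) (it is attained at p = a_i ∈ ℙ, so "equals the
-- min" means "is ≤ the value at every prime").
record IsBOrderingOfPrimes (b : ℕ) (a : ℕ → ℤ) : Set where
  field
    inℙ     : ∀ i → IsPrimeℤ (a i)
    minimal : ∀ i → 1 ≤ i → ∀ p → IsPrimeℤ p → ordSum b a i (a i) ≤∞ ordSum b a i p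

α : ℕ → (ℕ → ℤ) → ℕ → ℕ∞
α b a k = ordSum b a k (a k)

φ : ℕ → ℕ
φ n = length (filter (λ m → coprime? m n) (map suc (upTo n)))

ω : ℕ → ℕ
ω n = length (filter (λ p → prime? p ×-dec p ∣? n) (upTo (suc n)))

-- max{0, Σ_{m≥0} ⌊(k−ω(b))/(b^m φ(b))⌋}.
-- If k < ω(b) every term is negative and the max is 0; otherwise all
-- terms are ≥ 0 and vanish once b^m > k − ω(b), so the series equals the
-- finite sum over m ≤ k − ω(b) of (k ∸ ω(b)) / (b^m φ(b)).  With k ∸ ω(b)
-- = 0 in the first case this single expression covers both cases.
-- floor division on ℕ; the d = 0 case is never used below (b ≥ 2 ⇒ φ(b) ≥ 1).
_div_ : ℕ → ℕ → ℕ
n div zero    = zero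
n div (suc d) = n / suc d

alphaFormula : ℕ → ℕ → ℕ
alphaFormula b k =
  sum (map (λ m → (k ∸ ω b) div (b ^ m * φ b)) (upTo (suc (k ∸ ω b))))

{-# OPTIONS --safe #-}
-- The primes meet every residue class prime to b (Dirichlet); apart from these there are
-- only the ω(b) prime divisors of b, each alone in its class. So a b-ordering distributes
-- primes over a tree with φ(b) branches at the root and b at every later node. Descending
-- from the root into the least occupied class gives α_k ≤ F(k − ω(b)), F being the
-- right-hand side; counting congruent pairs level by level gives
-- Σ_{i≤k} α_i ≥ Σ_{i≤k} F(i − ω(b)), so equality holds throughout.
--
-- Dirichlet's theorem is obtained in the style of Selberg, with an exactly additive rational
-- substitute ℓ for the logarithm. If r mod q contains no prime, the symmetry formula
-- Σ_{n≡g} (Λℓ + Λ⋆Λ)(n)/n = ℓ²/φ(q) + O(ℓ) shows that products of three primes in the class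
-- of r have density zero, while the classes of positive density are at least half of the
-- units. These classes are then {χ = ±1} for a real character χ, which contradicts
-- Σ χ(n)Λ(n)/n = O(1), that is, L(1,χ) ≠ 0.
module Submission where

open import Defs
open import Data.Nat using (ℕ; zero; suc; _+_; _*_; _∸_; _^_; _≤_; _<_; _/_; _%_; z≤n; s≤s; NonZero; _≟_; _≤?_; _⊔_; _≡ᵇ_)
import Data.Nat.Properties as ℕ
open import Data.Nat.Induction using (<-rec)
open import Data.Nat.DivMod hiding (_div_)
open import Data.Nat.Divisibility
open import Data.Nat.Primality
open import Data.Nat.Coprimality as Cop using (Coprime; coprime?)
open import Data.Nat.GCD using (module Bézout)
open import Data.Nat.Primality.Factorisation using (factorise; module PrimeFactorisation)
open import Data.Nat.Base using (nonTrivial⇒n>1; >-nonZero; >-nonZero⁻¹; pred)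
open import Data.List.Relation.Unary.All as All using (All; []; _∷_)
open import Data.Integer as ℤ using (ℤ; +_; ∣_∣)
import Data.Integer.Properties as ℤ
open import Data.Rational as ℚ using (ℚ)
import Data.Rational.Properties as ℚ
open import Data.Bool using (Bool; true; false; if_then_else_; T; _∧_)
open import Data.Fin using (Fin; zero; suc)
open import Data.Vec as Vec using (Vec; []; _∷_)
open import Data.List as List using (List; []; _∷_)
open import Data.Nat.ListAction using (product; sum)
open import Data.Nat.ListAction.Properties using (sum-++)
open import Data.List using (upTo)
open import Data.List.Properties using (map-++; filter-++; length-++; filter-accept; filter-reject; upTo-∷ʳ; map-id)
open import Data.Product using (Σ; ∃; _×_; _,_; proj₁; proj₂)
open import Data.Sum using (_⊎_; inj₁; inj₂; [_,_]′)
open import Relation.Binary.Definitions using (tri<; tri≈; tri>)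
open import Data.Empty using (⊥; ⊥-elim)
open import Relation.Nullary using (¬_; Dec; yes; no)
open import Relation.Nullary.Decidable using (_×-dec_; does; toWitness)
open import Relation.Binary.PropositionalEquality
  using (_≡_; _≢_; refl; sym; trans; cong; cong₂; subst; subst₂)

-- K is ℚ, sealed so that terms are never unfolded to fractions.

-- There are no limits and no reals, so every O-term is an explicit constant and the contradiction
-- is reached at one finite point: `y` is a power of two with `ℓ y` above the constant `W`, and
-- `x = y³` leaves room for three factors up to `y`. The logarithm matters through two properties.
-- Exact additivity makes multiplication by `ℓ` a derivation of Dirichlet convolution, so Selberg's
-- identity holds without error; small increments make sums against `ℓ` comparable with integrals. A
-- harmonic sum has the increments but is only nearly additive, while `Λ ⋆ 𝟏` is exactly additive
-- for any weights at the primes. Weights taken from a harmonic sum give both, but only up to a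
-- cutoff `X`. So `ℓ` depends on `X`, and all constants must be uniform in it. Three factors are
-- needed because of parity: a class without primes may still be rich in products of two primes.
-- Applying Selberg's formula to the class and to its quotients cancels the terms of order ℓ³ in the
-- count of triple products.

infixl 6 _⊕_ _⊖_
infixl 7 _⊗_
infix 4 _≼_ _≼?_

opaque
  K : Set
  K = ℚ

  0# 1# : K
  0# = ℚ.0ℚ
  1# = ℚ.1ℚ

  _⊕_ _⊗_ : K → K → K
  _⊕_ = ℚ._+_
  _⊗_ = ℚ._*_

  neg : K → K
  neg = ℚ.-_

  _≼_ : K → K → Set
  _≼_ = ℚ._≤_

  recip : K → K
  recip x with x ℚ.≟ ℚ.0ℚ
  ... | yes _ = ℚ.0ℚ
  ... | no x≢0 = ℚ.1/_ x {{ℚ.≢-nonZero x≢0}}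

  ⊕-comm : ∀ x y → x ⊕ y ≡ y ⊕ x
  ⊕-comm = ℚ.+-comm

  ⊕-assoc : ∀ x y z → (x ⊕ y) ⊕ z ≡ x ⊕ (y ⊕ z)
  ⊕-assoc = ℚ.+-assoc

  ⊕-identityˡ : ∀ x → 0# ⊕ x ≡ x
  ⊕-identityˡ = ℚ.+-identityˡ

  ⊕-inverseʳ : ∀ x → x ⊕ neg x ≡ 0#
  ⊕-inverseʳ = ℚ.+-inverseʳ

  ⊗-comm : ∀ x y → x ⊗ y ≡ y ⊗ x
  ⊗-comm = ℚ.*-comm

  ⊗-assoc : ∀ x y z → (x ⊗ y) ⊗ z ≡ x ⊗ (y ⊗ z)
  ⊗-assoc = ℚ.*-assoc

  ⊗-identityˡ : ∀ x → 1# ⊗ x ≡ x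
  ⊗-identityˡ = ℚ.*-identityˡ

  ⊗-distribˡ-⊕ : ∀ x y z → x ⊗ (y ⊕ z) ≡ x ⊗ y ⊕ x ⊗ z
  ⊗-distribˡ-⊕ = ℚ.*-distribˡ-+

  ≼-refl : ∀ {x} → x ≼ x
  ≼-refl = ℚ.≤-refl

  ≼-trans : ∀ {x y z} → x ≼ y → y ≼ z → x ≼ z
  ≼-trans = ℚ.≤-trans

  ≼-antisym : ∀ {x y} → x ≼ y → y ≼ x → x ≡ y
  ≼-antisym = ℚ.≤-antisym

  ≼-total : ∀ x y → x ≼ y ⊎ y ≼ x
  ≼-total = ℚ.≤-total

  _≼?_ : ∀ x y → Dec (x ≼ y)
  _≼?_ = ℚ._≤?_

  ⊕-mono : ∀ {a b c d} → a ≼ b → c ≼ d → a ⊕ c ≼ b ⊕ d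
  ⊕-mono = ℚ.+-mono-≤

  ⊗-monoˡ : ∀ {c a b} → 0# ≼ c → a ≼ b → c ⊗ a ≼ c ⊗ b
  ⊗-monoˡ {c} 0≤c = ℚ.*-monoˡ-≤-nonNeg c {{ℚ.nonNegative 0≤c}}

  0≼1 : 0# ≼ 1#
  0≼1 = toWitness {a? = ℚ.0ℚ ℚ.≤? ℚ.1ℚ} _

  1⋠0 : ¬ 1# ≼ 0#
  1⋠0 h with ℚ.0ℚ ℚ.≟ ℚ.1ℚ | ℚ.≤-antisym h 0≼1
  ... | yes () | _
  ... | no _ | ()

  recip-inverse : ∀ {x} → 1# ≼ x → x ⊗ recip x ≡ 1#
  recip-inverse {x} 1≤x with x ℚ.≟ ℚ.0ℚ
  ... | yes refl = ⊥-elim (1⋠0 1≤x)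
  ... | no x≢0 = ℚ.*-inverseʳ x {{ℚ.≢-nonZero x≢0}}

ι : ℕ → K
ι zero = 0#
ι (suc n) = 1# ⊕ ι n

_⊖_ : K → K → K
x ⊖ y = x ⊕ neg y

⊕-identityʳ : ∀ x → x ⊕ 0# ≡ x
⊕-identityʳ x = trans (⊕-comm x 0#) (⊕-identityˡ x)

⊗-identityʳ : ∀ x → x ⊗ 1# ≡ x
⊗-identityʳ x = trans (⊗-comm x 1#) (⊗-identityˡ x)

⊕-cancelʳ : ∀ x y → (x ⊕ y) ⊖ y ≡ x
⊕-cancelʳ x y = trans (⊕-assoc x y (neg y)) (trans (cong (x ⊕_) (⊕-inverseʳ y)) (⊕-identityʳ x))

⊕-injʳ : ∀ {x y} z → x ⊕ z ≡ y ⊕ z → x ≡ y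
⊕-injʳ {x} {y} z h = trans (sym (⊕-cancelʳ x z)) (trans (cong (_⊖ z) h) (⊕-cancelʳ y z))

⊗-zeroʳ : ∀ x → x ⊗ 0# ≡ 0#
⊗-zeroʳ x = ⊕-injʳ (x ⊗ 0#) (trans (sym (⊗-distribˡ-⊕ x 0# 0#))
  (trans (cong (x ⊗_) (⊕-identityˡ 0#)) (sym (⊕-identityˡ (x ⊗ 0#)))))

⊗-zeroˡ : ∀ x → 0# ⊗ x ≡ 0#
⊗-zeroˡ x = trans (⊗-comm 0# x) (⊗-zeroʳ x)

⊗-distribʳ-⊕ : ∀ x y z → (y ⊕ z) ⊗ x ≡ y ⊗ x ⊕ z ⊗ x
⊗-distribʳ-⊕ x y z = trans (⊗-comm (y ⊕ z) x)
  (trans (⊗-distribˡ-⊕ x y z) (cong₂ _⊕_ (⊗-comm x y) (⊗-comm x z)))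

⊕-interchange : ∀ a b c d → (a ⊕ b) ⊕ (c ⊕ d) ≡ (a ⊕ c) ⊕ (b ⊕ d)
⊕-interchange a b c d = trans (⊕-assoc a b (c ⊕ d)) (trans (cong (a ⊕_)
  (trans (sym (⊕-assoc b c d)) (trans (cong (_⊕ d) (⊕-comm b c)) (⊕-assoc c b d))))
  (sym (⊕-assoc a c (b ⊕ d))))

⊗-interchange : ∀ a b c d → (a ⊗ b) ⊗ (c ⊗ d) ≡ (a ⊗ c) ⊗ (b ⊗ d)
⊗-interchange a b c d = trans (⊗-assoc a b (c ⊗ d)) (trans (cong (a ⊗_)
  (trans (sym (⊗-assoc b c d)) (trans (cong (_⊗ d) (⊗-comm b c)) (⊗-assoc c b d))))
  (sym (⊗-assoc a c (b ⊗ d))))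

ι-+ : ∀ m n → ι (m + n) ≡ ι m ⊕ ι n
ι-+ zero n = sym (⊕-identityˡ (ι n))
ι-+ (suc m) n = trans (cong (1# ⊕_) (ι-+ m n)) (sym (⊕-assoc 1# (ι m) (ι n)))

ι-* : ∀ m n → ι (m * n) ≡ ι m ⊗ ι n
ι-* zero n = sym (⊗-zeroˡ (ι n))
ι-* (suc m) n = trans (ι-+ n (m * n)) (trans (cong₂ _⊕_ (sym (⊗-identityˡ (ι n))) (ι-* m n))
  (sym (⊗-distribʳ-⊕ (ι n) 1# (ι m))))

-- A ring solver for K; the coefficient of a monomial is a pair (p , n) of naturals, read as p − n.
module Solver where
  infixl 6 _:+_ _:-_
  infixl 7 _:*_
  infix 4 _:=_

  data Expr (n : ℕ) : Set where
    var : Fin n → Expr n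
    con : ℕ → Expr n
    one : Expr n
    _:+_ _:*_ : Expr n → Expr n → Expr n
    :-_ : Expr n → Expr n

  _:-_ : ∀ {n} → Expr n → Expr n → Expr n
  x :- y = x :+ (:- y)

  _:=_ : ∀ {n} → Expr n → Expr n → Expr n × Expr n
  _:=_ = _,_

  Mono : ℕ → Set
  Mono n = Vec ℕ n

  Poly : ℕ → Set
  Poly n = List ((ℕ × ℕ) × Mono n)

  ⟦_⟧ : ∀ {n} → Expr n → Vec K n → K
  ⟦ var i ⟧ ρ = Vec.lookup ρ i
  ⟦ con k ⟧ ρ = ι k
  ⟦ one ⟧ ρ = 1#
  ⟦ a :+ b ⟧ ρ = ⟦ a ⟧ ρ ⊕ ⟦ b ⟧ ρ
  ⟦ a :* b ⟧ ρ = ⟦ a ⟧ ρ ⊗ ⟦ b ⟧ ρ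
  ⟦ :- a ⟧ ρ = neg (⟦ a ⟧ ρ)

  pow : K → ℕ → K
  pow x zero = 1#
  pow x (suc k) = x ⊗ pow x k

  monoVal : ∀ {n} → Mono n → Vec K n → K
  monoVal [] [] = 1#
  monoVal (k ∷ m) (x ∷ ρ) = pow x k ⊗ monoVal m ρ

  coefVal : ℕ × ℕ → K
  coefVal (p , n) = ι p ⊖ ι n

  polyVal : ∀ {n} → Poly n → Vec K n → K
  polyVal [] ρ = 0#
  polyVal ((c , m) ∷ t) ρ = coefVal c ⊗ monoVal m ρ ⊕ polyVal t ρ

  eqᵇ : ∀ {n} → Mono n → Mono n → Bool
  eqᵇ [] [] = true
  eqᵇ (j ∷ m) (k ∷ l) = (j ≡ᵇ k) ∧ eqᵇ m l

  addC mulC : ℕ × ℕ → ℕ × ℕ → ℕ × ℕ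
  addC (p , n) (q , m) = p + q , n + m
  mulC (p , n) (q , m) = p * q + n * m , p * m + n * q

  insert : ∀ {n} → (ℕ × ℕ) → Mono n → Poly n → Poly n
  insert c m [] = (c , m) ∷ []
  insert c m ((d , l) ∷ t) = if eqᵇ m l then (addC c d , l) ∷ t else (d , l) ∷ insert c m t

  add : ∀ {n} → Poly n → Poly n → Poly n
  add [] q = q
  add ((c , m) ∷ t) q = add t (insert c m q)

  scale : ∀ {n} → (ℕ × ℕ) → Mono n → Poly n → Poly n → Poly n
  scale c m [] r = r
  scale c m ((d , l) ∷ t) r = scale c m t (insert (mulC c d) (Vec.zipWith _+_ m l) r)

  mul : ∀ {n} → Poly n → Poly n → Poly n → Poly n
  mul [] q r = r
  mul ((c , m) ∷ t) q r = mul t q (scale c m q r)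

  unit : ∀ {n} → Fin n → Mono n
  unit zero = 1 ∷ Vec.replicate _ 0
  unit (suc i) = 0 ∷ unit i

  norm : ∀ {n} → Expr n → Poly n
  norm (var i) = ((1 , 0) , unit i) ∷ []
  norm (con k) = ((k , 0) , Vec.replicate _ 0) ∷ []
  norm one = ((1 , 0) , Vec.replicate _ 0) ∷ []
  norm (a :+ b) = add (norm a) (norm b)
  norm (a :* b) = mul (norm a) (norm b) []
  norm (:- a) = scale (0 , 1) (Vec.replicate _ 0) (norm a) []

  isZero : ∀ {n} → Poly n → Bool
  isZero [] = true
  isZero (((p , n) , _) ∷ t) = (p ≡ᵇ n) ∧ isZero t

  ∧-split : ∀ {a b} → a ∧ b ≡ true → a ≡ true × b ≡ true
  ∧-split {true} {true} refl = refl , refl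

  ≡ᵇ-sound : ∀ m n → (m ≡ᵇ n) ≡ true → m ≡ n
  ≡ᵇ-sound m n h = ℕ.≡ᵇ⇒≡ m n (subst T (sym h) _)

  eqᵇ-sound : ∀ {n} (m l : Mono n) → eqᵇ m l ≡ true → m ≡ l
  eqᵇ-sound [] [] _ = refl
  eqᵇ-sound (j ∷ m) (k ∷ l) h with ∧-split {j ≡ᵇ k} h
  ... | h₁ , h₂ = cong₂ _∷_ (≡ᵇ-sound j k h₁) (eqᵇ-sound m l h₂)

  neg-⊕ : ∀ x y → neg (x ⊕ y) ≡ neg x ⊕ neg y
  neg-⊕ x y = ⊕-injʳ (x ⊕ y) (trans (⊕-comm _ _) (trans (⊕-inverseʳ (x ⊕ y))
    (sym (trans (⊕-interchange (neg x) (neg y) x y) (trans (cong₂ _⊕_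
      (trans (⊕-comm _ _) (⊕-inverseʳ x)) (trans (⊕-comm _ _) (⊕-inverseʳ y))) (⊕-identityˡ 0#))))))

  neg-⊗ : ∀ x y → neg x ⊗ y ≡ neg (x ⊗ y)
  neg-⊗ x y = ⊕-injʳ (x ⊗ y) (trans (sym (⊗-distribʳ-⊕ y (neg x) x))
    (trans (cong (_⊗ y) (trans (⊕-comm _ _) (⊕-inverseʳ x))) (trans (⊗-zeroˡ y)
    (sym (trans (⊕-comm _ _) (⊕-inverseʳ (x ⊗ y)))))))

  neg-neg : ∀ x → neg (neg x) ≡ x
  neg-neg x = ⊕-injʳ (neg x) (trans (⊕-comm _ _) (trans (⊕-inverseʳ (neg x)) (sym (⊕-inverseʳ x))))

  addC-val : ∀ c d → coefVal (addC c d) ≡ coefVal c ⊕ coefVal d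
  addC-val (p , n) (q , m) = trans (cong₂ _⊕_ (ι-+ p q) (trans (cong neg (ι-+ n m)) (neg-⊕ (ι n) (ι m))))
    (⊕-interchange (ι p) (ι q) (neg (ι n)) (neg (ι m)))

  mulC-val : ∀ c d → coefVal (mulC c d) ≡ coefVal c ⊗ coefVal d
  mulC-val (p , n) (q , m) = trans (cong₂ _⊕_ (pos p q n m) (trans (cong neg (pos p m n q)) (neg-⊕ _ _)))
    (trans (⊕-interchange _ _ _ _) (sym (trans (⊗-distribˡ-⊕ (ι p ⊖ ι n) (ι q) (neg (ι m)))
      (trans (cong₂ _⊕_ (⊗-distribʳ-⊕ (ι q) (ι p) (neg (ι n))) (⊗-distribʳ-⊕ (neg (ι m)) (ι p) (neg (ι n))))
      (trans (cong₂ _⊕_ (cong (ι p ⊗ ι q ⊕_) (neg-⊗ (ι n) (ι q)))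
        (cong₂ _⊕_ (trans (⊗-comm _ _) (trans (neg-⊗ _ _) (cong neg (⊗-comm _ _))))
          (trans (neg-⊗ _ _) (trans (cong neg (trans (⊗-comm _ _) (trans (neg-⊗ _ _) (cong neg (⊗-comm _ _))))) (neg-neg _)))))
      (trans (⊕-interchange _ _ _ _) (cong (ι p ⊗ ι q ⊕ neg (ι p ⊗ ι m) ⊕_) (⊕-comm _ _))))))))
    where
    pos : ∀ a b c d → ι (a * b + c * d) ≡ ι a ⊗ ι b ⊕ ι c ⊗ ι d
    pos a b c d = trans (ι-+ (a * b) (c * d)) (cong₂ _⊕_ (ι-* a b) (ι-* c d))

  pow-+ : ∀ x j k → pow x (j + k) ≡ pow x j ⊗ pow x k
  pow-+ x zero k = sym (⊗-identityˡ _)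
  pow-+ x (suc j) k = trans (cong (x ⊗_) (pow-+ x j k)) (sym (⊗-assoc x _ _))

  monoVal-* : ∀ {n} (m l : Mono n) ρ → monoVal (Vec.zipWith _+_ m l) ρ ≡ monoVal m ρ ⊗ monoVal l ρ
  monoVal-* [] [] [] = sym (⊗-identityˡ 1#)
  monoVal-* (j ∷ m) (k ∷ l) (x ∷ ρ) = trans (cong₂ _⊗_ (pow-+ x j k) (monoVal-* m l ρ)) (⊗-interchange _ _ _ _)

  monoVal-0 : ∀ {n} (ρ : Vec K n) → monoVal (Vec.replicate n 0) ρ ≡ 1#
  monoVal-0 [] = refl
  monoVal-0 (x ∷ ρ) = trans (⊗-identityˡ _) (monoVal-0 ρ)

  monoVal-unit : ∀ {n} (i : Fin n) ρ → monoVal (unit i) ρ ≡ Vec.lookup ρ i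
  monoVal-unit zero (x ∷ ρ) = trans (cong₂ _⊗_ (⊗-identityʳ x) (monoVal-0 ρ)) (⊗-identityʳ x)
  monoVal-unit (suc i) (x ∷ ρ) = trans (⊗-identityˡ _) (monoVal-unit i ρ)

  insert-val : ∀ {n} c (m : Mono n) p ρ → polyVal (insert c m p) ρ ≡ coefVal c ⊗ monoVal m ρ ⊕ polyVal p ρ
  insert-val c m [] ρ = refl
  insert-val c m ((d , l) ∷ t) ρ with eqᵇ m l in eq
  ... | true rewrite eqᵇ-sound m l eq = trans (cong (_⊕ polyVal t ρ)
      (trans (cong (_⊗ monoVal l ρ) (addC-val c d)) (⊗-distribʳ-⊕ _ _ _))) (⊕-assoc _ _ _)
  ... | false = trans (cong (coefVal d ⊗ monoVal l ρ ⊕_) (insert-val c m t ρ))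
      (trans (sym (⊕-assoc _ _ _)) (trans (cong (_⊕ polyVal t ρ) (⊕-comm _ _)) (⊕-assoc _ _ _)))

  add-val : ∀ {n} (p q : Poly n) ρ → polyVal (add p q) ρ ≡ polyVal p ρ ⊕ polyVal q ρ
  add-val [] q ρ = sym (⊕-identityˡ _)
  add-val ((c , m) ∷ t) q ρ = trans (add-val t (insert c m q) ρ) (trans (cong (polyVal t ρ ⊕_) (insert-val c m q ρ))
    (trans (sym (⊕-assoc _ _ _)) (cong (_⊕ polyVal q ρ) (⊕-comm _ _))))

  scale-val : ∀ {n} c (m : Mono n) p r ρ →
    polyVal (scale c m p r) ρ ≡ coefVal c ⊗ monoVal m ρ ⊗ polyVal p ρ ⊕ polyVal r ρ
  scale-val c m [] r ρ = sym (trans (cong (_⊕ polyVal r ρ) (⊗-zeroʳ _)) (⊕-identityˡ _))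
  scale-val c m ((d , l) ∷ t) r ρ = trans (scale-val c m t _ ρ)
    (trans (cong (coefVal c ⊗ monoVal m ρ ⊗ polyVal t ρ ⊕_) (trans (insert-val _ _ r ρ)
      (cong (_⊕ polyVal r ρ) (trans (cong₂ _⊗_ (mulC-val c d) (monoVal-* m l ρ)) (⊗-interchange _ _ _ _)))))
    (trans (sym (⊕-assoc _ _ _)) (cong (_⊕ polyVal r ρ) (trans (⊕-comm _ _) (sym (⊗-distribˡ-⊕ _ _ _))))))

  mul-val : ∀ {n} (p q r : Poly n) ρ → polyVal (mul p q r) ρ ≡ polyVal p ρ ⊗ polyVal q ρ ⊕ polyVal r ρ
  mul-val [] q r ρ = sym (trans (cong (_⊕ polyVal r ρ) (⊗-zeroˡ _)) (⊕-identityˡ _))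
  mul-val ((c , m) ∷ t) q r ρ = trans (mul-val t q _ ρ) (trans (cong (polyVal t ρ ⊗ polyVal q ρ ⊕_) (scale-val c m q r ρ))
    (trans (sym (⊕-assoc _ _ _)) (cong (_⊕ polyVal r ρ) (trans (⊕-comm _ _) (sym (⊗-distribʳ-⊕ _ _ _))))))

  coef-ι : ∀ k → coefVal (k , 0) ≡ ι k
  coef-ι k = trans (cong (λ z → ι k ⊕ z) neg-0) (⊕-identityʳ _)
    where
    neg-0 : neg 0# ≡ 0#
    neg-0 = trans (sym (⊕-identityˡ _)) (⊕-inverseʳ 0#)

  norm-val : ∀ {n} (e : Expr n) ρ → polyVal (norm e) ρ ≡ ⟦ e ⟧ ρ
  norm-val (var i) ρ = trans (⊕-identityʳ _) (trans (cong₂ _⊗_ (trans (coef-ι 1) (⊕-identityʳ 1#)) (monoVal-unit i ρ)) (⊗-identityˡ _))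
  norm-val (con k) ρ = trans (⊕-identityʳ _) (trans (cong₂ _⊗_ (coef-ι k) (monoVal-0 ρ)) (⊗-identityʳ _))
  norm-val one ρ = trans (⊕-identityʳ _) (trans (cong₂ _⊗_ (trans (coef-ι 1) (⊕-identityʳ 1#)) (monoVal-0 ρ)) (⊗-identityʳ _))
  norm-val (a :+ b) ρ = trans (add-val (norm a) (norm b) ρ) (cong₂ _⊕_ (norm-val a ρ) (norm-val b ρ))
  norm-val (a :* b) ρ = trans (mul-val (norm a) (norm b) [] ρ) (trans (⊕-identityʳ _) (cong₂ _⊗_ (norm-val a ρ) (norm-val b ρ)))
  norm-val (:- a) ρ = trans (scale-val (0 , 1) (Vec.replicate _ 0) (norm a) [] ρ) (trans (⊕-identityʳ _)
    (trans (cong₂ _⊗_ (cong₂ _⊗_ (trans (⊕-identityˡ _) (cong neg (⊕-identityʳ 1#))) (monoVal-0 ρ)) (norm-val a ρ))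
    (trans (cong (_⊗ ⟦ a ⟧ ρ) (⊗-identityʳ _)) (trans (neg-⊗ _ _) (cong neg (⊗-identityˡ _))))))

  isZero-val : ∀ {n} (p : Poly n) ρ → isZero p ≡ true → polyVal p ρ ≡ 0#
  isZero-val [] ρ _ = refl
  isZero-val (((p , n) , m) ∷ t) ρ h with ∧-split {p ≡ᵇ n} h
  ... | h₁ , h₂ rewrite ≡ᵇ-sound p n h₁ = trans (cong₂ _⊕_ (trans (cong (_⊗ monoVal m ρ) (⊕-inverseʳ (ι n))) (⊗-zeroˡ _))
      (isZero-val t ρ h₂)) (⊕-identityˡ 0#)

  Closed : ℕ → Set → Set → Set
  Closed zero A B = B
  Closed (suc n) A B = A → Closed n A B

  close : (n : ℕ) {A B : Set} → Closed n A B → Vec A n → B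
  close zero f [] = f
  close (suc n) f (x ∷ xs) = close n (f x) xs

  Π : (n : ℕ) → (Vec K n → Set) → Set
  Π zero P = P []
  Π (suc n) P = ∀ x → Π n (λ ρ → P (x ∷ ρ))

  Π-intro : (n : ℕ) {P : Vec K n → Set} → (∀ ρ → P ρ) → Π n P
  Π-intro zero f = f []
  Π-intro (suc n) f = λ x → Π-intro n (λ ρ → f (x ∷ ρ))

  equation : (n : ℕ) → Closed n (Expr n) (Expr n × Expr n) → Expr n × Expr n
  equation n f = close n f (Vec.tabulate var)

  solve : (n : ℕ) (f : Closed n (Expr n) (Expr n × Expr n)) →
    isZero (norm (proj₁ (equation n f) :- proj₂ (equation n f))) ≡ true →
    Π n (λ ρ → ⟦ proj₁ (equation n f) ⟧ ρ ≡ ⟦ proj₂ (equation n f) ⟧ ρ)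
  solve n f h = Π-intro n λ ρ → ⊕-injʳ (neg (⟦ proj₂ (equation n f) ⟧ ρ))
    (trans (trans (sym (norm-val (proj₁ (equation n f) :- proj₂ (equation n f)) ρ))
      (isZero-val (norm (proj₁ (equation n f) :- proj₂ (equation n f))) ρ h)) (sym (⊕-inverseʳ _)))

-- Order and inequalities

open Solver using (solve; con; one; _:+_; _:*_; _:-_; :-_; _:=_)

-- Linear certificates: hypotheses are added by `⊞` and scaled by `⊠`, and the solver only has to
-- see that the two differences agree. Products of nonnegative factors enter as further hypotheses,
-- equations through `≼-reflexive`.
linear : ∀ {x y a b} → a ≼ b → y ⊖ x ≡ b ⊖ a → x ≼ y
linear {x} {y} {a} {b} h e = subst₂ _≼_ lhs rhs (⊕-mono h (≼-refl {x ⊖ a}))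
  where
  lhs : a ⊕ (x ⊖ a) ≡ x
  lhs = (solve 2 (λ x y → x :+ (y :- x) := y) refl _ _)

  rhs : b ⊕ (x ⊖ a) ≡ y
  rhs = trans aux₁ (trans (cong (_⊕ x) (sym e)) aux₂)
    where
    aux₁ : b ⊕ (x ⊖ a) ≡ (b ⊖ a) ⊕ x
    aux₁ = (solve 3 (λ x y z → x :+ (y :- z) := x :- z :+ y) refl _ _ _)

    aux₂ : (y ⊖ x) ⊕ x ≡ y
    aux₂ = (solve 2 (λ x y → x :- y :+ y := x) refl _ _)

infixl 5 _⊞_
_⊞_ : ∀ {a b c d} → a ≼ b → c ≼ d → a ⊕ c ≼ b ⊕ d
_⊞_ = ⊕-mono

≼-reflexive : ∀ {x y} → x ≡ y → x ≼ y
≼-reflexive refl = ≼-refl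

0≼ι : ∀ n → 0# ≼ ι n
0≼ι zero = ≼-refl
0≼ι (suc n) = linear (0≼ι n ⊞ 0≼1) (solve 1 (λ x → one :+ x :- con 0 := x :+ one :- (con 0 :+ con 0)) refl _)

infix 6 _⊠_
_⊠_ : ∀ n {a b} → a ≼ b → ι n ⊗ a ≼ ι n ⊗ b
n ⊠ h = ⊗-monoˡ (0≼ι n) h

0≼⊗ : ∀ {x y} → 0# ≼ x → 0# ≼ y → 0# ≼ x ⊗ y
0≼⊗ {x} {y} hx hy = ≼-trans (≼-reflexive (sym (⊗-zeroʳ x))) (⊗-monoˡ hx hy)

0≼⊖ : ∀ {a b} → a ≼ b → 0# ≼ b ⊖ a
0≼⊖ h = linear h (solve 2 (λ x y → x :- y :- con 0 := x :- y) refl _ _)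

mul≼ : ∀ {a b c d} → a ≼ b → c ≼ d → 0# ≼ (b ⊖ a) ⊗ (d ⊖ c)
mul≼ h k = 0≼⊗ (0≼⊖ h) (0≼⊖ k)

-- A certificate for a positive multiple, which avoids division: in the case `y ≼ x` the nonnegative
-- `ι k ⊗ (x ⊖ y)` is added to bring the multiple down to 1.
linear′ : ∀ k {x y a b} → a ≼ b → ι (suc k) ⊗ (y ⊖ x) ≡ b ⊖ a → x ≼ y
linear′ k {x} {y} {a} {b} h e with ≼-total x y
... | inj₁ x≼y = x≼y
... | inj₂ y≼x = linear (h ⊞ 0≼⊗ (0≼ι k) (0≼⊖ y≼x)) (trans aux₁ (trans (cong (_⊕ ι k ⊗ (x ⊖ y)) e) aux₂))
  where
  aux₁ : y ⊖ x ≡ ι (suc k) ⊗ (y ⊖ x) ⊕ ι k ⊗ (x ⊖ y)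
  aux₁ = (solve 3 (λ x y z → x :- y := (one :+ z) :* (x :- y) :+ z :* (y :- x)) refl _ _ _)

  aux₂ : (b ⊖ a) ⊕ ι k ⊗ (x ⊖ y) ≡ (b ⊕ ι k ⊗ (x ⊖ y)) ⊖ (a ⊕ 0#)
  aux₂ = (solve 5 (λ x y z u v → x :- y :+ z :* (u :- v) := x :+ z :* (u :- v) :- (y :+ con 0)) refl _ _ _ _ _)

ι-mono : ∀ {m n} → m ≤ n → ι m ≼ ι n
ι-mono {n = n} z≤n = 0≼ι n
ι-mono (s≤s h) = ⊕-mono ≼-refl (ι-mono h)

1≼ι : ∀ {n} → 1 ≤ n → 1# ≼ ι n
1≼ι h = (linear ((ι-mono h)) (solve 1 (λ x → x :- one := x :- con 1) refl _))

⊗-monoʳ : ∀ {c a b} → 0# ≼ c → a ≼ b → a ⊗ c ≼ b ⊗ c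
⊗-monoʳ {c} {a} {b} hc h = (linear ((mul≼ h hc)) (solve 3 (λ x y z → x :* y :- z :* y := (x :- z) :* (y :- con 0) :- con 0) refl _ _ _))

⊗-mono : ∀ {a b c d} → 0# ≼ a → a ≼ b → 0# ≼ c → c ≼ d → a ⊗ c ≼ b ⊗ d
⊗-mono {a} {b} {c} {d} ha h hc k = ≼-trans (⊗-monoʳ hc h) (⊗-monoˡ (≼-trans ha h) k)

0≼sq : ∀ x → 0# ≼ x ⊗ x
0≼sq x with ≼-total 0# x
... | inj₁ h = 0≼⊗ h h
... | inj₂ h = (linear ((mul≼ h h)) (solve 1 (λ x → x :* x :- con 0 := (con 0 :- x) :* (con 0 :- x) :- con 0) refl _))

≼-contra : ∀ {x y} → ¬ (x ≼ y) → y ≼ x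
≼-contra {x} {y} h with ≼-total x y
... | inj₁ a = ⊥-elim (h a)
... | inj₂ a = a

-- In place of a strict order, positivity of a factor is given as `1 ≼ c`. If `y ≼ x`, then (c -
-- 1)(x - y) ≥ 0 completes the certificate.
⊗-cancel : ∀ {c x y} → 1# ≼ c → c ⊗ x ≼ c ⊗ y → x ≼ y
⊗-cancel {c} {x} {y} hc h with ≼-total x y
... | inj₁ a = a
... | inj₂ a = (linear (h ⊞ (mul≼ hc a)) (solve 3 (λ x y z → x :- y := z :* x :+ (z :- one) :* (y :- x) :- (z :* y :+ con 0)) refl _ _ _))

0≼recip : ∀ {x} → 1# ≼ x → 0# ≼ recip x
0≼recip {x} h = ⊗-cancel h ((linear (≼-reflexive (sym (recip-inverse h)) ⊞ 0≼1) (solve 2 (λ x y → x :* y :- x :* con 0 := x :* y :+ one :- (one :+ con 0)) refl _ _)))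

recip-anti : ∀ {x y} → 1# ≼ x → x ≼ y → recip y ≼ recip x
recip-anti {x} {y} hx h = ⊗-cancel hx (⊗-cancel (≼-trans hx h) (≼-trans (≼-reflexive e₁) (≼-trans h (≼-reflexive e₂))))
  where
  e₁ : y ⊗ (x ⊗ recip y) ≡ x
  e₁ = trans (ring-swap y x (recip y)) (trans (cong (x ⊗_) (recip-inverse (≼-trans hx h))) (⊗-identityʳ x))
    where
    ring-swap : ∀ a b c → a ⊗ (b ⊗ c) ≡ b ⊗ (a ⊗ c)
    ring-swap a b c = (solve 3 (λ x y z → x :* (y :* z) := y :* (x :* z)) refl _ _ _)

  e₂ : y ≡ y ⊗ (x ⊗ recip x)
  e₂ = sym (trans (cong (y ⊗_) (recip-inverse hx)) (⊗-identityʳ y))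

-- inv 0 is a junk value.
inv : ℕ → K
inv n = recip (ι n)

inv-inverse : ∀ {n} → 1 ≤ n → ι n ⊗ inv n ≡ 1#
inv-inverse h = recip-inverse (1≼ι h)

0≼inv : ∀ {n} → 1 ≤ n → 0# ≼ inv n
0≼inv h = 0≼recip (1≼ι h)

inv-anti : ∀ {m n} → 1 ≤ m → m ≤ n → inv n ≼ inv m
inv-anti h k = recip-anti (1≼ι h) (ι-mono k)

inv-unique : ∀ {n x} → 1 ≤ n → ι n ⊗ x ≡ 1# → x ≡ inv n
inv-unique {n} {x} h e = trans (sym (⊗-identityʳ x)) (trans (cong (x ⊗_) (sym (inv-inverse h)))
  (trans aux (trans (cong (_⊗ inv n) e) (⊗-identityˡ _))))
  where
  aux : x ⊗ (ι n ⊗ inv n) ≡ ι n ⊗ x ⊗ inv n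
  aux = (solve 3 (λ x y z → x :* (y :* z) := y :* x :* z) refl _ _ _)

inv-* : ∀ {m n} → 1 ≤ m → 1 ≤ n → inv (m * n) ≡ inv m ⊗ inv n
inv-* {m} {n} hm hn = sym (inv-unique (ℕ.*-mono-≤ hm hn) (trans (cong (_⊗ (inv m ⊗ inv n)) (ι-* m n))
  (trans (⊗-interchange _ _ _ _) (trans (cong₂ _⊗_ (inv-inverse hm) (inv-inverse hn)) (⊗-identityˡ _)))))

inv-1 : inv 1 ≡ 1#
inv-1 = sym (inv-unique {1} (s≤s z≤n) (solve 0 (con 1 :* one := one) refl))

inv≼1 : ∀ {n} → 1 ≤ n → inv n ≼ 1#
inv≼1 {n} h = ≼-trans (inv-anti (s≤s z≤n) h) (≼-reflexive inv-1)

linear-≡ : ∀ {x y a b} → a ≡ b → y ⊖ x ≡ b ⊖ a → x ≡ y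
linear-≡ {x} {y} {a} refl e = ≼-antisym (linear (≼-refl {a}) e) (linear (≼-refl {a}) (trans aux₁ (trans (cong neg e) aux₂)))
  where
  aux₁ : x ⊖ y ≡ neg (y ⊖ x)
  aux₁ = (solve 2 (λ x y → x :- y := :- (y :- x)) refl _ _)

  aux₂ : neg (a ⊖ a) ≡ a ⊖ a
  aux₂ = (solve 1 (λ x → :- (x :- x) := x :- x) refl _)

infixl 5 _⊞≡_
_⊞≡_ : ∀ {a b c d} → a ≡ b → c ≡ d → a ⊕ c ≡ b ⊕ d
_⊞≡_ = cong₂ _⊕_

infix 6 _⊠≡_
_⊠≡_ : ∀ c {a b} → a ≡ b → c ⊗ a ≡ c ⊗ b
c ⊠≡ h = cong (c ⊗_) h

inv-step : ∀ {n} → 1 ≤ n → inv n ⊖ inv (suc n) ≡ inv n ⊗ inv (suc n)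
inv-step {n} h = (linear-≡ (sym (inv n ⊠≡ inv-inverse {suc n} (s≤s z≤n)) ⊞≡ inv (suc n) ⊠≡ inv-inverse h) (solve 3 (λ x y z → x :* y :- (x :- y) := x :* ((one :+ z) :* y) :+ y :* one :- (x :* one :+ y :* (z :* x))) refl _ _ _))

-- Two-sided bounds, in place of absolute values

Bd : K → K → Set
Bd x B = (neg B ≼ x) × (x ≼ B)

Bd-0 : ∀ {B} → 0# ≼ B → Bd 0# B
Bd-0 h = (linear (h) (solve 1 (λ x → con 0 :- (:- x) := x :- con 0) refl _)) , h

Bd-neg : ∀ {x B} → Bd x B → Bd (neg x) B
Bd-neg (l , u) = (linear (u) (solve 2 (λ x y → :- x :- (:- y) := y :- x) refl _ _)) , (linear (l) (solve 2 (λ x y → x :- (:- y) := y :- (:- x)) refl _ _))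

Bd-weaken : ∀ {x B C} → B ≼ C → Bd x B → Bd x C
Bd-weaken h (l , u) = (linear (l ⊞ h) (solve 3 (λ x y z → x :- (:- y) := x :+ y :- (:- z :+ z)) refl _ _ _)) , (linear (u ⊞ h) (solve 3 (λ x y z → x :- y := z :+ x :- (y :+ z)) refl _ _ _))

Bd-⊕ : ∀ {x y A B} → Bd x A → Bd y B → Bd (x ⊕ y) (A ⊕ B)
Bd-⊕ (l , u) (m , v) = (linear (l ⊞ m) (solve 4 (λ x y z u → x :+ y :- (:- (z :+ u)) := x :+ y :- (:- z :+ (:- u))) refl _ _ _ _)) , (linear (u ⊞ v) (solve 4 (λ x y z u → x :+ y :- (z :+ u) := x :+ y :- (z :+ u)) refl _ _ _ _))

Bd-⊖ : ∀ {x y A B} → Bd x A → Bd y B → Bd (x ⊖ y) (A ⊕ B)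
Bd-⊖ h k = Bd-⊕ h (Bd-neg k)

Bd-scale : ∀ {c x B} → 0# ≼ c → Bd x B → Bd (c ⊗ x) (c ⊗ B)
Bd-scale hc (l , u) = (linear ((⊗-monoˡ hc l)) (solve 3 (λ x y z → x :* y :- (:- (x :* z)) := x :* y :- x :* (:- z)) refl _ _ _)) , (linear ((⊗-monoˡ hc u)) (solve 3 (λ x y z → x :* y :- x :* z := x :* y :- x :* z) refl _ _ _))

-- 2(AB + xy) = (x + A)(y + B) + (A - x)(B - y), and similarly for AB - xy, so no signs have to be
-- distinguished.
Bd-⊗ : ∀ {x y A B} → Bd x A → Bd y B → Bd (x ⊗ y) (A ⊗ B)
Bd-⊗ (l , u) (m , v) = (linear′ 1 ((mul≼ l m) ⊞ (mul≼ u v)) (solve 4 (λ x y z u → con 2 :* (x :* y :- (:- (z :* u))) := (x :- (:- z)) :* (y :- (:- u)) :+ (z :- x) :* (u :- y) :- (con 0 :+ con 0)) refl _ _ _ _)) , (linear′ 1 ((mul≼ u m) ⊞ (mul≼ l v)) (solve 4 (λ x y z u → con 2 :* (x :* y :- z :* u) := (x :- z) :* (u :- (:- y)) :+ (z :- (:- x)) :* (y :- u) :- (con 0 :+ con 0)) refl _ _ _ _))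

Bd-≡ : ∀ {x y B} → x ≡ y → Bd y B → Bd x B
Bd-≡ refl h = h

Bd-pos : ∀ {x B} → 0# ≼ x → x ≼ B → Bd x B
Bd-pos h k = (linear (2 ⊠ h ⊞ k) (solve 2 (λ x y → x :- (:- y) := con 2 :* x :+ y :- (con 2 :* con 0 :+ x)) refl _ _)) , k

-- Indicators of decidable conditions

opaque
  𝟙 : ∀ {P : Set} → Dec P → K
  𝟙 d = if does d then 1# else 0#

  𝟙-yes : ∀ {P : Set} (d : Dec P) → P → 𝟙 d ≡ 1#
  𝟙-yes (yes _) _ = refl
  𝟙-yes (no ¬p) p = ⊥-elim (¬p p)

  𝟙-no : ∀ {P : Set} (d : Dec P) → ¬ P → 𝟙 d ≡ 0#
  𝟙-no (yes p) ¬p = ⊥-elim (¬p p)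
  𝟙-no (no _) _ = refl

  𝟙-cong : ∀ {P Q : Set} (d : Dec P) (e : Dec Q) → (P → Q) → (Q → P) → 𝟙 d ≡ 𝟙 e
  𝟙-cong (yes p) e f g = sym (𝟙-yes e (f p))
  𝟙-cong (no ¬p) e f g = sym (𝟙-no e λ q → ¬p (g q))

  0≼𝟙 : ∀ {P : Set} (d : Dec P) → 0# ≼ 𝟙 d
  0≼𝟙 (yes _) = 0≼1
  0≼𝟙 (no _) = ≼-refl

  𝟙≼1 : ∀ {P : Set} (d : Dec P) → 𝟙 d ≼ 1#
  𝟙≼1 (yes _) = ≼-refl
  𝟙≼1 (no _) = 0≼1

  𝟙-≼ : ∀ {P Q : Set} (d : Dec P) (e : Dec Q) → (P → Q) → 𝟙 d ≼ 𝟙 e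
  𝟙-≼ (yes p) e f = ≼-reflexive (sym (𝟙-yes e (f p)))
  𝟙-≼ (no ¬p) e f = 0≼𝟙 e

  𝟙-⊗ : ∀ {P Q R : Set} (d : Dec P) (e : Dec Q) (r : Dec R) → (P → Q → R) → (R → P × Q) → 𝟙 d ⊗ 𝟙 e ≡ 𝟙 r
  𝟙-⊗ (yes p) e r f g = trans (⊗-identityˡ _) (𝟙-cong e r (f p) (λ z → proj₂ (g z)))
  𝟙-⊗ (no ¬p) e r f g = trans (⊗-zeroˡ _) (sym (𝟙-no r λ z → ¬p (proj₁ (g z))))

  𝟙-guard : ∀ {P : Set} (d : Dec P) {x y} → (P → x ≡ y) → 𝟙 d ⊗ x ≡ 𝟙 d ⊗ y
  𝟙-guard (yes p) h = cong (1# ⊗_) (h p)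
  𝟙-guard (no _) h = trans (⊗-zeroˡ _) (sym (⊗-zeroˡ _))

  𝟙-guard-≼ : ∀ {P : Set} (d : Dec P) {x y} → (P → x ≼ y) → 𝟙 d ⊗ x ≼ 𝟙 d ⊗ y
  𝟙-guard-≼ (yes p) h = ⊗-monoˡ 0≼1 (h p)
  𝟙-guard-≼ (no _) h = ≼-reflexive (trans (⊗-zeroˡ _) (sym (⊗-zeroˡ _)))

-- S x f = f 1 ⊕ ⋯ ⊕ f x: the index starts at 1.
S : ℕ → (ℕ → K) → K
S zero f = 0#
S (suc n) f = S n f ⊕ f (suc n)

S-cong : ∀ x {f g : ℕ → K} → (∀ n → 1 ≤ n → n ≤ x → f n ≡ g n) → S x f ≡ S x g
S-cong zero h = refl
S-cong (suc x) h = cong₂ _⊕_ (S-cong x λ n a b → h n a (ℕ.m≤n⇒m≤1+n b)) (h (suc x) (s≤s z≤n) ℕ.≤-refl)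

S-mono : ∀ x {f g : ℕ → K} → (∀ n → 1 ≤ n → n ≤ x → f n ≼ g n) → S x f ≼ S x g
S-mono zero h = ≼-refl
S-mono (suc x) h = ⊕-mono (S-mono x λ n a b → h n a (ℕ.m≤n⇒m≤1+n b)) (h (suc x) (s≤s z≤n) ℕ.≤-refl)

S-0 : ∀ x → S x (λ _ → 0#) ≡ 0#
S-0 zero = refl
S-0 (suc x) = trans (⊕-identityʳ _) (S-0 x)

S-zero : ∀ x {f : ℕ → K} → (∀ n → 1 ≤ n → n ≤ x → f n ≡ 0#) → S x f ≡ 0#
S-zero x h = trans (S-cong x h) (S-0 x)

0≼S : ∀ x {f : ℕ → K} → (∀ n → 1 ≤ n → n ≤ x → 0# ≼ f n) → 0# ≼ S x f
0≼S x h = ≼-trans (≼-reflexive (sym (S-0 x))) (S-mono x h)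

S-const : ∀ x c → S x (λ _ → c) ≡ ι x ⊗ c
S-const zero c = sym (⊗-zeroˡ c)
S-const (suc x) c = (linear-≡ (S-const x c) (solve 3 (λ x y z → (one :+ x) :* y :- (z :+ y) := x :* y :- z) refl _ _ _))

S-⊕ : ∀ x (f g : ℕ → K) → S x (λ n → f n ⊕ g n) ≡ S x f ⊕ S x g
S-⊕ zero f g = sym (⊕-identityˡ 0#)
S-⊕ (suc x) f g = trans (cong (_⊕ (f (suc x) ⊕ g (suc x))) (S-⊕ x f g)) (⊕-interchange _ _ _ _)

S-⊗ˡ : ∀ x c (f : ℕ → K) → S x (λ n → c ⊗ f n) ≡ c ⊗ S x f
S-⊗ˡ zero c f = sym (⊗-zeroʳ c)
S-⊗ˡ (suc x) c f = trans (cong (_⊕ c ⊗ f (suc x)) (S-⊗ˡ x c f)) (sym (⊗-distribˡ-⊕ c _ _))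

S-⊗ʳ : ∀ x c (f : ℕ → K) → S x (λ n → f n ⊗ c) ≡ S x f ⊗ c
S-⊗ʳ x c f = trans (S-cong x λ n _ _ → ⊗-comm (f n) c) (trans (S-⊗ˡ x c f) (⊗-comm c _))

S-neg : ∀ x (f : ℕ → K) → S x (λ n → neg (f n)) ≡ neg (S x f)
S-neg zero f = (solve 0 (con 0 := :- con 0) refl)
S-neg (suc x) f = (linear-≡ (S-neg x f) (solve 3 (λ x y z → :- (x :+ y) :- (z :+ (:- y)) := :- x :- z) refl _ _ _))

S-⊖ : ∀ x (f g : ℕ → K) → S x (λ n → f n ⊖ g n) ≡ S x f ⊖ S x g
S-⊖ x f g = trans (S-⊕ x f _) (cong (S x f ⊕_) (S-neg x g))

S-swap : ∀ x y (f : ℕ → ℕ → K) → S x (λ m → S y (f m)) ≡ S y (λ n → S x (λ m → f m n))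
S-swap zero y f = sym (S-0 y)
S-swap (suc x) y f = trans (cong (_⊕ S y (f (suc x))) (S-swap x y f)) (sym (S-⊕ y _ _))

S-split : ∀ x y (f : ℕ → K) → S (x + y) f ≡ S x f ⊕ S y (λ n → f (x + n))
S-split x zero f rewrite ℕ.+-identityʳ x = sym (⊕-identityʳ _)
S-split x (suc y) f rewrite ℕ.+-suc x y = trans (cong (_⊕ f (suc (x + y))) (S-split x y f)) (⊕-assoc _ _ _)

S-extend : ∀ {x y} (f : ℕ → K) → x ≤ y → (∀ n → x < n → n ≤ y → f n ≡ 0#) → S y f ≡ S x f
S-extend {x} {y} f h z = trans (cong (λ t → S t f) (sym (ℕ.m+[n∸m]≡n h))) (trans (S-split x (y ∸ x) f)
  (trans (cong (S x f ⊕_) (S-zero (y ∸ x) λ n a b → z (x + n) (ℕ.m<m+n x a)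
    (subst (x + n ≤_) (ℕ.m+[n∸m]≡n h) (ℕ.+-monoʳ-≤ x b)))) (⊕-identityʳ _)))

S-mono-range : ∀ {x y} (f : ℕ → K) → x ≤ y → (∀ n → x < n → n ≤ y → 0# ≼ f n) → S x f ≼ S y f
S-mono-range {x} {y} f h z = ≼-trans ((linear ((0≼S (y ∸ x) {λ n → f (x + n)} λ n a b → z (x + n) (ℕ.m<m+n x a) (subst (x + n ≤_) (ℕ.m+[n∸m]≡n h) (ℕ.+-monoʳ-≤ x b)))) (solve 2 (λ x y → x :+ y :- x := y :- con 0) refl _ _)))
  (≼-reflexive (trans (sym (S-split x (y ∸ x) f)) (cong (λ t → S t f) (ℕ.m+[n∸m]≡n h))))

S-restrict : ∀ {x y} (f : ℕ → K) → y ≤ x → S x (λ n → 𝟙 (n ≤? y) ⊗ f n) ≡ S y f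
S-restrict {x} {y} f h = trans (S-extend _ h λ n a _ → trans (cong (_⊗ f n) (𝟙-no (n ≤? y) (ℕ.<⇒≱ a))) (⊗-zeroˡ _))
  (S-cong y λ n _ b → trans (cong (_⊗ f n) (𝟙-yes (n ≤? y) b)) (⊗-identityˡ _))

S-pick : ∀ x k (f : ℕ → K) → 1 ≤ k → k ≤ x → (∀ n → 1 ≤ n → n ≤ x → n ≢ k → f n ≡ 0#) → S x f ≡ f k
S-pick zero k f h l = ⊥-elim (ℕ.<⇒≱ h l)
S-pick (suc x) k f h l z with k ≟ suc x
... | yes refl = trans (cong (_⊕ f (suc x)) (S-zero x λ n a b → z n a (ℕ.m≤n⇒m≤1+n b) (ℕ.<⇒≢ (s≤s b)))) (⊕-identityˡ _)
... | no k≢ = trans (cong₂ _⊕_ (S-pick x k f h (ℕ.≤-pred (ℕ.≤∧≢⇒< l k≢)) λ n a b → z n a (ℕ.m≤n⇒m≤1+n b))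
    (z (suc x) (s≤s z≤n) ℕ.≤-refl (λ e → k≢ (sym e)))) (⊕-identityʳ _)

S-𝟙 : ∀ x k (f : ℕ → K) → 1 ≤ k → k ≤ x → S x (λ n → 𝟙 (k ≟ n) ⊗ f n) ≡ f k
S-𝟙 x k f h l = trans (S-pick x k _ h l λ n _ _ ne → trans (cong (_⊗ f n) (𝟙-no (k ≟ n) λ e → ne (sym e))) (⊗-zeroˡ _))
  (trans (cong (_⊗ f k) (𝟙-yes (k ≟ k) refl)) (⊗-identityˡ _))

S-sub : ∀ J (s : ℕ → ℕ) (f : ℕ → K) → (∀ j → s j < s (suc j)) → (∀ n → 1 ≤ n → 0# ≼ f n) →
  S J (λ j → f (s j)) ≼ S (s J) f
S-sub zero s f _ hf = 0≼S (s 0) λ n a _ → hf n a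
S-sub (suc J) s f hs hf with s (suc J) | hs J
... | suc t | s≤s h = ⊕-mono (≼-trans (S-sub J s f hs hf) (S-mono-range f h λ n a _ → hf n (ℕ.≤-trans (s≤s z≤n) a))) ≼-refl

S-Bd : ∀ x {f g : ℕ → K} → (∀ n → 1 ≤ n → n ≤ x → Bd (f n) (g n)) → Bd (S x f) (S x g)
S-Bd zero h = Bd-0 ≼-refl
S-Bd (suc x) h = Bd-⊕ (S-Bd x λ n a b → h n a (ℕ.m≤n⇒m≤1+n b)) (h (suc x) (s≤s z≤n) ℕ.≤-refl)

S-term : ∀ x (f : ℕ → K) k → 1 ≤ k → k ≤ x → (∀ n → 1 ≤ n → 0# ≼ f n) → f k ≼ S x f
S-term x f (suc k) h l hf = ≼-trans ((linear ((0≼S k {f} λ n a _ → hf n a)) (solve 2 (λ x y → x :+ y :- y := x :- con 0) refl _ _))) (S-mono-range f l λ n a _ → hf n (ℕ.≤-trans (s≤s z≤n) a))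

-- Summation by parts, with g majorising the variation of f.
S-abel : ∀ x (a f g : ℕ → K) B → 0# ≼ B → (∀ t → t ≤ x → Bd (S t a) B) →
  (∀ n → 1 ≤ n → n < x → Bd (f n ⊖ f (suc n)) (g n ⊖ g (suc n))) → 1 ≤ x →
  Bd (S x (λ n → a n ⊗ f n) ⊖ S x a ⊗ f x) (B ⊗ (g 1 ⊖ g x))
S-abel (suc zero) a f g B hB ha hf _ = Bd-≡ (solve 2 (λ x y → con 0 :+ x :* y :- (con 0 :+ x) :* y := con 0) refl _ _) (Bd-weaken (≼-reflexive (solve 2 (λ x y → con 0 := x :* (y :- y)) refl _ _)) (Bd-0 ≼-refl))
S-abel (suc (suc x)) a f g B hB ha hf _ = Bd-≡ (solve 6 (λ x y z u v w → x :+ y :* z :+ u :* v :- (w :+ y :+ u) :* v := x :+ y :* z :- (w :+ y) :* z :+ (w :+ y) :* (z :- v)) refl _ _ _ _ _ _) (Bd-weaken (≼-reflexive (solve 4 (λ x y z u → x :* (y :- z) :+ x :* (z :- u) := x :* (y :- u)) refl _ _ _ _)) (Bd-⊕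
  (S-abel (suc x) a f g B hB (λ t h → ha t (ℕ.m≤n⇒m≤1+n h)) (λ n h l → hf n h (ℕ.m≤n⇒m≤1+n l)) (s≤s z≤n))
  (Bd-⊗ (ha (suc x) (ℕ.n≤1+n _)) (hf (suc x) (s≤s z≤n) ℕ.≤-refl))))

-- The boundary term costs at most B g(x), which is exactly what the variation bound B (g(1) - g(x))
-- leaves over. Only g has to decrease; f may rise at first, as ℓ(n)/n does.
S-abel-dec : ∀ x (a f g : ℕ → K) B → 0# ≼ B → (∀ t → t ≤ x → Bd (S t a) B) →
  (∀ n → 1 ≤ n → n < x → Bd (f n ⊖ f (suc n)) (g n ⊖ g (suc n))) →
  (∀ n → 1 ≤ n → n ≤ x → Bd (f n) (g n)) → 0# ≼ g 1 →
  Bd (S x (λ n → a n ⊗ f n)) (B ⊗ g 1)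
S-abel-dec zero a f g B hB ha hf hg h1 = Bd-0 (0≼⊗ hB h1)
S-abel-dec x@(suc _) a f g B hB ha hf hg h1 = Bd-≡ (solve 3 (λ x y z → x := x :- y :* z :+ y :* z) refl _ _ _) (Bd-weaken (≼-reflexive (solve 3 (λ x y z → x :* (y :- z) :+ x :* z := x :* y) refl _ _ _)) (Bd-⊕
  (S-abel x a f g B hB ha hf (s≤s z≤n)) (Bd-⊗ (ha x ℕ.≤-refl) (hg x (s≤s z≤n) ℕ.≤-refl))))

-- An increasing f has -f as majorant of its variation: B (f(x) - f(1)) comes from the variation and
-- B f(x) from the boundary term.
S-abel-inc : ∀ x (a f : ℕ → K) B → 0# ≼ B → (∀ t → t ≤ x → Bd (S t a) B) →
  (∀ n → 1 ≤ n → n < x → f n ≼ f (suc n)) → (∀ n → 1 ≤ n → n ≤ x → 0# ≼ f n) → 1 ≤ x →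
  Bd (S x (λ n → a n ⊗ f n)) (ι 2 ⊗ B ⊗ f x)
S-abel-inc x@(suc _) a f B hB ha hf h0 _ = Bd-≡ (solve 3 (λ x y z → x := x :- y :* z :+ y :* z) refl _ _ _) (Bd-weaken
  ((linear ((⊗-monoˡ hB (h0 1 (s≤s z≤n) (s≤s z≤n)))) (solve 3 (λ x y z → con 2 :* x :* y :- (x :* (:- z :- (:- y)) :+ x :* y) := x :* z :- x :* con 0) refl _ _ _))) (Bd-⊕
  (S-abel x a f (λ n → neg (f n)) B hB ha (λ n h l → (linear (0 ⊠ 0≼1) (solve 2 (λ x y → x :- y :- (:- (:- x :- (:- y))) := con 0 :* one :- con 0 :* con 0) refl _ _)) , (linear (2 ⊠ (hf n h l)) (solve 2 (λ x y → :- x :- (:- y) :- (x :- y) := con 2 :* y :- con 2 :* x) refl _ _))) (s≤s z≤n))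
  (Bd-⊗ (ha x ℕ.≤-refl) (Bd-pos (h0 x (s≤s z≤n) ℕ.≤-refl) ≼-refl))))

S-𝟙≤ : ∀ x k (f : ℕ → K) → 1 ≤ k → S x (λ n → 𝟙 (k ≟ n) ⊗ f n) ≡ 𝟙 (k ≤? x) ⊗ f k
S-𝟙≤ x k f h with k ≤? x
... | yes l = trans (S-𝟙 x k f h l) (sym (trans (cong (_⊗ f k) (𝟙-yes (yes l) l)) (⊗-identityˡ _)))
... | no l = trans (S-zero x λ n _ b → trans (cong (_⊗ f n) (𝟙-no (k ≟ n) λ e → l (subst (_≤ x) (sym e) b))) (⊗-zeroˡ _))
  (sym (trans (cong (_⊗ f k) (𝟙-no (no l) l)) (⊗-zeroˡ _)))

1≤* : ∀ {a b} → 1 ≤ a → 1 ≤ b → 1 ≤ a * b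
1≤* = ℕ.*-mono-≤

≤*ˡ : ∀ a {b} → 1 ≤ b → a ≤ a * b
≤*ˡ a {suc b} h = ℕ.m≤m*n a (suc b)

≤*ʳ : ∀ b {a} → 1 ≤ a → b ≤ a * b
≤*ʳ b {suc a} h = ℕ.m≤n*m b (suc a)

⊗-left : ∀ a b c → a ⊗ (b ⊗ c) ≡ b ⊗ (a ⊗ c)
⊗-left a b c = (solve 3 (λ x y z → x :* (y :* z) := y :* (x :* z)) refl _ _ _)

-- Dirichlet convolution

-- The sum over the lattice points under the hyperbola d m ≤ x.
D : ℕ → (ℕ → ℕ → K) → K
D x F = S x λ d → S x λ m → 𝟙 (d * m ≤? x) ⊗ F d m

infixl 7 _⋆_
-- Summing over a square with an indicator for d m = n, instead of over divisors, turns the laws of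
-- convolution into exchanges of finite sums.
_⋆_ : (ℕ → K) → (ℕ → K) → ℕ → K
(f ⋆ g) n = S n λ d → S n λ m → 𝟙 (d * m ≟ n) ⊗ (f d ⊗ g m)

𝟏 : ℕ → K
𝟏 _ = 1#

ε : ℕ → K
ε n = 𝟙 (1 ≟ n)

⋆-extend : ∀ f g {n y} → n ≤ y → (f ⋆ g) n ≡ S y λ d → S y λ m → 𝟙 (d * m ≟ n) ⊗ (f d ⊗ g m)
⋆-extend f g {n} {y} h = sym (trans (S-extend _ h λ d a _ → S-zero y λ m b _ →
    trans (cong (_⊗ _) (𝟙-no (d * m ≟ n) λ e → ℕ.<⇒≱ a (subst (d ≤_) e (≤*ˡ d b)))) (⊗-zeroˡ _))
  (S-cong n λ d a _ → S-extend _ h λ m b _ →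
    trans (cong (_⊗ _) (𝟙-no (d * m ≟ n) λ e → ℕ.<⇒≱ b (subst (m ≤_) e (≤*ʳ m a)))) (⊗-zeroˡ _)))

S-⋆ : ∀ x (h f g : ℕ → K) → S x (λ n → h n ⊗ (f ⋆ g) n) ≡ D x (λ d m → h (d * m) ⊗ (f d ⊗ g m))
S-⋆ x h f g = trans (S-cong x λ n a b → trans (cong (h n ⊗_) (⋆-extend f g b)) (push n))
  (trans (S-swap x x _) (S-cong x λ d a _ → trans (S-swap x x _) (S-cong x λ m b _ →
    S-𝟙≤ x (d * m) (λ n → h n ⊗ (f d ⊗ g m)) (1≤* a b))))
  where
  push : ∀ n → h n ⊗ S x (λ d → S x λ m → 𝟙 (d * m ≟ n) ⊗ (f d ⊗ g m)) ≡
    S x (λ d → S x λ m → 𝟙 (d * m ≟ n) ⊗ (h n ⊗ (f d ⊗ g m)))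
  push n = trans (sym (S-⊗ˡ x _ _)) (S-cong x λ d _ _ → trans (sym (S-⊗ˡ x _ _)) (S-cong x λ m _ _ → ⊗-left _ _ _))

D-cong : ∀ x {F G : ℕ → ℕ → K} → (∀ d m → 1 ≤ d → 1 ≤ m → d * m ≤ x → F d m ≡ G d m) → D x F ≡ D x G
D-cong x h = S-cong x λ d a _ → S-cong x λ m b _ → 𝟙-guard (d * m ≤? x) (h d m a b)

D-swap : ∀ x F → D x F ≡ D x (λ d m → F m d)
D-swap x F = trans (S-swap x x _) (S-cong x λ d _ _ → S-cong x λ m _ _ →
  cong (_⊗ F m d) (𝟙-cong (m * d ≤? x) (d * m ≤? x) (subst (_≤ x) (ℕ.*-comm m d)) (subst (_≤ x) (ℕ.*-comm d m))))

D-⊕ : ∀ x (F G : ℕ → ℕ → K) → D x (λ d m → F d m ⊕ G d m) ≡ D x F ⊕ D x G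
D-⊕ x F G = trans (S-cong x λ d _ _ → trans (S-cong x λ m _ _ → ⊗-distribˡ-⊕ _ _ _) (S-⊕ x _ _)) (S-⊕ x _ _)

D-⊗ˡ : ∀ x c (F : ℕ → ℕ → K) → D x (λ d m → c ⊗ F d m) ≡ c ⊗ D x F
D-⊗ˡ x c F = trans (S-cong x λ d _ _ → trans (S-cong x λ m _ _ → ⊗-left _ _ _) (S-⊗ˡ x c _)) (S-⊗ˡ x c _)

≤div⇒ : ∀ x d {m} → 1 ≤ d → m ≤ x div d → d * m ≤ x
≤div⇒ x (suc d) {m} _ h = ℕ.≤-trans (ℕ.*-monoʳ-≤ (suc d) h) (subst (_≤ x) (ℕ.*-comm (x / suc d) (suc d)) (m/n*n≤m x (suc d)))

⇒≤div : ∀ x d {m} → 1 ≤ d → d * m ≤ x → m ≤ x div d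
⇒≤div x (suc d) {m} _ h = subst (_≤ x / suc d) (trans (cong (_/ suc d) (ℕ.*-comm (suc d) m)) (m*n/n≡m m (suc d))) (/-monoˡ-≤ (suc d) h)

div≤ : ∀ x d → x div d ≤ x
div≤ x zero = z≤n
div≤ x (suc d) = m/n≤m x (suc d)

S-div : ∀ x d (G : ℕ → K) → 1 ≤ d → S x (λ m → 𝟙 (d * m ≤? x) ⊗ G m) ≡ S (x div d) G
S-div x d G h = trans (S-cong x λ m _ _ → cong (_⊗ G m) (𝟙-cong (d * m ≤? x) (m ≤? x div d) (⇒≤div x d h) (≤div⇒ x d h)))
  (S-restrict G (div≤ x d))

D-div : ∀ x F → D x F ≡ S x (λ d → S (x div d) (F d))
D-div x F = S-cong x λ d a _ → S-div x d (F d) a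

⋆-comm : ∀ f g n → (f ⋆ g) n ≡ (g ⋆ f) n
⋆-comm f g n = trans (S-swap n n _) (S-cong n λ d _ _ → S-cong n λ m _ _ →
  cong₂ _⊗_ (𝟙-cong (m * d ≟ n) (d * m ≟ n) (trans (ℕ.*-comm d m)) (trans (ℕ.*-comm m d))) (⊗-comm _ _))

⋆-cong : ∀ n {f f′ g g′ : ℕ → K} → (∀ d → 1 ≤ d → d ≤ n → f d ≡ f′ d) → (∀ d → 1 ≤ d → d ≤ n → g d ≡ g′ d) →
  (f ⋆ g) n ≡ (f′ ⋆ g′) n
⋆-cong n h k = S-cong n λ d a a′ → S-cong n λ m b b′ → cong (𝟙 (d * m ≟ n) ⊗_) (cong₂ _⊗_ (h d a a′) (k m b b′))

⋆-⊕ˡ : ∀ (f g h : ℕ → K) n → ((λ k → f k ⊕ g k) ⋆ h) n ≡ (f ⋆ h) n ⊕ (g ⋆ h) n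
⋆-⊕ˡ f g h n = trans (S-cong n λ d _ _ → trans (S-cong n λ m _ _ → (solve 4 (λ x y z u → x :* ((y :+ z) :* u) := x :* (y :* u) :+ x :* (z :* u)) refl _ _ _ _)) (S-⊕ n _ _)) (S-⊕ n _ _)

⋆-neg : ∀ (f g : ℕ → K) n → ((λ k → neg (f k)) ⋆ g) n ≡ neg ((f ⋆ g) n)
⋆-neg f g n = trans (S-cong n λ d _ _ → trans (S-cong n λ m _ _ → (solve 3 (λ x y z → x :* ((:- y) :* z) := :- (x :* (y :* z))) refl _ _ _)) (S-neg n _)) (S-neg n _)

⋆-ε : ∀ f n → 1 ≤ n → (ε ⋆ f) n ≡ f n
⋆-ε f n h = trans (S-pick n 1 _ ℕ.≤-refl h λ d _ _ ne → S-zero n λ m _ _ →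
    trans (cong (λ t → 𝟙 (d * m ≟ n) ⊗ (t ⊗ f m)) (𝟙-no (1 ≟ d) λ e → ne (sym e))) (solve 2 (λ x y → x :* (con 0 :* y) := con 0) refl _ _))
  (trans (S-pick n n _ h ℕ.≤-refl λ m _ _ ne →
    trans (cong (_⊗ (ε 1 ⊗ f m)) (𝟙-no (1 * m ≟ n) λ e → ne (trans (sym (ℕ.*-identityˡ m)) e))) (⊗-zeroˡ _))
  (trans (cong₂ (λ a b → a ⊗ (b ⊗ f n)) (𝟙-yes (1 * n ≟ n) (ℕ.*-identityˡ n)) (𝟙-yes (1 ≟ 1) refl)) (solve 1 (λ x → one :* (one :* x) := x) refl _)))

-- On d m = n the factor ℓ(n) splits as ℓ(d) + ℓ(m). With an ℓ that is only approximately additive,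
-- every identity derived from this would carry an error term.
⋆-derivation : ∀ (ℓ : ℕ → K) → (∀ a b → 1 ≤ a → 1 ≤ b → ℓ (a * b) ≡ ℓ a ⊕ ℓ b) → ∀ f g n →
  (f ⋆ g) n ⊗ ℓ n ≡ ((λ k → f k ⊗ ℓ k) ⋆ g) n ⊕ (f ⋆ (λ k → g k ⊗ ℓ k)) n
⋆-derivation ℓ add f g n = trans (sym (S-⊗ʳ n _ _)) (trans (S-cong n λ d a _ → trans (sym (S-⊗ʳ n _ _))
  (trans (S-cong n λ m b _ → trans (assoc _ _ _) (trans (𝟙-guard (d * m ≟ n) λ e → term a b e) (⊗-distribˡ-⊕ _ _ _))) (S-⊕ n _ _))) (S-⊕ n _ _))
  where
  assoc : ∀ a b c → a ⊗ b ⊗ c ≡ a ⊗ (b ⊗ c)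
  assoc = ⊗-assoc

  term : ∀ {d m} → 1 ≤ d → 1 ≤ m → d * m ≡ n → f d ⊗ g m ⊗ ℓ n ≡ f d ⊗ ℓ d ⊗ g m ⊕ f d ⊗ (g m ⊗ ℓ m)
  term {d} {m} a b refl = trans (cong (f d ⊗ g m ⊗_) (add d m a b)) (solve 4 (λ x y z u → x :* y :* (z :+ u) := x :* z :* y :+ x :* (y :* u)) refl _ _ _ _)

-- A form invariant under rotating the three functions; together with `⋆-comm` this invariance gives
-- associativity.
⋆₃ : (f g h : ℕ → K) → ℕ → K
⋆₃ f g h n = S n λ a → S n λ b → S n λ c → 𝟙 (a * b * c ≟ n) ⊗ (f a ⊗ g b ⊗ h c)

⋆⋆≡⋆₃ : ∀ f g h n → ((f ⋆ g) ⋆ h) n ≡ ⋆₃ f g h n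
⋆⋆≡⋆₃ f g h n =
  trans (S-cong n λ e _ e≤n → S-cong n λ c _ _ → expand e e≤n c)
  (trans (S-cong n λ e _ _ → trans (S-swap n n _) (S-cong n λ a _ _ → S-swap n n _))
  (trans (S-swap n n _) (S-cong n λ a a≥1 _ → trans (S-swap n n _) (S-cong n λ b b≥1 _ →
  trans (S-swap n n _) (S-cong n λ c c≥1 _ →
    trans (S-𝟙≤ n (a * b) (λ e → 𝟙 (e * c ≟ n) ⊗ (f a ⊗ g b ⊗ h c)) (1≤* a≥1 b≥1))
    (trans (sym (⊗-assoc _ _ _)) (cong (_⊗ (f a ⊗ g b ⊗ h c))
      (𝟙-⊗ (a * b ≤? n) (a * b * c ≟ n) (a * b * c ≟ n) (λ _ e → e)
        λ e → subst (a * b ≤_) e (≤*ˡ (a * b) c≥1) , e))))))))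
  where
  expand : ∀ e → e ≤ n → ∀ c → 𝟙 (e * c ≟ n) ⊗ ((f ⋆ g) e ⊗ h c) ≡
    S n (λ a → S n λ b → 𝟙 (a * b ≟ e) ⊗ (𝟙 (e * c ≟ n) ⊗ (f a ⊗ g b ⊗ h c)))
  expand e e≤n c = trans (cong (λ t → 𝟙 (e * c ≟ n) ⊗ (t ⊗ h c)) (⋆-extend f g e≤n)) (trans (⊗-left _ _ _)
    (trans (sym (S-⊗ʳ n _ _)) (S-cong n λ a _ _ → trans (sym (S-⊗ʳ n _ _)) (S-cong n λ b _ _ → (solve 5 (λ x y z u v → x :* (y :* z) :* (u :* v) := x :* (u :* (y :* z :* v))) refl _ _ _ _ _)))))

⋆₃-rotate : ∀ f g h n → ⋆₃ f g h n ≡ ⋆₃ g h f n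
⋆₃-rotate f g h n = trans (S-swap n n _) (S-cong n λ b _ _ → trans (S-swap n n _) (S-cong n λ c _ _ → S-cong n λ a _ _ →
  cong₂ _⊗_ (𝟙-cong (a * b * c ≟ n) (b * c * a ≟ n) (trans (eq a b c)) (trans (sym (eq a b c)))) (solve 3 (λ x y z → x :* y :* z := y :* z :* x) refl _ _ _)))
  where
  eq : ∀ a b c → b * c * a ≡ a * b * c
  eq a b c = trans (ℕ.*-comm (b * c) a) (sym (ℕ.*-assoc a b c))

⋆-assoc : ∀ f g h n → ((f ⋆ g) ⋆ h) n ≡ (f ⋆ (g ⋆ h)) n
⋆-assoc f g h n = trans (⋆⋆≡⋆₃ f g h n) (trans (⋆₃-rotate f g h n)
  (trans (sym (⋆⋆≡⋆₃ g h f n)) (⋆-comm (g ⋆ h) f n)))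

-- Prime powers and the von Mangoldt function

prime≥2 : ∀ {p} → Prime p → 2 ≤ p
prime≥2 {p} pr = nonTrivial⇒n>1 p {{prime⇒nonTrivial pr}}

prime≥1 : ∀ {p} → Prime p → 1 ≤ p
prime≥1 pr = ℕ.≤-trans (s≤s z≤n) (prime≥2 pr)

opaque
  isPrime? : ∀ n → Dec (Prime n)
  isPrime? = prime?

prime-induction : (P : ℕ → Set) → P 1 → (∀ p m → Prime p → 1 ≤ m → P m → P (p * m)) → ∀ n → 1 ≤ n → P n
prime-induction P p1 step (suc n) _ = subst P (sym isFactorisation) (proj₂ (go factors factorsPrime))
  where
  open PrimeFactorisation (factorise (suc n))

  go : ∀ as → All Prime as → 1 ≤ product as × P (product as)
  go [] [] = s≤s z≤n , p1
  go (a ∷ as) (pa ∷ pas) with go as pas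
  ... | h , q = 1≤* (prime≥1 pa) h , step a (product as) pa h q

coprime-* : ∀ {a b c} → Coprime a c → Coprime b c → Coprime (a * b) c
coprime-* {a} {b} {c} h k {d} (d∣ab , d∣c) = k (Cop.coprime-divisor d⊥a d∣ab , d∣c)
  where
  d⊥a : Coprime d a
  d⊥a (e∣d , e∣a) = h (e∣a , ∣-trans e∣d d∣c)

coprime-1 : ∀ c → Coprime 1 c
coprime-1 c (d∣1 , _) = ∣1⇒≡1 d∣1

coprime-^ : ∀ {a c} k → Coprime a c → Coprime (a ^ k) c
coprime-^ {a} {c} zero h = coprime-1 c
coprime-^ (suc k) h = coprime-* h (coprime-^ k h)

distinct-primes-coprime : ∀ {p q} → Prime p → Prime q → p ≢ q → Coprime p q
distinct-primes-coprime {p} {q} hp hq ne {d} (d∣p , d∣q) with prime⇒irreducible hp d∣p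
... | inj₁ d≡1 = d≡1
... | inj₂ refl with prime⇒irreducible hq d∣q
... | inj₁ d≡1 = d≡1
... | inj₂ d≡q = ⊥-elim (ne d≡q)

k<p^k : ∀ p k → 2 ≤ p → k < p ^ k
k<p^k p zero h = s≤s z≤n
k<p^k p (suc k) h = begin-strict
  suc k <⟨ s≤s (k<p^k p k h) ⟩
  suc (p ^ k) ≤⟨ ℕ.+-monoˡ-≤ (p ^ k) (ℕ.≤-trans (s≤s z≤n) (k<p^k p k h)) ⟩
  p ^ k + p ^ k ≡⟨ cong (λ z → p ^ k + z) (ℕ.+-identityʳ (p ^ k)) ⟨
  2 * p ^ k ≤⟨ ℕ.*-monoˡ-≤ (p ^ k) h ⟩
  p * p ^ k ∎
  where open ℕ.≤-Reasoning

p≤p^k : ∀ p k → 2 ≤ p → 1 ≤ k → p ≤ p ^ k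
p≤p^k p (suc k) h _ = ≤*ˡ p (ℕ.≤-trans (s≤s z≤n) (k<p^k p k h))

S-shift : ∀ x (f : ℕ → K) → S (suc x) f ≡ f 1 ⊕ S x (λ n → f (suc n))
S-shift x f = trans (S-split 1 x f) (cong (_⊕ S x (λ n → f (suc n))) (⊕-identityˡ _))

𝟙-∣ : ∀ q n → 1 ≤ q → 1 ≤ n → S n (λ m → 𝟙 (q * m ≟ n)) ≡ 𝟙 (q ∣? n)
𝟙-∣ q n hq hn with q ∣? n
... | no q∤n = trans (S-zero n λ m _ _ → 𝟙-no (q * m ≟ n) λ e → q∤n (divides m (trans (sym e) (ℕ.*-comm q m)))) (sym (𝟙-no (no q∤n) q∤n))
... | yes q∣n@(divides zero e) = ⊥-elim (ℕ.<⇒≢ hn (sym e))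
... | yes q∣n@(divides c@(suc _) e) = trans (S-pick n c _ (s≤s z≤n) (subst (c ≤_) (sym e) (≤*ˡ c hq)) λ m _ _ ne → 𝟙-no (q * m ≟ n) λ e′ →
      ne (ℕ.*-cancelˡ-≡ m c q {{>-nonZero hq}} (trans e′ (trans e (ℕ.*-comm c q)))))
    (trans (𝟙-yes (q * c ≟ n) (trans (ℕ.*-comm q c) (sym e))) (sym (𝟙-yes (yes q∣n) q∣n)))

module PrimePowers (λp : ℕ → K) where

  -- The von Mangoldt function with arbitrary weights `λp` in place of log p. Whatever the weights,
  -- `L₀` is the completely additive function with these values at the primes.
  Λ₀ : ℕ → K
  Λ₀ n = S n λ p → S n λ k → 𝟙 (isPrime? p) ⊗ (𝟙 (p ^ k ≟ n) ⊗ λp p)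

  L₀ : ℕ → K
  L₀ n = (Λ₀ ⋆ 𝟏) n

  -- Since p ≤ p^k and k < p^k, a pair with p or k above n has p^k > n.
  pp-range : ∀ {n x} → n ≤ x → (F : ℕ → ℕ → K) → (∀ p k → Prime p → 1 ≤ k → n < p ^ k → F p k ≡ 0#) →
    S n (λ p → S n λ k → 𝟙 (isPrime? p) ⊗ F p k) ≡ S x (λ p → S x λ k → 𝟙 (isPrime? p) ⊗ F p k)
  pp-range {n} {x} h F z = sym (trans (S-extend _ h λ p a _ → S-zero x λ k b _ →
      trans (𝟙-guard (isPrime? p) λ pr → z p k pr b (ℕ.<-≤-trans a (p≤p^k p k (prime≥2 pr) b))) (⊗-zeroʳ _))
    (S-cong n λ p _ _ → S-extend _ h λ k a _ →
      trans (𝟙-guard (isPrime? p) λ pr → z p k pr (ℕ.≤-trans (s≤s z≤n) a)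
        (ℕ.<-trans a (k<p^k p k (prime≥2 pr)))) (⊗-zeroʳ _)))

  S-Λ₀ : ∀ x (w : ℕ → K) → S x (λ n → w n ⊗ Λ₀ n) ≡
    S x (λ p → S x λ k → 𝟙 (isPrime? p) ⊗ (𝟙 (p ^ k ≤? x) ⊗ (w (p ^ k) ⊗ λp p)))
  S-Λ₀ x w = trans (S-cong x λ n a b → trans (cong (w n ⊗_) (pp-range b (λ p k → 𝟙 (p ^ k ≟ n) ⊗ λp p)
      λ p k _ _ c → trans (cong (_⊗ λp p) (𝟙-no (p ^ k ≟ n) λ e → ℕ.<⇒≢ c (sym e))) (⊗-zeroˡ _)))
      (trans (sym (S-⊗ˡ x _ _)) (S-cong x λ p _ _ → trans (sym (S-⊗ˡ x _ _)) (S-cong x λ k _ _ → (solve 4 (λ x y z u → x :* (y :* (z :* u)) := y :* (z :* (x :* u))) refl _ _ _ _)))))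
    (trans (S-swap x x _) (S-cong x λ p _ _ → trans (S-swap x x _) (S-cong x λ k _ _ →
      trans (S-⊗ˡ x _ _) (𝟙-guard (isPrime? p) λ pr →
        S-𝟙≤ x (p ^ k) (λ n → w n ⊗ λp p) (ℕ.≤-trans (s≤s z≤n) (k<p^k p k (prime≥2 pr)))))))

  0≼Λ₀ : (∀ p → 1 ≤ p → 0# ≼ λp p) → ∀ n → 0# ≼ Λ₀ n
  0≼Λ₀ h n = 0≼S n λ p a _ → 0≼S n λ k _ _ → 0≼⊗ (0≼𝟙 (isPrime? p)) (0≼⊗ (0≼𝟙 (p ^ k ≟ n)) (h p a))

  -- p^k = n gives p^(2k) = n². For n ≥ 2 the doubled exponents stay within the range n² because 2n
  -- ≤ n²; at n = 1 both sides coincide.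
  Λ₀-sq : (∀ p → 1 ≤ p → 0# ≼ λp p) → ∀ n → 1 ≤ n → Λ₀ n ≼ Λ₀ (n * n)
  Λ₀-sq h (suc zero) _ = ≼-refl
  Λ₀-sq h n@(suc (suc m)) _ = ≼-trans (S-mono n λ p a _ → ≼-trans (S-mono n λ k _ _ → 𝟙-guard-≼ (isPrime? p) λ _ →
      ⊗-monoʳ (h p a) (𝟙-≼ (p ^ k ≟ n) (p ^ (k + k) ≟ n * n) λ e → trans (ℕ.^-distribˡ-+-* p k k) (cong₂ _*_ e e)))
      (≼-trans (S-sub n (λ k → k + k) (λ k → 𝟙 (isPrime? p) ⊗ (𝟙 (p ^ k ≟ n * n) ⊗ λp p))
        (λ j → ℕ.+-mono-< (ℕ.n<1+n j) (ℕ.n<1+n j)) λ k _ → nn p k a)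
        (S-mono-range _ 2n≤ λ k _ _ → nn p k a)))
    (S-mono-range _ (≤*ˡ n {n} (s≤s z≤n)) λ p a _ → 0≼S (n * n) λ k _ _ → nn p k (ℕ.≤-trans (s≤s z≤n) a))
    where
    nn : ∀ p k → 1 ≤ p → 0# ≼ 𝟙 (isPrime? p) ⊗ (𝟙 (p ^ k ≟ n * n) ⊗ λp p)
    nn p k a = 0≼⊗ (0≼𝟙 (isPrime? p)) (0≼⊗ (0≼𝟙 (p ^ k ≟ n * n)) (h p a))

    2n≤ : n + n ≤ n * n
    2n≤ = subst (_≤ n * n) (cong (λ z → n + z) (ℕ.+-identityʳ n)) (ℕ.*-monoˡ-≤ n {2} {n} (s≤s (s≤s z≤n)))

  L₀-form : ∀ {n x} → 1 ≤ n → n ≤ x → L₀ n ≡ S x λ p → S x λ k → 𝟙 (isPrime? p) ⊗ (𝟙 (p ^ k ∣? n) ⊗ λp p)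
  L₀-form {n} {x} hn h = trans (S-cong n λ d _ _ → trans (S-cong n λ m _ _ → (solve 2 (λ x y → x :* (y :* one) := x :* y) refl _ _)) (S-⊗ʳ n (Λ₀ d) _))
    (trans (S-Λ₀ n (λ d → S n λ m → 𝟙 (d * m ≟ n)))
    (trans (S-cong n λ p _ _ → S-cong n λ k _ _ → 𝟙-guard (isPrime? p) λ pr →
      trans (cong (λ t → 𝟙 (p ^ k ≤? n) ⊗ (t ⊗ λp p)) (𝟙-∣ (p ^ k) n (ℕ.≤-trans (s≤s z≤n) (k<p^k p k (prime≥2 pr))) hn))
      (trans (sym (⊗-assoc _ _ _)) (cong (_⊗ λp p) (𝟙-⊗ (p ^ k ≤? n) (p ^ k ∣? n) (p ^ k ∣? n) (λ _ q → q)
        λ q → ∣⇒≤ {{>-nonZero hn}} q , q))))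
    (pp-range h (λ p k → 𝟙 (p ^ k ∣? n) ⊗ λp p) λ p k _ _ c →
      trans (cong (_⊗ λp p) (𝟙-no (p ^ k ∣? n) λ q → ℕ.<⇒≱ c (∣⇒≤ {{>-nonZero hn}} q))) (⊗-zeroˡ _))))

  L₀-1 : L₀ 1 ≡ 0#
  L₀-1 = trans (L₀-form {1} {1} ℕ.≤-refl ℕ.≤-refl) (S-zero 1 {λ p → S 1 λ k → F p k} λ p _ h →
      S-zero 1 {F p} λ k _ _ → trans (cong (_⊗ (𝟙 (p ^ k ∣? 1) ⊗ λp p)) (𝟙-no (isPrime? p) λ pr → ℕ.<⇒≱ (prime≥2 pr) h)) (⊗-zeroˡ _))
    where
    F : ℕ → ℕ → K
    F p k = 𝟙 (isPrime? p) ⊗ (𝟙 (p ^ k ∣? 1) ⊗ λp p)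

  -- For p ≠ q the same powers of p divide m and q m. For p = q the exponents shift by one and k = 1
  -- is new; the range for m then has one exponent more, which is too large to divide m.
  L₀-prime : ∀ q m → Prime q → 1 ≤ m → L₀ (q * m) ≡ λp q ⊕ L₀ m
  L₀-prime q m hq hm = trans (L₀-form {Y} {Y} hY ℕ.≤-refl) (trans (S-cong Y λ p _ _ → inner p)
    (trans (S-⊕ Y _ _) (cong₂ _⊕_ (S-𝟙 Y q λp (prime≥1 hq) (≤*ˡ q hm)) (sym (L₀-form hm (≤*ʳ m (prime≥1 hq)))))))
    where
    Y = q * m
    hY = 1≤* (prime≥1 hq) hm

    count : ∀ p → Prime p → S Y (λ k → 𝟙 (p ^ k ∣? Y)) ≡ 𝟙 (q ≟ p) ⊕ S Y (λ k → 𝟙 (p ^ k ∣? m))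
    count p pr = helper (q ≟ p)
      where
      helper : Dec (q ≡ p) → S Y (λ k → 𝟙 (p ^ k ∣? Y)) ≡ 𝟙 (q ≟ p) ⊕ S Y (λ k → 𝟙 (p ^ k ∣? m))
      helper (no ne) = trans (S-cong Y λ k _ _ → 𝟙-cong (p ^ k ∣? Y) (p ^ k ∣? m)
          (Cop.coprime-divisor (coprime-^ k (distinct-primes-coprime pr hq λ e → ne (sym e)))) (∣n⇒∣m*n q))
        (sym (trans (cong (_⊕ S Y (λ k → 𝟙 (p ^ k ∣? m))) (𝟙-no (q ≟ p) ne)) (⊕-identityˡ _)))
      helper (yes refl) with Y in eq
      ... | zero = ⊥-elim (ℕ.<⇒≢ hY (sym eq))
      ... | suc y = trans (S-cong (suc y) λ k _ _ → 𝟙-cong (p ^ k ∣? suc y) (p ^ k ∣? p * m) (subst (p ^ k ∣_) (sym eq)) (subst (p ^ k ∣_) eq))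
        (trans (S-shift y _) (cong₂ _⊕_
          (trans (𝟙-yes (p ^ 1 ∣? p * m) (*-monoʳ-∣ p (1∣ m))) (sym (𝟙-yes (p ≟ p) refl)))
          (trans (S-cong y λ k _ _ → 𝟙-cong (p ^ suc k ∣? p * m) (p ^ k ∣? m) (*-cancelˡ-∣ p {{prime⇒nonZero pr}}) (*-monoʳ-∣ p))
            (sym (trans (cong (S y (λ k → 𝟙 (p ^ k ∣? m)) ⊕_) (𝟙-no (p ^ suc y ∣? m) λ d →
              ℕ.<⇒≱ (ℕ.<-≤-trans (k<p^k p (suc y) (prime≥2 pr)) (∣⇒≤ {{>-nonZero hm}} d)) (subst (m ≤_) eq (≤*ʳ m (prime≥1 pr)))))
              (⊕-identityʳ _))))))

    inner : ∀ p → S Y (λ k → 𝟙 (isPrime? p) ⊗ (𝟙 (p ^ k ∣? Y) ⊗ λp p)) ≡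
      𝟙 (q ≟ p) ⊗ λp p ⊕ S Y (λ k → 𝟙 (isPrime? p) ⊗ (𝟙 (p ^ k ∣? m) ⊗ λp p))
    inner p = trans (S-⊗ˡ Y _ _) (trans (cong (𝟙 (isPrime? p) ⊗_) (S-⊗ʳ Y _ _)) (trans (split (isPrime? p))
      (cong (𝟙 (q ≟ p) ⊗ λp p ⊕_) (sym (trans (S-⊗ˡ Y _ _) (cong (𝟙 (isPrime? p) ⊗_) (S-⊗ʳ Y _ _)))))))
      where
      split : Dec (Prime p) → 𝟙 (isPrime? p) ⊗ (S Y (λ k → 𝟙 (p ^ k ∣? Y)) ⊗ λp p) ≡
        𝟙 (q ≟ p) ⊗ λp p ⊕ 𝟙 (isPrime? p) ⊗ (S Y (λ k → 𝟙 (p ^ k ∣? m)) ⊗ λp p)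
      split (yes pr) = trans (cong₂ (λ a b → a ⊗ (b ⊗ λp p)) (𝟙-yes (isPrime? p) pr) (count p pr))
        (trans (solve 3 (λ x y z → one :* ((x :+ y) :* z) := x :* z :+ one :* (y :* z)) refl _ _ _) (cong (λ a → 𝟙 (q ≟ p) ⊗ λp p ⊕ a ⊗ (S Y (λ k → 𝟙 (p ^ k ∣? m)) ⊗ λp p)) (sym (𝟙-yes (isPrime? p) pr))))
      split (no ¬pr) = trans (cong (_⊗ (S Y (λ k → 𝟙 (p ^ k ∣? Y)) ⊗ λp p)) (𝟙-no (isPrime? p) ¬pr)) (trans ((solve 3 (λ x y z → con 0 :* (x :* y) := con 0 :* y :+ con 0 :* (z :* y)) refl _ _ _))
        (cong₂ (λ a b → a ⊗ λp p ⊕ b ⊗ (S Y (λ k → 𝟙 (p ^ k ∣? m)) ⊗ λp p)) (sym (𝟙-no (q ≟ p) λ e → ¬pr (subst Prime e hq))) (sym (𝟙-no (isPrime? p) ¬pr))))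

  L₀-* : ∀ a b → 1 ≤ a → 1 ≤ b → L₀ (a * b) ≡ L₀ a ⊕ L₀ b
  L₀-* a b ha hb = prime-induction (λ a → L₀ (a * b) ≡ L₀ a ⊕ L₀ b)
    (trans (cong L₀ (ℕ.*-identityˡ b)) (trans (sym (⊕-identityˡ _)) (cong (_⊕ L₀ b) (sym L₀-1))))
    (λ p m pr hm ih → trans (cong L₀ (ℕ.*-assoc p m b)) (trans (L₀-prime p (m * b) pr (1≤* hm hb))
      (trans (cong (λp p ⊕_) ih) (trans (sym (⊕-assoc _ _ _)) (cong (_⊕ L₀ b) (sym (L₀-prime p m pr hm))))))) a ha

  L₀-at-prime : ∀ p → Prime p → L₀ p ≡ λp p
  L₀-at-prime p pr = trans (cong L₀ (sym (ℕ.*-identityʳ p))) (trans (L₀-prime p 1 pr ℕ.≤-refl)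
    (trans (cong (λp p ⊕_) L₀-1) (⊕-identityʳ _)))

-- H (n R) − H R approximates log n and is additive up to 1/R; extending half of its values at the primes additively costs
-- an error of n/R at n, which is negligible up to X once R ≥ 4 X².
H : ℕ → K
H n = S n inv

H-def : ∀ n → H n ≡ S n inv
H-def n = refl

-- The difference consists of R terms, each between 1/((n+1)R) and 1/(nR).
H-block : ∀ n R → 1 ≤ n → 1 ≤ R →
  inv (suc n) ≼ H (suc n * R) ⊖ H (n * R) × H (suc n * R) ⊖ H (n * R) ≼ inv n
H-block n R hn hR = subst (λ z → inv (suc n) ≼ z × z ≼ inv n) (sym block)
  ( ≼-trans (≼-reflexive (sym (scaled (suc n) (s≤s z≤n)))) (S-mono R λ j a b →
      inv-anti (1≤* hn hR +ʳ a) (subst (n * R + j ≤_) (ℕ.+-comm (n * R) R) (ℕ.+-monoʳ-≤ (n * R) b)))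
  , ≼-trans (S-mono R λ j a b → inv-anti (1≤* hn hR) (ℕ.m≤m+n (n * R) j)) (≼-reflexive (scaled n hn)))
  where
  _+ʳ_ : ∀ {a b} → 1 ≤ a → 1 ≤ b → 1 ≤ a + b
  _+ʳ_ {a} {b} h _ = ℕ.≤-trans h (ℕ.m≤m+n a b)

  block : H (suc n * R) ⊖ H (n * R) ≡ S R (λ j → inv (n * R + j))
  block = trans (cong (_⊖ H (n * R)) (trans (cong H (ℕ.+-comm R (n * R))) (S-split (n * R) R inv))) (linear-≡ (sym (H-def (n * R))) (solve 3 (λ x y z → x :- (y :+ x :- z) := z :- y) refl _ _ _))

  scaled : ∀ k → 1 ≤ k → S R (λ _ → inv (k * R)) ≡ inv k
  scaled k hk = trans (S-const R _) (trans (cong (ι R ⊗_) (inv-* hk hR)) (trans (solve 3 (λ x y z → x :* (y :* z) := y :* (x :* z)) refl _ _ _) (trans (cong (inv k ⊗_) (inv-inverse hR)) (⊗-identityʳ _))))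

-- Between i m and (i+1) m the harmonic sum grows by at least 1/(i+1) and at most 1/i. Compared with
-- H k - H j, the surplus telescopes to 1/j - 1/k.
HDilate : ℕ → ℕ → ℕ → Set
HDilate m j k = 0# ≼ (H (k * m) ⊖ H (j * m)) ⊖ (H k ⊖ H j) × (H (k * m) ⊖ H (j * m)) ⊖ (H k ⊖ H j) ≼ inv j ⊖ inv k

H-dilate : ∀ m j t → 1 ≤ m → 1 ≤ j → HDilate m j (j + t)
H-dilate m j zero hm hj = subst (HDilate m j) (sym (ℕ.+-identityʳ j)) (≼-reflexive (solve 2 (λ x y → con 0 := x :- x :- (y :- y)) refl _ _) , ≼-reflexive (solve 3 (λ x y z → x :- x :- (y :- y) := z :- z) refl _ _ _))
H-dilate m j (suc t) hm hj = subst (HDilate m j) (sym (ℕ.+-suc j t))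
  ((linear ((proj₁ ih) ⊞ (proj₁ blk) ⊞ ≼-reflexive H-suc) (solve 7 (λ x y z u v w a → x :- y :- (z :- u) :- con 0 := v :- y :- (w :- u) :+ (x :- v) :+ (w :+ a) :- (con 0 :+ a :+ z)) refl _ _ _ _ _ _ _)) , (linear ((proj₂ ih) ⊞ (proj₂ blk) ⊞ ≼-reflexive (sym H-suc)) (solve 9 (λ x y z u v w a b c → x :- y :- (z :- u :- (v :- w)) := x :- a :+ a :+ v :- (b :- u :- (c :- w) :+ (z :- b) :+ (c :+ y))) refl _ _ _ _ _ _ _ _ _)))
  where
  H-suc : H (suc (j + t)) ≡ H (j + t) ⊕ inv (suc (j + t))
  H-suc = refl

  ih = H-dilate m j t hm hj
  blk = H-block (j + t) m (ℕ.≤-trans hj (ℕ.m≤m+n j t)) hm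

module HarmonicLog (R : ℕ) (hR : 1 ≤ R) where
  h : ℕ → K
  h n = H (n * R) ⊖ H R

  h-def : ∀ n → h n ≡ H (n * R) ⊖ H R
  h-def n = refl

  h-step : ∀ n → 1 ≤ n → inv (suc n) ≼ h (suc n) ⊖ h n × h (suc n) ⊖ h n ≼ inv n
  h-step n hn = (linear ((proj₁ (H-block n R hn hR)) ⊞ ≼-reflexive (h-def n) ⊞ ≼-reflexive (sym (h-def (suc n)))) (solve 6 (λ x y z u v w → x :- y :- z := u :- v :+ (v :- w) :+ x :- (z :+ y :+ (u :- w))) refl _ _ _ _ _ _)) , (linear ((proj₂ (H-block n R hn hR)) ⊞ ≼-reflexive (sym (h-def n)) ⊞ ≼-reflexive (h-def (suc n))) (solve 6 (λ x y z u v w → x :- (y :- z) := x :+ z :+ (u :- v) :- (u :- w :+ (w :- v) :+ y)) refl _ _ _ _ _ _))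

  -- h(mn) - h(m) - h(n) compares the harmonic sum between R and nR with its dilation by m, so
  -- `H-dilate` with j = R applies.
  h-* : ∀ m n → 1 ≤ m → 1 ≤ n → Bd (h (m * n) ⊖ (h m ⊕ h n)) (inv R)
  h-* m (suc n) hm hn = subst (λ z → Bd (z ⊖ H R ⊖ (h m ⊕ h (suc n))) (inv R)) (cong H e₁)
      ( subst (λ z → neg (inv R) ≼ H ((R + n * R) * m) ⊖ H R ⊖ (z ⊖ H R ⊕ h (suc n))) (cong H (ℕ.*-comm R m))
          ((linear ((proj₁ (H-dilate m R (n * R) hm hR)) ⊞ (0≼inv hR) ⊞ ≼-reflexive h-def′) (solve 6 (λ x y z u v w → x :- y :- (z :- y :+ u) :- (:- v) := x :- z :- (w :- y) :+ v :+ (w :- y) :- (con 0 :+ con 0 :+ u)) refl _ _ _ _ _ _)))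
      , subst (λ z → H ((R + n * R) * m) ⊖ H R ⊖ (z ⊖ H R ⊕ h (suc n)) ≼ inv R) (cong H (ℕ.*-comm R m))
          ((linear ((proj₂ (H-dilate m R (n * R) hm hR)) ⊞ (0≼inv {R + n * R} (ℕ.≤-trans hR (ℕ.m≤m+n R (n * R)))) ⊞ ≼-reflexive (sym h-def′)) (solve 7 (λ x y z u v w a → x :- (y :- z :- (u :- z :+ v)) := x :- w :+ w :+ v :- (y :- u :- (a :- z) :+ con 0 :+ (a :- z))) refl _ _ _ _ _ _ _))))
      where
      h-def′ : h (suc n) ≡ H (R + n * R) ⊖ H R
      h-def′ = refl

      e₁ : (R + n * R) * m ≡ m * suc n * R
      e₁ = trans (ℕ.*-comm (R + n * R) m) (sym (ℕ.*-assoc m (suc n) R))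

  0≼h : ∀ n → 1 ≤ n → 0# ≼ h n
  0≼h n hn = (linear (≼-reflexive (sym (h-def n)) ⊞ ≼-reflexive (H-def R) ⊞ ≼-reflexive (sym (H-def (n * R))) ⊞ (S-mono-range {R} {n * R} inv (≤*ʳ R hn) (λ k a _ → 0≼inv (ℕ.≤-trans (s≤s z≤n) a)))) (solve 5 (λ x y z u v → x :- con 0 := x :+ y :+ z :+ u :- (z :- v :+ v :+ u :+ y)) refl _ _ _ _ _))

  -- The increments of `h` may use up all of the 1/n that `ℓ-upper` allows. Halving leaves room for
  -- an error of 1/(4(n+1)) in both bounds required by `Log`.
  open PrimePowers (λ p → inv 2 ⊗ h p) public

  0≼λ : ∀ p → 1 ≤ p → 0# ≼ inv 2 ⊗ h p
  0≼λ p hp = 0≼⊗ (0≼inv {2} (s≤s z≤n)) (0≼h p hp)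

  -- Induction over prime factors: a factor p adds an error of at most 1/R to m/R, and m + 1 ≤ p m.
  -- The 2 undoes the halving of the weights.
  L₀-approx : ∀ n → 1 ≤ n → Bd (ι 2 ⊗ L₀ n ⊖ h n) (ι n ⊗ inv R)
  L₀-approx = prime-induction _ base step
    where
    base : Bd (ι 2 ⊗ L₀ 1 ⊖ h 1) (ι 1 ⊗ inv R)
    base = Bd-≡ (trans (cong₂ (λ a b → ι 2 ⊗ a ⊖ (H b ⊖ H R)) L₀-1 (ℕ.*-identityˡ R)) (solve 1 (λ x → con 2 :* con 0 :- (x :- x) := con 0) refl _)) (Bd-0 ((linear ((0≼inv hR)) (solve 1 (λ x → con 1 :* x :- con 0 := x :- con 0) refl _))))

    step : ∀ p m → Prime p → 1 ≤ m → Bd (ι 2 ⊗ L₀ m ⊖ h m) (ι m ⊗ inv R) → Bd (ι 2 ⊗ L₀ (p * m) ⊖ h (p * m)) (ι (p * m) ⊗ inv R)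
    step p m pr hm ih = subst (λ z → Bd (ι 2 ⊗ z ⊖ h (p * m)) (ι (p * m) ⊗ inv R)) (sym (L₀-prime p m pr hm))
        ( (linear ((proj₁ ih) ⊞ (proj₂ (h-* p m (prime≥1 pr) hm)) ⊞ grow ⊞ ≼-reflexive (sym 2h)) (solve 8 (λ x y z u v w a b → con 2 :* (x :* y :+ z) :- u :- (:- (v :* w)) := con 2 :* z :- a :+ w :+ v :* w :+ y :* (con 2 :* x) :- (:- (b :* w) :+ (u :- (y :+ a)) :+ (one :+ b) :* w :+ y :* one)) refl _ _ _ _ _ _ _ _)) , (linear ((proj₂ ih) ⊞ (proj₁ (h-* p m (prime≥1 pr) hm)) ⊞ grow ⊞ ≼-reflexive 2h) (solve 8 (λ x y z u v w a b → x :* y :- (con 2 :* (z :* u :+ v) :- w) := a :* y :+ (w :- (u :+ b)) :+ x :* y :+ u :* one :- (con 2 :* v :- b :+ (:- y) :+ (one :+ a) :* y :+ u :* (con 2 :* z))) refl _ _ _ _ _ _ _ _)))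
      where
      sucm≤pm : suc m ≤ p * m
      sucm≤pm = ℕ.≤-trans (ℕ.+-monoˡ-≤ m hm) (subst (_≤ p * m) (cong (λ z → m + z) (ℕ.+-identityʳ m)) (ℕ.*-monoˡ-≤ m (prime≥2 pr)))

      grow : ι (suc m) ⊗ inv R ≼ ι (p * m) ⊗ inv R
      grow = ⊗-monoʳ (0≼inv hR) (ι-mono sucm≤pm)

      2h : h p ⊗ (ι 2 ⊗ inv 2) ≡ h p ⊗ 1#
      2h = cong (h p ⊗_) (inv-inverse {2} (s≤s z≤n))

-- A substitute for (log n) / 2: exactly additive, and with increments between 1/4(n+1) and 1/n up to X, which is all that
-- the estimates need.
record Log (X : ℕ) : Set where
  field
    ℓ Λ : ℕ → K
    ℓ-* : ∀ a b → 1 ≤ a → 1 ≤ b → ℓ (a * b) ≡ ℓ a ⊕ ℓ b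
    ℓ-upper : ∀ n → 1 ≤ n → n < X → ℓ (suc n) ⊖ ℓ n ≼ inv n
    ℓ-lower : ∀ n → 1 ≤ n → n < X → inv (suc n) ≼ ι 4 ⊗ (ℓ (suc n) ⊖ ℓ n)
    0≼Λ : ∀ n → 0# ≼ Λ n
    Λ⋆𝟏 : ∀ n → ℓ n ≡ (Λ ⋆ 𝟏) n
    Λ-sq : ∀ n → 1 ≤ n → Λ n ≼ Λ (n * n)
    S-Λ : ∀ x (w : ℕ → K) → S x (λ n → w n ⊗ Λ n) ≡
      S x (λ p → S x λ k → 𝟙 (isPrime? p) ⊗ (𝟙 (p ^ k ≤? x) ⊗ (w (p ^ k) ⊗ ℓ p)))

mkLog : ∀ X → Log X
mkLog X = record
  { ℓ = L₀
  ; Λ = Λ₀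
  ; ℓ-* = L₀-*
  ; ℓ-upper = λ n hn hX → upper n hn hX (L₀-approx n hn) (L₀-approx (suc n) (s≤s z≤n)) (h-step n hn) (err n hn hX)
  ; ℓ-lower = λ n hn hX → lower n hn hX (L₀-approx n hn) (L₀-approx (suc n) (s≤s z≤n)) (h-step n hn) (err n hn hX)
  ; 0≼Λ = 0≼Λ₀ 0≼λ
  ; Λ⋆𝟏 = λ n → refl
  ; Λ-sq = Λ₀-sq 0≼λ
  ; S-Λ = λ x w → trans (S-Λ₀ x w) (S-cong x λ p _ _ → S-cong x λ k _ _ → 𝟙-guard (isPrime? p) λ pr →
      cong (λ z → 𝟙 (p ^ k ≤? x) ⊗ (w (p ^ k) ⊗ z)) (sym (L₀-at-prime p pr)))
  }
  where
  -- With R > 4X² the errors of two neighbouring values satisfy `err`: 4(n+1)/R ≤ 1/(n+1) for n < X.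
  R = suc (2 * X * X * 2)
  open HarmonicLog R (s≤s z≤n)

  err : ∀ n → 1 ≤ n → n < X → ι 2 ⊗ ι (2 * suc n) ⊗ inv R ≼ inv (suc n)
  err n hn hX = ≼-trans (⊗-monoˡ (0≼⊗ (0≼ι 2) (0≼ι (2 * suc n))) (inv-anti (1≤* {suc n * (2 * suc n)} {2} (1≤* {suc n} {2 * suc n} (s≤s z≤n) (s≤s z≤n)) (s≤s z≤n)) R≥))
    (≼-reflexive (trans (cong (ι 2 ⊗ ι (2 * suc n) ⊗_) (trans (inv-* {suc n * (2 * suc n)} {2} (1≤* {suc n} {2 * suc n} (s≤s z≤n) (s≤s z≤n)) (s≤s z≤n))
        (cong (_⊗ inv 2) (inv-* {suc n} {2 * suc n} (s≤s z≤n) (s≤s z≤n)))))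
      (trans (rearrange _ _ _ _ _) (trans (cong₂ (λ a b → inv (suc n) ⊗ (a ⊗ b)) (inv-inverse {2} (s≤s z≤n)) (inv-inverse {2 * suc n} (s≤s z≤n))) (solve 1 (λ x → x :* (one :* one) := x) refl _)))))
    where
    rearrange : ∀ a b c d e → a ⊗ b ⊗ (c ⊗ d ⊗ e) ≡ c ⊗ ((a ⊗ e) ⊗ (b ⊗ d))
    rearrange a b c d e = (solve 5 (λ x y z u v → x :* y :* (z :* u :* v) := z :* (x :* v :* (y :* u))) refl _ _ _ _ _)

    R≥ : suc n * (2 * suc n) * 2 ≤ R
    R≥ = ℕ.m≤n⇒m≤1+n (ℕ.*-monoˡ-≤ 2 (subst (_≤ 2 * X * X) (ℕ.*-comm (2 * suc n) (suc n)) (ℕ.*-mono-≤ (ℕ.*-monoʳ-≤ 2 hX) hX)))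

  Hyps : ℕ → Set → Set
  Hyps n G = Bd (ι 2 ⊗ L₀ n ⊖ h n) (ι n ⊗ inv R) → Bd (ι 2 ⊗ L₀ (suc n) ⊖ h (suc n)) (ι (suc n) ⊗ inv R) →
    inv (suc n) ≼ h (suc n) ⊖ h n × h (suc n) ⊖ h n ≼ inv n → ι 2 ⊗ ι (2 * suc n) ⊗ inv R ≼ inv (suc n) → G

  double : ∀ n → ι (2 * n) ≡ ι 2 ⊗ ι n
  double n = ι-* 2 n

  upper : ∀ n → 1 ≤ n → n < X → Hyps n (L₀ (suc n) ⊖ L₀ n ≼ inv n)
  upper n hn _ (l , u) (l′ , u′) (s , s′) e = (linear′ 3 (2 ⊠ l ⊞ 2 ⊠ u′ ⊞ 2 ⊠ s′ ⊞ e ⊞ ≼-reflexive (sym (cong (λ z → ι 2 ⊗ z ⊗ inv R) (double (suc n)))) ⊞ (inv-anti {n} {suc n} hn (ℕ.n≤1+n n)) ⊞ 2 ⊠ (0≼inv {R} (s≤s z≤n)) ⊞ (0≼inv hn)) (solve 9 (λ x y z u v w a b c → con 4 :* (x :- (y :- z)) := con 2 :* (con 2 :* z :- u) :+ con 2 :* ((one :+ v) :* w) :+ con 2 :* x :+ a :+ con 2 :* b :* w :+ x :+ con 2 :* w :+ x :- (con 2 :* (:- (v :* w)) :+ con 2 :* (con 2 :* y :- c) :+ con 2 :* (c :- u) :+ con 2 :* b :* w :+ con 2 :* (con 2 :* (one :+ v)) :* w :+ a :+ con 2 :* con 0 :+ con 0)) refl _ _ _ _ _ _ _ _ _))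

  lower : ∀ n → 1 ≤ n → n < X → Hyps n (inv (suc n) ≼ ι 4 ⊗ (L₀ (suc n) ⊖ L₀ n))
  lower n hn _ (l , u) (l′ , u′) (s , s′) e = (linear (2 ⊠ u ⊞ 2 ⊠ l′ ⊞ 2 ⊠ s ⊞ e ⊞ ≼-reflexive (sym (cong (λ z → ι 2 ⊗ z ⊗ inv R) (double (suc n)))) ⊞ 2 ⊠ (0≼inv {R} (s≤s z≤n))) (solve 8 (λ x y z u v w a b → con 4 :* (x :- y) :- z := con 2 :* (u :* v) :+ con 2 :* (con 2 :* x :- w) :+ con 2 :* (w :- a) :+ z :+ con 2 :* b :* v :+ con 2 :* v :- (con 2 :* (con 2 :* y :- a) :+ con 2 :* (:- ((one :+ u) :* v)) :+ con 2 :* z :+ con 2 :* b :* v :+ con 2 :* (con 2 :* (one :+ u)) :* v :+ con 2 :* con 0)) refl _ _ _ _ _ _ _ _))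

-- Chebyshev and Mertens estimates

div-bounds : ∀ x d → 1 ≤ d → ι (x div d) ≼ ι x ⊗ inv d × ι x ⊗ inv d ≼ ι (x div d) ⊕ 1#
div-bounds x d hd =
  ⊗-cancel (1≼ι hd) (≼-trans (≼-reflexive (sym (ι-* d (x div d)))) (≼-trans (ι-mono (≤div⇒ x d hd ℕ.≤-refl)) (≼-reflexive (sym unit)))) ,
  ⊗-cancel (1≼ι hd) (≼-trans (≼-reflexive unit) (≼-trans (ι-mono (ℕ.<⇒≤ (ℕ.≰⇒> λ h → ℕ.<⇒≱ (ℕ.n<1+n (x div d)) (⇒≤div x d hd h))))
    (≼-trans (≼-reflexive (ι-* d (suc (x div d)))) (≼-reflexive (solve 2 (λ x y → x :* (one :+ y) := x :* (y :+ one)) refl _ _)))))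
  where
  unit : ι d ⊗ (ι x ⊗ inv d) ≡ ι x
  unit = (linear-≡ (ι x ⊠≡ inv-inverse hd) (solve 3 (λ x y z → x :- y :* (x :* z) := x :* one :- x :* (y :* z)) refl _ _ _))

halve : ∀ n → Σ ℕ λ k → n ≡ k + k ⊎ n ≡ suc (k + k)
halve zero = 0 , inj₁ refl
halve (suc n) with halve n
... | k , inj₁ refl = k , inj₂ refl
... | k , inj₂ refl = suc k , inj₁ (cong suc (sym (ℕ.+-suc k k)))

S-inv-^ : ∀ p Y → 2 ≤ p → S Y (λ k → inv (p ^ k)) ≼ ι 2 ⊗ inv p
S-inv-^ p zero hp = 0≼⊗ (0≼ι 2) (0≼inv (ℕ.≤-trans (s≤s z≤n) hp))
S-inv-^ p (suc Y) hp = (linear ((go Y) ⊞ (0≼inv {p ^ suc Y} (1≤^ (suc Y)))) (solve 4 (λ x y z u → con 2 :* x :- (y :+ z) := con 2 :* x :+ u :- (y :+ z :+ u :+ con 0)) refl _ _ _ _))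
  where
  1≤^ : ∀ k → 1 ≤ p ^ k
  1≤^ k = ℕ.≤-trans (s≤s z≤n) (k<p^k p k hp)

  2inv≤1 : ι 2 ⊗ inv p ≼ 1#
  2inv≤1 = ≼-trans (⊗-monoˡ (0≼ι 2) (inv-anti {2} (s≤s z≤n) hp)) (≼-reflexive (inv-inverse {2} (s≤s z≤n)))

  inv-suc : ∀ k → inv (p ^ suc k) ≡ inv p ⊗ inv (p ^ k)
  inv-suc k = inv-* (ℕ.≤-trans (s≤s z≤n) hp) (1≤^ k)

  -- Counting the last term twice makes the induction close, because 2/p^(k+1) ≤ 1/p^k.
  go : ∀ Y → S (suc Y) (λ k → inv (p ^ k)) ⊕ inv (p ^ suc Y) ≼ ι 2 ⊗ inv p
  go zero = ≼-reflexive (trans (cong (λ z → 0# ⊕ inv z ⊕ inv z) (ℕ.*-identityʳ p)) (solve 1 (λ x → con 0 :+ x :+ x := con 2 :* x) refl _))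
  go (suc Y) = (linear ((go Y) ⊞ 2 ⊠ (≼-reflexive (inv-suc (suc Y))) ⊞ (mul≼ 2inv≤1 (0≼inv (1≤^ (suc Y))))) (solve 4 (λ x y z u → con 2 :* x :- (y :+ z :+ u :+ u) := con 2 :* x :+ con 2 :* (x :* z) :+ (one :- con 2 :* x) :* (z :- con 0) :- (y :+ z :+ z :+ con 2 :* u :+ con 0)) refl _ _ _ _))

S-inv-^≥2 : ∀ p Y → 2 ≤ p → S Y (λ k → 𝟙 (2 ≤? k) ⊗ inv (p ^ k)) ≼ ι 2 ⊗ (inv p ⊗ inv p)
S-inv-^≥2 p zero hp = 0≼⊗ (0≼ι 2) (0≼⊗ (0≼inv (ℕ.≤-trans (s≤s z≤n) hp)) (0≼inv (ℕ.≤-trans (s≤s z≤n) hp)))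
S-inv-^≥2 p (suc Y) hp = ≼-trans (≼-reflexive (trans (S-shift Y _) (trans (cong₂ (λ a b → a ⊗ inv (p ^ 1) ⊕ b) (𝟙-no (2 ≤? 1) λ { (s≤s ()) })
    (trans (S-cong Y λ k hk _ → trans (cong₂ _⊗_ (𝟙-yes (2 ≤? suc k) (s≤s hk)) (inv-* hp1 (ℕ.≤-trans (s≤s z≤n) (k<p^k p k hp)))) (⊗-identityˡ _)) (S-⊗ˡ Y _ _))) (solve 3 (λ x y z → con 0 :* x :+ y :* z := y :* z) refl _ _ _))))
  (≼-trans (⊗-monoˡ (0≼inv hp1) (S-inv-^ p Y hp)) (≼-reflexive (solve 1 (λ x → x :* (con 2 :* x) := con 2 :* (x :* x)) refl _)))
  where
  hp1 : 1 ≤ p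
  hp1 = ℕ.≤-trans (s≤s z≤n) hp

S-cut : ∀ x q (f : ℕ → K) → (∀ n → 1 ≤ n → 0# ≼ f n) → S x (λ n → 𝟙 (n ≤? q) ⊗ f n) ≼ S q f
S-cut x q f hf with ℕ.≤-total q x
... | inj₁ h = ≼-reflexive (S-restrict f h)
... | inj₂ h = ≼-trans (S-mono x λ n a b → ≼-reflexive (trans (cong (_⊗ f n) (𝟙-yes (n ≤? q) (ℕ.≤-trans b h))) (⊗-identityˡ _)))
  (S-mono-range f h λ n a _ → hf n (ℕ.≤-trans (s≤s z≤n) a))

module LogFacts {X : ℕ} (lg : Log X) where
  open Log lg public

  ℓ-1 : ℓ 1 ≡ 0#
  ℓ-1 = (linear-≡ (sym ℓ-1+1) (solve 1 (λ x → con 0 :- x := x :- (x :+ x)) refl _))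
    where
    ℓ-1+1 : ℓ 1 ≡ ℓ 1 ⊕ ℓ 1
    ℓ-1+1 = ℓ-* 1 1 ℕ.≤-refl ℕ.≤-refl

  0≼ℓ-step : ∀ n → 1 ≤ n → n < X → 0# ≼ ℓ (suc n) ⊖ ℓ n
  0≼ℓ-step n h l = (linear′ 3 ((ℓ-lower n h l) ⊞ (0≼inv {suc n} (s≤s z≤n))) (solve 3 (λ x y z → con 4 :* (x :- y :- con 0) := con 4 :* (x :- y) :+ z :- (z :+ con 0)) refl _ _ _))

  ℓ-mono : ∀ {m n} → 1 ≤ m → m ≤ n → n ≤ X → ℓ m ≼ ℓ n
  ℓ-mono {m} {zero} h z≤n _ = ≼-refl
  ℓ-mono {m} {suc n} h k l with m ≟ suc n
  ... | yes refl = ≼-refl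
  ... | no ne = (linear ((ℓ-mono h m≤n (ℕ.<⇒≤ l)) ⊞ (0≼ℓ-step n (ℕ.≤-trans h m≤n) l)) (solve 3 (λ x y z → x :- y := z :+ (x :- z) :- (y :+ con 0)) refl _ _ _))
    where
    m≤n : m ≤ n
    m≤n = ℕ.≤-pred (ℕ.≤∧≢⇒< k ne)

  0≼ℓ : ∀ {n} → 1 ≤ n → n ≤ X → 0# ≼ ℓ n
  0≼ℓ h l = (linear ((ℓ-mono {1} ℕ.≤-refl h l) ⊞ ≼-reflexive (sym ℓ-1)) (solve 2 (λ x y → x :- con 0 := x :+ y :- (y :+ con 0)) refl _ _))

  ℓ≼ι : ∀ n → 1 ≤ n → n ≤ X → ℓ n ≼ ι n
  ℓ≼ι (suc zero) _ _ = (linear (≼-reflexive ℓ-1 ⊞ 0≼1) (solve 1 (λ x → con 1 :- x := con 0 :+ one :- (x :+ con 0)) refl _))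
  ℓ≼ι (suc (suc n)) _ l = (linear ((ℓ≼ι (suc n) (s≤s z≤n) (ℕ.<⇒≤ l)) ⊞ (ℓ-upper (suc n) (s≤s z≤n) l) ⊞ (inv≼1 {suc n} (s≤s z≤n))) (solve 4 (λ x y z u → one :+ (one :+ x) :- y := one :+ x :+ z :+ one :- (u :+ (y :- u) :+ z)) refl _ _ _ _))

  H≼ : ∀ x → 1 ≤ x → x ≤ X → H x ≼ 1# ⊕ ι 4 ⊗ ℓ x
  H≼ (suc zero) _ _ = ≼-reflexive (trans (cong (λ z → 0# ⊕ z) inv-1) ((linear-≡ (ι 4 ⊠≡ (sym ℓ-1)) (solve 1 (λ x → one :+ con 4 :* x :- (con 0 :+ one) := con 4 :* x :- con 4 :* con 0) refl _))))
  H≼ (suc (suc n)) _ l = (linear ((H≼ (suc n) (s≤s z≤n) (ℕ.<⇒≤ l)) ⊞ (ℓ-lower (suc n) (s≤s z≤n) l) ⊞ ≼-reflexive H-suc) (solve 5 (λ x y z u v → one :+ con 4 :* x :- y := one :+ con 4 :* z :+ con 4 :* (x :- z) :+ (u :+ v) :- (u :+ v :+ y)) refl _ _ _ _ _))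
    where
    H-suc : H (suc (suc n)) ≡ H (suc n) ⊕ inv (suc (suc n))
    H-suc = refl

  Σℓ : ℕ → K
  Σℓ x = S x ℓ

  Σℓ-bounds : ∀ x → 1 ≤ x → x ≤ X → ι x ⊗ ℓ x ⊖ ι x ≼ Σℓ x × Σℓ x ≼ ι x ⊗ ℓ x
  Σℓ-bounds (suc zero) _ _ = (linear (0≼1) (solve 1 (λ x → con 0 :+ x :- (con 1 :* x :- con 1) := one :- con 0) refl _)) , (linear (0 ⊠ 0≼1) (solve 1 (λ x → con 1 :* x :- (con 0 :+ x) := con 0 :* one :- con 0 :* con 0) refl _))
  Σℓ-bounds (suc (suc n)) _ l =
    (linear ((proj₁ (Σℓ-bounds (suc n) (s≤s z≤n) (ℕ.<⇒≤ l))) ⊞ (⊗-monoˡ (0≼ι (suc n)) (ℓ-upper (suc n) (s≤s z≤n) l)) ⊞ ≼-reflexive (inv-inverse {suc n} (s≤s z≤n))) (solve 5 (λ x y z u v → x :+ y :+ z :- ((one :+ (one :+ u)) :* z :- (one :+ (one :+ u))) := x :+ y :+ (one :+ u) :* v :+ one :- ((one :+ u) :* y :- (one :+ u) :+ (one :+ u) :* (z :- y) :+ (one :+ u) :* v)) refl _ _ _ _ _)) ,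
    (linear ((proj₂ (Σℓ-bounds (suc n) (s≤s z≤n) (ℕ.<⇒≤ l))) ⊞ (⊗-monoˡ (0≼ι (suc n)) (0≼ℓ-step (suc n) (s≤s z≤n) l))) (solve 4 (λ x y z u → (one :+ (one :+ x)) :* y :- (z :+ u :+ y) := (one :+ x) :* u :+ (one :+ x) :* (y :- u) :- (z :+ u :+ (one :+ x) :* con 0)) refl _ _ _ _))

  S-div-count : ∀ x d → 1 ≤ d → S x (λ m → 𝟙 (d * m ≤? x)) ≡ ι (x div d)
  S-div-count x d hd = trans (S-cong x λ m _ _ → sym (⊗-identityʳ _)) (trans (S-div x d 𝟏 hd) (trans (S-const (x div d) 1#) (⊗-identityʳ _)))

  Σℓ-Λ : ∀ x → Σℓ x ≡ S x (λ d → Λ d ⊗ ι (x div d))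
  Σℓ-Λ x = trans (S-cong x λ n _ _ → trans (Λ⋆𝟏 n) (sym (⊗-identityˡ _))) (trans (S-⋆ x 𝟏 Λ 𝟏)
    (S-cong x λ d hd _ → trans (S-cong x λ m _ _ → trans (cong (𝟙 (d * m ≤? x) ⊗_) (trans (⊗-identityˡ _) (⊗-identityʳ _))) (⊗-comm _ _))
      (trans (S-⊗ˡ x _ _) (cong (Λ d ⊗_) (S-div-count x d hd)))))

  Λ≼ℓ : ∀ n → 1 ≤ n → Λ n ≼ ℓ n
  Λ≼ℓ n h = ≼-trans (≼-trans (≼-reflexive (sym (trans (cong (_⊗ (Λ n ⊗ 𝟏 1)) (𝟙-yes (n * 1 ≟ n) (ℕ.*-identityʳ n))) (solve 1 (λ x → one :* (x :* one) := x) refl _))))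
      (≼-trans (S-term n (λ m → 𝟙 (n * m ≟ n) ⊗ (Λ n ⊗ 𝟏 m)) 1 ℕ.≤-refl h λ m _ → nn n m)
      (S-term n (λ d → S n λ m → 𝟙 (d * m ≟ n) ⊗ (Λ d ⊗ 𝟏 m)) n h ℕ.≤-refl λ d _ → 0≼S n λ m _ _ → nn d m)))
    (≼-reflexive (sym (Λ⋆𝟏 n)))
    where
    nn : ∀ d m → 0# ≼ 𝟙 (d * m ≟ n) ⊗ (Λ d ⊗ 𝟏 m)
    nn d m = 0≼⊗ (0≼𝟙 (d * m ≟ n)) (0≼⊗ (0≼Λ d) 0≼1)

  ψ : ℕ → K
  ψ x = S x Λ

  -- Chebyshev's argument: Σℓ(2n) - 2 Σℓ(n) is the sum of Λ(d)(⌊2n/d⌋ - 2⌊n/d⌋), whose terms are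
  -- nonnegative and at least Λ(d) for n < d ≤ 2n. By `Σℓ-bounds` it is at most 2n ℓ(2) + 2n ≤ 4n.
  ψ-double : ∀ n → 1 ≤ n → n + n ≤ X → ψ (n + n) ≼ ψ n ⊕ ι 4 ⊗ ι n
  ψ-double n hn hX = (linear (lower ⊞ (proj₂ (Σℓ-bounds (n + n) 1≤2n hX)) ⊞ (2 ⊠ proj₁ (Σℓ-bounds n hn (ℕ.≤-trans (ℕ.m≤m+n n n) hX))) ⊞ ≼-reflexive (ι (n + n) ⊠≡ ℓ-double) ⊞ ≼-reflexive ((ℓ 2 ⊕ ℓ n) ⊠≡ ι-+ n n) ⊞ 2 ⊠ (≼-reflexive (ι n ⊠≡ ℓ-1)) ⊞ 2 ⊠ (⊗-monoˡ (0≼ι n) (ℓ-upper 1 ℕ.≤-refl (ℕ.≤-trans (ℕ.+-mono-≤ hn hn) hX))) ⊞ 2 ⊠ (≼-reflexive (ι n ⊠≡ inv-1))) (solve 11 (λ x y z u v w a b c d e → x :+ con 4 :* y :- z := u :+ x :+ v :* w :+ con 2 :* a :+ v :* (b :+ c) :+ (b :+ c) :* (y :+ y) :+ con 2 :* (y :* con 0) :+ con 2 :* (y :* d) :+ con 2 :* (y :* one) :- (z :+ con 2 :* a :+ u :+ con 2 :* (y :* c :- y) :+ v :* w :+ (b :+ c) :* v :+ con 2 :* (y :* e) :+ con 2 :* (y :* (b :- e)) :+ con 2 :* (y :* d))) refl _ _ _ _ _ _ _ _ _ _ _))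
    where
    1≤2n : 1 ≤ n + n
    1≤2n = ℕ.≤-trans hn (ℕ.m≤m+n n n)

    ℓ-double : ℓ (n + n) ≡ ℓ 2 ⊕ ℓ n
    ℓ-double = trans (cong ℓ (cong (λ z → n + z) (sym (ℕ.+-identityʳ n)))) (ℓ-* 2 n (s≤s z≤n) hn)

    double≤ : ∀ d → 1 ≤ d → n div d + n div d ≤ (n + n) div d
    double≤ d hd = ⇒≤div (n + n) d hd (subst (_≤ n + n) (sym (ℕ.*-distribˡ-+ d (n div d) (n div d))) (ℕ.+-mono-≤ (≤div⇒ n d hd ℕ.≤-refl) (≤div⇒ n d hd ℕ.≤-refl)))

    head : ι 2 ⊗ Σℓ n ≼ S n (λ d → Λ d ⊗ ι ((n + n) div d))
    head = ≼-trans (≼-reflexive (trans (cong (ι 2 ⊗_) (Σℓ-Λ n)) (sym (S-⊗ˡ n _ _)))) (S-mono n λ d hd _ →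
      (linear ((⊗-monoˡ (0≼Λ d) (≼-trans (≼-reflexive (sym (ι-+ (n div d) (n div d)))) (ι-mono (double≤ d hd))))) (solve 3 (λ x y z → x :* y :- con 2 :* (x :* z) := x :* y :- x :* (z :+ z)) refl _ _ _)))

    tail : S n (λ j → Λ (n + j)) ≼ S n (λ j → Λ (n + j) ⊗ ι ((n + n) div (n + j)))
    tail = S-mono n λ j hj hj′ → ≼-trans (≼-reflexive (sym (⊗-identityʳ _))) (⊗-monoˡ (0≼Λ (n + j))
      (1≼ι (⇒≤div (n + n) (n + j) (ℕ.≤-trans hn (ℕ.m≤m+n n j)) (subst (_≤ n + n) (sym (ℕ.*-identityʳ (n + j))) (ℕ.+-monoʳ-≤ n hj′)))))

    lower : ψ (n + n) ⊕ ι 2 ⊗ Σℓ n ≼ Σℓ (n + n) ⊕ ψ n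
    lower = (linear (head ⊞ tail ⊞ ≼-reflexive (sym (Σℓ-Λ (n + n))) ⊞ ≼-reflexive (sym (S-split n n (λ d → Λ d ⊗ ι ((n + n) div d)))) ⊞ ≼-reflexive split) (solve 8 (λ x y z u v w a b → x :+ y :- (z :+ con 2 :* u) := v :+ w :+ x :+ a :+ (y :+ b) :- (con 2 :* u :+ b :+ a :+ (v :+ w) :+ z)) refl _ _ _ _ _ _ _ _))
      where
      split : ψ (n + n) ≡ ψ n ⊕ S n (λ j → Λ (n + j))
      split = S-split n n Λ

  ψ-bound : ∀ n → n ≤ X → ψ n ≼ ι 8 ⊗ ι n
  ψ-bound = <-rec _ go
    where
    go : ∀ n → (∀ {m} → m < n → m ≤ X → ψ m ≼ ι 8 ⊗ ι m) → n ≤ X → ψ n ≼ ι 8 ⊗ ι n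
    go n rec hX with halve n
    ... | zero , inj₁ refl = ≼-reflexive (sym (⊗-zeroʳ _))
    ... | k@(suc _) , inj₁ refl = (linear ((ψ-double k (s≤s z≤n) hX) ⊞ (rec {k} (ℕ.m<m+n k (s≤s z≤n)) (ℕ.≤-trans (ℕ.m≤m+n k k) hX)) ⊞ 8 ⊠ (≼-reflexive (sym (ι-+ k k))) ⊞ 4 ⊠ (0≼ι k)) (solve 5 (λ x y z u v → (one :+ (one :+ (one :+ (one :+ (one :+ (one :+ (one :+ (one :+ con 0)))))))) :* x :- y := z :+ u :+ con 4 :* (one :+ v) :+ (one :+ (one :+ (one :+ (one :+ (one :+ (one :+ (one :+ (one :+ con 0)))))))) :* (one :+ v) :+ con 8 :* x :+ con 4 :* (one :+ v) :- (y :+ (z :+ u) :+ con 8 :* (one :+ v :+ (one :+ v)) :+ con 4 :* con 0)) refl _ _ _ _ _))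
    ... | zero , inj₂ refl = ψ-1
      where
      ψ-1 : ψ 1 ≼ ι 8 ⊗ ι 1
      ψ-1 = (linear ((Λ≼ℓ 1 ℕ.≤-refl) ⊞ ≼-reflexive ℓ-1 ⊞ 8 ⊠ 0≼1) (solve 2 (λ x y → con 8 :* con 1 :- (con 0 :+ x) := y :+ con 0 :+ con 8 :* one :- (x :+ y :+ con 8 :* con 0)) refl _ _))
    ... | k@(suc _) , inj₂ refl = (linear ((ψ-double k (s≤s z≤n) (ℕ.<⇒≤ hX)) ⊞ (rec {k} (ℕ.<-trans (ℕ.m<m+n k (s≤s z≤n)) (ℕ.n<1+n _)) (ℕ.≤-trans (ℕ.m≤m+n k k) (ℕ.<⇒≤ hX))) ⊞ 7 ⊠ (≼-reflexive (sym (ι-+ k k))) ⊞ 2 ⊠ (0≼ι k) ⊞ (Λ≼ℓ (suc (k + k)) (s≤s z≤n)) ⊞ (ℓ≼ι (suc (k + k)) (s≤s z≤n) hX) ⊞ 7 ⊠ 0≼1) (solve 7 (λ x y z u v w a → (one :+ (one :+ (one :+ (one :+ (one :+ (one :+ (one :+ (one :+ con 0)))))))) :* (one :+ x) :- (y :+ z) := u :+ v :+ con 4 :* (one :+ w) :+ (one :+ (one :+ (one :+ (one :+ (one :+ (one :+ (one :+ (one :+ con 0)))))))) :* (one :+ w) :+ con 7 :* x :+ con 2 :* (one :+ w) :+ a :+ (one :+ x) :+ con 7 :* one :- (y :+ (u :+ v) :+ con 7 :* (one :+ w :+ (one :+ w)) :+ con 2 :* con 0 :+ z :+ a :+ con 7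 :* con 0)) refl _ _ _ _ _ _ _))

  u : ℕ → K
  u n = Λ n ⊗ inv n

  0≼u : ∀ n → 1 ≤ n → 0# ≼ u n
  0≼u n h = 0≼⊗ (0≼Λ n) (0≼inv h)

  -- Divide Σℓ(x) = Σ Λ(d)⌊x/d⌋ by x; removing the floors costs at most ψ(x) ≤ 8x.
  mertens : ∀ x → 1 ≤ x → x ≤ X → ℓ x ⊖ 1# ≼ S x u × S x u ≼ ℓ x ⊕ ι 8
  mertens x hx hX =
    ⊗-cancel (1≼ι hx) ((linear ((proj₁ (Σℓ-bounds x hx hX)) ⊞ ≼-reflexive (Σℓ-Λ x) ⊞ lower ⊞ ≼-reflexive (S-⊗ˡ x (ι x) u)) (solve 6 (λ x y z u v w → x :* y :- x :* (z :- one) := u :+ v :+ w :+ x :* y :- (x :* z :- x :+ u :+ v :+ w)) refl _ _ _ _ _ _))) ,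
    ⊗-cancel (1≼ι hx) ((linear ((proj₂ (Σℓ-bounds x hx hX)) ⊞ ≼-reflexive (sym (Σℓ-Λ x)) ⊞ upper ⊞ ≼-reflexive (sym (S-⊗ˡ x (ι x) u)) ⊞ (ψ-bound x hX)) (solve 7 (λ x y z u v w a → x :* (y :+ con 8) :- x :* z := x :* y :+ u :+ (v :+ w) :+ a :+ con 8 :* x :- (u :+ v :+ a :+ x :* z :+ w)) refl _ _ _ _ _ _ _)))
    where
    lower : S x (λ d → Λ d ⊗ ι (x div d)) ≼ S x (λ d → ι x ⊗ u d)
    lower = S-mono x λ d hd _ → ≼-trans (⊗-monoˡ (0≼Λ d) (proj₁ (div-bounds x d hd))) (≼-reflexive (⊗-left _ _ _))

    upper : S x (λ d → ι x ⊗ u d) ≼ S x (λ d → Λ d ⊗ ι (x div d)) ⊕ ψ x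
    upper = ≼-trans (S-mono x λ d hd _ → ≼-trans (≼-reflexive (⊗-left _ _ _)) (≼-trans (⊗-monoˡ (0≼Λ d) (proj₂ (div-bounds x d hd)))
      (≼-reflexive (trans (⊗-distribˡ-⊕ _ _ _) (cong (Λ d ⊗ ι (x div d) ⊕_) (⊗-identityʳ _)))))) (≼-reflexive (S-⊕ x _ _))

  -- The comparison functions g₁ and g₂ make ℓ n / n and (ℓ n)² / n admissible in S-abel-dec without locating their maxima.
  f₁ f₂ g₁ g₂ : ℕ → K
  f₁ n = ℓ n ⊗ inv n
  f₂ n = ℓ n ⊗ ℓ n ⊗ inv n
  g₁ n = (ℓ n ⊕ ι 2) ⊗ inv n
  g₂ n = ((ℓ n ⊕ ι 2) ⊗ (ℓ n ⊕ ι 2) ⊕ ι 2) ⊗ inv n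

  private
    -- For i = 1/n and j = 1/(n+1) the added 2 makes g₁ fall by 2ij, while the rise of ℓ takes back
    -- at most ij. The second conclusion lets Σ ℓ(n)/(n(n+1)) be bounded by a telescoping sum.
    var₁ : ∀ {L M i j} → M ⊖ L ≼ i → 0# ≼ L → 0# ≼ i → 0# ≼ j → i ⊖ j ≡ i ⊗ j →
      Bd (L ⊗ i ⊖ M ⊗ j) ((L ⊕ ι 2) ⊗ i ⊖ (M ⊕ ι 2) ⊗ j) × L ⊗ (i ⊗ j) ≼ (L ⊕ ι 2) ⊗ i ⊖ (M ⊕ ι 2) ⊗ j
    var₁ {L} {M} {i} {j} h0 hL hi hj e =
      ((linear (2 ⊠ (mul≼ h0 hj) ⊞ 2 ⊠ (≼-reflexive (sym e)) ⊞ 2 ⊠ (≼-reflexive (sym (L ⊠≡ e))) ⊞ 2 ⊠ (0≼⊗ hL (0≼⊗ hi hj))) (solve 4 (λ x y z u → x :* y :- z :* u :- (:- ((x :+ con 2) :* y :- (z :+ con 2) :* u)) := con 2 :* ((y :- (z :- x)) :* (u :- con 0)) :+ con 2 :* (y :- u) :+ con 2 :* (x :* (y :- u)) :+ con 2 :* (x :* (y :* u)) :- (con 2 :* con 0 :+ con 2 :* (y :* u) :+ con 2 :* (x :* (y :* u)) :+ con 2 :* con 0)) refl _ _ _ _)) , (linear (2 ⊠ (≼-reflexive (sym e)) ⊞ 2 ⊠ (0≼⊗ hi hj)) (solve 4 (λ x y z u → (x :+ con 2) :* y :- (z :+ con 2) :* u :- (x :* y :- z :* u) := con 2 :* (y :-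 u) :+ con 2 :* (y :* u) :- (con 2 :* (y :* u) :+ con 2 :* con 0)) refl _ _ _ _))) ,
      (linear ((mul≼ h0 hj) ⊞ 2 ⊠ (≼-reflexive (sym e)) ⊞ ≼-reflexive (sym (L ⊠≡ e)) ⊞ (0≼⊗ hi hj)) (solve 4 (λ x y z u → (x :+ con 2) :* y :- (z :+ con 2) :* u :- x :* (y :* u) := (y :- (z :- x)) :* (u :- con 0) :+ con 2 :* (y :- u) :+ x :* (y :- u) :+ y :* u :- (con 0 :+ con 2 :* (y :* u) :+ x :* (y :* u) :+ con 0)) refl _ _ _ _))

    var₂ : ∀ {L M i j} → 0# ≼ M ⊖ L → M ⊖ L ≼ i → i ≼ 1# → 0# ≼ L → 0# ≼ i → 0# ≼ j → i ⊖ j ≡ i ⊗ j →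
      Bd (L ⊗ L ⊗ i ⊖ M ⊗ M ⊗ j) (((L ⊕ ι 2) ⊗ (L ⊕ ι 2) ⊕ ι 2) ⊗ i ⊖ ((M ⊕ ι 2) ⊗ (M ⊕ ι 2) ⊕ ι 2) ⊗ j)
    var₂ {L} {M} {i} {j} hd h0 h1 hL hi hj e =
      (linear (4 ⊠ (mul≼ h0 hj) ⊞ 4 ⊠ (0≼⊗ hL (mul≼ h0 hj)) ⊞ 2 ⊠ (0≼⊗ hd (mul≼ h0 hj)) ⊞ 2 ⊠ (mul≼ (≼-trans h0 h1) (0≼⊗ hi hj)) ⊞ 6 ⊠ (≼-reflexive (sym e)) ⊞ 4 ⊠ (≼-reflexive (sym (L ⊠≡ e))) ⊞ 2 ⊠ (≼-reflexive (sym ((L ⊗ L) ⊠≡ e))) ⊞ 2 ⊠ (0≼⊗ (0≼⊗ hL hL) (0≼⊗ hi hj))) (solve 4 (λ x y z u → x :* x :* y :- z :* z :* u :- (:- (((x :+ con 2) :* (x :+ con 2) :+ con 2) :* y :- ((z :+ con 2) :* (z :+ con 2) :+ con 2) :* u)) := con 4 :* ((y :- (z :- x)) :* (u :- con 0)) :+ con 4 :* (x :* ((y :- (z :- x)) :* (u :- con 0))) :+ con 2 :* ((z :- x) :* ((y :- (z :- x)) :* (u :- con 0))) :+ con 2 :* ((one :- (z :- x)) :* (y :* u :- con 0)) :+ con 6 :* (y :- u) :+ con 4 :* (x :* (y :- u)) :+ con 2 :* (x :* x :* (y :- u)) :+ con 2 :* (x :* x :* (y :* u)) :- (con 4 :*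 con 0 :+ con 4 :* con 0 :+ con 2 :* con 0 :+ con 2 :* con 0 :+ con 6 :* (y :* u) :+ con 4 :* (x :* (y :* u)) :+ con 2 :* (x :* x :* (y :* u)) :+ con 2 :* con 0)) refl _ _ _ _)) ,
      (linear (4 ⊠ (mul≼ h0 hj) ⊞ 6 ⊠ (≼-reflexive (sym e)) ⊞ 4 ⊠ (≼-reflexive (sym (L ⊠≡ e))) ⊞ 4 ⊠ (0≼⊗ hL (0≼⊗ hi hj)) ⊞ 2 ⊠ (0≼⊗ hi hj)) (solve 4 (λ x y z u → ((x :+ con 2) :* (x :+ con 2) :+ con 2) :* y :- ((z :+ con 2) :* (z :+ con 2) :+ con 2) :* u :- (x :* x :* y :- z :* z :* u) := con 4 :* ((y :- (z :- x)) :* (u :- con 0)) :+ con 6 :* (y :- u) :+ con 4 :* (x :* (y :- u)) :+ con 4 :* (x :* (y :* u)) :+ con 2 :* (y :* u) :- (con 4 :* con 0 :+ con 6 :* (y :* u) :+ con 4 :* (x :* (y :* u)) :+ con 4 :* con 0 :+ con 2 :* con 0)) refl _ _ _ _))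

  f₁-variation : ∀ n → 1 ≤ n → n < X → Bd (f₁ n ⊖ f₁ (suc n)) (g₁ n ⊖ g₁ (suc n)) × ℓ n ⊗ (inv n ⊗ inv (suc n)) ≼ g₁ n ⊖ g₁ (suc n)
  f₁-variation n h l = var₁ (ℓ-upper n h l) (0≼ℓ h (ℕ.<⇒≤ l)) (0≼inv h) (0≼inv {suc n} (s≤s z≤n)) (inv-step h)

  f₂-variation : ∀ n → 1 ≤ n → n < X → Bd (f₂ n ⊖ f₂ (suc n)) (g₂ n ⊖ g₂ (suc n))
  f₂-variation n h l = var₂ (0≼ℓ-step n h l) (ℓ-upper n h l) (inv≼1 h) (0≼ℓ h (ℕ.<⇒≤ l)) (0≼inv h) (0≼inv {suc n} (s≤s z≤n)) (inv-step h)

  g₁-1 : g₁ 1 ≡ ι 2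
  g₁-1 = trans (cong₂ (λ a b → (a ⊕ ι 2) ⊗ b) ℓ-1 inv-1) (solve 0 ((con 0 :+ con 2) :* one := con 2) refl)

  g₂-1 : g₂ 1 ≡ ι 6
  g₂-1 = trans (cong₂ (λ a b → ((a ⊕ ι 2) ⊗ (a ⊕ ι 2) ⊕ ι 2) ⊗ b) ℓ-1 inv-1) (solve 0 (((con 0 :+ con 2) :* (con 0 :+ con 2) :+ con 2) :* one := con 6) refl)

  f₁-Bd : ∀ n → 1 ≤ n → n ≤ X → Bd (f₁ n) (g₁ n)
  f₁-Bd n h l = Bd-pos (0≼⊗ (0≼ℓ h l) (0≼inv h)) (⊗-monoʳ (0≼inv h) ((linear (2 ⊠ 0≼1) (solve 1 (λ x → x :+ con 2 :- x := con 2 :* one :- con 2 :* con 0) refl _))))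

  f₂-Bd : ∀ n → 1 ≤ n → n ≤ X → Bd (f₂ n) (g₂ n)
  f₂-Bd n h l = Bd-pos (0≼⊗ (0≼⊗ (0≼ℓ h l) (0≼ℓ h l)) (0≼inv h)) (⊗-monoʳ (0≼inv h) ((linear (4 ⊠ (0≼ℓ h l) ⊞ 6 ⊠ 0≼1) (solve 1 (λ x → (x :+ con 2) :* (x :+ con 2) :+ con 2 :- x :* x := con 4 :* x :+ con 6 :* one :- (con 4 :* con 0 :+ con 6 :* con 0)) refl _))))

  abel₁ : ∀ x (a : ℕ → K) B → x ≤ X → 0# ≼ B → (∀ t → t ≤ x → Bd (S t a) B) → Bd (S x (λ n → a n ⊗ f₁ n)) (B ⊗ ι 2)
  abel₁ x a B hx hB ha = subst (λ z → Bd (S x (λ n → a n ⊗ f₁ n)) (B ⊗ z)) g₁-1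
    (S-abel-dec x a f₁ g₁ B hB ha (λ n h l → proj₁ (f₁-variation n h (ℕ.<-≤-trans l hx))) (λ n h l → f₁-Bd n h (ℕ.≤-trans l hx)) (subst (0# ≼_) (sym g₁-1) (0≼ι 2)))

  abel₂ : ∀ x (a : ℕ → K) B → x ≤ X → 0# ≼ B → (∀ t → t ≤ x → Bd (S t a) B) → Bd (S x (λ n → a n ⊗ f₂ n)) (B ⊗ ι 6)
  abel₂ x a B hx hB ha = subst (λ z → Bd (S x (λ n → a n ⊗ f₂ n)) (B ⊗ z)) g₂-1
    (S-abel-dec x a f₂ g₂ B hB ha (λ n h l → f₂-variation n h (ℕ.<-≤-trans l hx)) (λ n h l → f₂-Bd n h (ℕ.≤-trans l hx)) (subst (0# ≼_) (sym g₂-1) (0≼ι 6)))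

  Sℓ/n² : ∀ x → x < X → S x (λ n → ℓ n ⊗ (inv n ⊗ inv (suc n))) ≼ ι 2
  Sℓ/n² x hx = (linear ((go x hx) ⊞ ≼-reflexive g₁-1 ⊞ (0≼⊗ ℓ+2≥0 (0≼inv {suc x} (s≤s z≤n))) ⊞ ≼-reflexive (sym g₁-def)) (solve 5 (λ x y z u v → con 2 :- x := y :+ con 2 :+ (z :+ con 2) :* u :+ v :- (x :+ v :+ y :+ con 0 :+ (z :+ con 2) :* u)) refl _ _ _ _ _))
    where
    ℓ+2≥0 : 0# ≼ ℓ (suc x) ⊕ ι 2
    ℓ+2≥0 = (linear ((0≼ℓ {suc x} (s≤s z≤n) hx) ⊞ 2 ⊠ 0≼1) (solve 1 (λ x → x :+ con 2 :- con 0 := x :+ con 2 :* one :- (con 0 :+ con 2 :* con 0)) refl _))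

    g₁-def : g₁ (suc x) ≡ (ℓ (suc x) ⊕ ι 2) ⊗ inv (suc x)
    g₁-def = refl

    go : ∀ x → x < X → S x (λ n → ℓ n ⊗ (inv n ⊗ inv (suc n))) ⊕ g₁ (suc x) ≼ g₁ 1
    go zero _ = ≼-reflexive (⊕-identityˡ _)
    go (suc x) h = (linear ((go x (ℕ.<⇒≤ h)) ⊞ (proj₂ (f₁-variation (suc x) (s≤s z≤n) h))) (solve 7 (λ x y z u v w a → x :- (y :+ z :* (u :* v) :+ w) := x :+ (a :- w) :- (y :+ a :+ z :* (u :* v))) refl _ _ _ _ _ _ _))

  -- When c vanishes at the primes, only exponents k ≥ 2 remain. They contribute at most 2ℓ(p)/p² ≤
  -- 4ℓ(p)/(p(p+1)) for each p, and Σ ℓ(n)/(n(n+1)) ≤ 2.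
  prime-powers-bound : ∀ x (c : ℕ → K) → x < X → (∀ n → 0# ≼ c n) → (∀ n → c n ≼ 1#) → (∀ p → Prime p → p ≤ x → c p ≡ 0#) →
    S x (λ n → c n ⊗ u n) ≼ ι 8
  prime-powers-bound x c hx c≥0 c≤1 cp = ≼-trans (≼-reflexive (trans (S-cong x λ n _ _ → trans (cong (c n ⊗_) (⊗-comm _ _)) (sym (⊗-assoc _ _ _)))
      (S-Λ x (λ n → c n ⊗ inv n))))
    (≼-trans (S-mono x λ p hp hp′ → ≼-trans (S-mono x λ k hk _ → 𝟙-guard-≼ (isPrime? p) λ pr → term p k hp hp′ hk pr)
      (≼-trans (≼-reflexive (S-⊗ˡ x _ _)) (inner p hp hp′)))
    (≼-trans (≼-reflexive (S-⊗ˡ x (ι 4) _)) ((linear (4 ⊠ (Sℓ/n² x hx)) (solve 1 (λ x → con 8 :- con 4 :* x := con 4 :* con 2 :- con 4 :* x) refl _)))))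
    where
    term : ∀ p k → 1 ≤ p → p ≤ x → 1 ≤ k → Prime p →
      𝟙 (p ^ k ≤? x) ⊗ (c (p ^ k) ⊗ inv (p ^ k) ⊗ ℓ p) ≼ ℓ p ⊗ (𝟙 (2 ≤? k) ⊗ inv (p ^ k))
    term p (suc zero) hp hp′ _ pr = ≼-trans (≼-reflexive (trans (cong (λ z → 𝟙 (p ^ 1 ≤? x) ⊗ (z ⊗ inv (p ^ 1) ⊗ ℓ p)) (trans (cong c (ℕ.*-identityʳ p)) (cp p pr hp′))) (solve 3 (λ x y z → x :* (con 0 :* y :* z) := con 0) refl _ _ _)))
      (0≼⊗ (0≼ℓ hp (ℕ.≤-trans hp′ (ℕ.<⇒≤ hx))) (0≼⊗ (0≼𝟙 (2 ≤? 1)) (0≼inv {p ^ 1} (1≤* {p} {1} hp ℕ.≤-refl))))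
    term p k@(suc (suc _)) hp hp′ _ pr = ≼-trans ((linear ((mul≼ (𝟙≼1 (p ^ k ≤? x)) (0≼⊗ (0≼⊗ (c≥0 (p ^ k)) i≥0) ℓ≥0)) ⊞ (mul≼ (c≤1 (p ^ k)) (0≼⊗ i≥0 ℓ≥0))) (solve 4 (λ x y z u → x :* y :- z :* (u :* y :* x) := (one :- z) :* (u :* y :* x :- con 0) :+ (one :- u) :* (y :* x :- con 0) :- (con 0 :+ con 0)) refl _ _ _ _)))
      (≼-reflexive (sym (trans (cong (λ z → ℓ p ⊗ (z ⊗ inv (p ^ k))) (𝟙-yes (2 ≤? k) (s≤s (s≤s z≤n)))) (cong (ℓ p ⊗_) (⊗-identityˡ _)))))
      where
      ℓ≥0 : 0# ≼ ℓ p
      ℓ≥0 = 0≼ℓ hp (ℕ.≤-trans hp′ (ℕ.<⇒≤ hx))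

      i≥0 : 0# ≼ inv (p ^ k)
      i≥0 = 0≼inv (ℕ.≤-trans (s≤s z≤n) (k<p^k p k (prime≥2 pr)))

    inner : ∀ p → 1 ≤ p → p ≤ x → 𝟙 (isPrime? p) ⊗ S x (λ k → ℓ p ⊗ (𝟙 (2 ≤? k) ⊗ inv (p ^ k))) ≼ ι 4 ⊗ (ℓ p ⊗ (inv p ⊗ inv (suc p)))
    inner p hp hp′ with isPrime? p
    ... | no np = ≼-trans (≼-reflexive (trans (cong (_⊗ S x (λ k → ℓ p ⊗ (𝟙 (2 ≤? k) ⊗ inv (p ^ k)))) (𝟙-no (no np) np)) (⊗-zeroˡ _)))
        (0≼⊗ (0≼ι 4) (0≼⊗ (0≼ℓ hp (ℕ.≤-trans hp′ (ℕ.<⇒≤ hx))) (0≼⊗ (0≼inv hp) (0≼inv {suc p} (s≤s z≤n)))))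
    ... | yes pr = ≼-trans (≼-reflexive (trans (cong (_⊗ S x (λ k → ℓ p ⊗ (𝟙 (2 ≤? k) ⊗ inv (p ^ k)))) (𝟙-yes (yes pr) pr)) (trans (⊗-identityˡ _) (S-⊗ˡ x _ _))))
        (≼-trans (⊗-monoˡ ℓ≥0 (S-inv-^≥2 p x (prime≥2 pr))) ((linear (2 ⊠ (0≼⊗ ℓ≥0 i²≼2ij)) (solve 3 (λ x y z → (one :+ (one :+ (one :+ (one :+ con 0)))) :* (x :* (y :* z)) :- x :* (con 2 :* (y :* y)) := con 2 :* (x :* (con 2 :* (y :* z) :- y :* y)) :- con 2 :* con 0) refl _ _ _))))
      where
      ℓ≥0 : 0# ≼ ℓ p
      ℓ≥0 = 0≼ℓ hp (ℕ.≤-trans hp′ (ℕ.<⇒≤ hx))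

      i²≼2ij : 0# ≼ ι 2 ⊗ (inv p ⊗ inv (suc p)) ⊖ inv p ⊗ inv p
      i²≼2ij = (linear (≼-reflexive (inv p ⊠≡ inv-step hp) ⊞ (mul≼ (inv≼1 hp) (0≼⊗ (0≼inv hp) (0≼inv {suc p} (s≤s z≤n))))) (solve 2 (λ x y → con 2 :* (x :* y) :- x :* x :- con 0 := x :* (x :* y) :+ (one :- x) :* (x :* y :- con 0) :- (x :* (x :- y) :+ con 0)) refl _ _))

  -- Only primes p ≤ q remain, and all powers of one p together contribute at most 2ℓ(p)/p ≤ 2.
  small-primes-bound : ∀ x q (c : ℕ → K) → x ≤ X → (∀ n → 0# ≼ c n) → (∀ n → c n ≼ 1#) → (∀ p k → Prime p → q < p → c (p ^ k) ≡ 0#) →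
    S x (λ n → c n ⊗ u n) ≼ ι 2 ⊗ ι q
  small-primes-bound x q c hx c≥0 c≤1 cp = ≼-trans (≼-reflexive (trans (S-cong x λ n _ _ → trans (cong (c n ⊗_) (⊗-comm _ _)) (sym (⊗-assoc _ _ _)))
      (S-Λ x (λ n → c n ⊗ inv n))))
    (≼-trans (S-mono x λ p hp hp′ → inner p hp hp′)
    (≼-trans (S-cut x q (λ _ → ι 2) λ _ _ → 0≼ι 2) (≼-reflexive (trans (S-const q (ι 2)) (⊗-comm _ _)))))
    where
    F : ℕ → ℕ → K
    F p k = 𝟙 (isPrime? p) ⊗ (𝟙 (p ^ k ≤? x) ⊗ (c (p ^ k) ⊗ inv (p ^ k) ⊗ ℓ p))

    inner : ∀ p → 1 ≤ p → p ≤ x → S x (F p) ≼ 𝟙 (p ≤? q) ⊗ ι 2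
    inner p hp hp′ = cases (isPrime? p) (p ≤? q)
      where
      ℓ≥0 : 0# ≼ ℓ p
      ℓ≥0 = 0≼ℓ hp (ℕ.≤-trans hp′ hx)

      cases : Dec (Prime p) → Dec (p ≤ q) → S x (F p) ≼ 𝟙 (p ≤? q) ⊗ ι 2
      cases (no np) _ = ≼-trans (≼-reflexive (S-zero x λ k _ _ → trans (cong (_⊗ (𝟙 (p ^ k ≤? x) ⊗ (c (p ^ k) ⊗ inv (p ^ k) ⊗ ℓ p))) (𝟙-no (isPrime? p) np)) (⊗-zeroˡ _)))
        (0≼⊗ (0≼𝟙 (p ≤? q)) (0≼ι 2))
      cases (yes pr) (no p≰q) = ≼-trans (≼-reflexive (S-zero x λ k _ _ → trans (cong (λ z → 𝟙 (isPrime? p) ⊗ (𝟙 (p ^ k ≤? x) ⊗ (z ⊗ inv (p ^ k) ⊗ ℓ p))) (cp p k pr (ℕ.≰⇒> p≰q))) (solve 4 (λ x y z u → x :* (y :* (con 0 :* z :* u)) := con 0) refl _ _ _ _)))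
        (0≼⊗ (0≼𝟙 (p ≤? q)) (0≼ι 2))
      cases (yes pr) (yes p≤q) = ≼-trans (S-mono x λ k _ _ → term k) (≼-trans (≼-reflexive (S-⊗ˡ x (ℓ p) _))
          (≼-trans (⊗-monoˡ ℓ≥0 (S-inv-^ p x (prime≥2 pr))) (≼-trans ((linear (2 ⊠ (⊗-monoʳ (0≼inv hp) (ℓ≼ι p hp (ℕ.≤-trans hp′ hx))) ⊞ 2 ⊠ (≼-reflexive (inv-inverse hp))) (solve 3 (λ x y z → con 2 :- x :* (con 2 :* y) := con 2 :* (z :* y) :+ con 2 :* one :- (con 2 :* (x :* y) :+ con 2 :* (z :* y))) refl _ _ _)))
          (≼-reflexive (sym (trans (cong (_⊗ ι 2) (𝟙-yes (p ≤? q) p≤q)) (⊗-identityˡ _)))))))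
        where
        term : ∀ k → F p k ≼ ℓ p ⊗ inv (p ^ k)
        term k = (linear ((mul≼ (𝟙≼1 (isPrime? p)) (0≼⊗ (0≼𝟙 (p ^ k ≤? x)) nn)) ⊞ (mul≼ (𝟙≼1 (p ^ k ≤? x)) nn) ⊞ (mul≼ (c≤1 (p ^ k)) (0≼⊗ i≥0 ℓ≥0)) ⊞ ≼-reflexive F-def) (solve 6 (λ x y z u v w → x :* y :- z := (one :- u) :* (v :* (w :* y :* x) :- con 0) :+ (one :- v) :* (w :* y :* x :- con 0) :+ (one :- w) :* (y :* x :- con 0) :+ u :* (v :* (w :* y :* x)) :- (con 0 :+ con 0 :+ con 0 :+ z)) refl _ _ _ _ _ _))
          where
          F-def : F p k ≡ 𝟙 (isPrime? p) ⊗ (𝟙 (p ^ k ≤? x) ⊗ (c (p ^ k) ⊗ inv (p ^ k) ⊗ ℓ p))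
          F-def = refl

          i≥0 : 0# ≼ inv (p ^ k)
          i≥0 = 0≼inv (ℕ.≤-trans (s≤s z≤n) (k<p^k p k (prime≥2 pr)))

          nn : 0# ≼ c (p ^ k) ⊗ inv (p ^ k) ⊗ ℓ p
          nn = 0≼⊗ (0≼⊗ (c≥0 (p ^ k)) i≥0) ℓ≥0

-- The Möbius function and Selberg's formula

choose : ∀ {P : Set} → Dec P → K → K → K
choose (yes _) a b = a
choose (no _) a b = b

choose-yes : ∀ {P : Set} (d : Dec P) {a b} → P → choose d a b ≡ a
choose-yes (yes _) _ = refl
choose-yes (no ¬p) p = ⊥-elim (¬p p)

choose-no : ∀ {P : Set} (d : Dec P) {a b} → ¬ P → choose d a b ≡ b
choose-no (yes p) ¬p = ⊥-elim (¬p p)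
choose-no (no _) _ = refl

opaque
  -- Recursion on the relation Σ_{d∣n} μ(d) = ε(n). Carrying a table of all values up to N makes
  -- this course-of-values recursion structural.
  μ-table : ℕ → ℕ → K
  μ-table zero n = 0#
  μ-table (suc N) n = choose (n ≤? N) (μ-table N n) (ε (suc N) ⊖ S N (λ d → 𝟙 (d ∣? suc N) ⊗ μ-table N d))

  μ : ℕ → K
  μ n = μ-table n n

  μ-table-stable : ∀ N n → n ≤ N → μ-table N n ≡ μ n
  μ-table-stable zero zero _ = refl
  μ-table-stable (suc N) n h = cases (n ≤? N) (n ≟ suc N)
    where
    cases : Dec (n ≤ N) → Dec (n ≡ suc N) → μ-table (suc N) n ≡ μ n
    cases (yes l) _ = trans (choose-yes (n ≤? N) l) (μ-table-stable N n l)
    cases (no _) (yes refl) = refl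
    cases (no l) (no ne) = ⊥-elim (ne (ℕ.≤-antisym h (ℕ.≰⇒> l)))

  μ-suc : ∀ N → μ (suc N) ≡ ε (suc N) ⊖ S N (λ d → 𝟙 (d ∣? suc N) ⊗ μ d)
  μ-suc N = trans (choose-no (suc N ≤? N) (ℕ.<-irrefl refl)) (cong (ε (suc N) ⊖_) (S-cong N λ d _ h →
    cong (𝟙 (d ∣? suc N) ⊗_) (μ-table-stable N d h)))

infix 4 _≐_
_≐_ : (ℕ → K) → (ℕ → K) → Set
f ≐ g = ∀ n → 1 ≤ n → f n ≡ g n

≐-trans : ∀ {f g h} → f ≐ g → g ≐ h → f ≐ h
≐-trans p q n hn = trans (p n hn) (q n hn)

≐-sym : ∀ {f g} → f ≐ g → g ≐ f
≐-sym p n hn = sym (p n hn)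

⋆-≐ : ∀ {f f′ g g′} → f ≐ f′ → g ≐ g′ → f ⋆ g ≐ f′ ⋆ g′
⋆-≐ p q n _ = ⋆-cong n (λ d h _ → p d h) (λ d h _ → q d h)

⋆-≐ˡ : ∀ {f f′} g → f ≐ f′ → f ⋆ g ≐ f′ ⋆ g
⋆-≐ˡ g p = ⋆-≐ p (λ _ _ → refl)

⋆-≐ʳ : ∀ f {g g′} → g ≐ g′ → f ⋆ g ≐ f ⋆ g′
⋆-≐ʳ f q = ⋆-≐ (λ _ _ → refl) q

⋆-𝟏 : ∀ f n → (f ⋆ 𝟏) n ≡ S n (λ d → 𝟙 (d ∣? n) ⊗ f d)
⋆-𝟏 f n = S-cong n λ d hd hd′ → trans (S-cong n λ m _ _ → cong (𝟙 (d * m ≟ n) ⊗_) (⊗-identityʳ (f d))) (trans (S-⊗ʳ n (f d) _)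
  (cong (_⊗ f d) (𝟙-∣ d n hd (ℕ.≤-trans hd hd′))))

μ⋆𝟏 : μ ⋆ 𝟏 ≐ ε
μ⋆𝟏 (suc N) _ = trans (⋆-𝟏 μ (suc N)) (trans (cong (λ z → S N (λ d → 𝟙 (d ∣? suc N) ⊗ μ d) ⊕ z)
  (trans (cong (_⊗ μ (suc N)) (𝟙-yes (suc N ∣? suc N) ∣-refl)) (trans (⊗-identityˡ _) (μ-suc N)))) (solve 2 (λ x y → x :+ (y :- x) := y) refl _ _))

⋆-ε′ : ∀ f → f ⋆ ε ≐ f
⋆-ε′ f n hn = trans (⋆-comm f ε n) (⋆-ε f n hn)

μ-inversion : ∀ {f g} → f ⋆ 𝟏 ≐ g → f ≐ g ⋆ μ
μ-inversion {f} {g} h = ≐-trans (≐-sym (⋆-ε′ f)) (≐-trans (⋆-≐ʳ f (≐-trans (≐-sym μ⋆𝟏) λ n _ → ⋆-comm μ 𝟏 n))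
  (≐-trans (λ n _ → sym (⋆-assoc f 𝟏 μ n)) (⋆-≐ˡ μ h)))

module Selberg {X : ℕ} (lg : Log X) where
  open LogFacts lg public

  Λ-1 : Λ 1 ≡ 0#
  Λ-1 = ≼-antisym ((linear ((Λ≼ℓ 1 ℕ.≤-refl) ⊞ ≼-reflexive ℓ-1) (solve 2 (λ x y → con 0 :- x := y :+ con 0 :- (x :+ y)) refl _ _))) (0≼Λ 1)

  𝟏ℓ : (λ n → 𝟏 n ⊗ ℓ n) ≐ Λ ⋆ 𝟏
  𝟏ℓ n _ = trans (⊗-identityˡ _) (Λ⋆𝟏 n)

  -- The derivation rule applied to μ ⋆ 𝟏 = ε gives (μℓ) ⋆ 𝟏 + μ ⋆ ℓ = εℓ = 0. Now replace ℓ by Λ ⋆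
  -- 𝟏 and invert.
  μℓ : (λ n → μ n ⊗ ℓ n) ≐ (λ n → neg ((μ ⋆ Λ) n))
  μℓ = ≐-trans (μ-inversion {g = λ n → neg ((μ ⋆ (Λ ⋆ 𝟏)) n)} sum-zero) (≐-trans (λ n _ → ⋆-neg (μ ⋆ (Λ ⋆ 𝟏)) μ n) λ n hn → cong neg
    (≐-sym (μ-inversion {f = μ ⋆ Λ} λ m _ → ⋆-assoc μ Λ 𝟏 m) n hn))
    where
    εℓ : ∀ n → 1 ≤ n → ε n ⊗ ℓ n ≡ 0#
    εℓ n hn = trans (𝟙-guard (1 ≟ n) λ { refl → ℓ-1 }) (⊗-zeroʳ _)

    sum-zero : (λ n → μ n ⊗ ℓ n) ⋆ 𝟏 ≐ (λ n → neg ((μ ⋆ (Λ ⋆ 𝟏)) n))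
    sum-zero n hn = (linear-≡ (sym (⋆-derivation ℓ ℓ-* μ 𝟏 n) ⊞≡ sym μ⋆ℓ ⊞≡ ℓ n ⊠≡ μ⋆𝟏 n hn ⊞≡ εℓ n hn) (solve 6 (λ x y z u v w → :- x :- y := z :* u :+ v :+ u :* w :+ con 0 :- (y :+ v :+ x :+ u :* z :+ w :* u)) refl _ _ _ _ _ _))
      where
      μ⋆ℓ : (μ ⋆ (λ k → 𝟏 k ⊗ ℓ k)) n ≡ (μ ⋆ (Λ ⋆ 𝟏)) n
      μ⋆ℓ = ⋆-≐ʳ μ 𝟏ℓ n hn

  -- Positivity of ℓ in the form that `⊗-cancel` needs. The 8 is uniform in `X`: `ℓ-lower` at 1
  -- gives 1/2 ≤ 4ℓ(2).
  1≼8ℓ : ∀ n → 2 ≤ n → n ≤ X → 1# ≼ ι 8 ⊗ ℓ n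
  1≼8ℓ n h l = (linear ((8 ⊠ ℓ-mono {2} (s≤s z≤n) h l) ⊞ (2 ⊠ ℓ-lower 1 ℕ.≤-refl (ℕ.≤-trans h l)) ⊞ 8 ⊠ (≼-reflexive (sym ℓ-1)) ⊞ ≼-reflexive (sym (inv-inverse {2} (s≤s z≤n)))) (solve 4 (λ x y z u → con 8 :* x :- one := con 8 :* x :+ con 2 :* (con 4 :* (y :- z)) :+ con 8 :* z :+ con 2 :* u :- (con 8 :* y :+ con 2 :* u :+ con 8 :* con 0 :+ one)) refl _ _ _ _))

  Bd-cancelℓ : ∀ {z} n → 2 ≤ n → n ≤ X → Bd (z ⊗ ℓ n) (ℓ n) → Bd z 1#
  Bd-cancelℓ {z} n h l (a , b) = ⊗-cancel (1≼8ℓ n h l) ((linear ((8 ⊠ a)) (solve 2 (λ x y → con 8 :* x :* y :- con 8 :* x :* (:- one) := con 8 :* (y :* x) :- con 8 :* (:- x)) refl _ _))) , ⊗-cancel (1≼8ℓ n h l) ((linear ((8 ⊠ b)) (solve 2 (λ x y → con 8 :* x :* one :- con 8 :* x :* y := con 8 :* x :- con 8 :* (y :* x)) refl _ _)))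

  -- By induction, from |μ(n)| ℓ(n) ≤ Σ_{dm=n} |μ(d)| Λ(m) ≤ ℓ(n).
  μ-Bd : ∀ n → 1 ≤ n → n ≤ X → Bd (μ n) 1#
  μ-Bd = <-rec _ go
    where
    go : ∀ n → (∀ {m} → m < n → 1 ≤ m → m ≤ X → Bd (μ m) 1#) → 1 ≤ n → n ≤ X → Bd (μ n) 1#
    go (suc zero) rec _ _ = Bd-≡ (trans (μ-suc 0) (trans (cong (_⊖ 0#) (𝟙-yes (1 ≟ 1) refl)) (solve 0 (one :- con 0 := one) refl))) (Bd-pos 0≼1 ≼-refl)
    go n@(suc (suc _)) rec hn hX = Bd-cancelℓ n (s≤s (s≤s z≤n)) hX (Bd-≡ (μℓ n hn) (Bd-neg (Bd-weaken (≼-reflexive (trans (⋆-comm 𝟏 Λ n) (sym (Λ⋆𝟏 n))))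
      (S-Bd n λ d hd _ → S-Bd n λ m hm _ → term d m hd hm))))
      where
      term : ∀ d m → 1 ≤ d → 1 ≤ m → Bd (𝟙 (d * m ≟ n) ⊗ (μ d ⊗ Λ m)) (𝟙 (d * m ≟ n) ⊗ (𝟏 d ⊗ Λ m))
      term d (suc zero) hd _ = Bd-≡ (trans (cong (λ z → 𝟙 (d * 1 ≟ n) ⊗ (μ d ⊗ z)) Λ-1) (solve 2 (λ x y → x :* (y :* con 0) := con 0) refl _ _)) (Bd-0 (0≼⊗ (0≼𝟙 (d * 1 ≟ n)) (0≼⊗ 0≼1 (0≼Λ 1))))
      term d m@(suc (suc _)) hd hm = cases (d * m ≟ n)
        where
        cases : Dec (d * m ≡ n) → Bd (𝟙 (d * m ≟ n) ⊗ (μ d ⊗ Λ m)) (𝟙 (d * m ≟ n) ⊗ (𝟏 d ⊗ Λ m))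
        cases (no ne) = Bd-≡ (trans (cong (_⊗ (μ d ⊗ Λ m)) (𝟙-no (d * m ≟ n) ne)) (⊗-zeroˡ _)) (Bd-0 (0≼⊗ (0≼𝟙 (d * m ≟ n)) (0≼⊗ 0≼1 (0≼Λ m))))
        cases (yes e) = Bd-scale (0≼𝟙 (d * m ≟ n)) (Bd-⊗ (rec (subst (d <_) e d<dm) hd (ℕ.≤-trans (ℕ.<⇒≤ (subst (d <_) e d<dm)) hX)) (Bd-pos (0≼Λ m) ≼-refl))
          where
          d<dm : d < d * m
          d<dm = subst (_< d * m) (ℕ.*-identityʳ d) (ℕ.*-monoʳ-< d {{>-nonZero hd}} {1} {m} (s≤s (s≤s z≤n)))

  Λ₂ : ℕ → K
  Λ₂ n = Λ n ⊗ ℓ n ⊕ (Λ ⋆ Λ) n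

  ℓ² : ℕ → K
  ℓ² n = ℓ n ⊗ ℓ n

  -- Write one factor of ℓ² as Λ ⋆ 𝟏 and let the other act as a derivation: (Λℓ) ⋆ 𝟏 + Λ ⋆ (Λ ⋆ 𝟏).
  Λ₂⋆𝟏 : Λ₂ ⋆ 𝟏 ≐ ℓ²
  Λ₂⋆𝟏 n hn = sym (trans (cong (_⊗ ℓ n) (Λ⋆𝟏 n)) (trans (⋆-derivation ℓ ℓ-* Λ 𝟏 n) (trans (cong (((λ k → Λ k ⊗ ℓ k) ⋆ 𝟏) n ⊕_)
    (trans (⋆-≐ʳ Λ 𝟏ℓ n hn) (sym (⋆-assoc Λ Λ 𝟏 n)))) (sym (⋆-⊕ˡ (λ k → Λ k ⊗ ℓ k) (Λ ⋆ Λ) 𝟏 n)))))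

  Λ₂-inversion : Λ₂ ≐ μ ⋆ ℓ²
  Λ₂-inversion = ≐-trans (μ-inversion Λ₂⋆𝟏) λ n _ → ⋆-comm ℓ² μ n

  -- `u n` is Λ(n)/n. `P` and `Q` are the contributions of Λℓ and Λ ⋆ Λ to Selberg's formula with
  -- weight c, of order ℓ² for the indicator of the units; `V` is the Mertens sum, of order ℓ.
  P Q V : (ℕ → K) → ℕ → K
  P c x = S x λ n → c n ⊗ (u n ⊗ ℓ n)
  Q c x = D x λ d m → c (d * m) ⊗ (u d ⊗ u m)
  V c x = S x λ n → c n ⊗ u n

  S-Λ₂ : ∀ c x → S x (λ n → c n ⊗ inv n ⊗ Λ₂ n) ≡ P c x ⊕ Q c x
  S-Λ₂ c x = trans (trans (S-cong x λ n _ _ → trans (⊗-distribˡ-⊕ _ _ _) (cong (_⊕ c n ⊗ inv n ⊗ (Λ ⋆ Λ) n) (solve 4 (λ x y z u → x :* y :* (z :* u) := x :* (z :* y :* u)) refl _ _ _ _))) (S-⊕ x _ _))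
    (cong (P c x ⊕_) (trans (S-⋆ x (λ n → c n ⊗ inv n) Λ Λ) (D-cong x λ d m hd hm _ →
      trans (cong (λ z → c (d * m) ⊗ z ⊗ (Λ d ⊗ Λ m)) (inv-* hd hm)) (solve 5 (λ x y z u v → x :* (y :* z) :* (u :* v) := x :* (u :* y :* (v :* z))) refl _ _ _ _ _))))

  -- All dilations are included because Möbius inversion splits the sum over n into sums of m ↦ c(d
  -- m), one for each d.
  Balanced : (ℕ → K) → K → Set
  Balanced c B = ∀ d → 1 ≤ d → ∀ t → Bd (S t λ m → c (d * m)) B

  -- 6 is g₂(1), from `abel₂`; the bracket is the bound `H≼` for Σ 1/d.
  err : K → ℕ → K
  err B x = B ⊗ ι 6 ⊗ (1# ⊕ ι 4 ⊗ ℓ x)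

  -- Since Λ₂ = μ ⋆ ℓ², the sum is Σ_d μ(d)/d Σ_m c(dm) ℓ(m)²/m, whose inner sums are bounded.
  selberg : ∀ c B → 0# ≼ B → Balanced c B → ∀ x → 1 ≤ x → x ≤ X → Bd (P c x ⊕ Q c x) (err B x)
  selberg c B hB bal x hx hX = Bd-≡ (sym (S-Λ₂ c x)) (Bd-≡ expand (Bd-weaken total (S-Bd x λ d hd hd′ → Bd-⊗
      (Bd-weaken (≼-reflexive (⊗-identityˡ _)) (Bd-⊗ (μ-Bd d hd (ℕ.≤-trans hd′ hX)) (Bd-pos (0≼inv hd) ≼-refl)))
      (abel₂ (x div d) (λ m → c (d * m)) B (ℕ.≤-trans (div≤ x d) hX) hB λ t _ → bal d hd t))))
    where
    expand : S x (λ n → c n ⊗ inv n ⊗ Λ₂ n) ≡ S x (λ d → (μ d ⊗ inv d) ⊗ S (x div d) (λ m → c (d * m) ⊗ f₂ m))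
    expand = trans (S-cong x λ n hn _ → cong (c n ⊗ inv n ⊗_) (Λ₂-inversion n hn)) (trans (S-⋆ x (λ n → c n ⊗ inv n) μ ℓ²)
      (trans (D-div x _) (S-cong x λ d hd _ → trans (S-cong (x div d) λ m hm _ → trans (cong (λ z → c (d * m) ⊗ z ⊗ (μ d ⊗ ℓ² m)) (inv-* hd hm)) (shuffle _ _ _ _ _))
        (S-⊗ˡ (x div d) _ _))))
      where
      shuffle : ∀ a b e f g → a ⊗ (b ⊗ e) ⊗ (f ⊗ (g ⊗ g)) ≡ (f ⊗ b) ⊗ (a ⊗ (g ⊗ g ⊗ e))
      shuffle a b e f g = (solve 5 (λ x y z u v → x :* (y :* z) :* (u :* (v :* v)) := u :* y :* (x :* (v :* v :* z))) refl _ _ _ _ _)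

    total : S x (λ d → inv d ⊗ (B ⊗ ι 6)) ≼ err B x
    total = ≼-trans (≼-reflexive (S-⊗ʳ x (B ⊗ ι 6) inv)) (≼-trans (⊗-monoʳ (0≼⊗ hB (0≼ι 6)) (H≼ x hx hX)) (≼-reflexive (⊗-comm _ _)))

-- Units mod q and products of three prime powers

opaque
  isCoprime? : ∀ m n → Dec (Coprime m n)
  isCoprime? = coprime?

κ : ℕ → ℕ → K
κ q n = 𝟙 (isCoprime? n q)

coprime-*⁻ˡ : ∀ {a b c} → Coprime (a * b) c → Coprime a c
coprime-*⁻ˡ {a} {b} h (d∣a , d∣c) = h (∣m⇒∣m*n b d∣a , d∣c)

coprime-*⁻ʳ : ∀ {a b c} → Coprime (a * b) c → Coprime b c
coprime-*⁻ʳ {a} {b} h (d∣b , d∣c) = h (∣n⇒∣m*n a d∣b , d∣c)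

κ-* : ∀ q a b → κ q (a * b) ≡ κ q a ⊗ κ q b
κ-* q a b = sym (𝟙-⊗ (isCoprime? a q) (isCoprime? b q) (isCoprime? (a * b) q) coprime-* λ h → coprime-*⁻ˡ {a} {b} h , coprime-*⁻ʳ {a} {b} h)

module Triple {X : ℕ} (lg : Log X) (q : ℕ) (hq : 1 ≤ q) where
  open Selberg lg public

  -- 8 is the error in `mertens`; 2q pays for the prime powers that are not prime to q.
  C : K
  C = ι 8 ⊕ ι 2 ⊗ ι q

  κ-bounds : ∀ n → 0# ≼ κ q n × κ q n ≼ 1#
  κ-bounds n = 0≼𝟙 (isCoprime? n q) , 𝟙≼1 (isCoprime? n q)

  Vκ-bounds : ∀ x → 1 ≤ x → x ≤ X → Bd (V (κ q) x ⊖ ℓ x) C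
  Vκ-bounds x hx hX = (linear ((proj₁ (mertens x hx hX)) ⊞ ≼-reflexive u-split ⊞ small ⊞ 7 ⊠ 0≼1) (solve 5 (λ x y z u v → x :- y :- (:- (con 8 :+ con 2 :* z)) := u :+ (x :+ v) :+ con 2 :* z :+ con 7 :* one :- (y :- one :+ u :+ v :+ con 7 :* con 0)) refl _ _ _ _ _)) , (linear ((proj₂ (mertens x hx hX)) ⊞ ≼-reflexive (sym u-split) ⊞ pos ⊞ 2 ⊠ (0≼ι q)) (solve 5 (λ x y z u v → con 8 :+ con 2 :* x :- (y :- z) := z :+ con 8 :+ u :+ v :+ con 2 :* x :- (u :+ (y :+ v) :+ con 0 :+ con 2 :* con 0)) refl _ _ _ _ _))
    where
    rest : ℕ → K
    rest n = 1# ⊖ κ q n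

    rest≥0 : ∀ n → 0# ≼ rest n
    rest≥0 n = 0≼⊖ (proj₂ (κ-bounds n))

    u-split : S x u ≡ V (κ q) x ⊕ S x (λ n → rest n ⊗ u n)
    u-split = trans (S-cong x λ n _ _ → (solve 3 (λ x y z → x :* y := z :* (x :* y) :+ (one :- z) :* (x :* y)) refl _ _ _)) (S-⊕ x _ _)

    pos : 0# ≼ S x (λ n → rest n ⊗ u n)
    pos = 0≼S x λ n h _ → 0≼⊗ (rest≥0 n) (0≼u n h)

    small : S x (λ n → rest n ⊗ u n) ≼ ι 2 ⊗ ι q
    small = small-primes-bound x q rest hX rest≥0 (λ n → (linear ((proj₁ (κ-bounds n))) (solve 1 (λ x → one :- (one :- x) := x :- con 0) refl _))) λ p k pr q<p →
      trans (cong (1# ⊖_) (𝟙-yes (isCoprime? (p ^ k) q) (coprime-^ k (Cop.prime⇒coprime pr {{>-nonZero hq}} q<p)))) (⊕-inverseʳ 1#)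

  0≼C : 0# ≼ C
  0≼C = (linear (2 ⊠ (0≼ι q) ⊞ 8 ⊠ 0≼1) (solve 1 (λ x → con 8 :+ con 2 :* x :- con 0 := con 2 :* x :+ con 8 :* one :- (con 2 :* con 0 :+ con 8 :* con 0)) refl _))

  dℓ : ℕ → K
  dℓ zero = 0#
  dℓ (suc zero) = 0#
  dℓ (suc (suc n)) = ℓ (suc (suc n)) ⊖ ℓ (suc n)

  S-dℓ : ∀ x → S (suc x) dℓ ≡ ℓ (suc x)
  S-dℓ zero = trans (⊕-identityˡ _) (sym ℓ-1)
  S-dℓ (suc x) = trans (cong (_⊕ dℓ (suc (suc x))) (S-dℓ x)) (ring-cancel _ _)
    where
    ring-cancel : ∀ a b → a ⊕ (b ⊖ a) ≡ b
    ring-cancel a b = (solve 2 (λ x y → x :+ (y :- x) := y) refl _ _)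

  -- A discrete form of ∫ ℓ dℓ = ℓ²/2, from b² - a² ≤ 2b(b - a).
  S-dℓℓ : ∀ x → suc x ≤ X → ℓ (suc x) ⊗ ℓ (suc x) ≼ ι 2 ⊗ S (suc x) (λ n → dℓ n ⊗ ℓ n)
  S-dℓℓ zero _ = ≼-reflexive (trans (cong (λ z → z ⊗ z) ℓ-1) (trans (solve 0 (con 0 :* con 0 := con 2 :* (con 0 :+ con 0 :* con 0)) refl) (cong (λ z → ι 2 ⊗ (0# ⊕ 0# ⊗ z)) (sym ℓ-1))))
  S-dℓℓ (suc x) h = (linear ((S-dℓℓ x (ℕ.<⇒≤ h)) ⊞ (0≼sq (ℓ (suc (suc x)) ⊖ ℓ (suc x))) ⊞ 2 ⊠ (≼-reflexive (sym (ℓ (suc (suc x)) ⊠≡ dℓ-suc)))) (solve 5 (λ x y z u v → con 2 :* (x :+ y :* z :+ u :* v) :- v :* v := con 2 :* (x :+ y :* z) :+ (v :- z) :* (v :- z) :+ con 2 :* (v :* u) :- (z :* z :+ con 0 :+ con 2 :* (v :* (v :- z)))) refl _ _ _ _ _))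
    where
    dℓ-suc : dℓ (suc (suc x)) ≡ ℓ (suc (suc x)) ⊖ ℓ (suc x)
    dℓ-suc = refl

  -- By `Vκ-bounds` the sequence κΛ(n)/n - dℓ(n) has bounded partial sums; partial summation against
  -- the increasing ℓ leaves the sum of `S-dℓℓ`.
  Pκ-lower : ∀ x → 1 ≤ x → x ≤ X → ℓ x ⊗ ℓ x ≼ ι 2 ⊗ P (κ q) x ⊕ ι 4 ⊗ C ⊗ ℓ x
  Pκ-lower x@(suc x′) hx hX = (linear ((S-dℓℓ x′ hX) ⊞ (2 ⊠ proj₁ abel) ⊞ 2 ⊠ (≼-reflexive split)) (solve 7 (λ x y z u v w a → con 2 :* x :+ con 4 :* (con 8 :+ con 2 :* y) :* z :- z :* z := con 2 :* (u :+ v :* z) :+ con 2 :* (w :+ a :* z) :+ con 2 :* (x :- (u :+ v :* z)) :- (z :* z :+ con 2 :* (:- (con 2 :* (con 8 :+ con 2 :* y) :* z)) :+ con 2 :* (w :+ a :* z))) refl _ _ _ _ _ _ _))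
    where
    a : ℕ → K
    a n = κ q n ⊗ u n ⊖ dℓ n

    partial : ∀ t → t ≤ x → Bd (S t a) C
    partial zero _ = Bd-0 0≼C
    partial (suc t) h = Bd-≡ (trans (S-⊖ (suc t) (λ n → κ q n ⊗ u n) dℓ) (cong (V (κ q) (suc t) ⊖_) (S-dℓ t))) (Vκ-bounds (suc t) (s≤s z≤n) (ℕ.≤-trans h hX))

    abel : Bd (S x (λ n → a n ⊗ ℓ n)) (ι 2 ⊗ C ⊗ ℓ x)
    abel = S-abel-inc x a ℓ C 0≼C partial (λ n h l → (linear ((0≼ℓ-step n h (ℕ.<-≤-trans l hX))) (solve 2 (λ x y → x :- y := x :- y :- con 0) refl _ _))) (λ n h l → 0≼ℓ h (ℕ.≤-trans l hX)) hx

    split : S x (λ n → a n ⊗ ℓ n) ≡ P (κ q) x ⊖ S x (λ n → dℓ n ⊗ ℓ n)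
    split = trans (S-cong x λ n _ _ → distr _ _ _ _) (S-⊖ x _ _)
      where
      distr : ∀ k v e l → (k ⊗ v ⊖ e) ⊗ l ≡ k ⊗ (v ⊗ l) ⊖ e ⊗ l
      distr k v e l = (solve 4 (λ x y z u → (x :* y :- z) :* u := x :* (y :* u) :- z :* u) refl _ _ _ _)

  1≤div : ∀ {x d} → 1 ≤ d → d ≤ x → 1 ≤ x div d
  1≤div {x} {d} h l = ⇒≤div x d h (subst (_≤ x) (sym (ℕ.*-identityʳ d)) l)

  ℓ-div : ∀ {x d} → 1 ≤ d → d ≤ x → x ≤ X → ℓ (x div d) ≼ ℓ x ⊖ ℓ d
  ℓ-div {x} {d} h l hX = (linear ((ℓ-mono (1≤* h (1≤div h l)) (≤div⇒ x d h ℕ.≤-refl) hX) ⊞ ≼-reflexive (sym (ℓ-* d (x div d) h (1≤div h l)))) (solve 4 (λ x y z u → x :- y :- z := x :+ u :- (u :+ (y :+ z))) refl _ _ _ _))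

  0≼ℓ-div : ∀ {x d} → 1 ≤ d → d ≤ x → x ≤ X → 0# ≼ ℓ (x div d)
  0≼ℓ-div {x} {d} h l hX = 0≼ℓ (1≤div h l) (ℕ.≤-trans (div≤ x d) hX)

  w : ℕ → K
  w n = κ q n ⊗ u n

  0≼w : ∀ n → 1 ≤ n → 0# ≼ w n
  0≼w n h = 0≼⊗ (proj₁ (κ-bounds n)) (0≼u n h)

  S-wℓ : ∀ x → S x (λ n → w n ⊗ ℓ n) ≡ P (κ q) x
  S-wℓ x = S-cong x λ n _ _ → ⊗-assoc _ _ _

  S-wℓ² : ∀ x → S x (λ n → w n ⊗ (ℓ n ⊗ ℓ n)) ≡ P (λ n → κ q n ⊗ ℓ n) x
  S-wℓ² x = S-cong x λ n _ _ → (solve 4 (λ x y z u → x :* (y :* z) :* (u :* u) := x :* u :* (y :* z :* u)) refl _ _ _ _)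

  Qκ-D : ∀ x → Q (κ q) x ≡ S x (λ d → w d ⊗ V (κ q) (x div d))
  Qκ-D x = trans (D-div x _) (S-cong x λ d _ _ → trans (S-cong (x div d) λ m _ _ → trans (cong (_⊗ (u d ⊗ u m)) (κ-* q d m)) (⊗-interchange _ _ _ _)) (S-⊗ˡ (x div d) (w d) _))

  -- Q = Σ w(d) V(x/d), and V(x/d) ≤ ℓ(x) - ℓ(d) + C. The part -Σ w(d)ℓ(d) cancels P exactly,
  -- leaving (ℓ + C) V(x). For all units together the symmetry formula thus follows from Mertens
  -- alone.
  PQκ-upper : ∀ x → 1 ≤ x → x ≤ X → P (κ q) x ⊕ Q (κ q) x ≼ (ℓ x ⊕ C) ⊗ (ℓ x ⊕ C)
  PQκ-upper x hx hX = (linear (≼-reflexive (Qκ-D x) ⊞ upper ⊞ ≼-reflexive split ⊞ (⊗-monoˡ ℓ+C≥0 (proj₂ (Vκ-bounds x hx hX)))) (solve 7 (λ x y z u v w a → (x :+ (con 8 :+ con 2 :* y)) :* (x :+ (con 8 :+ con 2 :* y)) :- (z :+ u) := v :+ w :+ ((x :+ (con 8 :+ con 2 :* y)) :* a :- z) :+ (x :+ (con 8 :+ con 2 :* y)) :* (con 8 :+ con 2 :* y) :- (u :+ v :+ w :+ (x :+ (con 8 :+ con 2 :* y)) :* (a :- x))) refl _ _ _ _ _ _ _))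
    where
    upper : S x (λ d → w d ⊗ V (κ q) (x div d)) ≼ S x (λ d → (ℓ x ⊕ C) ⊗ w d ⊖ w d ⊗ ℓ d)
    upper = S-mono x λ d h l → ≼-trans (⊗-monoˡ (0≼w d h) (V≤ d h l)) (≼-reflexive (solve 6 (λ x y z u v w → x :* (y :* z) :* (u :- v :+ (con 8 :+ con 2 :* w)) := (u :+ (con 8 :+ con 2 :* w)) :* (x :* (y :* z)) :- x :* (y :* z) :* v) refl _ _ _ _ _ _))
      where
      V≤ : ∀ d → 1 ≤ d → d ≤ x → V (κ q) (x div d) ≼ ℓ x ⊖ ℓ d ⊕ C
      V≤ d h l = (linear ((proj₂ (Vκ-bounds (x div d) (1≤div h l) (ℕ.≤-trans (div≤ x d) hX))) ⊞ (ℓ-div h l hX)) (solve 5 (λ x y z u v → x :- y :+ (con 8 :+ con 2 :* z) :- u := con 8 :+ con 2 :* z :+ (x :- y) :- (u :- v :+ v)) refl _ _ _ _ _))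

    split : S x (λ d → (ℓ x ⊕ C) ⊗ w d ⊖ w d ⊗ ℓ d) ≡ (ℓ x ⊕ C) ⊗ V (κ q) x ⊖ P (κ q) x
    split = trans (S-⊖ x _ _) (cong₂ _⊖_ (S-⊗ˡ x (ℓ x ⊕ C) w) (S-wℓ x))

    ℓ+C≥0 : 0# ≼ ℓ x ⊕ C
    ℓ+C≥0 = (linear ((0≼ℓ hx hX) ⊞ 0≼C) (solve 2 (λ x y → x :+ (con 8 :+ con 2 :* y) :- con 0 := x :+ (con 8 :+ con 2 :* y) :- (con 0 :+ con 0)) refl _ _))

  Qκ-upper : ∀ x → 1 ≤ x → x ≤ X → ι 2 ⊗ Q (κ q) x ≼ ℓ x ⊗ ℓ x ⊕ (ι 8 ⊗ C) ⊗ ℓ x ⊕ ι 2 ⊗ C ⊗ C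
  Qκ-upper x hx hX = (linear ((2 ⊠ PQκ-upper x hx hX) ⊞ (Pκ-lower x hx hX)) (solve 4 (λ x y z u → x :* x :+ con 8 :* (con 8 :+ con 2 :* y) :* x :+ con 2 :* (con 8 :+ con 2 :* y) :* (con 8 :+ con 2 :* y) :- con 2 :* z := con 2 :* ((x :+ (con 8 :+ con 2 :* y)) :* (x :+ (con 8 :+ con 2 :* y))) :+ (con 2 :* u :+ con 4 :* (con 8 :+ con 2 :* y) :* x) :- (con 2 :* (u :+ z) :+ x :* x)) refl _ _ _ _))

  R : (ℕ → K) → ℕ → K
  R f x = S x λ d → u d ⊗ P (λ n → f (d * n)) (x div d)

  R-D : ∀ f x → R f x ≡ D x (λ d m → f (d * m) ⊗ (u d ⊗ (u m ⊗ ℓ m)))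
  R-D f x = sym (trans (D-div x _) (S-cong x λ d _ _ → trans (S-cong (x div d) λ m _ _ → ⊗-left _ _ _) (S-⊗ˡ (x div d) _ _)))

  -- ℓ(dm) = ℓ(d) + ℓ(m), and exchanging d and m shows that both halves equal `R`.
  2R : ∀ f x → ι 2 ⊗ R f x ≡ Q (λ n → f n ⊗ ℓ n) x
  2R f x = (linear-≡ (ι 2 ⊠≡ R-D f x ⊞≡ swapped ⊞≡ sym whole) (solve 4 (λ x y z u → x :- con 2 :* y := con 2 :* z :+ u :+ x :- (con 2 :* y :+ z :+ (u :+ z))) refl _ _ _ _))
    where
    swapped : D x (λ d m → f (d * m) ⊗ (u d ⊗ (u m ⊗ ℓ m))) ≡ D x (λ d m → f (d * m) ⊗ (u d ⊗ ℓ d ⊗ u m))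
    swapped = trans (D-swap x _) (D-cong x λ d m _ _ _ → cong₂ _⊗_ (cong f (ℕ.*-comm m d)) (⊗-comm _ _))

    whole : Q (λ n → f n ⊗ ℓ n) x ≡ D x (λ d m → f (d * m) ⊗ (u d ⊗ ℓ d ⊗ u m)) ⊕ D x (λ d m → f (d * m) ⊗ (u d ⊗ (u m ⊗ ℓ m)))
    whole = trans (D-cong x λ d m hd hm _ → trans (cong (λ z → f (d * m) ⊗ z ⊗ (u d ⊗ u m)) (ℓ-* d m hd hm)) (distr _ _ _ _ _)) (D-⊕ x _ _)
      where
      distr : ∀ a l k v v′ → a ⊗ (l ⊕ k) ⊗ (v ⊗ v′) ≡ a ⊗ (v ⊗ l ⊗ v′) ⊕ a ⊗ (v ⊗ (v′ ⊗ k))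
      distr a l k v v′ = (solve 5 (λ x y z u v → x :* (y :+ z) :* (u :* v) := x :* (u :* y :* v) :+ x :* (u :* (v :* z))) refl _ _ _ _ _)

  P-lin : ∀ f g N x → P (λ n → f n ⊖ N ⊗ g n) x ≡ P f x ⊖ N ⊗ P g x
  P-lin f g N x = trans (S-cong x λ n _ _ → distr _ _ _ _) (trans (S-⊖ x _ _) (cong (P f x ⊖_) (S-⊗ˡ x N _)))
    where
    distr : ∀ a b N v → (a ⊖ N ⊗ b) ⊗ v ≡ a ⊗ v ⊖ N ⊗ (b ⊗ v)
    distr a b N v = (solve 4 (λ x y z u → (x :- y :* z) :* u := x :* u :- y :* (z :* u)) refl _ _ _ _)

  Q-lin : ∀ f g N x → Q (λ n → f n ⊖ N ⊗ g n) x ≡ Q f x ⊖ N ⊗ Q g x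
  Q-lin f g N x = trans (D-cong x λ d m _ _ _ → distr _ _ _ _) (trans (D-⊕ x _ _) (cong (Q f x ⊕_) (trans (D-⊗ˡ x (neg N) _) (neg-⊗ N (Q g x)))))
    where
    distr : ∀ a b N v → (a ⊖ N ⊗ b) ⊗ v ≡ a ⊗ v ⊕ neg N ⊗ (b ⊗ v)
    distr a b N v = (solve 4 (λ x y z u → (x :- y :* z) :* u := x :* u :+ (:- y) :* (z :* u)) refl _ _ _ _)

    neg-⊗ : ∀ N z → neg N ⊗ z ≡ neg (N ⊗ z)
    neg-⊗ N z = (solve 2 (λ x y → (:- x) :* y := :- (x :* y)) refl _ _)

  T₃ : (ℕ → K) → ℕ → K
  T₃ c x = S x λ d → u d ⊗ Q (λ n → c (d * n)) (x div d)

  -- The trivial bound for T₃ has order ℓ³; it improves to ℓ² when c vanishes at all primes.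
  triple-bound : ∀ (c : ℕ → K) N B x → 0# ≼ N → 0# ≼ B → 1 ≤ x → x < X → (∀ n → 0# ≼ c n) → (∀ n → c n ≼ 1#) →
    (∀ d n → c (d * n) ≡ κ q d ⊗ c (d * n)) →
    (∀ d → Coprime d q → Balanced (λ n → κ q n ⊖ N ⊗ c (d * n)) B) →
    (∀ p → Prime p → p ≤ x → c p ≡ 0#) →
    ι 2 ⊗ N ⊗ T₃ c x ≼ (ι 5 ⊗ C ⊕ ι 8 ⊗ N) ⊗ (ℓ x ⊗ ℓ x) ⊕ (ι 8 ⊗ C ⊗ ℓ x ⊕ ι 2 ⊗ C ⊗ C) ⊗ (ℓ x ⊕ C) ⊕ ι 2 ⊗ err B x ⊗ (ℓ x ⊕ (ℓ x ⊕ C))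
  triple-bound c N B x hN hB hx hX c≥0 c≤1 cκ bal cp =
    -- How the cubic terms cancel: `NT≤` sums Selberg's formula for the quotients x/d. By `2R` its
    -- R-terms are Q(κℓ) - N Q(cℓ), which `abel` bounds by N P(cℓ) - P(κℓ) up to 2Eℓ. `Tκ≤` gives
    -- 2Tκ ≤ ℓ²V - 2ℓP + P(κℓ) plus smaller terms, so P(κℓ) drops out. Finally ℓ²V - 2ℓP ≤ 5Cℓ²,
    -- because V ≤ ℓ + C and 2P ≥ ℓ² - 4Cℓ.
    (linear ((2 ⊠ NT≤) ⊞ (≼-reflexive (2R (κ q) x)) ⊞ ≼-reflexive (sym (N ⊠≡ 2R c x)) ⊞ Tκ≤ ⊞ (proj₂ abel) ⊞ ≼-reflexive (sym e-split) ⊞ N·Zc≤ ⊞ (2 ⊠ ⊗-monoˡ E≥0 Vκ≤) ⊞ (⊗-monoˡ L²≥0 Vκ≤) ⊞ (⊗-monoˡ L≥0 (Pκ-lower x hx x≤X)) ⊞ (⊗-monoˡ K≥0 Vκ≤)) (solve 16 (λ x y z u v w a b c d e f g h i j → (con 5 :* (con 8 :+ con 2 :* x) :+ con 8 :* y) :* (z :* z) :+ (con 8 :* (con 8 :+ con 2 :* x) :* z :+ con 2 :* (con 8 :+ con 2 :* x) :* (con 8 :+ con 2 :* x)) :* (z :+ (con 8 :+ con 2 :* x)) :+ con 2 :* (u :* con 6 :* (one :+ con 4 :* z)) :* (z :+ (z :+ (con 8 :+ con 2 :* x))) :- con 2 :* y :* v := con 2 :* (w :+ a :- y :* b :+ c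 :* (u :* con 6 :* (one :+ con 4 :* z))) :+ d :+ y :* (con 2 :* b) :+ (z :* z :* c :- con 2 :* z :* e :+ f :+ (con 8 :* (con 8 :+ con 2 :* x) :* z :+ con 2 :* (con 8 :+ con 2 :* x) :* (con 8 :+ con 2 :* x)) :* c) :+ con 2 :* (u :* con 6 :* (one :+ con 4 :* z)) :* z :+ (g :+ h) :+ y :* (z :* z :* con 8) :+ con 2 :* (u :* con 6 :* (one :+ con 4 :* z) :* (z :+ (con 8 :+ con 2 :* x))) :+ z :* z :* (z :+ (con 8 :+ con 2 :* x)) :+ z :* (con 2 :* e :+ con 4 :* (con 8 :+ con 2 :* x) :* z) :+ (con 8 :* (con 8 :+ con 2 :* x) :* z :+ con 2 :* (con 8 :+ con 2 :* x) :* (con 8 :+ con 2 :* x)) :* (z :+ (con 8 :+ con 2 :* x)) :- (con 2 :* (y :* v) :+ con 2 :* a :+ y :* i :+ con 2 :* w :+ (g :+ h) :+ (f :- y :* j :+ (d :- y :* i)) :+ y :* j :+ con 2 :* (u :* con 6 :* (one :+ con 4 :* z) :* c) :+ z :* z :* c :+ z :* (z :* z) :+ (con 8 :* (con 8 :+ con 2 :* x) :* z :+ con 2 :* (con 8 :+ con 2 :* x) :* (con 8 :+ con 2 :* x)) :* c)) refl _ _ _ _ _ _ _ _ _ _ _ _ _ _ _ _))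
    where
    x≤X : x ≤ X
    x≤X = ℕ.<⇒≤ hX

    L E Kx : K
    L = ℓ x
    E = err B x
    Kx = ι 8 ⊗ C ⊗ L ⊕ ι 2 ⊗ C ⊗ C

    L≥0 : 0# ≼ ℓ x
    L≥0 = 0≼ℓ hx x≤X

    L²≥0 : 0# ≼ ℓ x ⊗ ℓ x
    L²≥0 = 0≼⊗ L≥0 L≥0

    Vκ≤ : V (κ q) x ≼ ℓ x ⊕ C
    Vκ≤ = (linear ((proj₂ (Vκ-bounds x hx x≤X))) (solve 3 (λ x y z → x :+ (con 8 :+ con 2 :* y) :- z := con 8 :+ con 2 :* y :- (z :- x)) refl _ _ _))

    K≥0 : 0# ≼ ι 8 ⊗ C ⊗ ℓ x ⊕ ι 2 ⊗ C ⊗ C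
    K≥0 = (linear (8 ⊠ (0≼⊗ 0≼C L≥0) ⊞ 2 ⊠ (0≼⊗ 0≼C 0≼C)) (solve 2 (λ x y → con 8 :* (con 8 :+ con 2 :* x) :* y :+ con 2 :* (con 8 :+ con 2 :* x) :* (con 8 :+ con 2 :* x) :- con 0 := con 8 :* ((con 8 :+ con 2 :* x) :* y) :+ con 2 :* ((con 8 :+ con 2 :* x) :* (con 8 :+ con 2 :* x)) :- (con 8 :* con 0 :+ con 2 :* con 0)) refl _ _))

    E≥0 : 0# ≼ err B x
    E≥0 = 0≼⊗ (0≼⊗ hB (0≼ι 6)) ((linear (4 ⊠ L≥0 ⊞ 0≼1) (solve 1 (λ x → one :+ con 4 :* x :- con 0 := con 4 :* x :+ one :- (con 4 :* con 0 :+ con 0)) refl _)))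

    err-mono : ∀ y → 1 ≤ y → y ≤ x → err B y ≼ err B x
    err-mono y h l = ⊗-monoˡ (0≼⊗ hB (0≼ι 6)) ((linear (4 ⊠ (ℓ-mono h l x≤X)) (solve 2 (λ x y → one :+ con 4 :* x :- (one :+ con 4 :* y) := con 4 :* x :- con 4 :* y) refl _ _)))

    term : ∀ d → 1 ≤ d → d ≤ x → N ⊗ (u d ⊗ Q (λ n → c (d * n)) (x div d)) ≼
      w d ⊗ Q (κ q) (x div d) ⊕ u d ⊗ P (λ n → κ q (d * n)) (x div d) ⊖ N ⊗ (u d ⊗ P (λ n → c (d * n)) (x div d)) ⊕ w d ⊗ err B x
    term d h l = cases (isCoprime? d q)
      where
      y′ = x div d

      κP : P (λ n → κ q (d * n)) y′ ≡ κ q d ⊗ P (κ q) y′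
      κP = trans (S-cong y′ λ n _ _ → trans (cong (_⊗ (u n ⊗ ℓ n)) (κ-* q d n)) (⊗-assoc _ _ _)) (S-⊗ˡ y′ _ _)

      cases : Dec (Coprime d q) → N ⊗ (u d ⊗ Q (λ n → c (d * n)) y′) ≼
        w d ⊗ Q (κ q) y′ ⊕ u d ⊗ P (λ n → κ q (d * n)) y′ ⊖ N ⊗ (u d ⊗ P (λ n → c (d * n)) y′) ⊕ w d ⊗ err B x
      -- For d not prime to q, `cκ` makes every c(dn) vanish along with κ(d), and both sides are 0.
      cases (no nc) = ≼-reflexive (trans (cong (λ z → N ⊗ (u d ⊗ z)) Q≡0) (trans (all-zero _ _ _ _ _ _) (sym
          (cong₂ _⊕_ (cong₂ _⊖_ (cong₂ (λ a b → a ⊗ u d ⊗ Q (κ q) y′ ⊕ u d ⊗ b) κ≡0 (trans κP (cong (_⊗ P (κ q) y′) κ≡0))) (cong (λ z → N ⊗ (u d ⊗ z)) P≡0)) (cong (λ z → z ⊗ u d ⊗ err B x) κ≡0)))))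
        where
        κ≡0 : κ q d ≡ 0#
        κ≡0 = 𝟙-no (isCoprime? d q) nc

        c≡0 : ∀ n → c (d * n) ≡ 0#
        c≡0 n = trans (cκ d n) (trans (cong (_⊗ c (d * n)) κ≡0) (⊗-zeroˡ _))

        Q≡0 : Q (λ n → c (d * n)) y′ ≡ 0#
        Q≡0 = S-zero y′ λ e _ _ → S-zero y′ λ m _ _ → trans (cong (λ z → 𝟙 (e * m ≤? y′) ⊗ (z ⊗ (u e ⊗ u m))) (c≡0 (e * m))) (solve 5 (λ x y z u v → x :* (con 0 :* (y :* z :* (u :* v))) := con 0) refl _ _ _ _ _)

        P≡0 : P (λ n → c (d * n)) y′ ≡ 0#
        P≡0 = S-zero y′ λ m _ _ → trans (cong (_⊗ (u m ⊗ ℓ m)) (c≡0 m)) (⊗-zeroˡ _)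

        all-zero : ∀ N v qk pk er n → N ⊗ (v ⊗ 0#) ≡ (0# ⊗ v ⊗ qk ⊕ v ⊗ (0# ⊗ pk) ⊖ n ⊗ (v ⊗ 0#)) ⊕ 0# ⊗ v ⊗ er
        all-zero N v qk pk er n = (solve 6 (λ x y z u v w → x :* (y :* con 0) := con 0 :* y :* z :+ y :* (con 0 :* u) :- v :* (y :* con 0) :+ con 0 :* y :* w) refl _ _ _ _ _ _)
      cases (yes co) = ≼-trans ((linear ((⊗-monoˡ (0≼u d h) main)) (solve 9 (λ x y z u v w a b c → one :* (x :* y) :* z :+ x :* y :* u :- v :* (x :* y :* w) :+ one :* (x :* y) :* (a :* con 6 :* (one :+ con 4 :* b)) :- v :* (x :* y :* c) := x :* y :* (z :+ u :- v :* w :+ a :* con 6 :* (one :+ con 4 :* b)) :- x :* y :* (v :* c)) refl _ _ _ _ _ _ _ _ _))) (≼-reflexive (sym (cong₂ _⊕_ (cong (_⊖ N ⊗ (u d ⊗ P (λ n → c (d * n)) y′))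
          (cong₂ (λ a b → a ⊗ u d ⊗ Q (κ q) y′ ⊕ u d ⊗ b) κ≡1 (trans κP (trans (cong (_⊗ P (κ q) y′) κ≡1) (⊗-identityˡ _))))) (cong (λ z → z ⊗ u d ⊗ err B x) κ≡1))))
        where
        κ≡1 : κ q d ≡ 1#
        κ≡1 = 𝟙-yes (isCoprime? d q) co

        main : N ⊗ Q (λ n → c (d * n)) y′ ≼ Q (κ q) y′ ⊕ P (κ q) y′ ⊖ N ⊗ P (λ n → c (d * n)) y′ ⊕ err B x
        main = (linear ((proj₁ (selberg (λ n → κ q n ⊖ N ⊗ c (d * n)) B hB (bal d co) y′ (1≤div h l) (ℕ.≤-trans (div≤ x d) x≤X))) ⊞ ≼-reflexive (P-lin (κ q) (λ n → c (d * n)) N y′) ⊞ ≼-reflexive (Q-lin (κ q) (λ n → c (d * n)) N y′) ⊞ (err-mono y′ (1≤div h l) (div≤ x d))) (solve 10 (λ x y z u v w a b c d → x :+ y :- z :* u :+ v :* con 6 :* (one :+ con 4 :* w) :- z :* a := b :+ c :+ (y :- z :* u) :+ (x :- z :* a) :+ v :* con 6 :* (one :+ con 4 :* w) :- (:- (v :* con 6 :* (one :+ con 4 :* d)) :+ b :+ c :+ v :* con 6 :* (one :+ con 4 :* d))) refl _ _ _ _ _ _ _ _ _ _))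

    Tκ : K
    Tκ = S x λ d → w d ⊗ Q (κ q) (x div d)

    NT≤ : N ⊗ T₃ c x ≼ Tκ ⊕ R (κ q) x ⊖ N ⊗ R c x ⊕ V (κ q) x ⊗ err B x
    NT≤ = ≼-trans (≼-reflexive (sym (S-⊗ˡ x N _))) (≼-trans (S-mono x term) (≼-reflexive
      (trans (S-⊕ x _ _) (cong₂ _⊕_ (trans (S-⊖ x _ _) (cong₂ _⊖_ (S-⊕ x _ _) (S-⊗ˡ x N _))) (S-⊗ʳ x (err B x) w)))))

    Tκ≤ : ι 2 ⊗ Tκ ≼ ℓ x ⊗ ℓ x ⊗ V (κ q) x ⊖ ι 2 ⊗ ℓ x ⊗ P (κ q) x ⊕ P (λ n → κ q n ⊗ ℓ n) x ⊕ (ι 8 ⊗ C ⊗ ℓ x ⊕ ι 2 ⊗ C ⊗ C) ⊗ V (κ q) x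
    Tκ≤ = ≼-trans (≼-reflexive (sym (S-⊗ˡ x (ι 2) _))) (≼-trans (S-mono x bound) (≼-reflexive
      (trans (S-⊕ x _ _) (cong₂ _⊕_ (trans (S-⊕ x _ _) (cong₂ _⊕_ (trans (S-⊖ x _ _) (cong₂ _⊖_ (S-⊗ˡ x (ℓ x ⊗ ℓ x) w) (trans (S-⊗ˡ x (ι 2 ⊗ ℓ x) _) (cong (ι 2 ⊗ ℓ x ⊗_) (S-wℓ x))))) (S-wℓ² x))) (S-⊗ˡ x Kx w)))))
      where
      bound : ∀ d → 1 ≤ d → d ≤ x → ι 2 ⊗ (w d ⊗ Q (κ q) (x div d)) ≼ ℓ x ⊗ ℓ x ⊗ w d ⊖ ι 2 ⊗ ℓ x ⊗ (w d ⊗ ℓ d) ⊕ w d ⊗ (ℓ d ⊗ ℓ d) ⊕ Kx ⊗ w d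
      bound d h l = ≼-trans (≼-reflexive (⊗-left _ _ _)) (≼-trans (⊗-monoˡ (0≼w d h) Q≤) (≼-reflexive (expand (w d) (ℓ x) (ℓ d) Kx)))
        where
        y′ = x div d

        expand : ∀ v a b k → v ⊗ ((a ⊖ b) ⊗ (a ⊖ b) ⊕ k) ≡ a ⊗ a ⊗ v ⊖ ι 2 ⊗ a ⊗ (v ⊗ b) ⊕ v ⊗ (b ⊗ b) ⊕ k ⊗ v
        expand v a b k = (solve 4 (λ x y z u → x :* ((y :- z) :* (y :- z) :+ u) := y :* y :* x :- con 2 :* y :* (x :* z) :+ x :* (z :* z) :+ u :* x) refl _ _ _ _)

        Q≤ : ι 2 ⊗ Q (κ q) y′ ≼ (ℓ x ⊖ ℓ d) ⊗ (ℓ x ⊖ ℓ d) ⊕ (ι 8 ⊗ C ⊗ ℓ x ⊕ ι 2 ⊗ C ⊗ C)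
        Q≤ = (linear ((Qκ-upper y′ (1≤div h l) (ℕ.≤-trans (div≤ x d) x≤X)) ⊞ (⊗-mono (0≼ℓ-div h l x≤X) (ℓ-div h l x≤X) (0≼ℓ-div h l x≤X) (ℓ-div h l x≤X)) ⊞ (8 ⊠ ⊗-monoˡ 0≼C (ℓ-mono (1≤div h l) (div≤ x d) x≤X))) (solve 5 (λ x y z u v → (x :- y) :* (x :- y) :+ (con 8 :* (con 8 :+ con 2 :* z) :* x :+ con 2 :* (con 8 :+ con 2 :* z) :* (con 8 :+ con 2 :* z)) :- con 2 :* u := v :* v :+ con 8 :* (con 8 :+ con 2 :* z) :* v :+ con 2 :* (con 8 :+ con 2 :* z) :* (con 8 :+ con 2 :* z) :+ (x :- y) :* (x :- y) :+ con 8 :* ((con 8 :+ con 2 :* z) :* x) :- (con 2 :* u :+ v :* v :+ con 8 :* ((con 8 :+ con 2 :* z) :* v))) refl _ _ _ _ _))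

    e : ℕ → K
    e n = κ q n ⊖ N ⊗ c n

    e-balanced : Balanced e B
    e-balanced d hd t = Bd-≡ (S-cong t λ m _ _ → cong (λ z → κ q (d * m) ⊖ N ⊗ c z) (sym (ℕ.*-identityˡ (d * m)))) (bal 1 (coprime-1 q) d hd t)

    abel : Bd (P (λ n → e n ⊗ ℓ n) x ⊕ Q (λ n → e n ⊗ ℓ n) x) (ι 2 ⊗ err B x ⊗ ℓ x)
    abel = Bd-≡ (trans (sym (S-Λ₂ (λ n → e n ⊗ ℓ n) x)) (S-cong x λ n _ _ → ring-move _ _ _ _))
      (S-abel-inc x (λ n → e n ⊗ inv n ⊗ Λ₂ n) ℓ E E≥0 partial (λ n h l → (linear ((0≼ℓ-step n h (ℕ.<-trans l hX))) (solve 2 (λ x y → x :- y := x :- y :- con 0) refl _ _))) (λ n h l → 0≼ℓ h (ℕ.≤-trans l x≤X)) hx)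
      where
      ring-move : ∀ a l i z → a ⊗ l ⊗ i ⊗ z ≡ a ⊗ i ⊗ z ⊗ l
      ring-move a l i z = (solve 4 (λ x y z u → x :* y :* z :* u := x :* z :* u :* y) refl _ _ _ _)

      partial : ∀ t → t ≤ x → Bd (S t (λ n → e n ⊗ inv n ⊗ Λ₂ n)) E
      partial zero _ = Bd-0 E≥0
      partial t@(suc _) h = Bd-weaken (err-mono t (s≤s z≤n) h) (Bd-≡ (S-Λ₂ e t) (selberg e B hB e-balanced t (s≤s z≤n) (ℕ.≤-trans h x≤X)))

    e-split : P (λ n → e n ⊗ ℓ n) x ⊕ Q (λ n → e n ⊗ ℓ n) x ≡
      (P (λ n → κ q n ⊗ ℓ n) x ⊖ N ⊗ P (λ n → c n ⊗ ℓ n) x) ⊕ (Q (λ n → κ q n ⊗ ℓ n) x ⊖ N ⊗ Q (λ n → c n ⊗ ℓ n) x)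
    e-split = cong₂ _⊕_ (trans (S-cong x λ n _ _ → cong (_⊗ (u n ⊗ ℓ n)) (distr _ _ _ _)) (P-lin (λ n → κ q n ⊗ ℓ n) (λ n → c n ⊗ ℓ n) N x))
      (trans (D-cong x λ d m _ _ _ → cong (_⊗ (u d ⊗ u m)) (distr _ _ _ _)) (Q-lin (λ n → κ q n ⊗ ℓ n) (λ n → c n ⊗ ℓ n) N x))
      where
      distr : ∀ a b N l → (a ⊖ N ⊗ b) ⊗ l ≡ a ⊗ l ⊖ N ⊗ (b ⊗ l)
      distr a b N l = (solve 4 (λ x y z u → (x :- y :* z) :* u := x :* u :- y :* (z :* u)) refl _ _ _ _)

    N·Zc≤ : N ⊗ P (λ n → c n ⊗ ℓ n) x ≼ N ⊗ (ℓ x ⊗ ℓ x ⊗ ι 8)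
    N·Zc≤ = ⊗-monoˡ hN (≼-trans (S-mono x zc) (≼-trans (≼-reflexive (S-⊗ˡ x (ℓ x ⊗ ℓ x) _)) (⊗-monoˡ L²≥0 (prime-powers-bound x c hX c≥0 c≤1 cp))))
      where
      zc : ∀ n → 1 ≤ n → n ≤ x → c n ⊗ ℓ n ⊗ (u n ⊗ ℓ n) ≼ ℓ x ⊗ ℓ x ⊗ (c n ⊗ u n)
      zc n h l = ≼-trans (≼-reflexive (solve 4 (λ x y z u → x :* y :* (z :* u :* y) := y :* y :* (x :* (z :* u))) refl _ _ _ _)) (⊗-monoʳ (0≼⊗ (c≥0 n) (0≼u n h)) (⊗-mono (0≼ℓ h (ℕ.≤-trans l x≤X)) (ℓ-mono h l x≤X) (0≼ℓ h (ℕ.≤-trans l x≤X)) (ℓ-mono h l x≤X)))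

-- Geometric weights for a Lambert series

module Geometric (M : ℕ) (hM : 2 ≤ M) where
  private
    1≤M : 1 ≤ M
    1≤M = ℕ.≤-trans (s≤s z≤n) hM

  t : K
  t = 1# ⊖ inv M

  s≥0 : 0# ≼ inv M
  s≥0 = 0≼inv 1≤M

  t≥0 : 0# ≼ t
  t≥0 = (linear ((inv≼1 1≤M)) (solve 1 (λ x → one :- x :- con 0 := one :- x) refl _))

  -- `pw d` is t^d and G(d) = 1 + t + ⋯ + t^(d-1) = M(1 - t^d). So h(d) is the Lambert factor t^d/(1
  -- - t^d), and b(d) = M/d - h(d) is its difference from the first-order term. Dividing by G(d) ≥ 1
  -- instead of 1 - t^d suits `recip-inverse`.
  pw G Gi b h : ℕ → K
  pw zero = 1#
  pw (suc d) = t ⊗ pw d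
  G zero = 0#
  G (suc d) = G d ⊕ pw d
  Gi d = recip (G d)
  b d = ι M ⊗ (inv d ⊖ pw d ⊗ Gi d)
  h d = ι M ⊗ (pw d ⊗ Gi d)

  0≼pw : ∀ d → 0# ≼ pw d
  0≼pw zero = 0≼1
  0≼pw (suc d) = 0≼⊗ t≥0 (0≼pw d)

  pw-step : ∀ d → pw (suc d) ≼ pw d
  pw-step d = (linear ((0≼⊗ s≥0 (0≼pw d)) ⊞ ≼-reflexive pw-suc) (solve 3 (λ x y z → x :- y := z :* x :+ (one :- z) :* x :- (con 0 :+ y)) refl _ _ _))
    where
    pw-suc : pw (suc d) ≡ t ⊗ pw d
    pw-suc = refl

  pw-anti : ∀ {m n} → m ≤ n → pw n ≼ pw m
  pw-anti {m} {zero} z≤n = ≼-refl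
  pw-anti {m} {suc n} le with m ≟ suc n
  ... | yes refl = ≼-refl
  ... | no ne = ≼-trans (pw-step n) (pw-anti (ℕ.≤-pred (ℕ.≤∧≢⇒< le ne)))

  pw-+ : ∀ m n → pw (m + n) ≡ pw m ⊗ pw n
  pw-+ zero n = sym (⊗-identityˡ _)
  pw-+ (suc m) n = trans (cong (t ⊗_) (pw-+ m n)) (sym (⊗-assoc _ _ _))

  G-suc : ∀ d → G (suc d) ≡ 1# ⊕ t ⊗ G d
  G-suc zero = (solve 1 (λ x → con 0 :+ one := one :+ (one :- x) :* con 0) refl _)
  G-suc (suc d) = trans (cong (_⊕ pw (suc d)) (G-suc d)) (step (G d) (pw d))
    where
    step : ∀ g p → 1# ⊕ t ⊗ g ⊕ t ⊗ p ≡ 1# ⊕ t ⊗ (g ⊕ p)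
    step g p = (solve 3 (λ x y z → one :+ (one :- x) :* y :+ (one :- x) :* z := one :+ (one :- x) :* (y :+ z)) refl _ _ _)

  sG : ∀ d → inv M ⊗ G d ≡ 1# ⊖ pw d
  sG zero = (solve 1 (λ x → x :* con 0 := one :- one) refl _)
  sG (suc d) = trans (⊗-distribˡ-⊕ _ _ _) (trans (cong (_⊕ inv M ⊗ pw d) (sG d)) (step (pw d)))
    where
    step : ∀ p → 1# ⊖ p ⊕ inv M ⊗ p ≡ 1# ⊖ t ⊗ p
    step p = (solve 2 (λ x y → one :- x :+ y :* x := one :- (one :- y) :* x) refl _ _)

  G≥1 : ∀ d → 1 ≤ d → 1# ≼ G d
  G≥1 (suc zero) _ = (linear (≼-reflexive (sym G-1)) (solve 1 (λ x → x :- one := x :- (con 0 :+ one)) refl _))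
    where
    G-1 : G 1 ≡ 0# ⊕ 1#
    G-1 = refl
  G≥1 (suc (suc d)) _ = (linear ((G≥1 (suc d) (s≤s z≤n)) ⊞ (0≼pw (suc d)) ⊞ ≼-reflexive (sym G-suc′)) (solve 3 (λ x y z → x :- one := y :+ z :+ x :- (one :+ con 0 :+ (y :+ z))) refl _ _ _))
    where
    G-suc′ : G (suc (suc d)) ≡ G (suc d) ⊕ pw (suc d)
    G-suc′ = refl

  G≥dp : ∀ d → ι d ⊗ pw d ≼ G d
  G≥dp zero = ≼-reflexive (⊗-zeroˡ _)
  G≥dp (suc d) = (linear ((G≥dp d) ⊞ ≼-reflexive (sym G-suc′) ⊞ (⊗-monoˡ (0≼ι (suc d)) (pw-step d))) (solve 5 (λ x y z u v → x :- (one :+ y) :* z := u :+ x :+ (one :+ y) :* v :- (y :* v :+ (u :+ v) :+ (one :+ y) :* z)) refl _ _ _ _ _))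
    where
    G-suc′ : G (suc d) ≡ G d ⊕ pw d
    G-suc′ = refl

  -- Since G n (1 + tⁿ) = Σ_{i<2n} tⁱ, pairing tⁱ with t²ⁿ⁻ⁱ gives the first inequality; the second makes b decreasing.
  G-pairing : ∀ n → ι 2 ⊗ ι n ⊗ pw n ≼ G n ⊗ (1# ⊕ pw n)
  G-pairing zero = (linear (0 ⊠ 0≼1) (solve 0 (con 0 :* (one :+ one) :- con 2 :* con 0 :* one := con 0 :* one :- con 0 :* con 0) refl))
  G-pairing (suc n) = ≼-trans (step (G n) (pw n) (G-pairing n) (sG n) (0≼pw n)) (≼-reflexive (cong (_⊗ (1# ⊕ t ⊗ pw n)) (sym (G-suc n))))
    where
    step : ∀ g p → ι 2 ⊗ ι n ⊗ p ≼ g ⊗ (1# ⊕ p) → inv M ⊗ g ≡ 1# ⊖ p → 0# ≼ p →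
      ι 2 ⊗ ι (suc n) ⊗ (t ⊗ p) ≼ (1# ⊕ t ⊗ g) ⊗ (1# ⊕ t ⊗ p)
    step g p ih e hp = (linear ((⊗-monoˡ t≥0 ih) ⊞ ≼-reflexive ((t ⊗ p) ⊠≡ e) ⊞ (0≼sq (1# ⊖ t ⊗ p)) ⊞ (0≼⊗ (0≼⊗ t≥0 s≥0) (0≼⊗ hp hp))) (solve 4 (λ x y z u → (one :+ (one :- x) :* y) :* (one :+ (one :- x) :* z) :- con 2 :* (one :+ u) :* ((one :- x) :* z) := (one :- x) :* (y :* (one :+ z)) :+ (one :- x) :* z :* (one :- z) :+ (one :- (one :- x) :* z) :* (one :- (one :- x) :* z) :+ (one :- x) :* x :* (z :* z) :- ((one :- x) :* (con 2 :* u :* z) :+ (one :- x) :* z :* (x :* y) :+ con 0 :+ con 0)) refl _ _ _ _))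

  G-product : ∀ d → ι d ⊗ ι (suc d) ⊗ pw d ≼ G d ⊗ G (suc d)
  G-product zero = (linear (0 ⊠ 0≼1) (solve 0 (con 0 :* (con 0 :+ one) :- con 0 :* con 1 :* one := con 0 :* one :- con 0 :* con 0) refl))
  G-product (suc d) = step (G d) (G (suc d)) (pw d) (G-suc d) (G-product d) (G-pairing (suc d))
    where
    step : ∀ g g′ p → g′ ≡ 1# ⊕ t ⊗ g → ι d ⊗ ι (suc d) ⊗ p ≼ g ⊗ g′ → ι 2 ⊗ ι (suc d) ⊗ (t ⊗ p) ≼ g′ ⊗ (1# ⊕ t ⊗ p) →
      ι (suc d) ⊗ ι (suc (suc d)) ⊗ (t ⊗ p) ≼ g′ ⊗ (g′ ⊕ t ⊗ p)
    step g g′ p e ih pair = (linear ((⊗-monoˡ t≥0 ih) ⊞ pair ⊞ ≼-reflexive (sym (g′ ⊠≡ e))) (solve 5 (λ x y z u v → x :* (x :+ (one :- y) :* z) :- (one :+ u) :* (one :+ (one :+ u)) :* ((one :- y) :* z) := (one :- y) :* (v :* x) :+ x :* (one :+ (one :- y) :* z) :+ x :* x :- ((one :- y) :* (u :* (one :+ u) :* z) :+ con 2 :* (one :+ u) :* ((one :- y) :* z) :+ x :* (one :+ (one :- y) :* v))) refl _ _ _ _ _))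

  G·Gi : ∀ d → 1 ≤ d → G d ⊗ Gi d ≡ 1#
  G·Gi d hd = recip-inverse (G≥1 d hd)

  0≼Gi : ∀ d → 1 ≤ d → 0# ≼ Gi d
  0≼Gi d hd = 0≼recip (G≥1 d hd)

  Gi≼1 : ∀ d → 1 ≤ d → Gi d ≼ 1#
  Gi≼1 d hd = ⊗-cancel (G≥1 d hd) ((linear (≼-reflexive (G·Gi d hd) ⊞ (G≥1 d hd)) (solve 2 (λ x y → x :* one :- x :* y := one :+ x :- (x :* y :+ one)) refl _ _)))

  0≼b : ∀ d → 1 ≤ d → 0# ≼ b d
  0≼b d hd = 0≼⊗ (0≼ι M) (⊗-cancel (1≼ι hd) (⊗-cancel (G≥1 d hd) ((linear ((G≥dp d) ⊞ ≼-reflexive (sym (G d ⊠≡ inv-inverse hd)) ⊞ ≼-reflexive ((ι d ⊗ pw d) ⊠≡ G·Gi d hd)) (solve 5 (λ x y z u v → x :* (y :* (z :- u :* v)) :- x :* (y :* con 0) := x :+ x :* (y :* z) :+ y :* u :* one :- (y :* u :+ x :* one :+ y :* u :* (x :* v))) refl _ _ _ _ _)))))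

  -- G(d+1) = 1 + tG(d) gives t^d/G(d) - t^(d+1)/G(d+1) = t^d/(G(d)G(d+1)). Compared with 1/d -
  -- 1/(d+1) = 1/(d(d+1)), this is `G-product` after clearing denominators.
  b-decreasing : ∀ d → 1 ≤ d → b (suc d) ≼ b d
  b-decreasing d hd = (linear ((⊗-monoˡ (0≼ι M) main)) (solve 7 (λ x y z u v w a → x :* (y :- z :* u) :- x :* (v :- w :* a) := x :* (y :- v :- (z :* u :- w :* a)) :- x :* con 0) refl _ _ _ _ _ _ _))
    where
    clear : ∀ D D′ i i′ g g′ k k′ p → D ⊗ i ≡ 1# → D′ ⊗ i′ ≡ 1# → g ⊗ k ≡ 1# → g′ ⊗ k′ ≡ 1# →
      (i ⊗ i′ ⊗ (k ⊗ k′)) ⊗ (g ⊗ g′ ⊖ D ⊗ D′ ⊗ p) ≡ i ⊗ i′ ⊖ p ⊗ k ⊗ k′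
    clear D D′ i i′ g g′ k k′ p e₁ e₂ e₃ e₄ = trans regroup (trans (cong₂ _⊖_ (cong₂ (λ a b → i ⊗ i′ ⊗ (a ⊗ b)) e₃ e₄) (cong₂ (λ a b → p ⊗ k ⊗ k′ ⊗ (a ⊗ b)) e₁ e₂)) (solve 5 (λ x y z u v → x :* y :* (one :* one) :- z :* u :* v :* (one :* one) := x :* y :- z :* u :* v) refl _ _ _ _ _))
      where
      regroup : (i ⊗ i′ ⊗ (k ⊗ k′)) ⊗ (g ⊗ g′ ⊖ D ⊗ D′ ⊗ p) ≡ i ⊗ i′ ⊗ ((g ⊗ k) ⊗ (g′ ⊗ k′)) ⊖ p ⊗ k ⊗ k′ ⊗ ((D ⊗ i) ⊗ (D′ ⊗ i′))
      regroup = (solve 9 (λ x y z u v w a b c → x :* y :* (z :* u) :* (v :* w :- a :* b :* c) := x :* y :* (v :* z :* (w :* u)) :- c :* z :* u :* (a :* x :* (b :* y))) refl _ _ _ _ _ _ _ _ _)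

    ratio : pw d ⊗ Gi d ⊖ pw (suc d) ⊗ Gi (suc d) ≡ pw d ⊗ Gi d ⊗ Gi (suc d)
    ratio = collapse (pw d) (G d) (G (suc d)) (Gi d) (Gi (suc d)) (G·Gi d hd) (G·Gi (suc d) (s≤s z≤n)) (G-suc d)
      where
      collapse : ∀ p g g′ k k′ → g ⊗ k ≡ 1# → g′ ⊗ k′ ≡ 1# → g′ ≡ 1# ⊕ t ⊗ g → p ⊗ k ⊖ (t ⊗ p) ⊗ k′ ≡ p ⊗ k ⊗ k′
      collapse p g g′ k k′ e₁ e₂ e₃ = (linear-≡ ((t ⊗ p ⊗ k′) ⊠≡ e₁ ⊞≡ sym ((p ⊗ k) ⊠≡ e₂) ⊞≡ (p ⊗ k ⊗ k′) ⊠≡ e₃) (solve 6 (λ x y z u v w → x :* y :* z :- (x :* y :- (one :- u) :* x :* z) := (one :- u) :* x :* z :* one :+ x :* y :* (v :* z) :+ x :* y :* z :* (one :+ (one :- u) :* w) :- ((one :- u) :* x :* z :* (w :* y) :+ x :* y :* one :+ x :* y :* z :* v)) refl _ _ _ _ _ _))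

    main : 0# ≼ (inv d ⊖ inv (suc d)) ⊖ (pw d ⊗ Gi d ⊖ pw (suc d) ⊗ Gi (suc d))
    main = ≼-trans (0≼⊗ (0≼⊗ (0≼⊗ (0≼inv hd) (0≼inv {suc d} (s≤s z≤n))) (0≼⊗ (0≼Gi d hd) (0≼Gi (suc d) (s≤s z≤n)))) (0≼⊖ (G-product d)))
      (≼-reflexive (trans (clear (ι d) (ι (suc d)) (inv d) (inv (suc d)) (G d) (G (suc d)) (Gi d) (Gi (suc d)) (pw d)
        (inv-inverse hd) (inv-inverse {suc d} (s≤s z≤n)) (G·Gi d hd) (G·Gi (suc d) (s≤s z≤n))) (sym (cong₂ _⊖_ (inv-step hd) ratio))))

  b-1 : b 1 ≼ 1#
  b-1 = (linear (≼-reflexive (ι M ⊠≡ inv-1) ⊞ ≼-reflexive (sym ((ι M ⊗ t) ⊠≡ Gi-1)) ⊞ ≼-reflexive (inv-inverse 1≤M) ⊞ ≼-reflexive (sym ((ι M ⊗ Gi 1) ⊠≡ pw-1))) (solve 5 (λ x y z u v → one :- x :* (y :- z :* u) := x :* one :+ x :* (one :- v) :* u :+ one :+ x :* u :* z :- (x :* y :+ x :* (one :- v) :* one :+ x :* v :+ x :* u :* (one :- v))) refl _ _ _ _ _))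
    where
    pw-1 : pw 1 ≡ t
    pw-1 = ⊗-identityʳ t

    Gi-1 : Gi 1 ≡ 1#
    Gi-1 = trans (sym (⊗-identityˡ _)) (trans (cong (_⊗ Gi 1) (sym (⊕-identityˡ 1#))) (G·Gi 1 ℕ.≤-refl))

  b+h : ∀ d → b d ⊕ h d ≡ ι M ⊗ inv d
  b+h d = (solve 4 (λ x y z u → x :* (y :- z :* u) :+ x :* (z :* u) := x :* y) refl _ _ _ _)

  0≼h : ∀ d → 1 ≤ d → 0# ≼ h d
  0≼h d hd = 0≼⊗ (0≼ι M) (0≼⊗ (0≼pw d) (0≼Gi d hd))

  h-fixed : ∀ d → 1 ≤ d → h d ≡ pw d ⊕ pw d ⊗ h d
  h-fixed d hd = (linear-≡ (sym ((ι M ⊗ pw d ⊗ Gi d) ⊠≡ sG d) ⊞≡ (ι M ⊗ inv M ⊗ pw d) ⊠≡ G·Gi d hd ⊞≡ pw d ⊠≡ inv-inverse 1≤M) (solve 5 (λ x y z u v → x :+ x :* (y :* (x :* z)) :- y :* (x :* z) := y :* x :* z :* (u :* v) :+ y :* u :* x :* one :+ x :* one :- (y :* x :* z :* (one :- x) :+ y :* u :* x :* (v :* z) :+ x :* (y :* u))) refl _ _ _ _ _))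

  geometric-sum : ∀ d k → 1 ≤ d → S k (λ m → pw (d * m)) ⊕ pw (d * k) ⊗ h d ≡ h d
  geometric-sum d zero hd = trans (cong (λ z → 0# ⊕ pw z ⊗ h d) (ℕ.*-zeroʳ d)) (unit (h d))
    where
    unit : ∀ z → 0# ⊕ 1# ⊗ z ≡ z
    unit z = (solve 1 (λ x → con 0 :+ one :* x := x) refl _)
  geometric-sum d (suc k) hd = trans (cong (λ z → S k (λ m → pw (d * m)) ⊕ z ⊕ z ⊗ h d) (trans (cong pw (ℕ.*-suc d k)) (pw-+ d (d * k))))
    (step _ _ _ _ (geometric-sum d k hd) (h-fixed d hd))
    where
    step : ∀ σ p r e → σ ⊕ r ⊗ e ≡ e → e ≡ p ⊕ p ⊗ e → σ ⊕ p ⊗ r ⊕ p ⊗ r ⊗ e ≡ e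
    step σ p r e e₁ e₂ = (linear-≡ (e₁ ⊞≡ sym (r ⊠≡ e₂)) (solve 4 (λ x y z u → x :- (y :+ z :* u :+ z :* u :* x) := x :+ u :* x :- (y :+ u :* x :+ u :* (z :+ z :* x))) refl _ _ _ _))

  bernoulli : ∀ n → 1# ⊖ ι n ⊗ inv M ≼ pw n
  bernoulli zero = ≼-reflexive (solve 1 (λ x → one :- con 0 :* x := one) refl _)
  bernoulli (suc n) = ≼-trans (step (bernoulli n)) ≼-refl
    where
    step : 1# ⊖ ι n ⊗ inv M ≼ pw n → 1# ⊖ ι (suc n) ⊗ inv M ≼ t ⊗ pw n
    step ih = (linear ((⊗-monoˡ t≥0 ih) ⊞ (0≼⊗ (0≼⊗ (0≼ι n) s≥0) s≥0)) (solve 3 (λ x y z → (one :- x) :* y :- (one :- (one :+ z) :* x) := (one :- x) :* y :+ z :* x :* x :- ((one :- x) :* (one :- z :* x) :+ con 0)) refl _ _ _))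

  -- Since t(1 + 1/M) ≤ 1, t^x is at most the inverse of (1 + 1/M)^x; the bracket is twice the
  -- binomial expansion of that power up to its quadratic term. Linear decay would not do, as the
  -- tail to be bounded has x terms of size M t^x.
  pw-decay : ∀ x → pw x ⊗ (ι 2 ⊕ ι 2 ⊗ ι x ⊗ inv M ⊕ ι x ⊗ (ι x ⊖ 1#) ⊗ (inv M ⊗ inv M)) ≼ ι 2
  pw-decay zero = ≼-reflexive (solve 1 (λ x → one :* (con 2 :+ con 2 :* con 0 :* x :+ con 0 :* (con 0 :- one) :* (x :* x)) := con 2) refl _)
  pw-decay (suc x) = ≼-trans (step (0≼pw x)) (pw-decay x)
    where
    step : ∀ {p} → 0# ≼ p → (t ⊗ p) ⊗ (ι 2 ⊕ ι 2 ⊗ ι (suc x) ⊗ inv M ⊕ ι (suc x) ⊗ (ι (suc x) ⊖ 1#) ⊗ (inv M ⊗ inv M)) ≼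
      p ⊗ (ι 2 ⊕ ι 2 ⊗ ι x ⊗ inv M ⊕ ι x ⊗ (ι x ⊖ 1#) ⊗ (inv M ⊗ inv M))
    step {p} hp = (linear (2 ⊠ (0≼⊗ hp (0≼⊗ s≥0 s≥0)) ⊞ (0≼⊗ (0≼⊗ hp (0≼ι x)) (0≼⊗ s≥0 (0≼⊗ s≥0 s≥0))) ⊞ (0≼⊗ (0≼⊗ hp (0≼⊗ (0≼ι x) (0≼ι x))) (0≼⊗ s≥0 (0≼⊗ s≥0 s≥0)))) (solve 3 (λ x y z → x :* (con 2 :+ con 2 :* y :* z :+ y :* (y :- one) :* (z :* z)) :- (one :- z) :* x :* (con 2 :+ con 2 :* (one :+ y) :* z :+ (one :+ y) :* (one :+ y :- one) :* (z :* z)) := con 2 :* (x :* (z :* z)) :+ x :* y :* (z :* (z :* z)) :+ x :* (y :* y) :* (z :* (z :* z)) :- (con 2 :* con 0 :+ con 0 :+ con 0)) refl _ _ _))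

  -- For x - 1 ≥ 2M³ the quadratic term x(x - 1)/M² in `pw-decay` is at least 2Mx.
  threshold : ℕ
  threshold = suc (2 * (M * M * M))

  pw-negligible : ∀ x → threshold ≤ x → ι x ⊗ (ι M ⊗ pw x) ≼ 1#
  pw-negligible x hx = (linear′ 1 ((pw-decay x) ⊞ 2 ⊠ (0≼pw x) ⊞ 2 ⊠ (0≼⊗ (0≼pw x) (0≼⊗ (0≼ι x) s≥0)) ⊞ (0≼⊗ (0≼⊗ (0≼⊗ (0≼pw x) (0≼ι x)) (0≼⊗ s≥0 s≥0)) (0≼⊖ 2M³≤)) ⊞ 2 ⊠ (≼-reflexive (sym ((pw x ⊗ ι x ⊗ ι M ⊗ (ι M ⊗ inv M ⊕ 1#)) ⊠≡ inv-inverse 1≤M)))) (solve 4 (λ x y z u → con 2 :* (one :- x :* (y :* z)) := con 2 :+ con 2 :* z :+ con 2 :* (z :* (x :* u)) :+ z :* x :* (u :* u) :* (x :- one :- con 2 :* (y :* y :* y)) :+ con 2 :* (z :* x :* y :* (y :* u :+ one) :* (y :* u)) :- (z :* (con 2 :+ con 2 :* x :* u :+ x :* (x :- one) :* (u :* u)) :+ con 2 :* con 0 :+ con 2 :* con 0 :+ con 0 :+ con 2 :* (z :* x :* y :* (y :* u :+ one) :* one))) refl _ _ _ _))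
    where
    2M³≤ : ι 2 ⊗ (ι M ⊗ ι M ⊗ ι M) ≼ ι x ⊖ 1#
    2M³≤ = (linear ((ι-mono hx) ⊞ ≼-reflexive (sym (ι-* 2 (M * M * M))) ⊞ ≼-reflexive (sym (ι 2 ⊠≡ ι-* (M * M) M)) ⊞ ≼-reflexive (sym ((ι 2 ⊗ ι M) ⊠≡ ι-* M M))) (solve 5 (λ x y z u v → x :- one :- con 2 :* (y :* y :* y) := x :+ z :+ con 2 :* u :+ con 2 :* y :* v :- (one :+ z :+ con 2 :* u :+ con 2 :* (v :* y) :+ con 2 :* y :* (y :* y))) refl _ _ _ _ _))

-- Real characters and the boundedness of Σ χ(n)Λ(n)/n

square-step : ∀ j → j * j < suc j * suc j
square-step j = ℕ.*-mono-< (ℕ.n<1+n j) (ℕ.n<1+n j)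

*-self-injective : ∀ m n → m * m ≡ n * n → m ≡ n
*-self-injective m n e with ℕ.<-cmp m n
... | tri< a _ _ = ⊥-elim (ℕ.<⇒≢ (ℕ.*-mono-< a a) e)
... | tri≈ _ b _ = b
... | tri> _ _ c = ⊥-elim (ℕ.<⇒≢ (ℕ.*-mono-< c c) (sym e))

*-interchange : ∀ a b c d → (a * b) * (c * d) ≡ (a * c) * (b * d)
*-interchange a b c d = trans (ℕ.*-assoc a b (c * d)) (trans (cong (a *_) (trans (sym (ℕ.*-assoc b c d))
  (trans (cong (_* d) (ℕ.*-comm b c)) (ℕ.*-assoc c b d)))) (sym (ℕ.*-assoc a c (b * d))))

-- `χ-partial` is all that is kept of periodicity and of χ being nonprincipal.
record RealCharacter (q : ℕ) : Set where
  field
    χ : ℕ → K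
    χ-* : ∀ a b → χ (a * b) ≡ χ a ⊗ χ b
    χ-Bd : ∀ n → Bd (χ n) 1#
    χ-1 : χ 1 ≡ 1#
    χ-sq : ∀ n → Coprime n q → χ n ⊗ χ n ≡ 1#
    χ-partial : ∀ t → Bd (S t χ) (ι q)

-- The Lambert series Σ (1 ⋆ χ)(n) tⁿ at a fixed t = 1 − 1/M bounds the partial sums of L(1,χ) from below.
module Nonvanishing {X : ℕ} (lg : Log X) (q : ℕ) (hq : 1 ≤ q) (rc : RealCharacter q) where
  open Selberg lg public
  open RealCharacter rc public

  g : ℕ → K
  g = 𝟏 ⋆ χ

  κΛ : ℕ → K
  κΛ n = Λ n ⊕ χ n ⊗ Λ n

  0≼κΛ : ∀ n → 0# ≼ κΛ n
  0≼κΛ n = (linear ((⊗-monoʳ (0≼Λ n) (proj₁ (χ-Bd n)))) (solve 2 (λ x y → x :+ y :* x :- con 0 := y :* x :- (:- one) :* x) refl _ _))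

  χℓ : (λ n → χ n ⊗ ℓ n) ≐ (λ n → χ n ⊗ Λ n) ⋆ χ
  χℓ n hn = trans (cong (χ n ⊗_) (Λ⋆𝟏 n)) (trans (sym (S-⊗ˡ n _ _)) (S-cong n λ d _ _ → trans (sym (S-⊗ˡ n _ _)) (S-cong n λ m _ _ →
    trans (⊗-left _ _ _) (𝟙-guard (d * m ≟ n) λ e → trans (cong (_⊗ (Λ d ⊗ 𝟏 m)) (trans (cong χ (sym e)) (χ-* d m))) (regroup _ _ _)))))
    where
    regroup : ∀ a b c → (a ⊗ b) ⊗ (c ⊗ 1#) ≡ a ⊗ c ⊗ b
    regroup a b c = (solve 3 (λ x y z → x :* y :* (z :* one) := x :* z :* y) refl _ _ _)

  -- The derivation rule with 𝟏ℓ = Λ ⋆ 𝟏 and χℓ = χΛ ⋆ χ. In terms of Dirichlet series, κΛ belongs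
  -- to the negative logarithmic derivative of ζ(s)L(s,χ).
  gℓ : (λ n → g n ⊗ ℓ n) ≐ κΛ ⋆ g
  gℓ n hn = trans (⋆-derivation ℓ ℓ-* 𝟏 χ n) (trans (cong₂ _⊕_
      (trans (⋆-≐ˡ χ 𝟏ℓ n hn) (⋆-assoc Λ 𝟏 χ n))
      (trans (⋆-≐ʳ 𝟏 χℓ n hn) (trans (sym (⋆-assoc 𝟏 _ χ n)) (trans (⋆-≐ˡ χ (λ m _ → ⋆-comm 𝟏 _ m) n hn) (⋆-assoc _ 𝟏 χ n)))))
    (sym (⋆-⊕ˡ Λ _ g n)))

  g-1 : g 1 ≡ 1#
  g-1 = trans (cong₂ (λ a b → 0# ⊕ (0# ⊕ a ⊗ (1# ⊗ b))) (𝟙-yes (1 * 1 ≟ 1) refl) χ-1) (solve 0 (con 0 :+ (con 0 :+ one :* (one :* one)) := one) refl)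

  κΛ-1 : κΛ 1 ≡ 0#
  κΛ-1 = trans (cong (λ z → z ⊕ χ 1 ⊗ z) Λ-1) (solve 1 (λ x → con 0 :+ x :* con 0 := con 0) refl _)

  -- g ℓ = κΛ ⋆ g with κΛ ≥ 0 gives g ≥ 0, and g ≥ 1 at squares, without factoring the argument.
  0≼g : ∀ n → 1 ≤ n → n ≤ X → 0# ≼ g n
  0≼g = <-rec _ go
    where
    go : ∀ n → (∀ {m} → m < n → 1 ≤ m → m ≤ X → 0# ≼ g m) → 1 ≤ n → n ≤ X → 0# ≼ g n
    go (suc zero) rec _ _ = ≼-trans 0≼1 (≼-reflexive (sym g-1))
    go n@(suc (suc _)) rec hn hX = ⊗-cancel (1≼8ℓ n (s≤s (s≤s z≤n)) hX) (≼-trans ((linear (0 ⊠ 0≼1) (solve 1 (λ x → con 8 :* con 0 :- con 8 :* x :* con 0 := con 0 :* one :- con 0 :* con 0) refl _)))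
        (≼-trans (8 ⊠ sum≥0) (≼-reflexive (trans (cong (ι 8 ⊗_) (sym (gℓ n hn))) (rearrange _ _ _)))))
      where
      rearrange : ∀ a b c → a ⊗ (b ⊗ c) ≡ a ⊗ c ⊗ b
      rearrange a b c = (solve 3 (λ x y z → x :* (y :* z) := x :* z :* y) refl _ _ _)

      term : ∀ d m → 1 ≤ d → 1 ≤ m → 0# ≼ 𝟙 (d * m ≟ n) ⊗ (κΛ d ⊗ g m)
      term (suc zero) m _ _ = ≼-reflexive (sym (trans (cong (λ z → 𝟙 (1 * m ≟ n) ⊗ (z ⊗ g m)) κΛ-1) (solve 2 (λ x y → x :* (con 0 :* y) := con 0) refl _ _)))
      term d@(suc (suc _)) m _ hm = ≼-trans (≼-reflexive (sym (⊗-zeroʳ (𝟙 (d * m ≟ n))))) (𝟙-guard-≼ (d * m ≟ n) λ e →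
        0≼⊗ (0≼κΛ d) (rec (subst (m <_) e m<dm) hm (ℕ.≤-trans (ℕ.<⇒≤ (subst (m <_) e m<dm)) hX)))
        where
        m<dm : m < d * m
        m<dm = subst (_< d * m) (ℕ.*-identityˡ m) (ℕ.*-monoˡ-< m {{>-nonZero hm}} {1} {d} (s≤s (s≤s z≤n)))

      sum≥0 : 0# ≼ (κΛ ⋆ g) n
      sum≥0 = 0≼S n λ d hd _ → 0≼S n λ m hm _ → term d m hd hm

  -- ℓ(m²) = 2ℓ(m) is the sum of 2Λ(e) over ef = m. Here χ(e²) = 1 and Λ(e) ≤ Λ(e²) give 2Λ(e) ≤
  -- κΛ(e²), and g(f²) ≥ 1 by induction when e > 1. So ℓ(m²) is at most the part of (κΛ ⋆ g)(m²)
  -- carried by pairs of squares, hence at most g(m²)ℓ(m²).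
  g-square : ∀ m → 1 ≤ m → m * m ≤ X → Coprime m q → 1# ≼ g (m * m)
  g-square = <-rec _ go
    where
    go : ∀ m → (∀ {k} → k < m → 1 ≤ k → k * k ≤ X → Coprime k q → 1# ≼ g (k * k)) → 1 ≤ m → m * m ≤ X → Coprime m q → 1# ≼ g (m * m)
    go (suc zero) rec _ _ _ = ≼-reflexive (sym g-1)
    go m@(suc (suc _)) rec hm hX co = ⊗-cancel (1≼8ℓ (m * m) 2≤m² hX) (≼-trans (≼-reflexive (⊗-identityʳ _))
        (≼-trans (8 ⊠ ℓ≤gℓ) (≼-reflexive (rearrange _ _ _))))
      where
      rearrange : ∀ a b c → a ⊗ (b ⊗ c) ≡ a ⊗ c ⊗ b
      rearrange a b c = (solve 3 (λ x y z → x :* (y :* z) := x :* z :* y) refl _ _ _)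

      2≤m² : 2 ≤ m * m
      2≤m² = ℕ.≤-trans (s≤s (s≤s z≤n)) (≤*ˡ m {m} (s≤s z≤n))

      F : ℕ → ℕ → K
      F d k = 𝟙 (d * k ≟ m * m) ⊗ (κΛ d ⊗ g k)

      0≼F : ∀ d k → 1 ≤ d → 1 ≤ k → 0# ≼ F d k
      0≼F d k hd hk = ≼-trans (≼-reflexive (sym (⊗-zeroʳ (𝟙 (d * k ≟ m * m))))) (𝟙-guard-≼ (d * k ≟ m * m) λ e →
        0≼⊗ (0≼κΛ d) (0≼g k hk (ℕ.≤-trans (subst (k ≤_) e (≤*ʳ k hd)) hX)))

      square-term : ∀ e f → 1 ≤ e → 1 ≤ f → 𝟙 (e * f ≟ m) ⊗ (ι 2 ⊗ Λ e) ≼ F (e * e) (f * f)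
      square-term e f he hf = ≼-trans (𝟙-guard-≼ (e * f ≟ m) (inner e f he hf)) (≼-reflexive (cong (_⊗ (κΛ (e * e) ⊗ g (f * f)))
        (𝟙-cong (e * f ≟ m) (e * e * (f * f) ≟ m * m) (λ e₁ → trans (*-interchange e e f f) (cong₂ _*_ e₁ e₁))
          λ e₂ → *-self-injective (e * f) m (trans (*-interchange e f e f) e₂))))
        where
        inner : ∀ e f → 1 ≤ e → 1 ≤ f → e * f ≡ m → ι 2 ⊗ Λ e ≼ κΛ (e * e) ⊗ g (f * f)
        inner (suc zero) f _ _ _ = ≼-reflexive (trans (cong (ι 2 ⊗_) Λ-1) (trans (solve 1 (λ x → con 2 :* con 0 := con 0 :* x) refl _) (cong (_⊗ g (f * f)) (sym κΛ-1))))
        inner e@(suc (suc _)) f he hf ef = ≼-trans ((linear ((2 ⊠ Λ-sq e he)) (solve 2 (λ x y → con 2 :* x :* one :- con 2 :* y := con 2 :* x :- con 2 :* y) refl _ _))) (≼-trans (⊗-monoˡ (0≼⊗ (0≼ι 2) (0≼Λ (e * e)))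
            (rec f<m hf (ℕ.≤-trans (ℕ.<⇒≤ (ℕ.*-mono-< f<m f<m)) hX) (coprime-*⁻ʳ {e} {f} (subst (λ z → Coprime z q) (sym ef) co))))
          (≼-reflexive (cong (_⊗ g (f * f)) (sym (trans (cong (λ z → Λ (e * e) ⊕ z ⊗ Λ (e * e)) (trans (χ-* e e) (χ-sq e (coprime-*⁻ˡ {e} {f} (subst (λ z → Coprime z q) (sym ef) co))))) (solve 1 (λ x → x :+ one :* x := con 2 :* x) refl _))))))
          where
          f<m : f < m
          f<m = subst (f <_) ef (subst (_< e * f) (ℕ.*-identityˡ f) (ℕ.*-monoˡ-< f {{>-nonZero hf}} {1} {e} (s≤s (s≤s z≤n))))

      ℓ≤gℓ : ℓ (m * m) ≼ g (m * m) ⊗ ℓ (m * m)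
      ℓ≤gℓ = ≼-trans (≼-reflexive (trans (ℓ-* m m hm hm) (trans (two _) (trans (cong (ι 2 ⊗_) (Λ⋆𝟏 m)) (trans (sym (S-⊗ˡ m _ _)) (S-cong m λ e _ _ → trans (sym (S-⊗ˡ m _ _)) (S-cong m λ f _ _ → shuffle _ _)))))))
        (≼-trans (S-mono m λ e he _ → ≼-trans (S-mono m λ f hf _ → square-term e f he hf)
            (S-sub m (λ f → f * f) (F (e * e)) square-step λ k hk → 0≼F (e * e) k (1≤* he he) hk))
        (≼-trans (S-sub m (λ e → e * e) (λ d → S (m * m) (F d)) square-step λ d hd → 0≼S (m * m) λ k hk _ → 0≼F d k hd hk)
          (≼-reflexive (sym (gℓ (m * m) (1≤* hm hm))))))
        where
        two : ∀ z → z ⊕ z ≡ ι 2 ⊗ z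
        two z = (solve 1 (λ x → x :+ x := con 2 :* x) refl _)

        shuffle : ∀ a b → ι 2 ⊗ (a ⊗ (b ⊗ 1#)) ≡ a ⊗ (ι 2 ⊗ b)
        shuffle a b = (solve 2 (λ x y → con 2 :* (x :* (y :* one)) := x :* (con 2 :* y)) refl _ _)

-- Squares of numbers congruent to 1 mod q, which are prime to q, as `g-square` requires.
node : ℕ → ℕ → ℕ
node q j = (1 + j * q) * (1 + j * q)

-- Each node contributes at least 1/2, so these give q + 2. In `M·Lχ-lower` q is lost to the sum of
-- χb and 1 to the tail, and 1 remains.
nodes : ℕ → ℕ
nodes q = 2 * q + 4

-- Chosen so that tⁿ ≥ 1/2 at the squares node q j with j ≤ nodes q, for t = 1 − 1 / scale q.
scale : ℕ → ℕ
scale q = 2 * node q (nodes q)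

-- The first summand comes from `Vχ-large`; the second covers x below the threshold by the trivial
-- bound ℓ(x) + 8 ≤ x + 8.
characterBound : ℕ → ℕ
characterBound q = scale q * (18 * q) + (suc (2 * (scale q * scale q * scale q)) + 8)

module CharacterSum {X : ℕ} (lg : Log X) (q : ℕ) (hq : 1 ≤ q) (rc : RealCharacter q) where
  open Nonvanishing lg q hq rc public

  M : ℕ
  M = scale q

  2≤M : 2 ≤ M
  2≤M = ≤*ˡ 2 {node q (nodes q)} (s≤s z≤n)

  open Geometric M 2≤M public

  Lχ : ℕ → K
  Lχ x = S x λ n → χ n ⊗ inv n

  node-mono : ∀ {j k} → j ≤ k → node q j ≤ node q k
  node-mono h = ℕ.*-mono-≤ (s≤s (ℕ.*-monoˡ-≤ q h)) (s≤s (ℕ.*-monoˡ-≤ q h))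

  node-< : ∀ j → node q j < node q (suc j)
  node-< j = ℕ.*-mono-< lt lt
    where
    lt : 1 + j * q < 1 + suc j * q
    lt = s≤s (ℕ.m<n+m (j * q) hq)

  node-coprime : ∀ j → Coprime (1 + j * q) q
  node-coprime j {d} (a , b) = ∣1⇒≡1 (∣m+n∣m⇒∣n (subst (d ∣_) (ℕ.+-comm 1 (j * q)) a) (∣n⇒∣m*n j b))

  M≤threshold : M ≤ threshold
  M≤threshold = ℕ.m≤n⇒m≤1+n (ℕ.≤-trans (≤*ˡ M {M} 1≤M) (ℕ.≤-trans (≤*ˡ (M * M) {M} 1≤M) (≤*ʳ (M * M * M) {2} (s≤s z≤n))))
    where
    1≤M : 1 ≤ M
    1≤M = ℕ.≤-trans (s≤s z≤n) 2≤M

  pw·g-lower : ∀ x → threshold ≤ x → x ≤ X → ι q ⊕ ι 2 ≼ S x (λ n → pw n ⊗ g n)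
  pw·g-lower x hx hX = linear-2 (≼-trans (≼-reflexive count) (≼-trans (S-mono J λ j _ hj → half j hj)
      (≼-trans (≼-reflexive (S-⊗ˡ J (ι 2) _)) (2 ⊠ ≼-trans (S-sub J (node q) f node-< 0≼f)
        (≼-trans (S-mono-range f node≤x λ n hn _ → 0≼f n (ℕ.≤-trans (s≤s z≤n) hn)) (≼-reflexive (S-restrict {x} {x} (λ n → pw n ⊗ g n) ℕ.≤-refl)))))))
    where
    J = nodes q

    f : ℕ → K
    f n = 𝟙 (n ≤? x) ⊗ (pw n ⊗ g n)

    0≼f : ∀ n → 1 ≤ n → 0# ≼ f n
    0≼f n hn = ≼-trans (≼-reflexive (sym (⊗-zeroʳ (𝟙 (n ≤? x))))) (𝟙-guard-≼ (n ≤? x) λ l → 0≼⊗ (0≼pw n) (0≼g n hn (ℕ.≤-trans l hX)))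

    node≤x : node q J ≤ x
    node≤x = ℕ.≤-trans (≤*ʳ (node q J) {2} (s≤s z≤n)) (ℕ.≤-trans M≤threshold hx)

    count : ι 2 ⊗ (ι q ⊕ ι 2) ≡ S J (λ _ → 1#)
    count = sym (trans (S-const J 1#) (trans (⊗-identityʳ _) (trans (ι-+ (2 * q) 4) (trans (cong (_⊕ ι 4) (ι-* 2 q)) (solve 1 (λ x → con 2 :* x :+ con 4 := con 2 :* (x :+ con 2)) refl _)))))

    half : ∀ j → j ≤ J → 1# ≼ ι 2 ⊗ f (node q j)
    half j hj = ≼-trans ((linear ((2 ⊠ bernoulli (node q j)) ⊞ small) (solve 3 (λ x y z → con 2 :* x :- one := con 2 :* x :+ one :- (con 2 :* (one :- y :* z) :+ con 2 :* y :* z)) refl _ _ _))) (2 ⊠ ≼-trans (≼-reflexive (sym (⊗-identityʳ _)))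
        (≼-trans (⊗-monoˡ (0≼pw (node q j)) (g-square (1 + j * q) (s≤s z≤n) (ℕ.≤-trans (node-mono hj) (ℕ.≤-trans node≤x hX)) (node-coprime j)))
        (≼-reflexive (sym (trans (cong (_⊗ (pw (node q j) ⊗ g (node q j))) (𝟙-yes (node q j ≤? x) (ℕ.≤-trans (node-mono hj) node≤x))) (⊗-identityˡ _))))))
      where
      small : ι 2 ⊗ ι (node q j) ⊗ inv M ≼ 1#
      small = ≼-trans (⊗-monoʳ s≥0 (≼-trans (≼-reflexive (sym (ι-* 2 (node q j)))) (ι-mono (ℕ.*-monoʳ-≤ 2 (node-mono hj)))))
        (≼-reflexive (inv-inverse {M} (ℕ.≤-trans (s≤s z≤n) 2≤M)))

    linear-2 : ∀ {a b} → ι 2 ⊗ a ≼ ι 2 ⊗ b → a ≼ b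
    linear-2 h = (linear′ 1 (h) (solve 2 (λ x y → con 2 :* (x :- y) := con 2 :* x :- con 2 :* y) refl _ _))

  -- Split M/n = b(n) + h(n). As b decreases from at most 1, the sum of χb is at least -q. Expanding
  -- h into geometric series turns the sum of χh into Σ tⁿg(n) ≥ q + 2 plus a tail bounded by 1.
  M·Lχ-lower : ∀ x → threshold ≤ x → x ≤ X → 1# ≼ ι M ⊗ Lχ x
  M·Lχ-lower x hx hX = (linear ((pw·g-lower x hx hX) ⊞ (proj₁ χb) ⊞ ≼-reflexive (sym split) ⊞ ≼-reflexive (sym χh) ⊞ (proj₁ tail)) (solve 7 (λ x y z u v w a → x :* y :- one := z :+ u :+ x :* y :+ v :+ w :- (a :+ con 2 :+ (:- a) :+ (u :+ v) :+ (z :+ w) :+ (:- one))) refl _ _ _ _ _ _ _))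
    where
    χb : Bd (S x (λ n → χ n ⊗ b n)) (ι q)
    χb = Bd-weaken (≼-trans (⊗-monoˡ (0≼ι q) b-1) (≼-reflexive (⊗-identityʳ _)))
      (S-abel-dec x χ b b (ι q) (0≼ι q) (λ t _ → χ-partial t) (λ n hn _ → Bd-pos (0≼⊖ (b-decreasing n hn)) ≼-refl)
        (λ n hn _ → Bd-pos (0≼b n hn) ≼-refl) (0≼b 1 ℕ.≤-refl))

    split : ι M ⊗ Lχ x ≡ S x (λ n → χ n ⊗ b n) ⊕ S x (λ n → χ n ⊗ h n)
    split = trans (sym (S-⊗ˡ x _ _)) (trans (S-cong x λ n _ _ → trans (⊗-left _ _ _) (trans (cong (χ n ⊗_) (sym (b+h n))) (⊗-distribˡ-⊕ _ _ _))) (S-⊕ x _ _))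

    rest : ℕ → K
    rest d = χ d ⊗ (pw (d * (x div d)) ⊗ h d)

    χh : S x (λ n → χ n ⊗ h n) ≡ S x (λ n → pw n ⊗ g n) ⊕ S x rest
    χh = trans (S-cong x λ d hd _ → trans (cong (χ d ⊗_) (sym (geometric-sum d (x div d) hd))) (⊗-distribˡ-⊕ _ _ _)) (trans (S-⊕ x _ _)
      (cong (_⊕ S x rest) (trans (S-cong x λ d _ _ → sym (S-⊗ˡ (x div d) (χ d) _)) (trans (sym (D-div x _))
        (trans (D-cong x λ d m _ _ _ → trans (⊗-comm _ _) (cong (pw (d * m) ⊗_) (sym (⊗-identityʳ _)))) (trans (sym (S-⋆ x pw χ 𝟏))
          (S-cong x λ n _ _ → cong (pw n ⊗_) (⋆-comm χ 𝟏 n))))))))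

    tail : Bd (S x rest) 1#
    tail = Bd-weaken (≼-trans (≼-reflexive (S-const x _)) (pw-negligible x hx)) (S-Bd x λ d hd _ →
      Bd-weaken (≼-trans (≼-reflexive (⊗-identityˡ _)) (pw·h d hd)) (Bd-⊗ (χ-Bd d) (Bd-pos (0≼⊗ (0≼pw (d * (x div d))) (0≼h d hd)) ≼-refl)))
      where
      -- The remainder of each geometric series starts beyond x, as d⌊x/d⌋ + d ≥ x.
      pw·h : ∀ d → 1 ≤ d → pw (d * (x div d)) ⊗ h d ≼ ι M ⊗ pw x
      pw·h d hd = ≼-trans (≼-reflexive (regroup _ _ _ _)) (⊗-monoˡ (0≼ι M) (≼-trans (⊗-monoˡ (0≼⊗ (0≼pw (d * (x div d))) (0≼pw d)) (Gi≼1 d hd))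
          (≼-trans (≼-reflexive (trans (⊗-identityʳ _) (sym (pw-+ (d * (x div d)) d)))) (pw-anti x≤))))
        where
        regroup : ∀ p m r k → p ⊗ (m ⊗ (r ⊗ k)) ≡ m ⊗ (p ⊗ r ⊗ k)
        regroup p m r k = (solve 4 (λ x y z u → x :* (y :* (z :* u)) := y :* (x :* z :* u)) refl _ _ _ _)

        x≤ : x ≤ d * (x div d) + d
        x≤ = subst (x ≤_) (trans (ℕ.*-suc d (x div d)) (ℕ.+-comm d (d * (x div d)))) (ℕ.<⇒≤ (ℕ.≰⇒> λ z → ℕ.<⇒≱ (ℕ.n<1+n (x div d)) (⇒≤div x d hd z)))

  -- Sums of χ over any window are at most 2q, and the first term after ⌊x/d⌋ is at most d/x.
  Lχ-difference : ∀ x d → 1 ≤ d → d ≤ x → Bd (Lχ x ⊖ Lχ (x div d)) (ι 2 ⊗ ι q ⊗ (ι d ⊗ inv x))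
  Lχ-difference x d hd hdx = Bd-≡ (trans (cong (_⊖ Lχ y) (trans (cong Lχ (sym (ℕ.m+[n∸m]≡n (div≤ x d)))) (S-split y (x ∸ y) _))) (cancel _ _))
    (Bd-weaken (⊗-monoˡ (0≼⊗ (0≼ι 2) (0≼ι q)) inv≤)
      (S-abel-dec (x ∸ y) (λ n → χ (y + n)) (λ n → inv (y + n)) (λ n → inv (y + n)) (ι 2 ⊗ ι q) (0≼⊗ (0≼ι 2) (0≼ι q)) (λ t _ → window t)
        (λ n hn _ → Bd-pos (0≼⊖ (inv-anti (ℕ.≤-trans hn (ℕ.m≤n+m n y)) (ℕ.+-monoʳ-≤ y (ℕ.n≤1+n n)))) ≼-refl)
        (λ n hn _ → Bd-pos (0≼inv (ℕ.≤-trans hn (ℕ.m≤n+m n y))) ≼-refl) (0≼inv (ℕ.m≤n+m 1 y))))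
    where
    y = x div d

    cancel : ∀ a b → a ⊕ b ⊖ a ≡ b
    cancel a b = (solve 2 (λ x y → x :+ y :- x := y) refl _ _)

    window : ∀ t → Bd (S t (λ n → χ (y + n))) (ι 2 ⊗ ι q)
    window t = Bd-≡ (trans (sym (cancel (S y χ) _)) (cong (_⊖ S y χ) (sym (S-split y t χ)))) (Bd-weaken (≼-reflexive (two (ι q))) (Bd-⊖ (χ-partial (y + t)) (χ-partial y)))
      where
      two : ∀ z → z ⊕ z ≡ ι 2 ⊗ z
      two z = (solve 1 (λ x → x :+ x := con 2 :* x) refl _)

    inv≤ : inv (y + 1) ≼ ι d ⊗ inv x
    inv≤ = ≼-trans (≼-reflexive (trans (sym (⊗-identityˡ _)) (trans (cong (_⊗ inv (y + 1)) (sym (inv-inverse hd))) (trans (⊗-assoc _ _ _) (cong (ι d ⊗_) (sym (inv-* hd (ℕ.m≤n+m 1 y))))))))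
      (⊗-monoˡ (0≼ι d) (inv-anti (ℕ.≤-trans hd hdx) (subst (λ z → x ≤ d * z) (ℕ.+-comm 1 y) (ℕ.<⇒≤ (ℕ.≰⇒> λ z → ℕ.<⇒≱ (ℕ.n<1+n (x div d)) (⇒≤div x d hd z))))))

  -- Σ χ(n)ℓ(n)/n = Σ χ(d)u(d) Lχ(x/d) is at most 2q by `abel₁`. Replacing Lχ(x/d) by Lχ(x) costs Σ
  -- u(d) · 2qd/x = 2qψ(x)/x ≤ 16q. So Lχ(x)Vχ(x) is bounded by 18q, and M Lχ(x) ≥ 1 can be
  -- cancelled.
  Vχ-large : ∀ x → threshold ≤ x → x ≤ X → Bd (V χ x) (ι M ⊗ (ι 18 ⊗ ι q))
  Vχ-large x hx hX = cancelᵇ (M·Lχ-lower x hx hX) (0≼⊗ (0≼ι M) (0≼⊗ (0≼ι 18) (0≼ι q))) (Bd-≡ (⊗-assoc _ _ _) (Bd-scale (0≼ι M) Lχ·Vχ))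
    where
    1≤x : 1 ≤ x
    1≤x = ℕ.≤-trans (s≤s z≤n) hx

    cancelᵇ : ∀ {c z B} → 1# ≼ c → 0# ≼ B → Bd (c ⊗ z) B → Bd z B
    cancelᵇ {c} {z} {B} h hB (l , r) = ⊗-cancel h ((linear (l ⊞ (mul≼ h hB)) (solve 3 (λ x y z → x :* y :- x :* (:- z) := x :* y :+ (x :- one) :* (z :- con 0) :- (:- z :+ con 0)) refl _ _ _))) , ⊗-cancel h ((linear (r ⊞ (mul≼ h hB)) (solve 3 (λ x y z → x :* y :- x :* z := y :+ (x :- one) :* (y :- con 0) :- (x :* z :+ con 0)) refl _ _ _)))

    f₁-sum : S x (λ n → χ n ⊗ f₁ n) ≡ S x (λ d → χ d ⊗ u d ⊗ Lχ (x div d))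
    f₁-sum = trans (S-cong x λ n _ _ → trans (cong (λ z → χ n ⊗ (z ⊗ inv n)) (Λ⋆𝟏 n)) (swap₂ _ _ _)) (trans (S-⋆ x (λ n → χ n ⊗ inv n) Λ 𝟏)
      (trans (D-div x _) (S-cong x λ d hd _ → trans (S-cong (x div d) λ m hm _ → trans (cong₂ (λ a b → a ⊗ b ⊗ (Λ d ⊗ 1#)) (χ-* d m) (inv-* hd hm)) (regroup _ _ _ _ _))
        (S-⊗ˡ (x div d) _ _))))
      where
      swap₂ : ∀ a b c → a ⊗ (b ⊗ c) ≡ a ⊗ c ⊗ b
      swap₂ a b c = (solve 3 (λ x y z → x :* (y :* z) := x :* z :* y) refl _ _ _)

      regroup : ∀ a b c d e → a ⊗ b ⊗ (c ⊗ d) ⊗ (e ⊗ 1#) ≡ a ⊗ (e ⊗ c) ⊗ (b ⊗ d)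
      regroup a b c d e = (solve 5 (λ x y z u v → x :* y :* (z :* u) :* (v :* one) := x :* (v :* z) :* (y :* u)) refl _ _ _ _ _)

    error : Bd (S x (λ d → χ d ⊗ u d ⊗ (Lχ x ⊖ Lχ (x div d)))) (ι 16 ⊗ ι q)
    error = Bd-weaken total (S-Bd x λ d hd hdx → Bd-weaken (≼-reflexive (clear d hd)) (Bd-⊗ (Bd-⊗ (χ-Bd d) (Bd-pos (0≼u d hd) ≼-refl)) (Lχ-difference x d hd hdx)))
      where
      clear : ∀ d → 1 ≤ d → 1# ⊗ u d ⊗ (ι 2 ⊗ ι q ⊗ (ι d ⊗ inv x)) ≡ ι 2 ⊗ ι q ⊗ inv x ⊗ Λ d
      clear d hd = (linear-≡ ((Λ d ⊗ ι 2 ⊗ ι q ⊗ inv x) ⊠≡ inv-inverse hd) (solve 5 (λ x y z u v → con 2 :* x :* y :* z :- one :* (z :* u) :* (con 2 :* x :* (v :* y)) := z :* con 2 :* x :* y :* one :- z :* con 2 :* x :* y :* (v :* u)) refl _ _ _ _ _))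

      total : S x (λ d → ι 2 ⊗ ι q ⊗ inv x ⊗ Λ d) ≼ ι 16 ⊗ ι q
      total = ≼-trans (≼-reflexive (S-⊗ˡ x _ Λ)) (≼-trans (⊗-monoˡ (0≼⊗ (0≼⊗ (0≼ι 2) (0≼ι q)) (0≼inv 1≤x)) (ψ-bound x hX))
        (≼-reflexive ((linear-≡ ((ι 16 ⊗ ι q) ⊠≡ inv-inverse 1≤x) (solve 3 (λ x y z → con 16 :* x :- con 2 :* x :* y :* (con 8 :* z) := con 16 :* x :* one :- con 16 :* x :* (z :* y)) refl _ _ _)))))

    Lχ·Vχ : Bd (Lχ x ⊗ V χ x) (ι 18 ⊗ ι q)
    Lχ·Vχ = Bd-≡ (trans expand (cong (_⊕ S x (λ d → χ d ⊗ u d ⊗ (Lχ x ⊖ Lχ (x div d)))) (sym f₁-sum)))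
      (Bd-weaken (≼-reflexive (solve 1 (λ x → x :* con 2 :+ con 16 :* x := con 18 :* x) refl _)) (Bd-⊕ (abel₁ x χ (ι q) hX (0≼ι q) λ t _ → χ-partial t) error))
      where
      expand : Lχ x ⊗ V χ x ≡ S x (λ d → χ d ⊗ u d ⊗ Lχ (x div d)) ⊕ S x (λ d → χ d ⊗ u d ⊗ (Lχ x ⊖ Lχ (x div d)))
      expand = trans (sym (S-⊗ˡ x (Lχ x) _)) (trans (S-cong x λ d _ _ → split _ _ _) (S-⊕ x _ _))
        where
        split : ∀ a b c → a ⊗ b ≡ b ⊗ c ⊕ b ⊗ (a ⊖ c)
        split a b c = (solve 3 (λ x y z → x :* y := y :* z :+ y :* (x :- z)) refl _ _ _)

  Vχ-Bd : ∀ x → x ≤ X → Bd (V χ x) (ι (characterBound q))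
  Vχ-Bd zero _ = Bd-0 (0≼ι (characterBound q))
  Vχ-Bd x@(suc _) hX = Bd-weaken (≼-reflexive (sym (trans (ι-+ (M * (18 * q)) (threshold + 8)) (cong₂ _⊕_ (trans (ι-* M (18 * q)) (cong (ι M ⊗_) (ι-* 18 q))) (ι-+ threshold 8)))))
      (cases (threshold ≤? x))
    where
    nn : 0# ≼ ι M ⊗ (ι 18 ⊗ ι q)
    nn = 0≼⊗ (0≼ι M) (0≼⊗ (0≼ι 18) (0≼ι q))

    cases : Dec (threshold ≤ x) → Bd (V χ x) (ι M ⊗ (ι 18 ⊗ ι q) ⊕ (ι threshold ⊕ ι 8))
    cases (yes h) = Bd-weaken ((linear ((0≼ι threshold) ⊞ 8 ⊠ 0≼1) (solve 3 (λ x y z → x :* (con 18 :* y) :+ (z :+ con 8) :- x :* (con 18 :* y) := z :+ con 8 :* one :- (con 0 :+ con 8 :* con 0)) refl _ _ _))) (Vχ-large x h hX)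
    cases (no h) = Bd-weaken ((linear ((proj₂ (mertens x (s≤s z≤n) hX)) ⊞ (ℓ≼ι x (s≤s z≤n) hX) ⊞ (ι-mono (ℕ.<⇒≤ (ℕ.≰⇒> h))) ⊞ nn) (solve 8 (λ x y z u v w a b → x :* (con 18 :* y) :+ (z :+ con 8) :- (u :+ v :* w) := a :+ con 8 :+ (one :+ b) :+ z :+ x :* (con 18 :* y) :- (u :+ v :* w :+ a :+ (one :+ b) :+ con 0)) refl _ _ _ _ _ _ _ _)))
      (S-Bd x λ n hn _ → Bd-weaken (≼-reflexive (⊗-identityˡ _)) (Bd-⊗ (χ-Bd n) (Bd-pos (0≼u n hn) ≼-refl)))

-- Dirichlet's theorem

module Residues (q : ℕ) .{{nz : NonZero q}} where
  1≤q : 1 ≤ q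
  1≤q = >-nonZero⁻¹ q

  infix 4 _≈_ _≈?_
  _≈_ : ℕ → ℕ → Set
  m ≈ n = m % q ≡ n % q

  _≈?_ : ∀ m n → Dec (m ≈ n)
  m ≈? n = m % q ≟ n % q

  ≈-* : ∀ {a a′ b b′} → a ≈ a′ → b ≈ b′ → a * b ≈ a′ * b′
  ≈-* {a} {a′} {b} {b′} h k = trans (%-distribˡ-* a b q) (trans (cong₂ (λ x y → (x * y) % q) h k) (sym (%-distribˡ-* a′ b′ q)))

  ≈-*ʳ : ∀ a {b b′} → b ≈ b′ → a * b ≈ a * b′
  ≈-*ʳ a {b} {b′} h = ≈-* {a} {a} {b} {b′} refl h

  ≈-coprime : ∀ {m n} → m ≈ n → Coprime m q → Coprime n q
  ≈-coprime {m} {n} h co {d} (d∣n , d∣q) = co (∣n∣m%n⇒∣m d∣q (subst (d ∣_) (sym h) (%-presˡ-∣ d∣n d∣q)) , d∣q)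

  κ-≈ : ∀ {m n} → m ≈ n → κ q m ≡ κ q n
  κ-≈ {m} {n} h = 𝟙-cong (isCoprime? m q) (isCoprime? n q) (≈-coprime {m} {n} h) (≈-coprime {n} {m} (sym h))

  inverse : ∀ a → Coprime a q → ∃ λ a′ → a * a′ ≈ 1
  inverse a co with Cop.coprime-Bézout co
  ... | Bézout.+- x y eq = x , trans (cong (_% q) (trans (ℕ.*-comm a x) (sym eq))) ([m+kn]%n≡m%n 1 y q)
  -- In this case a x ≡ -1, so (a x)² ≡ 1 and the inverse is x (x a).
  ... | Bézout.-+ x y eq = x * (x * a) , trans (sym ([m+kn]%n≡m%n (a * (x * (x * a))) y q)) (trans (cong (_% q) calc) ([m+kn]%n≡m%n 1 (x * a * y) q))
    where
    z = x * a

    square : a * (x * z) ≡ z * z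
    square = trans (sym (ℕ.*-assoc a x z)) (cong (_* z) (ℕ.*-comm a x))

    calc : a * (x * (x * a)) + y * q ≡ 1 + (x * a * y) * q
    calc = trans (cong₂ _+_ square (sym eq)) (trans (ℕ.+-suc (z * z) z) (cong suc (trans (ℕ.+-comm (z * z) z)
      (trans (sym (ℕ.*-suc z z)) (trans (cong (z *_) eq) (sym (ℕ.*-assoc z y q)))))))

  ≈-cancel : ∀ a {x y} → Coprime a q → a * x ≈ a * y → x ≈ y
  ≈-cancel a {x} {y} co h with inverse a co
  ... | a′ , e = trans (sym (unit x)) (trans (≈-*ʳ a′ {a * x} {a * y} h) (unit y))
    where
    unit : ∀ z → a′ * (a * z) ≈ z
    unit z = trans (cong (_% q) (trans (sym (ℕ.*-assoc a′ a z)) (cong (_* z) (ℕ.*-comm a′ a))))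
      (trans (≈-* {a * a′} {1} {z} {z} e refl) (cong (_% q) (ℕ.*-identityˡ z)))

  -- The representative in 1, ..., q, not 0, ..., q - 1, to match the range of `S q`; this is why q
  -- - 1 is added before reducing.
  rep : ℕ → ℕ
  rep n = suc ((n + pred q) % q)

  rep-≈ : ∀ n → rep n ≈ n
  rep-≈ n = trans (suc-≈ (n + pred q)) (trans (cong (_% q) (trans (sym (ℕ.+-suc n (pred q))) (cong (λ z → n + z) (ℕ.suc-pred q)))) ([m+n]%n≡m%n n q))
    where
    suc-≈ : ∀ m → suc (m % q) ≈ suc m
    suc-≈ m = trans (%-distribˡ-+ 1 (m % q) q) (trans (cong (λ z → (1 % q + z) % q) (m%n%n≡m%n m q)) (sym (%-distribˡ-+ 1 m q)))

  rep≤q : ∀ n → rep n ≤ q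
  rep≤q n = m%n<n (n + pred q) q

  ≈⇒≡ : ∀ {m n} → 1 ≤ m → m ≤ q → 1 ≤ n → n ≤ q → m ≈ n → m ≡ n
  ≈⇒≡ {m} {n} hm hm′ hn hn′ h with m ≟ q | n ≟ q
  ... | yes a | yes b = trans a (sym b)
  ... | no a | no b = trans (sym (m<n⇒m%n≡m (ℕ.≤∧≢⇒< hm′ a))) (trans h (m<n⇒m%n≡m (ℕ.≤∧≢⇒< hn′ b)))
  ... | yes refl | no b = ⊥-elim (ℕ.<⇒≢ hn (sym (trans (sym (m<n⇒m%n≡m (ℕ.≤∧≢⇒< hn′ b))) (trans (sym h) (n%n≡0 q)))))
  ... | no a | yes refl = ⊥-elim (ℕ.<⇒≢ hm (sym (trans (sym (m<n⇒m%n≡m (ℕ.≤∧≢⇒< hm′ a))) (trans h (n%n≡0 q)))))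

  cls : ℕ → ℕ → K
  cls r n = 𝟙 (n ≈? r)

  S-class : ∀ (F : ℕ → K) → (∀ {m n} → m ≈ n → F m ≡ F n) → ∀ n → S q (λ k → F k ⊗ cls k n) ≡ F n
  S-class F hF n = trans (S-pick q (rep n) _ (s≤s z≤n) (rep≤q n) λ k hk hk′ ne → trans (cong (F k ⊗_) (𝟙-no (n ≈? k) λ e →
      ne (≈⇒≡ hk hk′ (s≤s z≤n) (rep≤q n) (trans (sym e) (sym (rep-≈ n)))))) (⊗-zeroʳ _))
    (trans (cong₂ _⊗_ (hF {rep n} {n} (rep-≈ n)) (𝟙-yes (n ≈? rep n) (sym (rep-≈ n)))) (⊗-identityʳ _))

  S-involution : ∀ (σ : ℕ → ℕ) (F : ℕ → K) →
    (∀ x → 1 ≤ x → x ≤ q → Coprime x q → (1 ≤ σ x × σ x ≤ q) × Coprime (σ x) q × σ (σ x) ≡ x) →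
    S q (λ x → κ q x ⊗ F (σ x)) ≡ S q (λ x → κ q x ⊗ F x)
  S-involution σ F hσ = trans (S-cong q λ x h l → 𝟙-guard (isCoprime? x q) λ co → sym (S-𝟙 q (σ x) F (proj₁ (proj₁ (hσ x h l co))) (proj₂ (proj₁ (hσ x h l co)))))
    (trans (S-cong q λ x _ _ → trans (sym (S-⊗ˡ q _ _)) (S-cong q λ y _ _ → sym (⊗-assoc _ _ _))) (trans (S-swap q q _)
    (S-cong q λ y h l → trans (S-⊗ʳ q (F y) _) (cong (_⊗ F y) (inner y h l (isCoprime? y q))))))
    where
    inner : ∀ y → 1 ≤ y → y ≤ q → Dec (Coprime y q) → S q (λ x → κ q x ⊗ 𝟙 (σ x ≟ y)) ≡ κ q y
    inner y h l (yes co) = let ((h′ , l′) , co′ , invol) = hσ y h l co in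
      trans (S-pick q (σ y) _ h′ l′ λ x hx lx ne → trans (𝟙-guard (isCoprime? x q) λ cx → 𝟙-no (σ x ≟ y) λ e →
          ne (trans (sym (proj₂ (proj₂ (hσ x hx lx cx)))) (cong σ e))) (⊗-zeroʳ _))
        (trans (cong₂ _⊗_ (𝟙-yes (isCoprime? (σ y) q) co′) (𝟙-yes (σ (σ y) ≟ y) invol)) (trans (⊗-identityˡ _) (sym (𝟙-yes (isCoprime? y q) co))))
    inner y h l (no nc) = trans (S-zero q λ x hx lx → trans (𝟙-guard (isCoprime? x q) λ cx → 𝟙-no (σ x ≟ y) λ e →
        nc (subst (λ z → Coprime z q) e (proj₁ (proj₂ (hσ x hx lx cx))))) (⊗-zeroʳ _)) (sym (𝟙-no (isCoprime? y q) nc))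

  Periodic : (ℕ → K) → Set
  Periodic h = ∀ {m n} → m ≈ n → h m ≡ h n

  -- Whole periods contribute nothing and can be removed until at most q terms are left.
  periodic-Bd : ∀ (h : ℕ → K) B → Periodic h → S q h ≡ 0# → 0# ≼ B → (∀ n → Bd (h n) B) → ∀ t → Bd (S t h) (ι q ⊗ B)
  periodic-Bd h B per zero-sum hB hBd = <-rec _ go
    where
    go : ∀ t → (∀ {s} → s < t → Bd (S s h) (ι q ⊗ B)) → Bd (S t h) (ι q ⊗ B)
    go t rec with t ≤? q
    ... | yes t≤q = Bd-weaken (≼-trans (≼-reflexive (S-const t B)) (⊗-monoʳ hB (ι-mono t≤q))) (S-Bd t λ n _ _ → hBd n)
    ... | no t≰q = Bd-≡ (trans (cong (λ z → S z h) (sym (ℕ.m+[n∸m]≡n q≤t))) (trans (S-split q (t ∸ q) h) (trans (cong₂ _⊕_ zero-sum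
          (S-cong (t ∸ q) λ n _ _ → per {q + n} {n} (trans (cong (_% q) (ℕ.+-comm q n)) ([m+n]%n≡m%n n q)))) (⊕-identityˡ _))))
        (rec (ℕ.∸-monoʳ-< 1≤q q≤t))
      where
      q≤t : q ≤ t
      q≤t = ℕ.<⇒≤ (ℕ.≰⇒> t≰q)

  N : K
  N = S q (κ q)

  1≼N : 1# ≼ N
  1≼N = ≼-trans (≼-reflexive (sym (𝟙-yes (isCoprime? 1 q) (coprime-1 q)))) (S-term q (κ q) 1 ℕ.≤-refl 1≤q λ n _ → 0≼𝟙 (isCoprime? n q))

  solution : ∀ d r → Coprime d q → ∃ λ m → d * m ≈ r
  solution d r co with inverse d co
  ... | d′ , e = d′ * r , trans (cong (_% q) (sym (ℕ.*-assoc d d′ r))) (trans (≈-* {d * d′} {1} {r} {r} e refl) (cong (_% q) (ℕ.*-identityˡ r)))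

  S-cls-dilate : ∀ d r → Coprime d q → S q (λ m → cls r (d * m)) ≡ 1#
  S-cls-dilate d r co = pick (solution d r co)
    where
    pick : (∃ λ m → d * m ≈ r) → S q (λ m → cls r (d * m)) ≡ 1#
    pick (m , e) = trans (S-pick q (rep m) _ (s≤s z≤n) (rep≤q m) λ k hk hk′ ne → 𝟙-no (d * k ≈? r) λ e′ →
        ne (≈⇒≡ hk hk′ (s≤s z≤n) (rep≤q m) (≈-cancel d {k} {rep m} co (trans e′ (trans (sym e) (≈-*ʳ d {m} {rep m} (sym (rep-≈ m))))))))
      (𝟙-yes (d * rep m ≈? r) (trans (≈-*ʳ d {rep m} {m} (rep-≈ m)) e))

  cls-κ : ∀ r d n → Coprime r q → cls r (d * n) ≡ κ q d ⊗ cls r (d * n)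
  cls-κ r d n co = sym (𝟙-⊗ (isCoprime? d q) (d * n ≈? r) (d * n ≈? r) (λ _ e → e)
    λ e → coprime-*⁻ˡ {d} {n} (≈-coprime {r} {d * n} (sym e) co) , e)

  -- Over a period κ(em) sums to N and the class indicator to 1 if e is prime to q. Otherwise both
  -- vanish identically, since r is prime to q. This is the balance that `selberg` needs, with the
  -- dilation d of `triple-bound` built in.
  mean-zero : ∀ r d → Coprime r q → Coprime d q → ∀ e → 1 ≤ e → ∀ t → Bd (S t λ m → κ q (e * m) ⊖ N ⊗ cls r (d * (e * m))) (ι q ⊗ N)
  mean-zero r d cr cd e _ = periodic-Bd h N (λ {m} {n} p → cong₂ (λ a b → a ⊖ N ⊗ b) (κ-≈ {e * m} {e * n} (≈-*ʳ e {m} {n} p))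
      (𝟙-cong (d * (e * m) ≈? r) (d * (e * n) ≈? r) (trans (sym (≈-*ʳ d {e * m} {e * n} (≈-*ʳ e {m} {n} p)))) (trans (≈-*ʳ d {e * m} {e * n} (≈-*ʳ e {m} {n} p)))))
      (trans (S-⊖ q _ _) (trans (cong (S q (λ m → κ q (e * m)) ⊖_) (S-⊗ˡ q N _)) (balance (isCoprime? e q)))) (≼-trans 0≼1 1≼N) bounded
    where
    h : ℕ → K
    h m = κ q (e * m) ⊖ N ⊗ cls r (d * (e * m))

    bounded : ∀ n → Bd (h n) N
    bounded n = (linear ((mul≼ (𝟙≼1 (d * (e * n) ≈? r)) (≼-trans 0≼1 1≼N)) ⊞ (0≼𝟙 (isCoprime? (e * n) q))) (solve 3 (λ x y z → x :- y :* z :- (:- y) := (one :- z) :* (y :- con 0) :+ x :- (con 0 :+ con 0)) refl _ _ _)) ,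
      (linear ((0≼⊗ (≼-trans 0≼1 1≼N) (0≼𝟙 (d * (e * n) ≈? r))) ⊞ (𝟙≼1 (isCoprime? (e * n) q)) ⊞ 1≼N) (solve 3 (λ x y z → x :- (y :- x :* z) := x :* z :+ one :+ x :- (con 0 :+ y :+ one)) refl _ _ _))

    balance : Dec (Coprime e q) → S q (λ m → κ q (e * m)) ⊖ N ⊗ S q (λ m → cls r (d * (e * m))) ≡ 0#
    balance (yes ce) = trans (cong₂ (λ a b → a ⊖ N ⊗ b) (S-cong q λ m _ _ → trans (κ-* q e m) (trans (cong (_⊗ κ q m) (𝟙-yes (isCoprime? e q) ce)) (⊗-identityˡ _)))
        (trans (S-cong q λ m _ _ → cong (cls r) (sym (ℕ.*-assoc d e m))) (S-cls-dilate (d * e) r (coprime-* cd ce)))) (cancel N)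
      where
      cancel : ∀ z → z ⊖ z ⊗ 1# ≡ 0#
      cancel z = (solve 1 (λ x → x :- x :* one := con 0) refl _)
    balance (no nc) = trans (cong₂ (λ a b → a ⊖ N ⊗ b) (S-zero q λ m _ _ → trans (κ-* q e m) (trans (cong (_⊗ κ q m) (𝟙-no (isCoprime? e q) nc)) (⊗-zeroˡ _)))
        (S-zero q λ m _ _ → 𝟙-no (d * (e * m) ≈? r) λ p → nc (coprime-*⁻ˡ {e} {m} (coprime-*⁻ʳ {d} {e * m} (≈-coprime {r} {d * (e * m)} (sym p) cr))))) cancel
      where
      cancel : 0# ⊖ N ⊗ 0# ≡ 0#
      cancel = (solve 1 (λ x → con 0 :- x :* con 0 := con 0) refl _)

  S-nonpos : ∀ (f : ℕ → K) → (∀ n → 1 ≤ n → n ≤ q → f n ≼ 0#) → 0# ≼ S q f → ∀ n → 1 ≤ n → n ≤ q → f n ≡ 0#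
  S-nonpos f h s n hn l = ≼-antisym (h n hn l) ((linear (s ⊞ rest) (solve 2 (λ x y → x :- con 0 := y :+ (:- y) :- (con 0 :+ (:- x))) refl _ _)))
    where
    F : ℕ → K
    F m = 𝟙 (m ≤? q) ⊗ neg (f m)

    0≼F : ∀ m → 1 ≤ m → 0# ≼ F m
    0≼F m hm = ≼-trans (≼-reflexive (sym (⊗-zeroʳ (𝟙 (m ≤? q))))) (𝟙-guard-≼ (m ≤? q) λ l → (linear ((h m hm l)) (solve 1 (λ x → :- x :- con 0 := con 0 :- x) refl _)))

    rest : neg (f n) ≼ neg (S q f)
    rest = ≼-trans (≼-reflexive (sym (trans (cong (_⊗ neg (f n)) (𝟙-yes (n ≤? q) l)) (⊗-identityˡ _))))
      (≼-trans (S-term q F n hn l 0≼F) (≼-reflexive (trans (S-restrict {q} {q} (λ m → neg (f m)) ℕ.≤-refl) (S-neg q f))))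

  -- For f a = 1 the involution x ↦ r/(a x) must exchange {f = 1} and {f = −1}. Hence f a f x f y = −1 whenever a x y ≡ r,
  -- which makes f a character up to sign.
  module Coset (r : ℕ) (cr : Coprime r q) (f : ℕ → K) (f-≈ : Periodic f) (f-sign : ∀ n → f n ≡ 1# ⊎ f n ≡ neg 1#)
    (avoid : ∀ a b c → Coprime a q → Coprime b q → Coprime c q → a * b * c ≈ r → f a ≡ 1# → f b ≡ 1# → f c ≡ 1# → ⊥)
    (half : 0# ≼ S q (λ n → κ q n ⊗ f n)) where

    f² : ∀ n → f n ⊗ f n ≡ 1#
    f² n with f n | f-sign n
    ... | _ | inj₁ refl = (solve 0 (one :* one := one) refl)
    ... | _ | inj₂ refl = (solve 0 ((:- one) :* (:- one) := one) refl)

    invF : ∀ a → Dec (Coprime a q) → ℕ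
    invF a (yes co) = proj₁ (inverse a co)
    invF a (no _) = 0

    -- r/(a x), taken in 1, ..., q so that `σ-involution` is an equality and not only a congruence.
    σ : ℕ → ℕ → ℕ
    σ a x = rep (invF (a * x) (isCoprime? (a * x) q) * r)

    σ-solves : ∀ a x → Coprime a q → Coprime x q → a * x * σ a x ≈ r
    σ-solves a x ca cx with isCoprime? (a * x) q
    ... | no nc = ⊥-elim (nc (coprime-* ca cx))
    ... | yes co with inverse (a * x) co
    ... | z , e = trans (≈-*ʳ (a * x) {rep (z * r)} {z * r} (rep-≈ (z * r))) (trans (cong (_% q) (sym (ℕ.*-assoc (a * x) z r)))
          (trans (≈-* {a * x * z} {1} {r} {r} e refl) (cong (_% q) (ℕ.*-identityˡ r))))

    σ-coprime : ∀ a x → Coprime a q → Coprime x q → Coprime (σ a x) q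
    σ-coprime a x ca cx = coprime-*⁻ʳ {a * x} {σ a x} (≈-coprime {r} {a * x * σ a x} (sym (σ-solves a x ca cx)) cr)

    σ-unique : ∀ a x y → Coprime a q → Coprime x q → a * x * y ≈ r → σ a x ≈ y
    σ-unique a x y ca cx e = ≈-cancel (a * x) {σ a x} {y} (coprime-* ca cx) (trans (σ-solves a x ca cx) (sym e))

    σ-involution : ∀ a → Coprime a q → ∀ x → 1 ≤ x → x ≤ q → Coprime x q →
      (1 ≤ σ a x × σ a x ≤ q) × Coprime (σ a x) q × σ a (σ a x) ≡ x
    σ-involution a ca x hx lx cx = (s≤s z≤n , rep≤q _) , σ-coprime a x ca cx ,
      ≈⇒≡ (s≤s z≤n) (rep≤q _) hx lx (σ-unique a (σ a x) x ca (σ-coprime a x ca cx)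
        (trans (cong (_% q) (trans (ℕ.*-assoc a (σ a x) x) (trans (cong (a *_) (ℕ.*-comm (σ a x) x)) (sym (ℕ.*-assoc a x (σ a x)))))) (σ-solves a x ca cx)))

    private
      sign-sum : ∀ {x y} → x ≡ 1# ⊎ x ≡ neg 1# → y ≡ 1# ⊎ y ≡ neg 1# → ¬ (x ≡ 1# × y ≡ 1#) → x ⊕ y ≼ 0#
      sign-sum (inj₁ a) (inj₁ b) h = ⊥-elim (h (a , b))
      sign-sum (inj₁ refl) (inj₂ refl) h = ≼-reflexive (solve 0 (one :+ (:- one) := con 0) refl)
      sign-sum (inj₂ refl) (inj₁ refl) h = ≼-reflexive (solve 0 (:- one :+ one := con 0) refl)
      sign-sum (inj₂ refl) (inj₂ refl) h = (linear (2 ⊠ 0≼1) (solve 0 (con 0 :- (:- one :+ (:- one)) := con 2 :* one :- con 2 :* con 0) refl))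

    pair-sum : ∀ a → Coprime a q → S q (λ x → κ q x ⊗ (f x ⊕ f (σ a x))) ≡ S q (λ x → κ q x ⊗ f x) ⊕ S q (λ x → κ q x ⊗ f x)
    pair-sum a ca = trans (S-cong q λ x _ _ → ⊗-distribˡ-⊕ _ _ _) (trans (S-⊕ q _ _)
      (cong (S q (λ x → κ q x ⊗ f x) ⊕_) (S-involution (σ a) f (σ-involution a ca))))

    -- By `avoid`, x and r/(a x) cannot both lie in {f = 1}, so every summand is at most 0. The
    -- involution makes the total twice the sum in `half`, which is at least 0, so every summand is
    -- 0.
    pair : ∀ a → Coprime a q → f a ≡ 1# → ∀ x → 1 ≤ x → x ≤ q → κ q x ⊗ (f x ⊕ f (σ a x)) ≡ 0#
    pair a ca fa = S-nonpos _ (λ x _ _ → ≼-trans (𝟙-guard-≼ (isCoprime? x q) λ cx → sign-sum (f-sign x) (f-sign (σ a x)) λ (e₁ , e₂) →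
        avoid a x (σ a x) ca cx (σ-coprime a x ca cx) (σ-solves a x ca cx) fa e₁ e₂) (≼-reflexive (⊗-zeroʳ _)))
      (≼-trans ((linear (2 ⊠ half) (solve 1 (λ x → x :+ x :- con 0 := con 2 :* x :- con 2 :* con 0) refl _))) (≼-reflexive (sym (pair-sum a ca))))

    f-pair : ∀ a x y → Coprime a q → Coprime x q → f a ≡ 1# → a * x * y ≈ r → f y ≡ neg (f x)
    f-pair a x y ca cx fa e = trans (f-≈ {y} {σ a (rep x)} (sym (σ-unique a (rep x) y ca c-rep e′))) ((linear-≡ (both ⊞≡ f-≈ {x} {rep x} (sym (rep-≈ x))) (solve 3 (λ x y z → :- x :- y := con 0 :+ z :- (z :+ y :+ x)) refl _ _ _)))
      where
      c-rep : Coprime (rep x) q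
      c-rep = ≈-coprime {x} {rep x} (sym (rep-≈ x)) cx

      e′ : a * rep x * y ≈ r
      e′ = trans (≈-* {a * rep x} {a * x} {y} {y} (≈-*ʳ a {rep x} {x} (rep-≈ x)) refl) e

      both : f (rep x) ⊕ f (σ a (rep x)) ≡ 0#
      both = trans (sym (⊗-identityˡ _)) (trans (cong (_⊗ (f (rep x) ⊕ f (σ a (rep x)))) (sym (𝟙-yes (isCoprime? (rep x) q) c-rep))) (pair a ca fa (rep x) (s≤s z≤n) (rep≤q x)))

    1≢-1 : ¬ 1# ≡ neg 1#
    1≢-1 e = 1⋠0 ((linear′ 1 (≼-reflexive e) (solve 0 (con 2 :* (con 0 :- one) := :- one :- one) refl)))

    -- Any of the three numbers with f = 1 can play the part of a in `f-pair`; if there is none, the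
    -- claim is -1 = -(-1)(-1).
    f-triple : ∀ a x y → Coprime a q → Coprime x q → Coprime y q → a * x * y ≈ r → f y ≡ neg (f a ⊗ f x)
    f-triple a x y ca cx cy e with f-sign a | f-sign x | f-sign y
    ... | inj₁ fa | _ | _ = trans (f-pair a x y ca cx fa e) (cong neg (trans (sym (⊗-identityˡ _)) (cong (_⊗ f x) (sym fa))))
    ... | inj₂ fa | inj₁ fx | _ = trans (f-pair x a y cx ca fx (trans (cong (λ z → (z * y) % q) (ℕ.*-comm x a)) e))
          (cong neg (trans (sym (⊗-identityʳ _)) (cong (f a ⊗_) (sym fx))))
    ... | inj₂ fa | inj₂ fx | inj₂ fy = trans fy (trans (solve 0 (:- one := :- ((:- one) :* (:- one))) refl) (cong₂ (λ u v → neg (u ⊗ v)) (sym fa) (sym fx)))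
    ... | inj₂ fa | inj₂ fx | inj₁ fy = ⊥-elim (1≢-1 (sym (trans (sym fa) (trans (f-pair y x a cy cx fy (trans (cong (_% q) rev) e)) (trans (cong neg fx) (solve 0 (:- (:- one) := one) refl))))))
      where
      rev : y * x * a ≡ a * x * y
      rev = trans (ℕ.*-comm (y * x) a) (trans (cong (a *_) (ℕ.*-comm y x)) (sym (ℕ.*-assoc a x y)))

    -- The triples m, n, z and 1, mn, z have the same product, so `f-triple` determines f(z) in two
    -- ways.
    f-* : ∀ m n → Coprime m q → Coprime n q → f 1 ⊗ f (m * n) ≡ f m ⊗ f n
    f-* m n cm cn = compare (solution (m * n) r (coprime-* cm cn))
      where
      compare : (∃ λ z → m * n * z ≈ r) → f 1 ⊗ f (m * n) ≡ f m ⊗ f n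
      compare (z , e) = cancel (f-triple m n z cm cn cz e) (f-triple 1 (m * n) z (coprime-1 q) (coprime-* cm cn) cz (trans (cong (λ w → (w * z) % q) (ℕ.*-identityˡ (m * n))) e))
        where
        cz : Coprime z q
        cz = coprime-*⁻ʳ {m * n} {z} (≈-coprime {r} {m * n * z} (sym e) cr)

        cancel : ∀ {z x y} → z ≡ neg x → z ≡ neg y → y ≡ x
        cancel e₁ e₂ = (linear-≡ (sym e₁ ⊞≡ e₂) (solve 3 (λ x y z → x :- y := z :+ (:- y) :- (:- x :+ z)) refl _ _ _))

    -- `pair` has content only if some unit has f = 1; if none has, the sum in `half` is -N, which
    -- is negative.
    search : ∀ n → (∃ λ a → Coprime a q × f a ≡ 1#) ⊎ (∀ k → 1 ≤ k → k ≤ n → κ q k ⊗ f k ≡ neg (κ q k))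
    search zero = inj₂ λ k h l → ⊥-elim (ℕ.<⇒≱ h l)
    search (suc n) with search n | isCoprime? (suc n) q | f-sign (suc n)
    ... | inj₁ w | _ | _ = inj₁ w
    ... | inj₂ _ | yes co | inj₁ fa = inj₁ (suc n , co , fa)
    ... | inj₂ h | yes co | inj₂ fa = inj₂ (extend (trans (cong (κ q (suc n) ⊗_) fa) (solve 1 (λ x → x :* (:- one) := :- x) refl _)))
      where
      extend : κ q (suc n) ⊗ f (suc n) ≡ neg (κ q (suc n)) → ∀ k → 1 ≤ k → k ≤ suc n → κ q k ⊗ f k ≡ neg (κ q k)
      extend e k hk l with k ≟ suc n
      ... | yes refl = e
      ... | no ne = h k hk (ℕ.≤-pred (ℕ.≤∧≢⇒< l ne))
    ... | inj₂ h | no nc | _ = inj₂ (extend (trans (cong (_⊗ f (suc n)) κ0) (trans (solve 1 (λ x → con 0 :* x := :- con 0) refl _) (cong neg (sym κ0)))))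
      where
      κ0 : κ q (suc n) ≡ 0#
      κ0 = 𝟙-no (isCoprime? (suc n) q) nc

      extend : κ q (suc n) ⊗ f (suc n) ≡ neg (κ q (suc n)) → ∀ k → 1 ≤ k → k ≤ suc n → κ q k ⊗ f k ≡ neg (κ q k)
      extend e k hk l with k ≟ suc n
      ... | yes refl = e
      ... | no ne = h k hk (ℕ.≤-pred (ℕ.≤∧≢⇒< l ne))

    S-f : S q (λ n → κ q n ⊗ f n) ≡ 0#
    S-f with search q
    ... | inj₂ h = ⊥-elim (1⋠0 ((linear (half ⊞ 1≼N ⊞ ≼-reflexive (trans (S-cong q h) (S-neg q (κ q)))) (solve 2 (λ x y → con 0 :- one := x :+ y :+ (:- y) :- (con 0 :+ one :+ x)) refl _ _))))
    ... | inj₁ (a , ca , fa) = ≼-antisym ((linear′ 1 (≼-reflexive (sym (pair-sum a ca)) ⊞ ≼-reflexive (S-zero q (pair a ca fa))) (solve 2 (λ x y → con 2 :* (con 0 :- x) := y :+ con 0 :- (x :+ x :+ y)) refl _ _))) half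

    -- f may be the negative of a character; the factor f(1) corrects the sign so that the value at
    -- 1 is 1.
    χf : ℕ → K
    χf n = κ q n ⊗ (f 1 ⊗ f n)

    f-Bd : ∀ n → Bd (f n) 1#
    f-Bd n with f n | f-sign n
    ... | _ | inj₁ refl = Bd-pos 0≼1 ≼-refl
    ... | _ | inj₂ refl = ≼-refl , (linear (2 ⊠ 0≼1) (solve 0 (one :- (:- one) := con 2 :* one :- con 2 :* con 0) refl))

    χf-Bd : ∀ n → Bd (χf n) 1#
    χf-Bd n = Bd-weaken (≼-reflexive (solve 0 (one :* (one :* one) := one) refl)) (Bd-⊗ (Bd-pos (0≼𝟙 (isCoprime? n q)) (𝟙≼1 (isCoprime? n q))) (Bd-⊗ (f-Bd 1) (f-Bd n)))

    character : RealCharacter q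
    character = record
      { χ = χf
      ; χ-* = mult
      ; χ-Bd = χf-Bd
      ; χ-1 = trans (cong₂ _⊗_ (𝟙-yes (isCoprime? 1 q) (coprime-1 q)) (f² 1)) (⊗-identityˡ _)
      ; χ-sq = λ n co → trans (cong (λ z → z ⊗ (f 1 ⊗ f n) ⊗ (z ⊗ (f 1 ⊗ f n))) (𝟙-yes (isCoprime? n q) co)) ((linear-≡ (f² 1 ⊞≡ (f 1 ⊗ f 1) ⊠≡ f² n) (solve 2 (λ x y → one :- one :* (x :* y) :* (one :* (x :* y)) := one :+ x :* x :* one :- (x :* x :+ x :* x :* (y :* y))) refl _ _)))
      ; χ-partial = λ t → Bd-weaken (≼-reflexive (⊗-identityʳ _)) (periodic-Bd χf 1# (λ {m} {n} p → cong₂ (λ a b → a ⊗ (f 1 ⊗ b)) (κ-≈ {m} {n} p) (f-≈ {m} {n} p))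
          (trans (S-cong q λ n _ _ → ⊗-left _ _ _) (trans (S-⊗ˡ q (f 1) _) (trans (cong (f 1 ⊗_) S-f) (⊗-zeroʳ _)))) 0≼1 χf-Bd t)
      }
      where
      mult : ∀ a b → χf (a * b) ≡ χf a ⊗ χf b
      mult a b = trans (cong (_⊗ (f 1 ⊗ f (a * b))) (κ-* q a b)) (cases (isCoprime? a q) (isCoprime? b q))
        where
        cases : Dec (Coprime a q) → Dec (Coprime b q) → κ q a ⊗ κ q b ⊗ (f 1 ⊗ f (a * b)) ≡ χf a ⊗ χf b
        cases (yes ca) (yes cb) = trans (cong (κ q a ⊗ κ q b ⊗_) (trans (f-* a b ca cb) ((linear-≡ (sym ((f a ⊗ f b) ⊠≡ f² 1)) (solve 3 (λ x y z → x :* x :* (y :* z) :- y :* z := y :* z :* (x :* x) :- y :* z :* one) refl _ _ _))))) (regroup _ _ _ _ _)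
          where
          regroup : ∀ x y z a b → x ⊗ y ⊗ (z ⊗ z ⊗ (a ⊗ b)) ≡ x ⊗ (z ⊗ a) ⊗ (y ⊗ (z ⊗ b))
          regroup x y z a b = (solve 5 (λ x y z u v → x :* y :* (z :* z :* (u :* v)) := x :* (z :* u) :* (y :* (z :* v))) refl _ _ _ _ _)
        cases (no nc) _ = trans (cong (λ z → z ⊗ κ q b ⊗ (f 1 ⊗ f (a * b))) κ0) (trans (vanish _ _ _ _) (cong (λ z → z ⊗ (f 1 ⊗ f a) ⊗ χf b) (sym κ0)))
          where
          κ0 : κ q a ≡ 0#
          κ0 = 𝟙-no (isCoprime? a q) nc

          vanish : ∀ x y z w → 0# ⊗ x ⊗ y ≡ 0# ⊗ z ⊗ w
          vanish x y z w = (solve 4 (λ x y z u → con 0 :* x :* y := con 0 :* z :* u) refl _ _ _ _)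
        cases (yes _) (no nc) = trans (cong (λ z → κ q a ⊗ z ⊗ (f 1 ⊗ f (a * b))) κ0) (trans (vanish _ _ _ _) (cong (λ z → χf a ⊗ (z ⊗ (f 1 ⊗ f b))) (sym κ0)))
          where
          κ0 : κ q b ≡ 0#
          κ0 = 𝟙-no (isCoprime? b q) nc

          vanish : ∀ x y z w → x ⊗ 0# ⊗ y ≡ z ⊗ (0# ⊗ w)
          vanish x y z w = (solve 4 (λ x y z u → x :* con 0 :* y := z :* (con 0 :* u)) refl _ _ _ _)

-- Recognising constants as naturals gives their nonnegativity and supplies the exponent from which
-- `dirichlet` builds y. For class counts it is the integrality behind floors and behind `tangent`.
IsNat : K → Set
IsNat x = ∃ λ n → x ≡ ι n

nat-ι : ∀ n → IsNat (ι n)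
nat-ι n = n , refl

nat-⊕ : ∀ {x y} → IsNat x → IsNat y → IsNat (x ⊕ y)
nat-⊕ (m , refl) (n , refl) = m + n , sym (ι-+ m n)

nat-⊗ : ∀ {x y} → IsNat x → IsNat y → IsNat (x ⊗ y)
nat-⊗ (m , refl) (n , refl) = m * n , sym (ι-* m n)

nat-1 : IsNat 1#
nat-1 = 1 , sym (⊕-identityʳ 1#)

nat-𝟙 : ∀ {P : Set} (d : Dec P) → IsNat (𝟙 d)
nat-𝟙 (yes p) = 1 , trans (𝟙-yes (yes p) p) (sym (⊕-identityʳ 1#))
nat-𝟙 (no p) = 0 , 𝟙-no (no p) p

nat-S : ∀ x {f : ℕ → K} → (∀ n → IsNat (f n)) → IsNat (S x f)
nat-S zero h = 0 , refl
nat-S (suc x) h = nat-⊕ (nat-S x h) (h (suc x))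

nat≥0 : ∀ {x} → IsNat x → 0# ≼ x
nat≥0 (n , refl) = 0≼ι n

-- Contradiction from a class without primes

module _ (q : ℕ) .{{_ : NonZero q}} (r : ℕ) (cr : Coprime r q) where
  open Residues q

  private
    -- A class is dense if its mass is at least ℓ²/D₈. Each Wᵢ is the size of ℓ(y) that one
    -- contradiction needs: W₁ for `half`, W₂ for `avoid`, W₃ for `absurd`. A₁ is the factor of ℓ²
    -- in the bound for triple products, and Bq bounds the partial sums in `mean-zero`.
    C D₈ Bq A₁ W₁ W₂ W₃ W : K
    C = ι 8 ⊕ ι 2 ⊗ ι q
    D₈ = ι 8 ⊗ (N ⊗ N)
    Bq = ι q ⊗ N
    A₁ = (ι 5 ⊗ C ⊕ ι 8 ⊗ N) ⊕ (ι 8 ⊗ C ⊕ ι 2 ⊗ C ⊗ C) ⊗ (1# ⊕ C) ⊕ ι 60 ⊗ Bq ⊗ (ι 2 ⊕ C)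
    W₁ = ι 32 ⊗ N ⊗ C ⊕ ι 8 ⊗ N ⊗ (ι 2 ⊗ C ⊕ C ⊗ C ⊕ ι 30 ⊗ Bq)
    W₂ = D₈ ⊗ (D₈ ⊗ D₈) ⊗ (ι 9 ⊗ A₁)
    W₃ = ι 8 ⊗ (C ⊕ ι (characterBound q))
    W = W₁ ⊕ W₂ ⊕ W₃ ⊕ 1#

    nat-N : IsNat N
    nat-N = nat-S q λ n → nat-𝟙 (isCoprime? n q)

    nat-C : IsNat C
    nat-C = nat-⊕ (nat-ι 8) (nat-⊗ (nat-ι 2) (nat-ι q))

    nat-B : IsNat Bq
    nat-B = nat-⊗ (nat-ι q) nat-N

    nat-D : IsNat D₈
    nat-D = nat-⊗ (nat-ι 8) (nat-⊗ nat-N nat-N)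

    nat-A₁ : IsNat A₁
    nat-A₁ = nat-⊕ (nat-⊕ (nat-⊕ (nat-⊗ (nat-ι 5) nat-C) (nat-⊗ (nat-ι 8) nat-N))
      (nat-⊗ (nat-⊕ (nat-⊗ (nat-ι 8) nat-C) (nat-⊗ (nat-⊗ (nat-ι 2) nat-C) nat-C)) (nat-⊕ nat-1 nat-C)))
      (nat-⊗ (nat-⊗ (nat-ι 60) nat-B) (nat-⊕ (nat-ι 2) nat-C))

    nat-W₁ : IsNat W₁
    nat-W₁ = nat-⊕ (nat-⊗ (nat-⊗ (nat-ι 32) nat-N) nat-C) (nat-⊗ (nat-⊗ (nat-ι 8) nat-N)
      (nat-⊕ (nat-⊕ (nat-⊗ (nat-ι 2) nat-C) (nat-⊗ nat-C nat-C)) (nat-⊗ (nat-ι 30) nat-B)))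

    nat-W₂ : IsNat W₂
    nat-W₂ = nat-⊗ (nat-⊗ nat-D (nat-⊗ nat-D nat-D)) (nat-⊗ (nat-ι 9) nat-A₁)

    nat-W₃ : IsNat W₃
    nat-W₃ = nat-⊗ (nat-ι 8) (nat-⊕ nat-C (nat-ι (characterBound q)))

    nat-W : IsNat W
    nat-W = nat-⊕ (nat-⊕ (nat-⊕ nat-W₁ nat-W₂) nat-W₃) nat-1

    W-bounds : (W₁ ⊕ 1# ≼ W) × (W₂ ⊕ 1# ≼ W) × (W₃ ⊕ 1# ≼ W)
    W-bounds = linear-bounds (nat≥0 nat-W₁) (nat≥0 nat-W₂) (nat≥0 nat-W₃)
      where
      linear-bounds : ∀ {a b c} → 0# ≼ a → 0# ≼ b → 0# ≼ c → (a ⊕ 1# ≼ a ⊕ b ⊕ c ⊕ 1#) × (b ⊕ 1# ≼ a ⊕ b ⊕ c ⊕ 1#) × (c ⊕ 1# ≼ a ⊕ b ⊕ c ⊕ 1#)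
      linear-bounds ha hb hc = (linear (hb ⊞ hc) (solve 3 (λ x y z → x :+ y :+ z :+ one :- (x :+ one) := y :+ z :- (con 0 :+ con 0)) refl _ _ _)) , (linear (ha ⊞ hc) (solve 3 (λ x y z → x :+ y :+ z :+ one :- (y :+ one) := x :+ z :- (con 0 :+ con 0)) refl _ _ _)) , (linear (ha ⊞ hb) (solve 3 (λ x y z → x :+ y :+ z :+ one :- (z :+ one) := x :+ y :- (con 0 :+ con 0)) refl _ _ _))

    -- Brings the bound of `triple-bound` into the form l² times a constant, raising lower powers of
    -- l by 1 ≤ l.
    quadratic : ∀ l c n b → 1# ≼ l → 0# ≼ c → 0# ≼ b →
      (ι 5 ⊗ c ⊕ ι 8 ⊗ n) ⊗ (l ⊗ l) ⊕ (ι 8 ⊗ c ⊗ l ⊕ ι 2 ⊗ c ⊗ c) ⊗ (l ⊕ c) ⊕ ι 2 ⊗ (b ⊗ ι 6 ⊗ (1# ⊕ ι 4 ⊗ l)) ⊗ (l ⊕ (l ⊕ c)) ≼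
      (l ⊗ l) ⊗ ((ι 5 ⊗ c ⊕ ι 8 ⊗ n) ⊕ (ι 8 ⊗ c ⊕ ι 2 ⊗ c ⊗ c) ⊗ (1# ⊕ c) ⊕ ι 60 ⊗ b ⊗ (ι 2 ⊕ c))
    quadratic l c n b hl hc hb = (linear (10 ⊠ (0≼⊗ (0≼⊗ hc hc) (0≼⊗ l≥0 l-1)) ⊞ 2 ⊠ (0≼⊗ (0≼⊗ hc (0≼⊗ hc hc)) l-1) ⊞ 2 ⊠ (0≼⊗ (0≼⊗ hc (0≼⊗ hc hc)) (0≼⊗ l≥0 l-1)) ⊞ 24 ⊠ (0≼⊗ hb (0≼⊗ l≥0 l-1)) ⊞ 12 ⊠ (0≼⊗ (0≼⊗ hb hc) l-1) ⊞ 60 ⊠ (0≼⊗ (0≼⊗ hb hc) (0≼⊗ l≥0 l-1))) (solve 4 (λ x y z u → x :* x :* (con 5 :* y :+ con 8 :* z :+ (con 8 :* y :+ con 2 :* y :* y) :* (one :+ y) :+ con 60 :* u :* (con 2 :+ y)) :- ((con 5 :* y :+ con 8 :* z) :* (x :* x) :+ (con 8 :* y :* x :+ con 2 :* y :* y) :* (x :+ y) :+ con 2 :* (u :* con 6 :* (one :+ con 4 :* x)) :* (x :+ (x :+ y))) := con 10 :* (y :* y :* (x :* (x :- one))) :+ con 2 :* (y :* (y :* y) :* (x :- one)) :+ con 2 :* (y :* (y :* y) :* (x :* (x :- one))) :+ con 24 :* (u :* (x :* (x :- one))) :+ con 12 :* (u :* y :* (x :- one)) :+ con 60 :* (u :*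 y :* (x :* (x :- one))) :- (con 10 :* con 0 :+ con 2 :* con 0 :+ con 2 :* con 0 :+ con 24 :* con 0 :+ con 12 :* con 0 :+ con 60 :* con 0)) refl _ _ _ _))
      where
      l-1 : 0# ≼ l ⊖ 1#
      l-1 = 0≼⊖ hl

      l≥0 : 0# ≼ l
      l≥0 = ≼-trans 0≼1 hl

    sign : K → K → K
    sign v w = choose (v ≼? w) 1# (neg 1#)

    sign-cases : ∀ v w → (sign v w ≡ 1# × v ≼ w) ⊎ (sign v w ≡ neg 1# × w ≼ v)
    sign-cases v w = go (v ≼? w)
      where
      go : Dec (v ≼ w) → (sign v w ≡ 1# × v ≼ w) ⊎ (sign v w ≡ neg 1# × w ≼ v)
      go (yes h) = inj₁ (choose-yes (v ≼? w) h , h)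
      go (no h) = inj₂ (choose-no (v ≼? w) h , ≼-contra h)

    module NoPrime (y : ℕ) (lg : Log (suc (y * y * y))) (hy : 1 ≤ y) (large : W ≼ Log.ℓ lg y)
      (none : ∀ p → Prime p → p ≤ y * y * y → ¬ p ≈ r) where
      open Triple lg q 1≤q hiding (C)

      x : ℕ
      x = y * y * y

      hx : 1 ≤ x
      hx = 1≤* (1≤* hy hy) hy

      y≤X : y ≤ suc x
      y≤X = ℕ.m≤n⇒m≤1+n (≤*ʳ y (1≤* hy hy))

      L : K
      L = ℓ y

      L≥W₁ : W₁ ⊕ 1# ≼ ℓ y
      L≥W₁ = ≼-trans (proj₁ W-bounds) large

      L≥W₂ : W₂ ⊕ 1# ≼ ℓ y
      L≥W₂ = ≼-trans (proj₁ (proj₂ W-bounds)) large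

      L≥W₃ : W₃ ⊕ 1# ≼ ℓ y
      L≥W₃ = ≼-trans (proj₂ (proj₂ W-bounds)) large

      1≼L : 1# ≼ ℓ y
      1≼L = (linear (L≥W₂ ⊞ (nat≥0 nat-W₂)) (solve 3 (λ x y z → x :- one := x :+ con 8 :* (y :* y) :* (con 8 :* (y :* y) :* (con 8 :* (y :* y))) :* (con 9 :* (con 5 :* (con 8 :+ con 2 :* z) :+ con 8 :* y :+ (con 8 :* (con 8 :+ con 2 :* z) :+ con 2 :* (con 8 :+ con 2 :* z) :* (con 8 :+ con 2 :* z)) :* (one :+ (con 8 :+ con 2 :* z)) :+ con 60 :* (z :* y) :* (con 2 :+ (con 8 :+ con 2 :* z)))) :- (con 8 :* (y :* y) :* (con 8 :* (y :* y) :* (con 8 :* (y :* y))) :* (con 9 :* (con 5 :* (con 8 :+ con 2 :* z) :+ con 8 :* y :+ (con 8 :* (con 8 :+ con 2 :* z) :+ con 2 :* (con 8 :+ con 2 :* z) :* (con 8 :+ con 2 :* z)) :* (one :+ (con 8 :+ con 2 :* z)) :+ con 60 :* (z :* y) :* (con 2 :+ (con 8 :+ con 2 :* z)))) :+ one :+ con 0)) refl _ _ _))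

      0≼L : 0# ≼ ℓ y
      0≼L = ≼-trans 0≼1 1≼L

      N≥0 : 0# ≼ N
      N≥0 = nat≥0 nat-N

      C≥0 : 0# ≼ C
      C≥0 = nat≥0 nat-C

      B≥0 : 0# ≼ Bq
      B≥0 = nat≥0 nat-B

      D≥0 : 0# ≼ D₈
      D≥0 = nat≥0 nat-D

      p : ℕ → K
      p k = P (cls k) y

      P-class : ∀ (F : ℕ → K) → Periodic F → P F y ≡ S q (λ k → F k ⊗ p k)
      P-class F hF = trans (S-cong y λ n _ _ → trans (cong (_⊗ (u n ⊗ ℓ n)) (sym (S-class F hF n))) (trans (sym (S-⊗ʳ q _ _)) (S-cong q λ k _ _ → ⊗-assoc _ _ _)))
        (trans (S-swap y q _) (S-cong q λ k _ _ → S-⊗ˡ y (F k) _))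

      U : K
      U = (ℓ y ⊕ C) ⊗ (ℓ y ⊕ C) ⊕ err Bq y

      -- Selberg's formula for one class, with its nonnegative Q dropped: no class has more than
      -- about twice its share ℓ²/(2N) of the total mass. Hence at least half of the classes must be
      -- dense.
      Np≤U : ∀ k → Coprime k q → N ⊗ p k ≼ (ℓ y ⊕ C) ⊗ (ℓ y ⊕ C) ⊕ err Bq y
      Np≤U k ck = (linear ((proj₁ (selberg (λ n → κ q n ⊖ N ⊗ cls k n) Bq B≥0 balanced y hy y≤X)) ⊞ ≼-reflexive (P-lin (κ q) (cls k) N y) ⊞ ≼-reflexive (Q-lin (κ q) (cls k) N y) ⊞ (0≼⊗ N≥0 Q≥0) ⊞ (PQκ-upper y hy y≤X)) (solve 9 (λ x y z u v w a b c → (x :+ (con 8 :+ con 2 :* y)) :* (x :+ (con 8 :+ con 2 :* y)) :+ y :* z :* con 6 :* (one :+ con 4 :* x) :- z :* u := v :+ w :+ (a :- z :* u) :+ (b :- z :* c) :+ z :* c :+ (x :+ (con 8 :+ con 2 :* y)) :* (x :+ (con 8 :+ con 2 :* y)) :- (:- (y :* z :* con 6 :* (one :+ con 4 :* x)) :+ v :+ w :+ con 0 :+ (a :+ b))) refl _ _ _ _ _ _ _ _ _))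
        where
        balanced : Balanced (λ n → κ q n ⊖ N ⊗ cls k n) Bq
        balanced e he t = Bd-≡ (S-cong t λ m _ _ → cong (λ z → κ q (e * m) ⊖ N ⊗ cls k z) (sym (ℕ.*-identityˡ (e * m)))) (mean-zero k 1 ck (coprime-1 q) e he t)

        Q≥0 : 0# ≼ Q (cls k) y
        Q≥0 = 0≼S y λ d hd _ → 0≼S y λ m hm _ → 0≼⊗ (0≼𝟙 (d * m ≤? y)) (0≼⊗ (0≼𝟙 (d * m ≈? k)) (0≼⊗ (0≼u d hd) (0≼u m hm)))

      f : ℕ → K
      f k = sign (ℓ y ⊗ ℓ y) (D₈ ⊗ p k)

      f-≈ : Periodic f
      f-≈ {k} {k′} e = cong (λ z → sign (ℓ y ⊗ ℓ y) (D₈ ⊗ z)) (S-cong y λ n _ _ → cong (_⊗ (u n ⊗ ℓ n))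
        (𝟙-cong (n ≈? k) (n ≈? k′) (λ h → trans h e) (λ h → trans h (sym e))))

      f-cases : ∀ k → (f k ≡ 1# × ℓ y ⊗ ℓ y ≼ D₈ ⊗ p k) ⊎ (f k ≡ neg 1# × D₈ ⊗ p k ≼ ℓ y ⊗ ℓ y)
      f-cases k = sign-cases (ℓ y ⊗ ℓ y) (D₈ ⊗ p k)

      f-sign : ∀ k → f k ≡ 1# ⊎ f k ≡ neg 1#
      f-sign k = [ (λ z → inj₁ (proj₁ z)) , (λ z → inj₂ (proj₁ z)) ]′ (f-cases k)

      f-large : ∀ k → f k ≡ 1# → ℓ y ⊗ ℓ y ≼ D₈ ⊗ p k
      f-large k e with f-cases k
      ... | inj₁ (_ , h) = h
      ... | inj₂ (e′ , _) = ⊥-elim (1⋠0 (neg-one (trans (sym e) e′)))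
        where
        neg-one : 1# ≡ neg 1# → 1# ≼ 0#
        neg-one z = (linear′ 1 (≼-reflexive z) (solve 0 (con 2 :* (con 0 :- one) := :- one :- one) refl))

      Sκf : K
      Sκf = S q λ k → κ q k ⊗ f k

      Pκ-sum : P (κ q) y ≡ S q (λ k → κ q k ⊗ p k)
      Pκ-sum = P-class (κ q) λ {m} {n} → κ-≈ {m} {n}

      -- Integrality: a negative value of the sum is at most -1, which is the gap that `shortfall`
      -- exploits.
      signed-count : ∀ t → Σ ℕ λ a → Σ ℕ λ b → S t (λ k → κ q k ⊗ f k) ≡ ι a ⊖ ι b
      signed-count zero = 0 , 0 , (solve 0 (con 0 := con 0 :- con 0) refl)
      signed-count (suc t) = step (signed-count t) (isCoprime? (suc t) q) (f-sign (suc t))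
        where
        step : (Σ ℕ λ a → Σ ℕ λ b → S t (λ k → κ q k ⊗ f k) ≡ ι a ⊖ ι b) → Dec (Coprime (suc t) q) → f (suc t) ≡ 1# ⊎ f (suc t) ≡ neg 1# →
          Σ ℕ λ a → Σ ℕ λ b → S (suc t) (λ k → κ q k ⊗ f k) ≡ ι a ⊖ ι b
        step (a , b , e) (no nc) _ = a , b , trans (cong (S t (λ k → κ q k ⊗ f k) ⊕_) (trans (cong (_⊗ f (suc t)) (𝟙-no (isCoprime? (suc t) q) nc)) (⊗-zeroˡ _))) (trans (⊕-identityʳ _) e)
        step (a , b , e) (yes co) (inj₁ g) = suc a , b , trans (cong₂ _⊕_ e (cong₂ _⊗_ (𝟙-yes (isCoprime? (suc t) q) co) g)) (solve 2 (λ x y → x :- y :+ one :* one := one :+ x :- y) refl _ _)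
        step (a , b , e) (yes co) (inj₂ g) = a , suc b , trans (cong₂ _⊕_ e (cong₂ _⊗_ (𝟙-yes (isCoprime? (suc t) q) co) g)) (solve 2 (λ x y → x :- y :+ one :* (:- one) := x :- (one :+ y)) refl _ _)

      -- Let σ be this sum. The (N + σ)/2 dense classes have mass at most U/N each, the (N - σ)/2
      -- others at most ℓ²/D₈ each. If σ ≤ -1, this contradicts the lower bound for the total in
      -- `Pκ-lower`.
      half : 0# ≼ S q (λ k → κ q k ⊗ f k)
      half = nonneg (signed-count q)
        where
        term : ∀ k → Dec (Coprime k q) → ι 2 ⊗ (D₈ ⊗ N) ⊗ (κ q k ⊗ p k) ≼
          (κ q k ⊕ κ q k ⊗ f k) ⊗ (D₈ ⊗ U) ⊕ (κ q k ⊖ κ q k ⊗ f k) ⊗ (N ⊗ (ℓ y ⊗ ℓ y))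
        term k (no nc) = ≼-reflexive (trans (cong (λ z → ι 2 ⊗ (D₈ ⊗ N) ⊗ (z ⊗ p k)) κ0) (trans (vanish _ _ _ _ _) (cong (λ z → (z ⊕ z ⊗ f k) ⊗ (D₈ ⊗ U) ⊕ (z ⊖ z ⊗ f k) ⊗ (N ⊗ (ℓ y ⊗ ℓ y))) (sym κ0))))
          where
          κ0 : κ q k ≡ 0#
          κ0 = 𝟙-no (isCoprime? k q) nc

          vanish : ∀ a b c d e → ι 2 ⊗ a ⊗ (0# ⊗ b) ≡ (0# ⊕ 0# ⊗ c) ⊗ d ⊕ (0# ⊖ 0# ⊗ c) ⊗ e
          vanish a b c d e = (solve 5 (λ x y z u v → con 2 :* x :* (con 0 :* y) := (con 0 :+ con 0 :* z) :* u :+ (con 0 :- con 0 :* z) :* v) refl _ _ _ _ _)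
        term k (yes ck) = ≼-trans (≼-reflexive (cong (λ z → ι 2 ⊗ (D₈ ⊗ N) ⊗ (z ⊗ p k)) κ1)) (≼-trans (main (f-cases k))
            (≼-reflexive (cong (λ z → (z ⊕ z ⊗ f k) ⊗ (D₈ ⊗ U) ⊕ (z ⊖ z ⊗ f k) ⊗ (N ⊗ (ℓ y ⊗ ℓ y))) (sym κ1))))
          where
          κ1 : κ q k ≡ 1#
          κ1 = 𝟙-yes (isCoprime? k q) ck

          generic₁ : ∀ d n π v l → 0# ≼ d → n ⊗ π ≼ v → ι 2 ⊗ (d ⊗ n) ⊗ (1# ⊗ π) ≼ (1# ⊕ 1# ⊗ 1#) ⊗ (d ⊗ v) ⊕ (1# ⊖ 1# ⊗ 1#) ⊗ l
          generic₁ d n π v l hd h = (linear (2 ⊠ (⊗-monoˡ hd h)) (solve 5 (λ x y z u v → (one :+ one :* one) :* (x :* y) :+ (one :- one :* one) :* z :- con 2 :* (x :* u) :* (one :* v) := con 2 :* (x :* y) :- con 2 :* (x :* (u :* v))) refl _ _ _ _ _))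

          generic₂ : ∀ d n π v l → 0# ≼ n → d ⊗ π ≼ l → ι 2 ⊗ (d ⊗ n) ⊗ (1# ⊗ π) ≼ (1# ⊕ 1# ⊗ neg 1#) ⊗ v ⊕ (1# ⊖ 1# ⊗ neg 1#) ⊗ (n ⊗ l)
          generic₂ d n π v l hn h = (linear (2 ⊠ (⊗-monoˡ hn h)) (solve 5 (λ x y z u v → (one :+ one :* (:- one)) :* x :+ (one :- one :* (:- one)) :* (y :* z) :- con 2 :* (u :* y) :* (one :* v) := con 2 :* (y :* z) :- con 2 :* (y :* (u :* v))) refl _ _ _ _ _))

          main : (f k ≡ 1# × ℓ y ⊗ ℓ y ≼ D₈ ⊗ p k) ⊎ (f k ≡ neg 1# × D₈ ⊗ p k ≼ ℓ y ⊗ ℓ y) →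
            ι 2 ⊗ (D₈ ⊗ N) ⊗ (1# ⊗ p k) ≼ (1# ⊕ 1# ⊗ f k) ⊗ (D₈ ⊗ U) ⊕ (1# ⊖ 1# ⊗ f k) ⊗ (N ⊗ (ℓ y ⊗ ℓ y))
          main (inj₁ (e , _)) = subst (λ z → ι 2 ⊗ (D₈ ⊗ N) ⊗ (1# ⊗ p k) ≼ (1# ⊕ 1# ⊗ z) ⊗ (D₈ ⊗ U) ⊕ (1# ⊖ 1# ⊗ z) ⊗ (N ⊗ (ℓ y ⊗ ℓ y))) (sym e)
            (generic₁ D₈ N (p k) U (N ⊗ (ℓ y ⊗ ℓ y)) D≥0 (Np≤U k ck))
          main (inj₂ (e , h)) = subst (λ z → ι 2 ⊗ (D₈ ⊗ N) ⊗ (1# ⊗ p k) ≼ (1# ⊕ 1# ⊗ z) ⊗ (D₈ ⊗ U) ⊕ (1# ⊖ 1# ⊗ z) ⊗ (N ⊗ (ℓ y ⊗ ℓ y))) (sym e)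
            (generic₂ D₈ N (p k) (D₈ ⊗ U) (ℓ y ⊗ ℓ y) N≥0 h)

        summed : ι 2 ⊗ (D₈ ⊗ N) ⊗ P (κ q) y ≼ (N ⊕ Sκf) ⊗ (D₈ ⊗ U) ⊕ (N ⊖ Sκf) ⊗ (N ⊗ (ℓ y ⊗ ℓ y))
        summed = ≼-trans (≼-reflexive (trans (cong (ι 2 ⊗ (D₈ ⊗ N) ⊗_) Pκ-sum) (sym (S-⊗ˡ q _ _)))) (≼-trans (S-mono q λ k _ _ → term k (isCoprime? k q))
          (≼-reflexive (trans (S-⊕ q _ _) (cong₂ _⊕_ (trans (S-⊗ʳ q _ _) (cong (_⊗ (D₈ ⊗ U)) (S-⊕ q _ _))) (trans (S-⊗ʳ q _ _) (cong (_⊗ (N ⊗ (ℓ y ⊗ ℓ y))) (S-⊖ q _ _)))))))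

        -N≤Sκf : neg N ≼ Sκf
        -N≤Sκf = proj₁ (S-Bd q {λ k → κ q k ⊗ f k} {κ q} λ k _ _ → Bd-weaken (≼-reflexive (⊗-identityʳ _)) (Bd-scale (0≼𝟙 (isCoprime? k q)) (pm (f-sign k))))
          where
          pm : ∀ {z} → z ≡ 1# ⊎ z ≡ neg 1# → Bd z 1#
          pm (inj₁ refl) = Bd-pos 0≼1 ≼-refl
          pm (inj₂ refl) = ≼-refl , (linear (2 ⊠ 0≼1) (solve 0 (one :- (:- one) := con 2 :* one :- con 2 :* con 0) refl))

        -- With σ = Σ κ f ≤ −1 the total mass of the classes falls short of ℓ²/2.
        shortfall : ∀ n c b l π σ → 1# ≼ n → 0# ≼ c → 0# ≼ b → 1# ≼ l → σ ≼ neg 1# → neg n ≼ σ →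
          l ⊗ l ≼ ι 2 ⊗ π ⊕ ι 4 ⊗ c ⊗ l →
          ι 2 ⊗ (ι 8 ⊗ (n ⊗ n) ⊗ n) ⊗ π ≼ (n ⊕ σ) ⊗ (ι 8 ⊗ (n ⊗ n) ⊗ ((l ⊕ c) ⊗ (l ⊕ c) ⊕ b ⊗ ι 6 ⊗ (1# ⊕ ι 4 ⊗ l))) ⊕ (n ⊖ σ) ⊗ (n ⊗ (l ⊗ l)) →
          ι 32 ⊗ n ⊗ c ⊕ ι 8 ⊗ n ⊗ (ι 2 ⊗ c ⊕ c ⊗ c ⊕ ι 30 ⊗ b) ⊕ 1# ≼ l → ⊥
        shortfall n c b l π σ hn hc hb hl hσ hσ′ hπ h hl′ = 1⋠0 ((linear′ 5 (final ⊞ 11 ⊠ hl ⊞ 5 ⊠ (0≼⊗ (0≼⊖ hl) (0≼⊖ hl))) (solve 1 (λ x → con 6 :* (con 0 :- one) := x :* (x :- one) :+ con 11 :* x :+ con 5 :* ((x :- one) :* (x :- one)) :- (con 6 :* (x :* x) :+ con 11 :* one :+ con 5 :* con 0)) refl _)))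
          where
          n≥0 : 0# ≼ n
          n≥0 = ≼-trans 0≼1 hn

          l≥0 : 0# ≼ l
          l≥0 = ≼-trans 0≼1 hl

          vₛ : K
          vₛ = (l ⊕ c) ⊗ (l ⊕ c) ⊕ b ⊗ ι 6 ⊗ (1# ⊕ ι 4 ⊗ l)

          vₛ≥0 : 0# ≼ (l ⊕ c) ⊗ (l ⊕ c) ⊕ b ⊗ ι 6 ⊗ (1# ⊕ ι 4 ⊗ l)
          vₛ≥0 = (linear ((0≼sq (l ⊕ c)) ⊞ 6 ⊠ hb ⊞ 24 ⊠ (0≼⊗ hb l≥0)) (solve 3 (λ x y z → (x :+ y) :* (x :+ y) :+ z :* con 6 :* (one :+ con 4 :* x) :- con 0 := (x :+ y) :* (x :+ y) :+ con 6 :* z :+ con 24 :* (z :* x) :- (con 0 :+ con 6 :* con 0 :+ con 24 :* con 0)) refl _ _ _))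

          reduced : ι 16 ⊗ n ⊗ π ≼ ι 8 ⊗ (n ⊖ 1#) ⊗ vₛ ⊕ ι 2 ⊗ (l ⊗ l)
          reduced = ⊗-cancel hn (⊗-cancel hn ((linear (h ⊞ 8 ⊠ (mul≼ hσ (0≼⊗ (0≼⊗ n≥0 n≥0) vₛ≥0)) ⊞ (mul≼ hσ′ (0≼⊗ n≥0 (0≼⊗ l≥0 l≥0)))) (solve 6 (λ x y z u v w → x :* (x :* (con 8 :* (x :- one) :* ((y :+ z) :* (y :+ z) :+ u :* con 6 :* (one :+ con 4 :* y)) :+ con 2 :* (y :* y))) :- x :* (x :* (con 16 :* x :* v)) := (x :+ w) :* (con 8 :* (x :* x) :* ((y :+ z) :* (y :+ z) :+ u :* con 6 :* (one :+ con 4 :* y))) :+ (x :- w) :* (x :* (y :* y)) :+ con 8 :* ((:- one :- w) :* (x :* x :* ((y :+ z) :* (y :+ z) :+ u :* con 6 :* (one :+ con 4 :* y)) :- con 0)) :+ (w :- (:- x)) :* (x :* (y :* y) :- con 0) :- (con 2 :* (con 8 :* (x :* x) :* x) :* v :+ con 8 :* con 0 :+ con 0)) refl _ _ _ _ _ _))))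

          vₛ≤ : vₛ ≼ l ⊗ l ⊕ (ι 2 ⊗ c ⊕ c ⊗ c ⊕ ι 30 ⊗ b) ⊗ l
          vₛ≤ = (linear ((0≼⊗ (0≼⊗ hc hc) (0≼⊖ hl)) ⊞ 6 ⊠ (0≼⊗ hb (0≼⊖ hl))) (solve 3 (λ x y z → x :* x :+ (con 2 :* y :+ y :* y :+ con 30 :* z) :* x :- ((x :+ y) :* (x :+ y) :+ z :* con 6 :* (one :+ con 4 :* x)) := y :* y :* (x :- one) :+ con 6 :* (z :* (x :- one)) :- (con 0 :+ con 6 :* con 0)) refl _ _ _))

          -- In `reduced` the left side is at least 8nl² and the right side at most 8(n - 1)l² +
          -- 2l², up to terms linear in l. This leaves 6l² on the left, and `hl′` keeps the linear
          -- terms below l(l - 1).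
          final : ι 6 ⊗ (l ⊗ l) ≼ l ⊗ (l ⊖ 1#)
          final = (linear (reduced ⊞ (8 ⊠ ⊗-monoˡ n≥0 hπ) ⊞ (8 ⊠ ⊗-monoˡ (0≼⊖ hn) vₛ≤) ⊞ (⊗-monoˡ l≥0 hl′) ⊞ 16 ⊠ (0≼⊗ l≥0 hc) ⊞ 8 ⊠ (0≼⊗ l≥0 (0≼⊗ hc hc)) ⊞ 240 ⊠ (0≼⊗ l≥0 hb)) (solve 5 (λ x y z u v → x :* (x :- one) :- con 6 :* (x :* x) := con 8 :* (y :- one) :* ((x :+ z) :* (x :+ z) :+ u :* con 6 :* (one :+ con 4 :* x)) :+ con 2 :* (x :* x) :+ con 8 :* (y :* (con 2 :* v :+ con 4 :* z :* x)) :+ con 8 :* ((y :- one) :* (x :* x :+ (con 2 :* z :+ z :* z :+ con 30 :* u) :* x)) :+ x :* x :+ con 16 :* (x :* z) :+ con 8 :* (x :* (z :* z)) :+ con 240 :* (x :* u) :- (con 16 :* y :* v :+ con 8 :* (y :* (x :* x)) :+ con 8 :* ((y :- one) :* ((x :+ z) :* (x :+ z) :+ u :* con 6 :* (one :+ con 4 :* x))) :+ x :* (con 32 :* y :* z :+ con 8 :* y :* (con 2 :* z :+ z :* z :+ con 30 :* u) :+ one) :+ con 16 :* con 0 :+ con 8 :* con 0 :+ con 240 :* con 0)) refl _ _ _ _ _))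

        impossible : Sκf ≼ neg 1# → ⊥
        impossible hσ = shortfall N C Bq (ℓ y) (P (κ q) y) Sκf 1≼N C≥0 B≥0 1≼L hσ -N≤Sκf (Pκ-lower y hy y≤X) summed L≥W₁

        nonneg : (Σ ℕ λ a → Σ ℕ λ b → Sκf ≡ ι a ⊖ ι b) → 0# ≼ Sκf
        nonneg (a , b , e) = [ (λ b≤a → (linear (≼-reflexive (sym e) ⊞ (ι-mono b≤a)) (solve 3 (λ x y z → x :- con 0 := x :+ y :- (y :- z :+ z)) refl _ _ _))) , (λ a≤b → cases (a ≟ b) a≤b) ]′ (ℕ.≤-total b a)
          where
          cases : Dec (a ≡ b) → a ≤ b → 0# ≼ Sκf
          cases (yes refl) _ = (linear (≼-reflexive (sym e)) (solve 2 (λ x y → x :- con 0 := x :- (y :- y)) refl _ _))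
          cases (no ne) a≤b = ⊥-elim (impossible ((linear (≼-reflexive e ⊞ (ι-mono (ℕ.≤∧≢⇒< a≤b ne))) (solve 3 (λ x y z → :- one :- x := y :- z :+ z :- (x :+ (one :+ y))) refl _ _ _))))

      V-large : ∀ k → f k ≡ 1# → ℓ y ≼ D₈ ⊗ V (cls k) y
      V-large k e = ⊗-cancel 1≼L (≼-trans (f-large k e) (≼-trans (⊗-monoˡ D≥0 p≤) (≼-reflexive (⊗-left _ _ _))))
        where
        p≤ : p k ≼ ℓ y ⊗ V (cls k) y
        p≤ = ≼-trans (S-mono y λ n h l → ≼-trans (⊗-monoˡ (0≼𝟙 (n ≈? k)) (⊗-monoˡ (0≼u n h) (ℓ-mono h l y≤X))) (≼-reflexive (rotate _ _ _))) (≼-reflexive (S-⊗ˡ y (ℓ y) _))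
          where
          rotate : ∀ a b c → a ⊗ (b ⊗ c) ≡ c ⊗ (a ⊗ b)
          rotate a b c = (solve 3 (λ x y z → x :* (y :* z) := z :* (x :* y)) refl _ _ _)

      -- For d, m, n ≤ y the product is at most y³ = x and lies in the class of r, so every term on
      -- the left occurs in `T₃`, whose other terms are nonnegative.
      VVV≤T : ∀ a b c → a * b * c ≈ r → V (cls a) y ⊗ (V (cls b) y ⊗ V (cls c) y) ≼ T₃ (cls r) x
      VVV≤T a b c e = ≼-trans (≼-reflexive (sym (S-⊗ʳ y _ _))) (≼-trans (S-mono y row) (S-mono-range _ (≤*ʳ y (1≤* hy hy)) λ d h _ → 0≼T (ℕ.≤-trans (s≤s z≤n) h)))
        where
        0≼T : ∀ {d} → 1 ≤ d → 0# ≼ u d ⊗ Q (λ n → cls r (d * n)) (x div d)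
        0≼T {d} hd = 0≼⊗ (0≼u d hd) (0≼S (x div d) λ m hm _ → 0≼S (x div d) λ n hn _ → 0≼⊗ (0≼𝟙 (m * n ≤? x div d)) (0≼⊗ (0≼𝟙 (d * (m * n) ≈? r)) (0≼⊗ (0≼u m hm) (0≼u n hn))))

        row : ∀ d → 1 ≤ d → d ≤ y → cls a d ⊗ u d ⊗ (V (cls b) y ⊗ V (cls c) y) ≼ u d ⊗ Q (λ n → cls r (d * n)) (x div d)
        row d hd hdy = ≼-trans (≼-reflexive (move _ _ _)) (⊗-monoˡ (0≼u d hd) (≼-trans (≼-reflexive (trans (cong (cls a d ⊗_) (sym (S-⊗ʳ y _ _))) (sym (S-⊗ˡ y _ _))))
            (≼-trans (S-mono y inner) (S-mono-range _ y≤z λ m hm _ → 0≼S z λ n hn _ → 0≼F m n (ℕ.≤-trans (s≤s z≤n) hm) hn))))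
          where
          z = x div d

          move : ∀ a b c → a ⊗ b ⊗ c ≡ b ⊗ (a ⊗ c)
          move a b c = (solve 3 (λ x y z → x :* y :* z := y :* (x :* z)) refl _ _ _)

          y²≤z : y * y ≤ z
          y²≤z = ⇒≤div x d hd (ℕ.≤-trans (ℕ.*-monoˡ-≤ (y * y) hdy) (ℕ.≤-reflexive (ℕ.*-comm y (y * y))))

          y≤z : y ≤ z
          y≤z = ℕ.≤-trans (≤*ˡ y hy) y²≤z

          F : ℕ → ℕ → K
          F m n = 𝟙 (m * n ≤? z) ⊗ (cls r (d * (m * n)) ⊗ (u m ⊗ u n))

          0≼F : ∀ m n → 1 ≤ m → 1 ≤ n → 0# ≼ F m n
          0≼F m n hm hn = 0≼⊗ (0≼𝟙 (m * n ≤? z)) (0≼⊗ (0≼𝟙 (d * (m * n) ≈? r)) (0≼⊗ (0≼u m hm) (0≼u n hn)))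

          inner : ∀ m → 1 ≤ m → m ≤ y → cls a d ⊗ (cls b m ⊗ u m ⊗ V (cls c) y) ≼ S z (F m)
          inner m hm hmy = ≼-trans (≼-reflexive (trans (sym (⊗-assoc _ _ _)) (sym (S-⊗ˡ y _ _)))) (≼-trans (S-mono y cell) (S-mono-range (F m) y≤z λ n hn _ → 0≼F m n hm (ℕ.≤-trans (s≤s z≤n) hn)))
            where
            cell : ∀ n → 1 ≤ n → n ≤ y → cls a d ⊗ (cls b m ⊗ u m) ⊗ (cls c n ⊗ u n) ≼ F m n
            cell n hn hny = ≼-trans (≼-reflexive (gather _ _ _ _ _)) (≼-trans (⊗-monoʳ (0≼⊗ (0≼u m hm) (0≼u n hn)) indicators)
                (≼-reflexive (sym (trans (cong (_⊗ (cls r (d * (m * n)) ⊗ (u m ⊗ u n))) (𝟙-yes (m * n ≤? z) (ℕ.≤-trans (ℕ.*-mono-≤ hmy hny) y²≤z))) (⊗-identityˡ _)))))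
              where
              gather : ∀ a b c d e → a ⊗ (b ⊗ d) ⊗ (c ⊗ e) ≡ a ⊗ (b ⊗ c) ⊗ (d ⊗ e)
              gather a b c d e = (solve 5 (λ x y z u v → x :* (y :* z) :* (u :* v) := x :* (y :* u) :* (z :* v)) refl _ _ _ _ _)

              indicators : cls a d ⊗ (cls b m ⊗ cls c n) ≼ cls r (d * (m * n))
              indicators = ≼-trans (𝟙-guard-≼ (d ≈? a) λ da → ≼-trans (𝟙-guard-≼ (m ≈? b) λ mb → 𝟙-≼ (n ≈? c) (d * (m * n) ≈? r) λ nc →
                  trans (≈-* {d} {a} {m * n} {b * c} da (≈-* {m} {b} {n} {c} mb nc)) (trans (cong (_% q) (sym (ℕ.*-assoc a b c))) e))
                (drop (m ≈? b))) (drop (d ≈? a))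
                where
                drop : ∀ {P : Set} (t : Dec P) → 𝟙 t ⊗ cls r (d * (m * n)) ≼ cls r (d * (m * n))
                drop t = ≼-trans (⊗-monoʳ (0≼𝟙 (d * (m * n) ≈? r)) (𝟙≼1 t)) (≼-reflexive (⊗-identityˡ _))

      -- Three dense classes with product r would give ℓ³ ≤ D₈³ T₃, whereas `triple-bound` allows T₃
      -- only the order ℓ²; the absence of primes in the class of r enters here. The 9 in W₂ is the
      -- square in ℓ(y³)² = 9ℓ(y)².
      avoid : ∀ a b c → Coprime a q → Coprime b q → Coprime c q → a * b * c ≈ r → f a ≡ 1# → f b ≡ 1# → f c ≡ 1# → ⊥
      avoid a b c _ _ _ e fa fb fc = overflow N D₈ (ℓ y) A₁ (T₃ (cls r) x) 1≼N D≥0 1≼L cube bound L≥W₂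
        where
        cube : ℓ y ⊗ (ℓ y ⊗ ℓ y) ≼ D₈ ⊗ (D₈ ⊗ D₈) ⊗ T₃ (cls r) x
        cube = ≼-trans (⊗-mono 0≼L (V-large a fa) (0≼⊗ 0≼L 0≼L) (⊗-mono 0≼L (V-large b fb) 0≼L (V-large c fc)))
          (≼-trans (≼-reflexive (collect D₈ _ _ _)) (⊗-monoˡ (0≼⊗ D≥0 (0≼⊗ D≥0 D≥0)) (VVV≤T a b c e)))
          where
          collect : ∀ d v w z → (d ⊗ v) ⊗ ((d ⊗ w) ⊗ (d ⊗ z)) ≡ d ⊗ (d ⊗ d) ⊗ (v ⊗ (w ⊗ z))
          collect d v w z = (solve 4 (λ x y z u → x :* y :* (x :* z :* (x :* u)) := x :* (x :* x) :* (y :* (z :* u))) refl _ _ _ _)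

        ℓx : ℓ x ≡ ι 3 ⊗ ℓ y
        ℓx = trans (ℓ-* (y * y) y (1≤* hy hy) hy) (trans (cong (_⊕ ℓ y) (ℓ-* y y hy hy)) (solve 1 (λ x → x :+ x :+ x := con 3 :* x) refl _))

        bound : ι 2 ⊗ N ⊗ T₃ (cls r) x ≼ (ι 3 ⊗ ℓ y) ⊗ (ι 3 ⊗ ℓ y) ⊗ A₁
        bound = ≼-trans (triple-bound (cls r) N Bq x N≥0 B≥0 hx (ℕ.n<1+n x) (λ n → 0≼𝟙 (n ≈? r)) (λ n → 𝟙≼1 (n ≈? r)) (λ d n → cls-κ r d n cr)
            (λ d cd → mean-zero r d cr cd) (λ p pr p≤x → 𝟙-no (p ≈? r) (none p pr p≤x)))
          (≼-trans (quadratic (ℓ x) C N Bq (subst (1# ≼_) (sym ℓx) ((linear ((3 ⊠ 1≼L) ⊞ 2 ⊠ 0≼1) (solve 1 (λ x → con 3 :* x :- one := con 3 :* x :+ con 2 :* one :- (con 3 :* one :+ con 2 :* con 0)) refl _)))) C≥0 B≥0) (≼-reflexive (cong (λ z → z ⊗ z ⊗ A₁) ℓx)))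

        overflow : ∀ n d l a t → 1# ≼ n → 0# ≼ d → 1# ≼ l → l ⊗ (l ⊗ l) ≼ d ⊗ (d ⊗ d) ⊗ t → ι 2 ⊗ n ⊗ t ≼ (ι 3 ⊗ l) ⊗ (ι 3 ⊗ l) ⊗ a →
          d ⊗ (d ⊗ d) ⊗ (ι 9 ⊗ a) ⊕ 1# ≼ l → ⊥
        overflow n d l a t hn hd hl h₁ h₂ h₃ = 1⋠0 (⊗-cancel l²≥1 ((linear (2 ⊠ (⊗-monoˡ n≥0 h₁) ⊞ (⊗-monoˡ d³≥0 h₂) ⊞ (⊗-monoˡ l²≥0 h₃) ⊞ 2 ⊠ (mul≼ hn l³≥0) ⊞ l³≥0) (solve 5 (λ x y z u v → x :* x :* con 0 :- x :* x :* one := con 2 :* (y :* (z :* (z :* z) :* u)) :+ z :* (z :* z) :* (con 3 :* x :* (con 3 :* x) :* v) :+ x :* x :* x :+ con 2 :* ((y :- one) :* (x :* (x :* x) :- con 0)) :+ x :* (x :* x) :- (con 2 :* (y :* (x :* (x :* x))) :+ z :* (z :* z) :* (con 2 :* y :* u) :+ x :* x :* (z :* (z :* z) :* (con 9 :* v) :+ one) :+ con 2 :* con 0 :+ con 0)) refl _ _ _ _ _))))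
          where
          n≥0 : 0# ≼ n
          n≥0 = ≼-trans 0≼1 hn

          l≥0 : 0# ≼ l
          l≥0 = ≼-trans 0≼1 hl

          l²≥0 : 0# ≼ l ⊗ l
          l²≥0 = 0≼⊗ l≥0 l≥0

          l²≥1 : 1# ≼ l ⊗ l
          l²≥1 = (linear ((mul≼ hl hl) ⊞ 2 ⊠ hl) (solve 1 (λ x → x :* x :- one := (x :- one) :* (x :- one) :+ con 2 :* x :- (con 0 :+ con 2 :* one)) refl _))

          l³≥0 : 0# ≼ l ⊗ (l ⊗ l)
          l³≥0 = 0≼⊗ l≥0 l²≥0

          d³≥0 : 0# ≼ d ⊗ (d ⊗ d)
          d³≥0 = 0≼⊗ hd (0≼⊗ hd hd)

      open Coset r cr f f-≈ f-sign avoid half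

      Pχ-Bd : Bd (P χf y) (ι 2 ⊗ ι (characterBound q) ⊗ ℓ y)
      Pχ-Bd = Bd-≡ (S-cong y λ n _ _ → sym (⊗-assoc _ _ _)) (S-abel-inc y (λ n → χf n ⊗ u n) ℓ (ι (characterBound q)) (0≼ι (characterBound q))
        (λ t h → CharacterSum.Vχ-Bd lg q 1≤q character t (ℕ.≤-trans h y≤X)) (λ n h l → (linear ((0≼ℓ-step n h (ℕ.<-≤-trans l y≤X))) (solve 2 (λ x y → x :- y := x :- y :- con 0) refl _ _))) (λ n h l → 0≼ℓ h (ℕ.≤-trans l y≤X)) hy)

      -- Σ κfp differs from the total mass by at most twice the mass of the sparse classes, 2N ·
      -- ℓ²/(8N²), so it is at least about ℓ²/4. Up to the sign f(1) it is also P(χ), which is O(ℓ)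
      -- by `Pχ-Bd`.
      absurd : ⊥
      absurd = clash N C (ι (characterBound q)) (ℓ y) (P (κ q) y) Σfp (f 1) 1≼N C≥0 (0≼ι (characterBound q)) 1≼L (f-sign 1) (Pκ-lower y hy y≤X) lower
          (subst (λ z → Bd z (ι 2 ⊗ ι (characterBound q) ⊗ ℓ y)) Pχ-sum Pχ-Bd) L≥W₃
        where
        Σfp : K
        Σfp = S q λ k → κ q k ⊗ (f k ⊗ p k)

        Pχ-sum : P χf y ≡ f 1 ⊗ Σfp
        Pχ-sum = trans (P-class χf λ {m} {n} e → cong₂ (λ a b → a ⊗ (f 1 ⊗ b)) (κ-≈ {m} {n} e) (f-≈ {m} {n} e))
          (trans (S-cong q λ k _ _ → regroup _ _ _ _) (S-⊗ˡ q (f 1) _))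
          where
          regroup : ∀ a b c d → a ⊗ (b ⊗ c) ⊗ d ≡ b ⊗ (a ⊗ (c ⊗ d))
          regroup a b c d = (solve 4 (λ x y z u → x :* (y :* z) :* u := y :* (x :* (z :* u))) refl _ _ _ _)

        lower : D₈ ⊗ P (κ q) y ⊖ ι 2 ⊗ (ℓ y ⊗ ℓ y) ⊗ N ≼ D₈ ⊗ Σfp
        lower = ≼-trans (≼-reflexive (trans (cong₂ _⊖_ (trans (cong (D₈ ⊗_) Pκ-sum) (sym (S-⊗ˡ q _ _))) (sym (S-⊗ˡ q _ _))) (sym (S-⊖ q _ _))))
            (≼-trans (S-mono q λ k _ _ → ≼-trans (≼-reflexive (factor _ _ _ _)) (≼-trans (⊗-monoˡ (0≼𝟙 (isCoprime? k q)) (term k (f-cases k))) (≼-reflexive (⊗-left _ _ _)))) (≼-reflexive (S-⊗ˡ q D₈ _)))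
          where
          factor : ∀ d κ π l → d ⊗ (κ ⊗ π) ⊖ ι 2 ⊗ l ⊗ κ ≡ κ ⊗ (d ⊗ π ⊖ ι 2 ⊗ l)
          factor d κ π l = (solve 4 (λ x y z u → x :* (y :* z) :- con 2 :* u :* y := y :* (x :* z :- con 2 :* u)) refl _ _ _ _)

          generic : ∀ d π l φ → 0# ≼ l → (φ ≡ 1# × l ≼ d ⊗ π) ⊎ (φ ≡ neg 1# × d ⊗ π ≼ l) → d ⊗ π ⊖ ι 2 ⊗ l ≼ d ⊗ (φ ⊗ π)
          generic d π l φ hl (inj₁ (refl , _)) = (linear (2 ⊠ hl) (solve 3 (λ x y z → x :* (one :* y) :- (x :* y :- con 2 :* z) := con 2 :* z :- con 2 :* con 0) refl _ _ _))
          generic d π l φ hl (inj₂ (refl , h)) = (linear (2 ⊠ h) (solve 3 (λ x y z → x :* ((:- one) :* y) :- (x :* y :- con 2 :* z) := con 2 :* z :- con 2 :* (x :* y)) refl _ _ _))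

          term : ∀ k → (f k ≡ 1# × ℓ y ⊗ ℓ y ≼ D₈ ⊗ p k) ⊎ (f k ≡ neg 1# × D₈ ⊗ p k ≼ ℓ y ⊗ ℓ y) → D₈ ⊗ p k ⊖ ι 2 ⊗ (ℓ y ⊗ ℓ y) ≼ D₈ ⊗ (f k ⊗ p k)
          term k = generic D₈ (p k) (ℓ y ⊗ ℓ y) (f k) (0≼⊗ 0≼L 0≼L)

        clash : ∀ n c w l π s φ → 1# ≼ n → 0# ≼ c → 0# ≼ w → 1# ≼ l → φ ≡ 1# ⊎ φ ≡ neg 1# → l ⊗ l ≼ ι 2 ⊗ π ⊕ ι 4 ⊗ c ⊗ l →
          ι 8 ⊗ (n ⊗ n) ⊗ π ⊖ ι 2 ⊗ (l ⊗ l) ⊗ n ≼ ι 8 ⊗ (n ⊗ n) ⊗ s → Bd (φ ⊗ s) (ι 2 ⊗ w ⊗ l) → ι 8 ⊗ (c ⊕ w) ⊕ 1# ≼ l → ⊥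
        clash n c w l π s φ hn hc hw hl hφ hπ h hs hl′ = 1⋠0 (⊗-cancel hl (⊗-cancel hn ((linear′ 1 (reduced ⊞ (8 ⊠ ⊗-monoˡ n≥0 (s≤ hφ hs)) ⊞ (4 ⊠ ⊗-monoˡ n≥0 hπ) ⊞ (2 ⊠ ⊗-monoˡ n≥0 (⊗-monoˡ l≥0 hl′)) ⊞ (2 ⊠ mul≼ hn (0≼⊗ l≥0 l≥0))) (solve 6 (λ x y z u v w → con 2 :* (x :* (y :* con 0) :- x :* (y :* one)) := con 8 :* x :* z :+ con 8 :* (x :* (con 2 :* u :* y)) :+ con 4 :* (x :* (con 2 :* v :+ con 4 :* w :* y)) :+ con 2 :* (x :* (y :* y)) :+ con 2 :* ((x :- one) :* (y :* y :- con 0)) :- (con 8 :* x :* v :- con 2 :* (y :* y) :+ con 8 :* (x :* z) :+ con 4 :* (x :* (y :* y)) :+ con 2 :* (x :* (y :* (con 8 :* (w :+ u) :+ one))) :+ con 2 :* con 0)) refl _ _ _ _ _ _)))))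
          where
          n≥0 : 0# ≼ n
          n≥0 = ≼-trans 0≼1 hn

          l≥0 : 0# ≼ l
          l≥0 = ≼-trans 0≼1 hl

          reduced : ι 8 ⊗ n ⊗ π ⊖ ι 2 ⊗ (l ⊗ l) ≼ ι 8 ⊗ n ⊗ s
          reduced = ⊗-cancel hn ((linear (h) (solve 4 (λ x y z u → x :* (con 8 :* x :* y) :- x :* (con 8 :* x :* z :- con 2 :* (u :* u)) := con 8 :* (x :* x) :* y :- (con 8 :* (x :* x) :* z :- con 2 :* (u :* u) :* x)) refl _ _ _ _)))

          s≤ : ∀ {φ} → φ ≡ 1# ⊎ φ ≡ neg 1# → Bd (φ ⊗ s) (ι 2 ⊗ w ⊗ l) → s ≼ ι 2 ⊗ w ⊗ l
          s≤ (inj₁ refl) (_ , u) = (linear (u) (solve 3 (λ x y z → con 2 :* x :* y :- z := con 2 :* x :* y :- one :* z) refl _ _ _))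
          s≤ (inj₂ refl) (v , _) = (linear (v) (solve 3 (λ x y z → con 2 :* x :* y :- z := (:- one) :* z :- (:- (con 2 :* x :* y))) refl _ _ _))

  dirichlet : ∃ λ p → Prime p × p % q ≡ r % q
  dirichlet = conclude (search x)
    where
    n : ℕ
    n = proj₁ nat-W

    -- 8ℓ(2) ≥ 1 holds for every cutoff, so y can be chosen before `lg` is built for a cutoff that
    -- depends on y: ℓ(y) = (8n + 1)ℓ(2) ≥ n, and n is `W`.
    y x : ℕ
    y = 2 ^ suc (8 * n)
    x = y * y * y

    lg : Log (suc x)
    lg = mkLog (suc x)

    open Selberg lg

    1≤2^ : ∀ j → 1 ≤ 2 ^ j
    1≤2^ j = ℕ.≤-trans (s≤s z≤n) (k<p^k 2 j ℕ.≤-refl)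

    ℓ-2^ : ∀ j → ℓ (2 ^ j) ≡ ι j ⊗ ℓ 2
    ℓ-2^ zero = trans ℓ-1 (sym (⊗-zeroˡ _))
    ℓ-2^ (suc j) = trans (ℓ-* 2 (2 ^ j) (s≤s z≤n) (1≤2^ j)) (trans (cong (ℓ 2 ⊕_) (ℓ-2^ j)) (solve 2 (λ x y → x :+ y :* x := (one :+ y) :* x) refl _ _))

    2≤y : 2 ≤ y
    2≤y = ≤*ˡ 2 (1≤2^ (8 * n))

    2≤X : 2 ≤ suc x
    2≤X = ℕ.≤-trans 2≤y (ℕ.m≤n⇒m≤1+n (≤*ʳ y (1≤* (1≤2^ (suc (8 * n))) (1≤2^ (suc (8 * n))))))

    large : W ≼ ℓ y
    large = ≼-trans (≼-reflexive (proj₂ nat-W)) (grow (ℓ-2^ (suc (8 * n))) (1≼8ℓ 2 ℕ.≤-refl 2≤X) (ι-* 8 n))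
      where
      grow : ∀ {e} → e ≡ ι (suc (8 * n)) ⊗ ℓ 2 → 1# ≼ ι 8 ⊗ ℓ 2 → ι (8 * n) ≡ ι 8 ⊗ ι n → ι n ≼ e
      grow e₁ h e₂ = (linear′ 7 (8 ⊠ (≼-reflexive (sym e₁)) ⊞ 8 ⊠ (⊗-monoˡ (0≼ι n) h) ⊞ 8 ⊠ (≼-reflexive (sym (ℓ 2 ⊠≡ e₂))) ⊞ h ⊞ 0≼1) (solve 4 (λ x y z u → con 8 :* (x :- y) := con 8 :* x :+ con 8 :* (y :* (con 8 :* z)) :+ con 8 :* (z :* u) :+ con 8 :* z :+ one :- (con 8 :* ((one :+ u) :* z) :+ con 8 :* (y :* one) :+ con 8 :* (z :* (con 8 :* y)) :+ one :+ con 0)) refl _ _ _ _))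

    search : ∀ t → (∃ λ p → Prime p × p ≈ r) ⊎ (∀ p → Prime p → p ≤ t → ¬ p ≈ r)
    search zero = inj₂ λ p pr h → ⊥-elim (ℕ.<⇒≱ (prime≥1 pr) h)
    search (suc t) with search t | isPrime? (suc t) | suc t ≈? r
    ... | inj₁ w | _ | _ = inj₁ w
    ... | inj₂ _ | yes pr | yes e = inj₁ (suc t , pr , e)
    ... | inj₂ h | no np | _ = inj₂ λ p pr l e → h p pr (ℕ.≤-pred (ℕ.≤∧≢⇒< l λ { refl → np pr })) e
    ... | inj₂ h | yes _ | no ne = inj₂ λ p pr l e → h p pr (ℕ.≤-pred (ℕ.≤∧≢⇒< l λ { refl → ne e })) e

    conclude : (∃ λ p → Prime p × p ≈ r) ⊎ (∀ p → Prime p → p ≤ x → ¬ p ≈ r) → ∃ λ p → Prime p × p % q ≡ r % q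
    conclude (inj₁ w) = w
    conclude (inj₂ none) = ⊥-elim (NoPrime.absurd y lg (1≤2^ (suc (8 * n))) large none)

-- b-orderings of the primes

-- Congruences as equations in ℕ, with multiples of d added on both sides in place of a difference.
%⇒Σ : ∀ {m n} d .{{_ : NonZero d}} → m % d ≡ n % d → m + (n / d) * d ≡ n + (m / d) * d
%⇒Σ {m} {n} d h = trans (cong (_+ (n / d) * d) (m≡m%n+[m/n]*n m d)) (trans (cong (λ z → z + (m / d) * d + (n / d) * d) h)
  (trans (ℕ.+-assoc (n % d) _ _) (trans (cong (λ z → n % d + z) (ℕ.+-comm ((m / d) * d) ((n / d) * d))) (trans (sym (ℕ.+-assoc (n % d) _ _))
  (cong (_+ (m / d) * d) (sym (m≡m%n+[m/n]*n n d)))))))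

Σ⇒% : ∀ {m n} d .{{_ : NonZero d}} x y → m + x * d ≡ n + y * d → m % d ≡ n % d
Σ⇒% {m} {n} d x y h = trans (sym ([m+kn]%n≡m%n m x d)) (trans (cong (_% d) h) ([m+kn]%n≡m%n n y d))

%-coarsen : ∀ {m n} d e .{{_ : NonZero d}} .{{_ : NonZero e}} → d ∣ e → m % e ≡ n % e → m % d ≡ n % d
%-coarsen {m} {n} d e (divides c refl) h = Σ⇒% d ((n / e) * c) ((m / e) * c)
  (trans (cong (λ z → m + z) (ℕ.*-assoc (n / e) c d)) (trans (%⇒Σ {m} {n} e h) (cong (λ z → n + z) (sym (ℕ.*-assoc (m / e) c d)))))

∣∸⇒% : ∀ {m n} d .{{_ : NonZero d}} → n ≤ m → d ∣ m ∸ n → m % d ≡ n % d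
∣∸⇒% {m} {n} d h k = trans (cong (_% d) (sym (ℕ.m+[n∸m]≡n h))) (%-remove-+ʳ n k)

%⇒∣∸ : ∀ {m n} d .{{_ : NonZero d}} → m % d ≡ n % d → d ∣ m ∸ n
%⇒∣∸ {m} {n} d h = divides (m / d ∸ n / d) (trans (cong₂ _∸_ (m≡m%n+[m/n]*n m d) (trans (m≡m%n+[m/n]*n n d) (cong (_+ (n / d) * d) (sym h))))
  (trans (ℕ.[m+n]∸[m+o]≡n∸o (m % d) _ _) (sym (ℕ.*-distribʳ-∸ d (m / d) (n / d)))))

diff : ℕ → ℕ → ℕ
diff m n = ∣ + m ℤ.- + n ∣

diff-≥ : ∀ {m n} → n ≤ m → diff m n ≡ m ∸ n
diff-≥ {m} {n} h = trans (cong ∣_∣ (ℤ.m-n≡m⊖n m n)) (cong ∣_∣ (ℤ.⊖-≥ h))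

diff-≤ : ∀ {m n} → m ≤ n → diff m n ≡ n ∸ m
diff-≤ {m} {n} h = trans (cong ∣_∣ (ℤ.m-n≡m⊖n m n)) (trans (cong ∣_∣ (ℤ.⊖-≤ h)) (ℤ.∣-i∣≡∣i∣ (+ (n ∸ m))))

∣diff⇒% : ∀ {m n} d .{{_ : NonZero d}} → d ∣ diff m n → m % d ≡ n % d
∣diff⇒% {m} {n} d h with ℕ.≤-total n m
... | inj₁ n≤m = ∣∸⇒% d n≤m (subst (d ∣_) (diff-≥ n≤m) h)
... | inj₂ m≤n = sym (∣∸⇒% d m≤n (subst (d ∣_) (diff-≤ m≤n) h))

%⇒∣diff : ∀ {m n} d .{{_ : NonZero d}} → m % d ≡ n % d → d ∣ diff m n
%⇒∣diff {m} {n} d h with ℕ.≤-total n m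
... | inj₁ n≤m = subst (d ∣_) (sym (diff-≥ n≤m)) (%⇒∣∸ d h)
... | inj₂ m≤n = subst (d ∣_) (sym (diff-≤ m≤n)) (%⇒∣∸ d (sym h))

diff≡0 : ∀ {m n} → diff m n ≡ 0 → m ≡ n
diff≡0 {m} {n} h = ℤ.+-injective (ℤ.i-j≡0⇒i≡j (+ m) (+ n) (ℤ.∣i∣≡0⇒i≡0 h))

S-support : ∀ {x y} (f : ℕ → K) → (∀ n → x < n → f n ≡ 0#) → (∀ n → y < n → f n ≡ 0#) → S x f ≡ S y f
S-support {x} {y} f hx hy with ℕ.≤-total x y
... | inj₁ h = sym (S-extend f h λ n a _ → hx n a)
... | inj₂ h = S-extend f h λ n a _ → hy n a

ι-injective : ∀ {m n} → ι m ≡ ι n → m ≡ n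
ι-injective {m} {n} h with ℕ.<-cmp m n
... | tri< a _ _ = ⊥-elim (1⋠0 ((linear ((ι-mono a) ⊞ ≼-reflexive (sym h)) (solve 2 (λ x y → con 0 :- one := x :+ y :- (one :+ y :+ x)) refl _ _))))
... | tri≈ _ e _ = e
... | tri> _ _ c = ⊥-elim (1⋠0 ((linear ((ι-mono c) ⊞ ≼-reflexive h) (solve 2 (λ x y → con 0 :- one := x :+ y :- (one :+ y :+ x)) refl _ _))))

ι-reflects-≤ : ∀ {m n} → ι m ≼ ι n → m ≤ n
ι-reflects-≤ {m} {n} h with m ≤? n
... | yes l = l
... | no l = ⊥-elim (1⋠0 ((linear (h ⊞ (ι-mono (ℕ.≰⇒> l))) (solve 2 (λ x y → con 0 :- one := x :+ y :- (y :+ (one :+ x))) refl _ _))))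

ι-sum-upTo : ∀ (f : ℕ → ℕ) n → ι (sum (List.map f (upTo n))) ≡ S n (λ m → ι (f (pred m)))
ι-sum-upTo f zero = refl
ι-sum-upTo f (suc n) = trans (cong (λ z → ι (sum (List.map f z))) (sym (upTo-∷ʳ n))) (trans (cong (λ z → ι (sum z)) (map-++ f (upTo n) (n ∷ [])))
  (trans (cong ι (sum-++ (List.map f (upTo n)) (f n ∷ []))) (trans (ι-+ (sum (List.map f (upTo n))) (f n + 0))
  (cong₂ _⊕_ (ι-sum-upTo f n) (cong ι (ℕ.+-identityʳ (f n)))))))

ι-length-filter : ∀ {P : ℕ → Set} (P? : ∀ n → Dec (P n)) (g : ℕ → ℕ) n →
  ι (List.length (List.filter P? (List.map g (upTo n)))) ≡ S n (λ m → 𝟙 (P? (g (pred m))))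
ι-length-filter P? g zero = refl
ι-length-filter {P} P? g (suc n) = trans (cong (λ z → ι (List.length (List.filter P? (List.map g z)))) (sym (upTo-∷ʳ n)))
  (trans (cong (λ z → ι (List.length (List.filter P? z))) (map-++ g (upTo n) (n ∷ []))) (trans (cong (λ z → ι (List.length z)) (filter-++ P? (List.map g (upTo n)) (g n ∷ [])))
  (trans (cong ι (length-++ (List.filter P? (List.map g (upTo n))))) (trans (ι-+ (List.length (List.filter P? (List.map g (upTo n)))) _)
  (cong₂ _⊕_ (ι-length-filter P? g n) (last (P? (g n))))))))
  where
  last : Dec (P (g n)) → ι (List.length (List.filter P? (g n ∷ []))) ≡ 𝟙 (P? (g n))
  last (yes p) = trans (cong (λ z → ι (List.length z)) (filter-accept P? {xs = []} p)) (trans (⊕-identityʳ 1#) (sym (𝟙-yes (P? (g n)) p)))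
  last (no ¬p) = trans (cong (λ z → ι (List.length z)) (filter-reject P? {xs = []} ¬p)) (sym (𝟙-no (P? (g n)) ¬p))

argmin : ∀ {P : ℕ → Set} (P? : ∀ n → Dec (P n)) (c : ℕ → K) n → (∃ λ v → 1 ≤ v × v ≤ n × P v) →
  ∃ λ v → 1 ≤ v × v ≤ n × P v × (∀ w → 1 ≤ w → w ≤ n → P w → c v ≼ c w)
argmin {P} P? c zero (v , a , b , _) = ⊥-elim (ℕ.<⇒≱ a b)
argmin {P} P? c (suc n) (v , a , b , pv) = go (search n) (P? (suc n))
  where
  search : ∀ n → (∃ λ v → 1 ≤ v × v ≤ n × P v) ⊎ (∀ w → 1 ≤ w → w ≤ n → ¬ P w)
  search zero = inj₂ λ w h l → ⊥-elim (ℕ.<⇒≱ h l)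
  search (suc n) with search n | P? (suc n)
  ... | inj₁ (v , a , b , pv) | _ = inj₁ (v , a , ℕ.m≤n⇒m≤1+n b , pv)
  ... | inj₂ _ | yes p = inj₁ (suc n , s≤s z≤n , ℕ.≤-refl , p)
  ... | inj₂ h | no np = inj₂ λ w hw l pw → [ (λ w≤n → h w hw w≤n pw) , (λ { refl → np pw }) ]′ (split l)
    where
    split : ∀ {w} → w ≤ suc n → w ≤ n ⊎ w ≡ suc n
    split {w} l with w ≟ suc n
    ... | yes e = inj₂ e
    ... | no ne = inj₁ (ℕ.≤-pred (ℕ.≤∧≢⇒< l ne))

  below : ∀ {w} → w ≤ suc n → w ≢ suc n → w ≤ n
  below l ne = ℕ.≤-pred (ℕ.≤∧≢⇒< l ne)

  Result : Set
  Result = ∃ λ v → 1 ≤ v × v ≤ suc n × P v × (∀ w → 1 ≤ w → w ≤ suc n → P w → c v ≼ c w)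

  go : (∃ λ v → 1 ≤ v × v ≤ n × P v) ⊎ (∀ w → 1 ≤ w → w ≤ n → ¬ P w) → Dec (P (suc n)) → Result
  go (inj₂ h) (no np) = ⊥-elim (at (v ≟ suc n))
    where
    at : Dec (v ≡ suc n) → ⊥
    at (yes refl) = np pv
    at (no ne) = h v a (below b ne) pv
  go (inj₂ h) (yes p) = suc n , s≤s z≤n , ℕ.≤-refl , p , min
    where
    min : ∀ w → 1 ≤ w → w ≤ suc n → P w → c (suc n) ≼ c w
    min w hw l pw with w ≟ suc n
    ... | yes refl = ≼-refl
    ... | no ne = ⊥-elim (h w hw (below l ne) pw)
  go (inj₁ e) d with argmin P? c n e
  ... | u , hu , lu , pu , mu = compare d (≼-total (c u) (c (suc n)))
    where
    compare : Dec (P (suc n)) → c u ≼ c (suc n) ⊎ c (suc n) ≼ c u → Result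
    compare (no np) _ = u , hu , ℕ.m≤n⇒m≤1+n lu , pu , min
      where
      min : ∀ w → 1 ≤ w → w ≤ suc n → P w → c u ≼ c w
      min w hw l pw with w ≟ suc n
      ... | yes refl = ⊥-elim (np pw)
      ... | no ne = mu w hw (below l ne) pw
    compare (yes p) (inj₁ le) = u , hu , ℕ.m≤n⇒m≤1+n lu , pu , min
      where
      min : ∀ w → 1 ≤ w → w ≤ suc n → P w → c u ≼ c w
      min w hw l pw with w ≟ suc n
      ... | yes refl = le
      ... | no ne = mu w hw (below l ne) pw
    compare (yes p) (inj₂ ge) = suc n , s≤s z≤n , ℕ.≤-refl , p , min
      where
      min : ∀ w → 1 ≤ w → w ≤ suc n → P w → c (suc n) ≼ c w
      min w hw l pw with w ≟ suc n
      ... | yes refl = ≼-refl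
      ... | no ne = ≼-trans ge (mu w hw (below l ne) pw)

div-small : ∀ {s d} → s < d → s div d ≡ 0
div-small {s} {suc d} h = m<n⇒m/n≡0 h

coprime-or-∣ : ∀ {p} b → Prime p → Coprime p b ⊎ p ∣ b
coprime-or-∣ {p} b pr with p ∣? b
... | yes h = inj₂ h
... | no h = inj₁ λ { {d} (d∣p , d∣b) → [ (λ e → e) , (λ { refl → ⊥-elim (h d∣b) }) ]′ (prime⇒irreducible pr d∣p) }

¬coprime-∣ : ∀ {p b} → Prime p → p ∣ b → ¬ Coprime p b
¬coprime-∣ pr h co = ℕ.<⇒≢ (prime≥2 pr) (sym (co (∣-refl , h)))

-- c² lies above its tangent through the integer points t and t + 1.
tangent : ∀ {c t} → IsNat c → IsNat t → (ι 2 ⊗ t ⊕ 1#) ⊗ c ⊖ t ⊗ (t ⊕ 1#) ≼ c ⊗ c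
tangent (m , refl) (n , refl) with m ≤? n
... | yes h = (linear ((mul≼ (ι-mono h) (ι-mono (s≤s h))) ⊞ (ι-mono h)) (solve 2 (λ x y → x :* x :- (((one :+ (one :+ con 0)) :* y :+ one) :* x :+ (:- (y :* (y :+ one)))) := (y :- x) :* (one :+ y :- (one :+ x)) :+ y :- (con 0 :+ x)) refl _ _))
... | no h = (linear ((mul≼ (ι-mono (ℕ.≰⇒> h)) (ι-mono (ℕ.≰⇒> h))) ⊞ (ι-mono (ℕ.≰⇒> h))) (solve 2 (λ x y → x :* x :- (((one :+ (one :+ con 0)) :* y :+ one) :* x :+ (:- (y :* (y :+ one)))) := (x :- (one :+ y)) :* (x :- (one :+ y)) :+ x :- (con 0 :+ (one :+ y))) refl _ _))

S-distinct : ∀ (P : ℕ → ℕ) x p → (∀ i j → 1 ≤ i → i < j → j ≤ x → P j ≢ P i) → S x (λ i → 𝟙 (P i ≟ p)) ≼ 1#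
S-distinct P zero p h = 0≼1
S-distinct P (suc x) p h = cases (P (suc x) ≟ p)
  where
  cases : Dec (P (suc x) ≡ p) → S x (λ i → 𝟙 (P i ≟ p)) ⊕ 𝟙 (P (suc x) ≟ p) ≼ 1#
  cases (yes e) = (linear (≼-reflexive (S-zero x (λ i hi l → 𝟙-no (P i ≟ p) λ e′ → h i (suc x) hi (s≤s l) ℕ.≤-refl (trans e (sym e′)))) ⊞ (𝟙≼1 (P (suc x) ≟ p))) (solve 2 (λ x y → one :- (x :+ y) := con 0 :+ one :- (x :+ y)) refl _ _))
  cases (no ne) = (linear ((S-distinct P x p (λ i j hi l m → h i j hi l (ℕ.m≤n⇒m≤1+n m))) ⊞ ≼-reflexive (𝟙-no (P (suc x) ≟ p) ne)) (solve 2 (λ x y → one :- (x :+ y) := one :+ con 0 :- (x :+ y)) refl _ _))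

S-triangle : ∀ x (F : ℕ → ℕ → K) → (∀ m n → F m n ≡ F n m) →
  S x (λ m → S x (F m)) ≡ ι 2 ⊗ S x (λ m → S (pred m) (F m)) ⊕ S x (λ m → F m m)
S-triangle zero F h = (solve 0 (con 0 := con 2 :* con 0 :+ con 0) refl)
S-triangle (suc x) F h = (linear-≡ (S-⊕ x (λ m → S x (F m)) (λ m → F m (suc x)) ⊞≡ S-triangle x F h ⊞≡ S-cong x (λ m _ _ → h m (suc x))) (solve 7 (λ x y z u v w a → con 2 :* (x :+ y) :+ (z :+ u) :- (v :+ (y :+ u)) := w :+ a :+ (con 2 :* x :+ z) :+ y :- (v :+ w :+ a)) refl _ _ _ _ _ _ _))

-- Sealed copies, so that φ, ω and alphaFormula are not unfolded to list computations.
opaque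
  Φ Ω : ℕ → ℕ
  Φ = φ
  Ω = ω

  formula : ℕ → ℕ → ℕ
  formula = alphaFormula

  Φ≡φ : ∀ b → Φ b ≡ φ b
  Φ≡φ b = refl

  Ω≡ω : ∀ b → Ω b ≡ ω b
  Ω≡ω b = refl

  formula≡alphaFormula : ∀ b k → formula b k ≡ alphaFormula b k
  formula≡alphaFormula b k = refl

-- Residue classes mod powers of b, and the order as a count of levels

module Levels (b : ℕ) (hb : 2 ≤ b) where
  1≤b : 1 ≤ b
  1≤b = ℕ.≤-trans (s≤s z≤n) hb

  nzb : NonZero b
  nzb = >-nonZero 1≤b

  nz^ : ∀ j → NonZero (b ^ j)
  nz^ j = >-nonZero (ℕ.≤-trans (s≤s z≤n) (k<p^k b j hb))

  module At (j : ℕ) = Residues (b ^ j) {{nz^ j}}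

  Same : ℕ → ℕ → ℕ → Set
  Same j m n = At._≈_ j m n

  E : ℕ → ℕ → ℕ → K
  E j v m = At.cls j v m

  Same-≤ : ∀ {i j m n} → i ≤ j → Same j m n → Same i m n
  Same-≤ {i} {j} {m} {n} h = %-coarsen {m} {n} (b ^ i) (b ^ j) {{nz^ i}} {{nz^ j}} (divides (b ^ (j ∸ i)) (trans (cong (b ^_) (sym (ℕ.m∸n+n≡m h))) (ℕ.^-distribˡ-+-* b (j ∸ i) i)))

  Same-b : ∀ {j m n} → 1 ≤ j → Same j m n → _%_ m b {{nzb}} ≡ _%_ n b {{nzb}}
  Same-b {suc j} {m} {n} _ = %-coarsen {m} {n} b (b ^ suc j) {{nzb}} {{nz^ (suc j)}} (m∣m*n (b ^ j))

  Same-coprime : ∀ {j m n} → 1 ≤ j → Same j m n → Coprime m b → Coprime n b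
  Same-coprime {j} {m} {n} h s = Residues.≈-coprime b {{nzb}} {m} {n} (Same-b {j} {m} {n} h s)

  κ-Same : ∀ {j m n} → 1 ≤ j → Same j m n → κ b m ≡ κ b n
  κ-Same {j} {m} {n} h s = Residues.κ-≈ b {{nzb}} {m} {n} (Same-b {j} {m} {n} h s)

  E-cong : ∀ j {v w} m → Same j v w → E j v m ≡ E j w m
  E-cong j {v} {w} m h = 𝟙-cong (At._≈?_ j m v) (At._≈?_ j m w) (λ e → trans e h) (λ e → trans e (sym h))

  -- φ(b^j) for j ≥ 1, the number of unit classes at level j. Level j belongs to the summand m = j -
  -- 1 of the formula.
  size : ℕ → ℕ
  size j = b ^ pred j * Φ b

  φ-count : ι (Φ b) ≡ S b (κ b)
  φ-count = trans (cong ι (Φ≡φ b)) (trans (ι-length-filter (λ m → coprime? m b) suc b) (S-cong b λ { (suc m) _ _ → 𝟙-cong (coprime? (suc m) b) (isCoprime? (suc m) b) (λ z → z) (λ z → z) }))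

  1≤Φ : 1 ≤ Φ b
  1≤Φ = ι-reflects-≤ (≼-trans (≼-reflexive (⊕-identityʳ 1#)) (≼-trans (Residues.1≼N b {{nzb}}) (≼-reflexive (sym φ-count))))

  size-count : ∀ j → 1 ≤ j → S (b ^ j) (κ b) ≡ ι (size j)
  size-count (suc j) _ = trans (cong (λ z → S z (κ b)) (ℕ.*-comm b (b ^ j))) (trans (blocks (b ^ j)) (sym (ι-* (b ^ j) (Φ b))))
    where
    blocks : ∀ n → S (n * b) (κ b) ≡ ι n ⊗ ι (Φ b)
    blocks zero = sym (⊗-zeroˡ _)
    blocks (suc n) = trans (S-split b (n * b) (κ b)) (trans (cong₂ _⊕_ (sym φ-count) (trans (S-cong (n * b) λ m _ _ →
      Residues.κ-≈ b {{nzb}} {b + m} {m} (trans (cong (λ z → _%_ z b {{nzb}}) (ℕ.+-comm b m)) ([m+n]%n≡m%n m b {{nzb}}))) (blocks n))) (solve 2 (λ x y → x :+ y :* x := (one :+ y) :* x) refl _ _))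

  1≤size : ∀ j → 1 ≤ size j
  1≤size j = 1≤* (ℕ.≤-trans (s≤s z≤n) (k<p^k b (pred j) hb)) 1≤Φ

  size-large : ∀ j → 1 ≤ j → j ≤ size j
  size-large (suc j) _ = ℕ.≤-trans (k<p^k b j hb) (≤*ˡ (b ^ j) 1≤Φ)

  Bad : ℕ → Set
  Bad p = Prime p × p ∣ b

  bad? : ∀ p → Dec (Bad p)
  bad? p = isPrime? p ×-dec (p ∣? b)

  ω-count : ι (Ω b) ≡ S b (λ p → 𝟙 (bad? p))
  ω-count = trans (cong ι (Ω≡ω b)) (trans (cong (λ z → ι (List.length (List.filter (λ p → prime? p ×-dec (p ∣? b)) z))) (sym (map-id (upTo (suc b)))))
    (trans (ι-length-filter (λ p → prime? p ×-dec (p ∣? b)) (λ p → p) (suc b)) (trans (S-shift b (λ m → 𝟙 (prime? (pred m) ×-dec (pred m ∣? b)))) (trans (cong₂ _⊕_ (𝟙-no (prime? 0 ×-dec (0 ∣? b)) λ z → ℕ.<⇒≱ (prime≥2 (proj₁ z)) z≤n)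
      (S-cong b λ m _ _ → 𝟙-cong (prime? m ×-dec (m ∣? b)) (bad? m) (λ z → z) (λ z → z))) (⊕-identityˡ _)))))

  κ-bad : ∀ {p} → Prime p → κ b p ⊕ 𝟙 (bad? p) ≡ 1#
  κ-bad {p} pr = cases (coprime-or-∣ b pr)
    where
    cases : Coprime p b ⊎ p ∣ b → κ b p ⊕ 𝟙 (bad? p) ≡ 1#
    cases (inj₁ co) = trans (cong₂ _⊕_ (𝟙-yes (isCoprime? p b) co) (𝟙-no (bad? p) λ z → ¬coprime-∣ pr (proj₂ z) co)) (⊕-identityʳ 1#)
    cases (inj₂ h) = trans (cong₂ _⊕_ (𝟙-no (isCoprime? p b) (¬coprime-∣ pr h)) (𝟙-yes (bad? p) (pr , h))) (⊕-identityˡ 1#)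

  -- p divides b^j and hence m, which is prime.
  bad-isolated : ∀ {j p m} → 1 ≤ j → Bad p → Prime m → Same j m p → m ≡ p
  bad-isolated {suc j} {p} {m} _ (pp , p∣b) pm e with prime⇒irreducible pm p∣m
    where
    p∣b^ : p ∣ b ^ suc j
    p∣b^ = ∣m⇒∣m*n (b ^ j) p∣b

    p∣m : p ∣ m
    p∣m = ∣n∣m%n⇒∣m {{nz^ (suc j)}} p∣b^ (subst (p ∣_) (sym e) (%-presˡ-∣ {{nz^ (suc j)}} ∣-refl p∣b^))
  ... | inj₁ p≡1 = ⊥-elim (ℕ.<⇒≢ (prime≥2 pp) (sym p≡1))
  ... | inj₂ p≡m = sym p≡m

  -- Divisibility by b^j passes to smaller j, so the largest exponent equals the number of exponents
  -- j ≥ 1. This turns sums of orders into counts of congruent pairs, level by level.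
  ordSearch-S : ∀ a k → ι (ordSearch b a k) ≡ S k (λ j → 𝟙 (b ^ j ∣? a))
  ordSearch-S a zero = refl
  ordSearch-S a (suc k) with (b ^ suc k) ∣? a
  ... | yes h = trans (trans (sym (⊗-identityʳ _)) (sym (S-const (suc k) 1#))) (cong₂ _⊕_ (S-cong k λ j _ l → sym (𝟙-yes (b ^ j ∣? a) (∣-trans (b^∣ l) h))) (sym (𝟙-yes (yes h) h)))
    where
    b^∣ : ∀ {j} → j ≤ k → b ^ j ∣ b ^ suc k
    b^∣ {j} l = divides (b ^ (suc k ∸ j)) (trans (cong (b ^_) (sym (ℕ.m∸n+n≡m (ℕ.m≤n⇒m≤1+n l)))) (ℕ.^-distribˡ-+-* b (suc k ∸ j) j))
  ... | no h = trans (ordSearch-S a k) (sym (trans (cong (S k (λ j → 𝟙 (b ^ j ∣? a)) ⊕_) (𝟙-no (no h) h)) (⊕-identityʳ _)))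

  ord-fin : ∀ z → ∣ z ∣ ≢ 0 → ord b z ≡ fin (ordSearch b ∣ z ∣ ∣ z ∣)
  ord-fin (+ zero) h = ⊥-elim (h refl)
  ord-fin (+ suc n) _ = refl
  ord-fin ℤ.-[1+ n ] _ = refl

  ord-∞ : ∀ m → ord b (+ m ℤ.- + m) ≡ ∞
  ord-∞ m = cong (ord b) (ℤ.+-inverseʳ (+ m))

  -- J is left free beyond the last level of agreement so that many pairs can share one range of
  -- levels.
  ord-value : ∀ m n → m ≢ n → Σ ℕ λ v → ord b (+ m ℤ.- + n) ≡ fin v ×
    (∀ J → (∀ j → J < j → ¬ Same j n m) → ι v ≡ S J (λ j → E j m n))
  ord-value m n ne = ordSearch b a a , ord-fin (+ m ℤ.- + n) a≢0 , λ J far →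
      trans (ordSearch-S a a) (trans (S-cong a λ j _ _ → level j) (S-support (λ j → E j m n) (λ j l → beyond j l) (λ j l → 𝟙-no (At._≈?_ j n m) (far j l))))
    where
    a = diff m n

    a≢0 : a ≢ 0
    a≢0 e = ne (diff≡0 {m} {n} e)

    level : ∀ j → 𝟙 (b ^ j ∣? a) ≡ E j m n
    level j = 𝟙-cong (b ^ j ∣? a) (At._≈?_ j n m) (λ h → sym (∣diff⇒% {m} {n} (b ^ j) {{nz^ j}} h)) (λ h → %⇒∣diff {m} {n} (b ^ j) {{nz^ j}} (sym h))

    beyond : ∀ j → a < j → E j m n ≡ 0#
    beyond j l = trans (sym (level j)) (𝟙-no (b ^ j ∣? a) λ h → ℕ.<⇒≱ (ℕ.<-trans l (k<p^k b j hb)) (∣⇒≤ {{>-nonZero (ℕ.n≢0⇒n>0 a≢0)}} h))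

  formula-S : ∀ k J → suc (k ∸ Ω b) ≤ J → ι (formula b k) ≡ S J (λ j → ι ((k ∸ Ω b) div size j))
  formula-S k J h = trans (trans (cong ι (formula≡alphaFormula b k)) (trans (ι-sum-upTo (λ m → (k ∸ ω b) div (b ^ m * φ b)) (suc (k ∸ ω b)))
      (cong₂ (λ w f → S (suc (k ∸ w)) (λ m → ι ((k ∸ w) div (b ^ pred m * f)))) (sym (Ω≡ω b)) (sym (Φ≡φ b)))))
    (sym (S-extend _ h λ j l _ → cong ι (div-small (ℕ.<-≤-trans (ℕ.<-trans (ℕ.n<1+n (k ∸ Ω b)) l) (size-large j (ℕ.≤-trans (s≤s z≤n) l))))))

  -- A number v + t b^j lies in the child whose i is congruent to t mod b, and in no other.
  split-class : ∀ j v m → S b (λ i → E (suc j) (v + i * b ^ j) m) ≡ E j v m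
  split-class j v m = cases (At._≈?_ j m v)
    where
    d = b ^ j

    open Residues b {{nzb}} using (rep; rep-≈; rep≤q) renaming (≈⇒≡ to residue-unique)

    descend : ∀ i → Same (suc j) m (v + i * d) → Same j m v
    descend i h = trans (Same-≤ {j} {suc j} {m} {v + i * d} (ℕ.n≤1+n j) h) ([m+kn]%n≡m%n v i d {{nz^ j}})

    cases : Dec (Same j m v) → S b (λ i → E (suc j) (v + i * d) m) ≡ E j v m
    cases (no h) = trans (S-zero b λ i _ _ → 𝟙-no (At._≈?_ (suc j) m (v + i * d)) λ e → h (descend i e)) (sym (𝟙-no (At._≈?_ j m v) h))
    cases (yes h) = trans (S-pick b (rep t) _ (s≤s z≤n) (rep≤q t) λ i hi li ne → 𝟙-no (At._≈?_ (suc j) m (v + i * d)) λ e →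
          ne (residue-unique hi li (s≤s z≤n) (rep≤q t) (trans (same-digit i e) (sym (rep-≈ t)))))
        (trans (𝟙-yes (At._≈?_ (suc j) m (v + rep t * d)) hit) (sym (𝟙-yes (At._≈?_ j m v) h)))
      where
      -- m is moved up by a multiple of b^(j+1) so that m′ ∸ v does not truncate
      m′ : ℕ
      m′ = m + v * b ^ suc j

      v≤m′ : v ≤ m′
      v≤m′ = ℕ.≤-trans (≤*ˡ v (ℕ.≤-trans (s≤s z≤n) (k<p^k b (suc j) hb))) (ℕ.m≤n+m (v * b ^ suc j) m)

      m′≈m : Same (suc j) m′ m
      m′≈m = [m+kn]%n≡m%n m v (b ^ suc j) {{nz^ (suc j)}}

      d∣ : d ∣ m′ ∸ v
      d∣ = %⇒∣∸ {m′} {v} d {{nz^ j}} (trans (Same-≤ {j} {suc j} {m′} {m} (ℕ.n≤1+n j) m′≈m) h)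

      t : ℕ
      t = _∣_.quotient d∣

      v+td : v + t * d ≡ m′
      v+td = trans (cong (λ z → v + z) (sym (_∣_.equality d∣))) (ℕ.m+[n∸m]≡n v≤m′)

      regroup : ∀ i x → v + i * d + x * b ^ suc j ≡ v + (i + x * b) * d
      regroup i x = trans (ℕ.+-assoc v (i * d) _) (cong (λ z → v + z) (trans (cong (λ z → i * d + z) (sym (ℕ.*-assoc x b d))) (sym (ℕ.*-distribʳ-+ d i (x * b)))))

      scale-up : ∀ i i′ → _%_ i b {{nzb}} ≡ _%_ i′ b {{nzb}} → Same (suc j) (v + i * d) (v + i′ * d)
      scale-up i i′ e = Σ⇒% {v + i * d} {v + i′ * d} (b ^ suc j) {{nz^ (suc j)}} (_/_ i′ b {{nzb}}) (_/_ i b {{nzb}})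
        (trans (regroup i (_/_ i′ b {{nzb}})) (trans (cong (λ z → v + z * d) (%⇒Σ {i} {i′} b {{nzb}} e)) (sym (regroup i′ (_/_ i b {{nzb}})))))

      hit : Same (suc j) m (v + rep t * d)
      hit = trans (sym m′≈m) (trans (cong (λ z → _%_ z (b ^ suc j) {{nz^ (suc j)}}) (sym v+td)) (sym (scale-up (rep t) t (rep-≈ t))))

      same-digit : ∀ i → Same (suc j) m (v + i * d) → _%_ i b {{nzb}} ≡ _%_ t b {{nzb}}
      same-digit i e = Σ⇒% {i} {t} b {{nzb}} x y (ℕ.*-cancelʳ-≡ (i + x * b) (t + y * b) d {{nz^ j}} (ℕ.+-cancelˡ-≡ v _ _ (trans (sym (regroup i x)) (trans rel (regroup t y)))))
        where
        e′ : Same (suc j) (v + i * d) (v + t * d)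
        e′ = trans (sym e) (trans (sym m′≈m) (cong (λ z → _%_ z (b ^ suc j) {{nz^ (suc j)}}) (sym v+td)))

        x y : ℕ
        x = _/_ (v + t * d) (b ^ suc j) {{nz^ (suc j)}}
        y = _/_ (v + i * d) (b ^ suc j) {{nz^ (suc j)}}

        rel : v + i * d + x * b ^ suc j ≡ v + t * d + y * b ^ suc j
        rel = %⇒Σ {v + i * d} {v + t * d} (b ^ suc j) {{nz^ (suc j)}} e′

-- Upper bound by descent and lower bound by counting pairs

module Sequence (b : ℕ) (hb : 2 ≤ b) (P : ℕ → ℕ) (P-prime : ∀ i → Prime (P i)) where
  open Levels b hb

  count : ℕ → ℕ → ℕ → K
  count k j v = S k λ i → E j v (P i)

  nat-E : ∀ j v m → IsNat (E j v m)
  nat-E j v m = nat-𝟙 (At._≈?_ j m v)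

  nat-count : ∀ k j v → IsNat (count k j v)
  nat-count k j v = nat-S k λ i → nat-E j v (P i)

  units : ℕ → K
  units k = S k λ i → κ b (P i)

  units-bad : ∀ k → units k ⊕ S k (λ i → 𝟙 (bad? (P i))) ≡ ι k
  units-bad k = trans (sym (S-⊕ k _ _)) (trans (S-cong k λ i _ _ → κ-bad (P-prime i)) (trans (S-const k 1#) (⊗-identityʳ _)))

  bad-swap : ∀ k → S b (λ p → 𝟙 (bad? p) ⊗ S k (λ i → 𝟙 (P i ≟ p))) ≡ S k (λ i → 𝟙 (bad? (P i)))
  bad-swap k = trans (S-cong b λ p _ _ → sym (S-⊗ˡ k _ _)) (trans (S-swap b k _) (S-cong k λ i _ _ → trans (S-cong b λ p _ _ → ⊗-comm _ _) (inner i (bad? (P i)))))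
    where
    inner : ∀ i → Dec (Bad (P i)) → S b (λ p → 𝟙 (P i ≟ p) ⊗ 𝟙 (bad? p)) ≡ 𝟙 (bad? (P i))
    inner i (yes h) = S-𝟙 b (P i) (λ p → 𝟙 (bad? p)) (prime≥1 (P-prime i)) (∣⇒≤ {{nzb}} (proj₂ h))
    inner i (no h) = trans (S-zero b λ p _ _ → trans (𝟙-guard (P i ≟ p) λ { refl → 𝟙-no (bad? (P i)) h }) (⊗-zeroʳ _)) (sym (𝟙-no (bad? (P i)) h))

  Used : ℕ → ℕ → Set
  Used k p = ∃ λ i → 1 ≤ i × i ≤ k × P i ≡ p

  used? : ∀ k p → Dec (Used k p)
  used? zero p = no λ (i , a , c , _) → ℕ.<⇒≱ a c
  used? (suc k) p with used? k p | P (suc k) ≟ p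
  ... | yes (i , a , c , e) | _ = yes (i , a , ℕ.m≤n⇒m≤1+n c , e)
  ... | no _ | yes e = yes (suc k , s≤s z≤n , ℕ.≤-refl , e)
  ... | no h | no ne = no λ (i , a , c , e) → [ (λ i≤k → h (i , a , i≤k , e)) , (λ { refl → ne e }) ]′ (split c)
    where
    split : ∀ {i} → i ≤ suc k → i ≤ k ⊎ i ≡ suc k
    split {i} c with i ≟ suc k
    ... | yes e = inj₂ e
    ... | no ne = inj₁ (ℕ.≤-pred (ℕ.≤∧≢⇒< c ne))

  unused-or-all : ∀ k n → (∃ λ p → Bad p × ¬ Used k p) ⊎ (∀ p → 1 ≤ p → p ≤ n → Bad p → Used k p)
  unused-or-all k zero = inj₂ λ p a c → ⊥-elim (ℕ.<⇒≱ a c)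
  unused-or-all k (suc n) with unused-or-all k n | bad? (suc n) | used? k (suc n)
  ... | inj₁ w | _ | _ = inj₁ w
  ... | inj₂ _ | yes bd | no nu = inj₁ (suc n , bd , nu)
  ... | inj₂ h | yes _ | yes us = inj₂ extend
    where
    extend : ∀ p → 1 ≤ p → p ≤ suc n → Bad p → Used k p
    extend p a c bp with p ≟ suc n
    ... | yes refl = us
    ... | no ne = h p a (ℕ.≤-pred (ℕ.≤∧≢⇒< c ne)) bp
  ... | inj₂ h | no nb | _ = inj₂ extend
    where
    extend : ∀ p → 1 ≤ p → p ≤ suc n → Bad p → Used k p
    extend p a c bp with p ≟ suc n
    ... | yes refl = ⊥-elim (nb bp)
    ... | no ne = h p a (ℕ.≤-pred (ℕ.≤∧≢⇒< c ne)) bp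

  -- Once every prime divisor of b has occurred, at least ω(b) of the terms are not units.
  units-upper : ∀ k → (∀ p → 1 ≤ p → p ≤ b → Bad p → Used k p) → units k ≼ ι (k ∸ Ω b)
  units-upper k all = ≼-trans ((linear (≼-reflexive (units-bad k) ⊞ ≼-reflexive (bad-swap k) ⊞ ω≤ ⊞ ≼-reflexive ω-count) (solve 6 (λ x y z u v w → x :- y :- z := x :+ u :+ v :+ w :- (z :+ u :+ v :+ w :+ y)) refl _ _ _ _ _ _))) le
    where
    ω≤ : S b (λ p → 𝟙 (bad? p)) ≼ S b (λ p → 𝟙 (bad? p) ⊗ S k (λ i → 𝟙 (P i ≟ p)))
    ω≤ = S-mono b λ p h l → ≼-trans (≼-reflexive (sym (⊗-identityʳ _))) (𝟙-guard-≼ (bad? p) λ bd → one-used p (all p h l bd))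
      where
      one-used : ∀ p → Used k p → 1# ≼ S k (λ i → 𝟙 (P i ≟ p))
      one-used p (i , a , c , e) = ≼-trans (≼-reflexive (sym (𝟙-yes (P i ≟ p) e))) (S-term k (λ i → 𝟙 (P i ≟ p)) i a c λ m _ → 0≼𝟙 (P m ≟ p))

    le : ι k ⊖ ι (Ω b) ≼ ι (k ∸ Ω b)
    le = (linear ((ι-mono (ℕ.m≤n+m∸n k (Ω b))) ⊞ ≼-reflexive (ι-+ (Ω b) (k ∸ Ω b))) (solve 4 (λ x y z u → x :- (y :- z) := u :+ (z :+ x) :- (y :+ u)) refl _ _ _ _))

  Distinct : ℕ → Set
  Distinct n = ∀ i j → 1 ≤ i → i < j → j ≤ n → P j ≢ P i

  -- Distinct terms contain each prime divisor of b at most once, so at most ω(b) of them are not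
  -- units.
  units-lower : ∀ n → Distinct n → ι (n ∸ Ω b) ≼ units n
  units-lower n dis = cases (Ω b ≤? n)
    where
    bad≤ω : S n (λ i → 𝟙 (bad? (P i))) ≼ ι (Ω b)
    bad≤ω = ≼-trans (≼-reflexive (sym (bad-swap n))) (≼-trans (S-mono b λ p _ _ → ≼-trans (⊗-monoˡ (0≼𝟙 (bad? p)) (S-distinct P n p dis)) (≼-reflexive (⊗-identityʳ _))) (≼-reflexive (sym ω-count)))

    cases : Dec (Ω b ≤ n) → ι (n ∸ Ω b) ≼ units n
    cases (yes h) = (linear (≼-reflexive (sym (units-bad n)) ⊞ bad≤ω ⊞ ≼-reflexive (sym (ι-+ (Ω b) (n ∸ Ω b))) ⊞ ≼-reflexive (cong ι (ℕ.m+[n∸m]≡n h))) (solve 6 (λ x y z u v w → x :- y := x :+ z :+ u :+ v :+ w :- (w :+ z :+ (u :+ y) :+ v)) refl _ _ _ _ _ _))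
    cases (no h) = ≼-trans (≼-reflexive (cong ι (ℕ.m≤n⇒m∸n≡0 (ℕ.<⇒≤ (ℕ.≰⇒> h))))) (0≼S n λ i _ _ → 0≼𝟙 (isCoprime? (P i) b))

  -- At each level up to M the class of v holds at most the average (k - ω(b))/φ(b^j) of the earlier
  -- terms.
  Descended : ℕ → ℕ → ℕ → Set
  Descended k M v = Coprime v b × (∀ j → 1 ≤ j → j ≤ M → count k j v ⊗ ι (size j) ≼ ι (k ∸ Ω b))

  class-sum : ∀ m → S b (λ w → κ b w ⊗ E 1 w m) ≡ κ b m
  class-sum m = trans (S-cong b λ w _ _ → cong (κ b w ⊗_) (𝟙-cong (At._≈?_ 1 m w) (Residues._≈?_ b {{nzb}} m w)
      (%-coarsen {m} {w} b (b ^ 1) {{nzb}} {{nz^ 1}} (∣-reflexive (sym (ℕ.*-identityʳ b)))) (%-coarsen {m} {w} (b ^ 1) b {{nz^ 1}} {{nzb}} (∣-reflexive (ℕ.*-identityʳ b)))))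
    (Residues.S-class b {{nzb}} (κ b) (λ {m} {n} → Residues.κ-≈ b {{nzb}} {m} {n}) m)

  descent-base : ∀ k → units k ≼ ι (k ∸ Ω b) → ∃ (Descended k 1)
  descent-base k hu = minimal-class (argmin (λ v → isCoprime? v b) (count k 1) b (1 , ℕ.≤-refl , 1≤b , coprime-1 b))
    where
    minimal-class : (∃ λ v → 1 ≤ v × v ≤ b × Coprime v b × (∀ w → 1 ≤ w → w ≤ b → Coprime w b → count k 1 v ≼ count k 1 w)) → ∃ (Descended k 1)
    minimal-class (v , _ , _ , cv , min) = v , cv , λ { (suc zero) _ _ → level₁ ; (suc (suc j)) _ (s≤s ()) }
      where
      level₁ : count k 1 v ⊗ ι (size 1) ≼ ι (k ∸ Ω b)
      level₁ = ≼-trans (≼-reflexive (trans (cong (λ z → count k 1 v ⊗ ι z) (ℕ.*-identityˡ (Φ b))) (trans (⊗-comm _ _) (trans (cong (_⊗ count k 1 v) φ-count) (sym (S-⊗ʳ b _ _))))))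
        (≼-trans (S-mono b λ w h l → 𝟙-guard-≼ (isCoprime? w b) λ cw → min w h l cw) (≼-trans (≼-reflexive
          (trans (S-cong b λ w _ _ → sym (S-⊗ˡ k _ _)) (trans (S-swap b k _) (S-cong k λ i _ _ → class-sum (P i))))) hu))

  -- The least occupied of the b children holds at most 1/b of its parent's terms, while `size`
  -- grows by the factor b. Lower levels do not change, because the child agrees with v there.
  descent-step : ∀ k M v → Descended k (suc M) v → ∃ (Descended k (suc (suc M)))
  descent-step k M v (cv , old) = minimal-child (argmin {λ w → w ≡ w} (λ _ → yes refl) children b (1 , ℕ.≤-refl , 1≤b , refl))
    where
    children : ℕ → K
    children i = count k (suc (suc M)) (v + i * b ^ suc M)

    minimal-child : (∃ λ i → 1 ≤ i × i ≤ b × i ≡ i × (∀ w → 1 ≤ w → w ≤ b → w ≡ w → children i ≼ children w)) → ∃ (Descended k (suc (suc M)))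
    minimal-child (i , _ , _ , _ , min) = child , Same-coprime {suc M} {v} {child} (s≤s z≤n) (sym same) cv , bound
      where
      child : ℕ
      child = v + i * b ^ suc M

      same : Same (suc M) child v
      same = [m+kn]%n≡m%n v i (b ^ suc M) {{nz^ (suc M)}}

      next : ι b ⊗ count k (suc (suc M)) child ≼ count k (suc M) v
      next = ≼-trans (≼-reflexive (sym (S-const b _))) (≼-trans (S-mono b λ w h l → min w h l refl) (≼-reflexive (trans (S-swap b k _) (S-cong k λ m _ _ → split-class (suc M) v (P m)))))

      bound : ∀ j → 1 ≤ j → j ≤ suc (suc M) → count k j child ⊗ ι (size j) ≼ ι (k ∸ Ω b)
      bound j h l = cases (j ≟ suc (suc M))
        where
        regroup : ∀ x y z → x ⊗ (y ⊗ z) ≡ y ⊗ x ⊗ z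
        regroup x y z = (solve 3 (λ x y z → x :* (y :* z) := y :* x :* z) refl _ _ _)

        cases : Dec (j ≡ suc (suc M)) → count k j child ⊗ ι (size j) ≼ ι (k ∸ Ω b)
        cases (no ne) = ≼-trans (≼-reflexive (cong (_⊗ ι (size j)) (S-cong k λ m _ _ → E-cong j {child} {v} (P m) (Same-≤ {j} {suc M} {child} {v} (ℕ.≤-pred (ℕ.≤∧≢⇒< l ne)) same))))
          (old j h (ℕ.≤-pred (ℕ.≤∧≢⇒< l ne)))
        cases (yes refl) = ≼-trans (≼-reflexive (trans (cong (count k (suc (suc M)) child ⊗_) (trans (cong ι (ℕ.*-assoc b (b ^ M) (Φ b))) (ι-* b (size (suc M))))) (regroup _ _ _)))
          (≼-trans (⊗-monoʳ (0≼ι (size (suc M))) next) (old (suc M) (s≤s z≤n) ℕ.≤-refl))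

  descent : ∀ k → units k ≼ ι (k ∸ Ω b) → ∀ M → ∃ (Descended k (suc M))
  descent k hu zero = descent-base k hu
  descent k hu (suc M) = let (v , d) = descent k hu M in descent-step k M v d

  count-div : ∀ k j v → count k j v ⊗ ι (size j) ≼ ι (k ∸ Ω b) → count k j v ≼ ι ((k ∸ Ω b) div size j)
  count-div k j v h with nat-count k j v
  ... | c , e = ≼-trans (≼-reflexive e) (ι-mono (⇒≤div (k ∸ Ω b) (size j) {c} (1≤size j) (ι-reflects-≤ (≼-trans (≼-reflexive (trans (ι-* (size j) c) (trans (⊗-comm _ _) (cong (_⊗ ι (size j)) (sym e))))) h))))

  Good : ℕ → ℕ → ℕ → Set
  Good k x J = (∀ i j → 1 ≤ i → i ≤ k → J < j → ¬ Same j (P i) x) × (∀ i → 1 ≤ i → i ≤ k → x ≢ P i)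

  Candidate : ℕ → Set
  Candidate k = ∃ λ x → Prime x × (∃ λ J → Good k x J × S k (λ i → S J (λ j → E j x (P i))) ≼ ι (formula b k))

  bad-candidate : ∀ k p → Bad p → ¬ Used k p → Candidate k
  bad-candidate k p bd unused = p , proj₁ bd , 0 ,
    ((λ i j a c h e → unused (i , a , c , bad-isolated {j} {p} {P i} h bd (P-prime i) e)) , λ i a c e → unused (i , a , c , sym e)) ,
    ≼-trans (≼-reflexive (S-0 k)) (0≼ι (formula b k))

  unit-candidate : ∀ k v → Descended k (suc (k ∸ Ω b)) v → Candidate k
  unit-candidate k v (cv , levels) = from-dirichlet (dirichlet (b ^ J) {{nz^ J}} v (Cop.sym (coprime-^ J (Cop.sym cv))))
    where
    -- At this level φ(b^J) exceeds k - ω(b), so the class reached is empty, and any prime found in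
    -- it differs from all earlier terms.
    J : ℕ
    J = suc (k ∸ Ω b)

    empty : count k J v ≡ 0#
    empty = ≼-antisym (≼-trans (count-div k J v (levels J (s≤s z≤n) ℕ.≤-refl)) (≼-reflexive (cong ι (div-small (size-large J (s≤s z≤n)))))) (0≼S k λ i _ _ → 0≼𝟙 (At._≈?_ J (P i) v))

    avoids : ∀ i → 1 ≤ i → i ≤ k → ¬ Same J (P i) v
    avoids i a c e = 1⋠0 (≼-trans (≼-reflexive (sym (𝟙-yes (At._≈?_ J (P i) v) e))) (≼-trans (S-term k (λ i → E J v (P i)) i a c λ m _ → 0≼𝟙 (At._≈?_ J (P m) v)) (≼-reflexive empty)))

    from-dirichlet : (∃ λ p → Prime p × Same J p v) → Candidate k
    from-dirichlet (x , px , e) = x , px , J , ((λ i j a c h e′ → avoids i a c (trans (Same-≤ {J} {j} {P i} {x} (ℕ.<⇒≤ h) e′) e)) , λ i a c → λ { refl → avoids i a c e }) ,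
      ≼-trans (≼-reflexive (S-swap k J _)) (≼-trans (S-mono J λ j h l → ≼-trans (≼-reflexive (S-cong k λ i _ _ → E-cong j {x} {v} (P i) (Same-≤ {j} {J} {x} {v} l e)))
        (count-div k j v (levels j h l))) (≼-reflexive (sym (formula-S k J ℕ.≤-refl))))

  opaque
    candidate : ∀ k → Candidate k
    candidate k = [ (λ (p , bd , unused) → bad-candidate k p bd unused)
      , (λ all → let (v , d) = descent k (units-upper k all) (k ∸ Ω b) in unit-candidate k v d) ]′ (unused-or-all k b)

  G : ℕ → ℕ → K
  G j n = S n λ k → ι ((pred k ∸ Ω b) div size j)

  -- G j n is piecewise linear in n ∸ ω; t is its current slope.
  G-value : ∀ j n → ∃ λ t → t * size j ≤ n ∸ Ω b × n ∸ Ω b < suc t * size j ×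
    ι 2 ⊗ G j n ≡ ι 2 ⊗ ι t ⊗ ι (n ∸ Ω b) ⊖ ι t ⊗ (ι t ⊕ 1#) ⊗ ι (size j)
  G-value j zero = 0 , z≤n , subst (_< 1 * size j) (sym (ℕ.0∸n≡0 (Ω b))) (1≤* {1} {size j} ℕ.≤-refl (1≤size j)) , (solve 2 (λ x y → con 2 :* con 0 := con 2 :* con 0 :* x :- con 0 :* (con 0 :+ one) :* y) refl _ _)
  G-value j (suc n) with G-value j n
  ... | t , lo , hi , e = step (Ω b ≤? n)
    where
    Goal : Set
    Goal = ∃ λ t → t * size j ≤ suc n ∸ Ω b × suc n ∸ Ω b < suc t * size j ×
      ι 2 ⊗ G j (suc n) ≡ ι 2 ⊗ ι t ⊗ ι (suc n ∸ Ω b) ⊖ ι t ⊗ (ι t ⊕ 1#) ⊗ ι (size j)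

    slope : (n ∸ Ω b) div size j ≡ t
    slope = ℕ.≤-antisym (ℕ.≤-pred (ℕ.*-cancelˡ-< (size j) _ _ (ℕ.≤-<-trans (≤div⇒ (n ∸ Ω b) (size j) (1≤size j) ℕ.≤-refl) (subst (n ∸ Ω b <_) (ℕ.*-comm (suc t) (size j)) hi))))
      (⇒≤div (n ∸ Ω b) (size j) (1≤size j) (subst (_≤ n ∸ Ω b) (ℕ.*-comm t (size j)) lo))

    G-suc : G j (suc n) ≡ G j n ⊕ ι t
    G-suc = cong (λ z → G j n ⊕ ι z) slope

    step : Dec (Ω b ≤ n) → Goal
    step (no h) = subst (λ m → ∃ λ t → t * size j ≤ m × m < suc t * size j × ι 2 ⊗ G j (suc n) ≡ ι 2 ⊗ ι t ⊗ ι m ⊖ ι t ⊗ (ι t ⊕ 1#) ⊗ ι (size j)) (sym zero₁)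
        (0 , z≤n , 1≤* {1} {size j} ℕ.≤-refl (1≤size j) , trans (cong (ι 2 ⊗_) G-suc) (flat t lo e))
      where
      zero₀ : n ∸ Ω b ≡ 0
      zero₀ = ℕ.m≤n⇒m∸n≡0 (ℕ.<⇒≤ (ℕ.≰⇒> h))

      zero₁ : suc n ∸ Ω b ≡ 0
      zero₁ = ℕ.m≤n⇒m∸n≡0 (ℕ.≰⇒> h)

      flat : ∀ t → t * size j ≤ n ∸ Ω b → ι 2 ⊗ G j n ≡ ι 2 ⊗ ι t ⊗ ι (n ∸ Ω b) ⊖ ι t ⊗ (ι t ⊕ 1#) ⊗ ι (size j) →
        ι 2 ⊗ (G j n ⊕ ι t) ≡ ι 2 ⊗ ι 0 ⊗ ι 0 ⊖ ι 0 ⊗ (ι 0 ⊕ 1#) ⊗ ι (size j)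
      flat zero _ e = (linear-≡ (e) (solve 3 (λ x y z → con 2 :* con 0 :* con 0 :- con 0 :* (con 0 :+ one) :* x :- con 2 :* (y :+ con 0) := con 2 :* con 0 :* z :- con 0 :* (con 0 :+ one) :* x :- con 2 :* y) refl _ _ _))
      flat (suc t) l _ = ⊥-elim (ℕ.<⇒≱ (1≤* {suc t} {size j} (s≤s z≤n) (1≤size j)) (subst (suc t * size j ≤_) zero₀ l))
    step (yes h) = subst (λ m → ∃ λ t → t * size j ≤ m × m < suc t * size j × ι 2 ⊗ G j (suc n) ≡ ι 2 ⊗ ι t ⊗ ι m ⊖ ι t ⊗ (ι t ⊕ 1#) ⊗ ι (size j)) (sym (ℕ.+-∸-assoc 1 h)) (cases (suc (n ∸ Ω b) ≟ suc t * size j))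
      where
      cases : Dec (suc (n ∸ Ω b) ≡ suc t * size j) → ∃ λ t → t * size j ≤ suc (n ∸ Ω b) × suc (n ∸ Ω b) < suc t * size j ×
        ι 2 ⊗ G j (suc n) ≡ ι 2 ⊗ ι t ⊗ ι (suc (n ∸ Ω b)) ⊖ ι t ⊗ (ι t ⊕ 1#) ⊗ ι (size j)
      cases (no ne) = t , ℕ.m≤n⇒m≤1+n lo , ℕ.≤∧≢⇒< hi ne , trans (cong (ι 2 ⊗_) G-suc) (grow e)
        where
        grow : ∀ {g s z} → ι 2 ⊗ g ≡ ι 2 ⊗ ι t ⊗ s ⊖ ι t ⊗ (ι t ⊕ 1#) ⊗ z → ι 2 ⊗ (g ⊕ ι t) ≡ ι 2 ⊗ ι t ⊗ (1# ⊕ s) ⊖ ι t ⊗ (ι t ⊕ 1#) ⊗ z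
        grow e = (linear-≡ (e) (solve 4 (λ x y z u → con 2 :* x :* (one :+ y) :- x :* (x :+ one) :* z :- con 2 :* (u :+ x) := con 2 :* x :* y :- x :* (x :+ one) :* z :- con 2 :* u) refl _ _ _ _))
      cases (yes eq) = suc t , ℕ.≤-reflexive (sym eq) , subst (_< suc (suc t) * size j) (sym eq) (ℕ.m<n+m (suc t * size j) (1≤size j)) ,
          trans (cong (ι 2 ⊗_) G-suc) (grow e (trans (cong ι eq) (ι-* (suc t) (size j))))
        where
        grow : ∀ {g s z} → ι 2 ⊗ g ≡ ι 2 ⊗ ι t ⊗ s ⊖ ι t ⊗ (ι t ⊕ 1#) ⊗ z → 1# ⊕ s ≡ ι (suc t) ⊗ z →
          ι 2 ⊗ (g ⊕ ι t) ≡ ι 2 ⊗ ι (suc t) ⊗ (1# ⊕ s) ⊖ ι (suc t) ⊗ (ι (suc t) ⊕ 1#) ⊗ z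
        grow e e′ = (linear-≡ (e ⊞≡ sym ((ι 2) ⊠≡ e′)) (solve 4 (λ x y z u → con 2 :* (one :+ x) :* (one :+ y) :- (one :+ x) :* (one :+ x :+ one) :* z :- con 2 :* (u :+ x) := con 2 :* x :* y :- x :* (x :+ one) :* z :+ con 2 :* (one :+ y) :- (con 2 :* u :+ con 2 :* ((one :+ x) :* z))) refl _ _ _ _))

  -- Convexity: the ordered pairs of congruent units number Σ c_v², with Σ c_v = u over φ(b^j) unit
  -- classes. The tangent at the slope t of `G-value` gives Σ c_v² ≥ (2t + 1)u - t(t + 1)φ(b^j).
  -- Removing the diagonal u leaves twice the number of unordered pairs, and u ≥ n - ω(b) then gives
  -- exactly 2G.
  level-lower : ∀ n j → Distinct n → 1 ≤ j → G j n ≼ S n (λ k → S (pred k) (λ i → E j (P k) (P i)))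
  level-lower n j dis hj with G-value j n
  ... | t , _ , _ , e = combine e tangents (S-triangle n F F-sym) full diag pairs (⊗-monoˡ (0≼ι t) (units-lower n dis))
    where
    d = b ^ j

    F : ℕ → ℕ → K
    F k i = κ b (P k) ⊗ E j (P k) (P i)

    F-sym : ∀ k i → F k i ≡ F i k
    F-sym k i = trans (⊗-comm _ _) (trans (𝟙-guard (At._≈?_ j (P i) (P k)) λ h → κ-Same {j} {P k} {P i} hj (sym h)) (trans (⊗-comm _ _)
      (cong (κ b (P i) ⊗_) (𝟙-cong (At._≈?_ j (P i) (P k)) (At._≈?_ j (P k) (P i)) sym sym))))

    c : ℕ → K
    c v = count n j v

    full : S n (λ k → S n (F k)) ≡ S d (λ v → κ b v ⊗ (c v ⊗ c v))
    full = sym (trans (S-cong d λ v _ _ → trans (cong (κ b v ⊗_) (trans (sym (S-⊗ʳ n (c v) _)) (S-cong n λ k _ _ → sym (S-⊗ˡ n _ _)))) (trans (sym (S-⊗ˡ n _ _)) (S-cong n λ k _ _ → sym (S-⊗ˡ n _ _))))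
      (trans (S-swap d n _) (S-cong n λ k _ _ → trans (S-swap d n _) (S-cong n λ i _ _ → trans (S-cong d λ v _ _ → regroup _ _ _)
        (At.S-class j (λ v → κ b v ⊗ E j v (P i)) (λ {v} {w} h → cong₂ _⊗_ (κ-Same {j} {v} {w} hj h) (E-cong j {v} {w} (P i) h)) (P k))))))
      where
      regroup : ∀ x y z → x ⊗ (y ⊗ z) ≡ x ⊗ z ⊗ y
      regroup x y z = (solve 3 (λ x y z → x :* (y :* z) := x :* z :* y) refl _ _ _)

    diag : S n (λ k → F k k) ≡ units n
    diag = S-cong n λ k _ _ → trans (cong (κ b (P k) ⊗_) (𝟙-yes (At._≈?_ j (P k) (P k)) refl)) (⊗-identityʳ _)

    total : S d (λ v → κ b v ⊗ c v) ≡ units n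
    total = trans (S-cong d λ v _ _ → sym (S-⊗ˡ n _ _)) (trans (S-swap d n _) (S-cong n λ i _ _ → At.S-class j (κ b) (λ {v} {w} → κ-Same {j} {v} {w} hj) (P i)))

    tangents : (ι 2 ⊗ ι t ⊕ 1#) ⊗ units n ⊖ ι t ⊗ (ι t ⊕ 1#) ⊗ ι (size j) ≼ S d (λ v → κ b v ⊗ (c v ⊗ c v))
    tangents = ≼-trans (≼-reflexive (sym (trans (S-⊖ d _ _) (cong₂ _⊖_ (trans (S-⊗ˡ d _ _) (cong ((ι 2 ⊗ ι t ⊕ 1#) ⊗_) total)) (trans (S-⊗ˡ d _ _) (cong (ι t ⊗ (ι t ⊕ 1#) ⊗_) (size-count j hj)))))))
      (S-mono d λ v _ _ → ≼-trans (≼-reflexive (factor _ _ _ _)) (⊗-monoˡ (0≼𝟙 (isCoprime? v b)) (tangent (nat-count n j v) (nat-ι t))))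
      where
      factor : ∀ a k c e → a ⊗ (k ⊗ c) ⊖ e ⊗ k ≡ k ⊗ (a ⊗ c ⊖ e)
      factor a k c e = (solve 4 (λ x y z u → x :* (y :* z) :- u :* y := y :* (x :* z :- u)) refl _ _ _ _)

    pairs : S n (λ k → S (pred k) (F k)) ≼ S n (λ k → S (pred k) (λ i → E j (P k) (P i)))
    pairs = S-mono n λ k _ _ → S-mono (pred k) λ i _ _ → ≼-trans (⊗-monoʳ (0≼𝟙 (At._≈?_ j (P i) (P k))) (𝟙≼1 (isCoprime? (P k) b))) (≼-reflexive (⊗-identityˡ _))

    combine : ∀ {g s z u q p r τ dg} → ι 2 ⊗ g ≡ ι 2 ⊗ τ ⊗ s ⊖ τ ⊗ (τ ⊕ 1#) ⊗ z → (ι 2 ⊗ τ ⊕ 1#) ⊗ u ⊖ τ ⊗ (τ ⊕ 1#) ⊗ z ≼ q →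
      ∀ {f} → f ≡ ι 2 ⊗ p ⊕ dg → f ≡ q → dg ≡ u → p ≼ r → τ ⊗ s ≼ τ ⊗ u → g ≼ r
    combine e₁ h₁ e₂ e₃ e₄ h₂ h₃ = (linear′ 1 (≼-reflexive e₁ ⊞ h₁ ⊞ ≼-reflexive e₂ ⊞ ≼-reflexive (sym e₃) ⊞ ≼-reflexive e₄ ⊞ 2 ⊠ h₂ ⊞ 2 ⊠ h₃) (solve 10 (λ x y z u v w a b c d → con 2 :* (x :- y) := con 2 :* z :* u :- z :* (z :+ one) :* v :+ w :+ (con 2 :* a :+ b) :+ c :+ d :+ con 2 :* x :+ con 2 :* (z :* d) :- (con 2 :* y :+ ((con 2 :* z :+ one) :* d :- z :* (z :+ one) :* v) :+ c :+ w :+ b :+ con 2 :* a :+ con 2 :* (z :* u))) refl _ _ _ _ _ _ _ _ _ _))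

-- Application to b-orderings

+∞-fin : ∀ {x y n} → x +∞ y ≡ fin n → (∃ λ l → x ≡ fin l) × (∃ λ m → y ≡ fin m)
+∞-fin {fin l} {fin m} _ = (l , refl) , (m , refl)

≤∞-fin : ∀ {x m} → x ≤∞ fin m → ∃ λ n → x ≡ fin n × n ≤ m
≤∞-fin (fin≤fin h) = _ , refl , h

fin-injective : ∀ {m n} → fin m ≡ fin n → m ≡ n
fin-injective refl = refl

module BOrdering (b : ℕ) (hb : 2 ≤ b) (a : ℕ → ℤ) (ordering : IsBOrderingOfPrimes b a) where
  open IsBOrderingOfPrimes ordering

  -- P is indexed from 1: P (suc i) is the prime a i.
  P : ℕ → ℕ
  P k = proj₁ (inℙ (pred k))

  P-prime : ∀ k → Prime (P k)
  P-prime k = proj₁ (proj₂ (inℙ (pred k)))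

  a≡P : ∀ i → a i ≡ + P (suc i)
  a≡P i = proj₂ (proj₂ (inℙ i))

  open Levels b hb
  open Sequence b hb P P-prime

  ordSum-value : ∀ k x → (∀ i → 1 ≤ i → i ≤ k → x ≢ P i) → Σ ℕ λ v → ordSum b a k (+ x) ≡ fin v ×
    (∀ J → (∀ i j → 1 ≤ i → i ≤ k → J < j → ¬ Same j (P i) x) → ι v ≡ S k (λ i → S J (λ j → E j x (P i))))
  ordSum-value zero x _ = 0 , refl , λ _ _ → refl
  ordSum-value (suc k) x ne =
    let (v , e , val) = ordSum-value k x (λ i h l → ne i h (ℕ.m≤n⇒m≤1+n l))
        (w , e′ , val′) = ord-value x (P (suc k)) (ne (suc k) (s≤s z≤n) ℕ.≤-refl)
    in v + w , cong₂ _+∞_ e (trans (cong (λ z → ord b (+ x ℤ.- z)) (a≡P k)) e′) ,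
      λ J far → trans (ι-+ v w) (cong₂ _⊕_ (val J λ i j h l → far i j h (ℕ.m≤n⇒m≤1+n l)) (val′ J λ j l → far (suc k) j (s≤s z≤n) ℕ.≤-refl l))

  -- A term equal to x would contribute ord(0) = ∞. With `α-upper` this shows that the terms of a
  -- b-ordering are distinct.
  ordSum-distinct : ∀ k x v → ordSum b a k (+ x) ≡ fin v → ∀ i → 1 ≤ i → i ≤ k → x ≢ P i
  ordSum-distinct zero x v _ i h l _ = ⊥-elim (ℕ.<⇒≱ h l)
  ordSum-distinct (suc k) x v e i h l refl with +∞-fin {ordSum b a k (+ x)} e | i ≟ suc k
  ... | (w , e′) , _ | no ne = ordSum-distinct k x w e′ i h (ℕ.≤-pred (ℕ.≤∧≢⇒< l ne)) refl
  ... | _ , (w , e′) | yes refl with trans (sym (trans (cong (λ z → ord b (+ P (suc k) ℤ.- z)) (a≡P k)) (ord-∞ (P (suc k))))) e′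
  ... | ()

  opaque
    -- Minimality against the prime supplied by `candidate`, whose value is finite and at most the
    -- formula.
    α-upper : ∀ k → ∃ λ w → α b a k ≡ fin w × w ≤ formula b k
    α-upper zero = 0 , refl , z≤n
    α-upper (suc k) with candidate (suc k)
    ... | x , px , J , (far , ne) , bound with ordSum-value (suc k) x ne
    ... | v , e , val with ≤∞-fin (subst (ordSum b a (suc k) (a (suc k)) ≤∞_) e (minimal (suc k) (s≤s z≤n) (+ x) (x , px , refl)))
    ... | w , e′ , w≤v = w , e′ , ℕ.≤-trans w≤v (ι-reflects-≤ (≼-trans (≼-reflexive (val J far)) bound))

  A : ℕ → ℕ
  A k = proj₁ (α-upper k)

  ordSum-A : ∀ k → ordSum b a k (+ P (suc k)) ≡ fin (A k)
  ordSum-A k = trans (cong (ordSum b a k) (sym (a≡P k))) (proj₁ (proj₂ (α-upper k)))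

  distinct : ∀ n → Distinct n
  distinct n i (suc j) h l _ = ordSum-distinct j (P (suc j)) (A j) (ordSum-A j) i h (ℕ.≤-pred l)

  -- Beyond level `top n` no two of the first n terms agree, since b^j > j exceeds their nonzero
  -- difference.
  top : ℕ → ℕ
  top zero = 0
  top (suc n) = top n ⊔ P (suc n)

  P≤top : ∀ n k → 1 ≤ k → k ≤ n → P k ≤ top n
  P≤top zero k h l = ⊥-elim (ℕ.<⇒≱ h l)
  P≤top (suc n) k h l with k ≟ suc n
  ... | yes refl = ℕ.m≤n⊔m (top n) (P (suc n))
  ... | no ne = ℕ.≤-trans (P≤top n k h (ℕ.≤-pred (ℕ.≤∧≢⇒< l ne))) (ℕ.m≤m⊔n (top n) (P (suc n)))

  diff≤ : ∀ {m n T} → m ≤ T → n ≤ T → diff m n ≤ T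
  diff≤ {m} {n} h l with ℕ.≤-total n m
  ... | inj₁ n≤m = subst (_≤ _) (sym (diff-≥ n≤m)) (ℕ.≤-trans (ℕ.m∸n≤m m n) h)
  ... | inj₂ m≤n = subst (_≤ _) (sym (diff-≤ m≤n)) (ℕ.≤-trans (ℕ.m∸n≤m n m) l)

  A-value : ∀ n k J → 1 ≤ k → k ≤ n → top n ≤ J → ι (A (pred k)) ≡ S (pred k) (λ i → S J (λ j → E j (P k) (P i)))
  A-value n (suc k) J _ l hJ =
    let (v , e , val) = ordSum-value k (P (suc k)) (ordSum-distinct k (P (suc k)) (A k) (ordSum-A k))
    in trans (cong ι (fin-injective (trans (sym (ordSum-A k)) e))) (val J far)
    where
    far : ∀ i j → 1 ≤ i → i ≤ k → J < j → ¬ Same j (P i) (P (suc k))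
    far i j h i≤k J<j s = ℕ.<⇒≱ (ℕ.<-trans J<j (k<p^k b j hb)) (ℕ.≤-trans (∣⇒≤ {{>-nonZero (ℕ.n≢0⇒n>0 nonzero)}} (%⇒∣diff {P i} {P (suc k)} (b ^ j) {{nz^ j}} s))
        (ℕ.≤-trans (diff≤ (P≤top n i h (ℕ.≤-trans i≤k (ℕ.<⇒≤ l))) (P≤top n (suc k) (s≤s z≤n) l)) hJ))
      where
      nonzero : diff (P i) (P (suc k)) ≢ 0
      nonzero e = ordSum-distinct k (P (suc k)) (A k) (ordSum-A k) i h i≤k (sym (diff≡0 {P i} {P (suc k)} e))

  -- `level-lower` summed over the levels. J exceeds both the last level at which two terms agree
  -- and the last nonzero level of the formula.
  totals : ∀ n → S n (λ k → ι (formula b (pred k))) ≼ S n (λ k → ι (A (pred k)))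
  totals n = ≼-trans (≼-reflexive (trans (S-cong n λ { (suc k) _ l → formula-S k J (s≤s (ℕ.≤-trans (ℕ.m∸n≤m k (Ω b)) (ℕ.≤-trans (ℕ.≤-pred (ℕ.m≤n⇒m≤1+n l)) (ℕ.m≤n+m n (top n))))) }) (S-swap n J _)))
    (≼-trans (S-mono J λ j hj _ → level-lower n j (distinct n) hj) (≼-reflexive (trans (S-swap J n _) (S-cong n λ k h l →
      trans (S-swap J (pred k) _) (sym (A-value n k J h l (ℕ.m≤n⇒m≤1+n (ℕ.m≤m+n (top n) n))))))))
    where
    J : ℕ
    J = suc (top n + n)

  -- In `totals` at k + 1 the terms before the last are replaced by their upper bounds, which
  -- isolates the lower bound for `A k`.
  A≡formula : ∀ k → A k ≡ formula b k
  A≡formula k = ℕ.≤-antisym (proj₂ (proj₂ (α-upper k))) (ι-reflects-≤ ((linear ((totals (suc k)) ⊞ (S-mono k {λ m → ι (A (pred m))} {λ m → ι (formula b (pred m))} (λ m _ _ → ι-mono (proj₂ (proj₂ (α-upper (pred m))))))) (solve 4 (λ x y z u → x :- y := z :+ x :+ u :- (u :+ y :+ z)) refl _ _ _ _))))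

  α≡formula : ∀ k → α b a k ≡ fin (formula b k)
  α≡formula k = trans (proj₁ (proj₂ (α-upper k))) (cong fin (A≡formula k))

  formula-vanishes : ∀ k → k < Φ b + Ω b → formula b k ≡ 0
  formula-vanishes k h = ι-injective (trans (formula-S k (suc s) ℕ.≤-refl) (S-zero (suc s) λ j _ _ → cong ι (div-small (ℕ.<-≤-trans s<Φ (≤*ʳ (Φ b) {b ^ pred j} (ℕ.≤-trans (s≤s z≤n) (k<p^k b (pred j) hb)))))))
    where
    s = k ∸ Ω b

    s<Φ : s < Φ b
    s<Φ = cases (Ω b ≤? k)
      where
      cases : Dec (Ω b ≤ k) → s < Φ b
      cases (yes l) = ℕ.+-cancelʳ-< (Ω b) s (Φ b) (subst (_< Φ b + Ω b) (sym (ℕ.m∸n+n≡m l)) h)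
      cases (no l) = subst (_< Φ b) (sym (ℕ.m≤n⇒m∸n≡0 (ℕ.<⇒≤ (ℕ.≰⇒> l)))) 1≤Φ

theorem8p1 : (b k : ℕ) → 2 ≤ b → (a : ℕ → ℤ) → IsBOrderingOfPrimes b a →
    (α b a k ≡ fin (alphaFormula b k)) × (k < φ b + ω b → α b a k ≡ fin 0)
theorem8p1 b k hb a ordering =
  trans (α≡formula k) (cong fin (formula≡alphaFormula b k)) ,
  λ h → trans (α≡formula k) (cong fin (formula-vanishes k (subst (k <_) (cong₂ _+_ (sym (Φ≡φ b)) (sym (Ω≡ω b))) h)))
  where
  open BOrdering b hb a ordering
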